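{- Let $d\ge1$ and $\ell\ge0$ be integers and let $s>0$. Then there is $\beta=\beta(d,\ell,s)>0$ such that for every sufficiently large constant integer $k$, \[\mathbb{P}\big(\mathfrak{h}(T^\cup_{n,d,\ell})<\beta\big)=O(n^{ -s})\quad (n\to\infty),\] where the implied constant may depend on $d,\ell,s,k$.
   Context: For $\sigma=\{x_0<x_1<\dots<x_d\}\subset[n]$ and $\tau\in\binom{[n]}{d}$, let $I_{n,d}(\tau,\sigma)=(-1)^i$ if $\tau=\sigma\setminus\{x_i\}$ and $0$ otherwise. For $\sigma,\tau\in\binom{[n]}{d+1}$ with $|\sigma\cap\tau|=d$, set $J(\sigma,\tau)=I_{n,d}(\sigma\cap\tau,\sigma)I_{n,d}(\sigma\cap\tau,\tau)$. For $0\le\ell<n$, $P_{n,d,\ell}$ is the matrix indexed by $\binom{[n]}{d+1}\times\binom{[n]}{d+1}$ with $P_{n,d,\ell}(\sigma,\sigma)=\frac{d+1+\ell}{n+\ell}$, $P_{n,d,\ell}(\sigma,\tau)=\frac{1}{n+\ell}J(\sigma,\tau)$ if $|\sigma\cap\tau|=d$, and $0$ otherwise; it is symmetric with spectrum in $[0,1]$. The generalized determinantal hypertree $T_{n,d,\ell}$ is the determinantal random subset $X$ of $\binom{[n]}{d+1}$ with kernel $P_{n,d,\ell}$, i.e. $\mathbb{P}(A\subset X)=\det (P_{n,d,\ell})_A$ for all $A$ (where $Q_A$ is the principal submatrix on $A$); it is regarded as the simplicial complex on $[n]$ with complete $(d-1)$-skeleton and $d$-faces $X$. For $k\ge1$,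 $T^\cup_{n,d,\ell}$ is the complex with complete $(d-1)$-skeleton on $[n]$ whose $d$-faces are $\bigcup_{i=1}^kT^i_{n,d,\ell}$, where $T^1_{n,d,\ell},\dots,T^k_{n,d,\ell}$ are i.i.d. copies of $T_{n,d,\ell}$. Coboundary expansion: for a $d$-dimensional complex $K$ and $0\le i\le d$, let $K(i)$ be its set of $i$-faces, $C^i(K,\mathbb{F}_2)$ the $\mathbb{F}_2$-valued functions on $K(i)$, $\delta_i$ the usual coboundary map, $B^i(K,\mathbb{F}_2)=\operatorname{Im}\delta_{i-1}$. The weight of an $i$-face $\sigma$ is $w(\sigma)=\frac{|\{\tau\in K(d):\sigma\subset\tau\}|}{\binom{d+1}{i+1}|K(d)|}$; $\|f\|=\sum_{\sigma\in\operatorname{supp}f}w(\sigma)$; $\|f+B^i\|=\min_{g\in f+B^i(K,\mathbb{F}_2)}\|g\|$. For $0\le i\le d-1$, $\mathfrak{h}_i(K)=\min_{f\in C^i\setminus B^i}\frac{\|\delta_if\|}{\|f+B^i\|}$ and $\mathfrak{h}(K)=\min_{0\le i\le d-1}\mathfrak{h}_i(K)$. -}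

module Defs where

open import Data.Bool using (Bool; true; false; _∧_; _∨_; not; if_then_else_; _xor_)
open import Data.Nat as ℕ using (ℕ; zero; suc; _≡ᵇ_; _<ᵇ_)
open import Data.Nat.Combinatorics using (_C_)
open import Data.Integer as ℤ using (ℤ; +_)
open import Data.Rational as ℚ using (ℚ; 0ℚ; 1ℚ; _+_; _*_; -_; _÷_; _⊓_; _≤ᵇ_)
open import Data.Rational.Properties using (_≟_)
open import Data.List using (List; []; _∷_; map; _++_; foldr; length; upTo; zipWith; concatMap; replicate)
open import Data.Bool.ListAction using (any; all)
open import Data.List.Membership.Propositional using (_∈_)
open import Data.Maybe using (Maybe; just; nothing)
open import Data.Product using (_×_)
open import Relation.Nullary using (yes; no)
open import Relation.Binary.PropositionalEquality using (_≡_)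

filterᵇ : {A : Set} → (A → Bool) → List A → List A
filterᵇ p [] = []
filterᵇ p (x ∷ xs) = if p x then x ∷ filterᵇ p xs else filterᵇ p xs

Σℚ : List ℚ → ℚ
Σℚ = foldr _+_ 0ℚ

ℕ→ℚ : ℕ → ℚ
ℕ→ℚ n = + n ℚ./ 1

_^ℚ_ : ℚ → ℕ → ℚ
p ^ℚ zero  = 1ℚ
p ^ℚ suc k = p * (p ^ℚ k)

-- division with the convention x / 0 = 0 (only 0/0 ever occurs)
safeDiv : ℚ → ℚ → ℚ
safeDiv p q with q ≟ 0ℚ
... | yes _ = 0ℚ
... | no q≢0 = _÷_ p q {{ℚ.≢-nonZero q≢0}}

sign : ℕ → ℚ
sign zero = 1ℚ
sign (suc i) = - sign i

-- minimum of a list of rationals (nothing for the empty list = +∞)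
minMaybe : List ℚ → Maybe ℚ
minMaybe [] = nothing
minMaybe (x ∷ xs) with minMaybe xs
... | nothing = just x
... | just y  = just (x ⊓ y)

-- all Boolean lists of length m (subsets of an m-element list)
allBools : ℕ → List (List Bool)
allBools zero = [] ∷ []
allBools (suc m) = map (true ∷_) (allBools m) ++ map (false ∷_) (allBools m)

select : {A : Set} → List A → List Bool → List A
select [] _ = []
select (x ∷ xs) [] = []
select (x ∷ xs) (true ∷ bs) = x ∷ select xs bs
select (x ∷ xs) (false ∷ bs) = select xs bs

_⊆ᵇ_ : List Bool → List Bool → Bool
[] ⊆ᵇ _ = true
(a ∷ as) ⊆ᵇ [] = false
(a ∷ as) ⊆ᵇ (b ∷ bs) = (not a ∨ b) ∧ (as ⊆ᵇ bs)

eqBools : List Bool → List Bool → Bool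
eqBools [] [] = true
eqBools (a ∷ as) (b ∷ bs) = (if a then b else not b) ∧ eqBools as bs
eqBools _ _ = false

-- Faces: a face is a strictly increasing list of vertices in [n] = {0,…,n-1}

Face : Set
Face = List ℕ

subsetsOf : List ℕ → ℕ → List Face
subsetsOf xs zero = [] ∷ []
subsetsOf [] (suc k) = []
subsetsOf (x ∷ xs) (suc k) = map (x ∷_) (subsetsOf xs k) ++ subsetsOf xs (suc k)

faces : ℕ → ℕ → List Face
faces n j = subsetsOf (upTo n) j

eqFace : Face → Face → Bool
eqFace [] [] = true
eqFace (x ∷ xs) (y ∷ ys) = (x ≡ᵇ y) ∧ eqFace xs ys
eqFace _ _ = false

memb : ℕ → Face → Bool
memb x ys = any (x ≡ᵇ_) ys

_⊆F_ : Face → Face → Bool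
σ ⊆F τ = all (λ x → memb x τ) σ

inter : Face → Face → Face
inter σ τ = filterᵇ (λ x → memb x τ) σ

facetsIx : Face → List (ℕ × Face)
facetsIx [] = []
facetsIx (x ∷ xs) = (0 , xs) ∷ map (λ p → (suc (proj₁ p) , x ∷ proj₂ p)) (facetsIx xs)
  where open import Data.Product using (_,_; proj₁; proj₂)

facets : Face → List Face
facets σ = map proj₂ (facetsIx σ)
  where open import Data.Product using (proj₂)

Icoef : Face → Face → ℚ
Icoef τ σ = Σℚ (map (λ p → if eqFace τ (proj₂ p) then sign (proj₁ p) else 0ℚ) (facetsIx σ))
  where open import Data.Product using (proj₁; proj₂)

Jcoef : Face → Face → ℚ
Jcoef σ τ = Icoef (inter σ τ) σ * Icoef (inter σ τ) τ

Pmat : (n d ℓ : ℕ) → Face → Face → ℚ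
Pmat n d ℓ σ τ =
  if eqFace σ τ then safeDiv (ℕ→ℚ (suc d ℕ.+ ℓ)) (ℕ→ℚ (n ℕ.+ ℓ))
  else if length (inter σ τ) ≡ᵇ d then safeDiv (Jcoef σ τ) (ℕ→ℚ (n ℕ.+ ℓ))
  else 0ℚ

removeAt : {A : Set} → ℕ → List A → List A
removeAt _ [] = []
removeAt zero (x ∷ xs) = xs
removeAt (suc i) (x ∷ xs) = x ∷ removeAt i xs

indexed : {A : Set} → List A → List (ℕ × A)
indexed xs = go 0 xs
  where
  open import Data.Product using (_,_)
  go : {A : Set} → ℕ → List A → List (ℕ × A)
  go i [] = []
  go i (x ∷ xs) = (i , x) ∷ go (suc i) xs

det : {A : Set} → (A → A → ℚ) → List A → List A → ℚ
det e [] cols = 1ℚ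
det e (a ∷ rows) cols =
  Σℚ (map (λ p → sign (proj₁ p) * e a (proj₂ p) * det e rows (removeAt (proj₁ p) cols)) (indexed cols))
  where open import Data.Product using (proj₁; proj₂)

principalMinor : {A : Set} → (A → A → ℚ) → List A → ℚ
principalMinor e As = det e As As

-- The generalized determinantal hypertree T_{n,d,ℓ}.
-- Its ground set binom([n], d+1) is enumerated as `faces n (suc d)`;
-- a random subset is encoded as a Boolean list over this enumeration, and a
-- law is a probability mass function μ on these Boolean lists.

dFaces : ℕ → ℕ → List Face
dFaces n d = faces n (suc d)

IsProbability : ℕ → (List Bool → ℚ) → Set
IsProbability m μ =
  (∀ S → S ∈ allBools m → 0ℚ ℚ.≤ μ S) × (Σℚ (map μ (allBools m)) ≡ 1ℚ)

IsDeterminantalHypertreeLaw : (n d ℓ : ℕ) → (List Bool → ℚ) → Set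
IsDeterminantalHypertreeLaw n d ℓ μ =
  IsProbability m μ ×
  (∀ A → A ∈ allBools m →
     Σℚ (map (λ S → if A ⊆ᵇ S then μ S else 0ℚ) (allBools m))
       ≡ principalMinor (Pmat n d ℓ) (select (dFaces n d) A))
  where m = length (dFaces n d)

unionProb : ℕ → (m : ℕ) → (List Bool → ℚ) → (List Bool → Bool) → List Bool → ℚ
unionProb zero m μ Q acc = if Q acc then 1ℚ else 0ℚ
unionProb (suc k) m μ Q acc =
  Σℚ (map (λ S → μ S * unionProb k m μ Q (zipWith _∨_ acc S)) (allBools m))

-- Coboundary expansion of the d-complex on [n] with complete (d-1)-skeleton
-- and set of d-faces X.  Faces of size j (= dimension j-1) for j = 0,…,d+1;
-- size 0 is the empty face (augmented complex: C^{-1} = F₂, so that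
-- B^0 = Im δ_{-1} = constant functions).  An F₂-cochain on faces of size j is
-- a Boolean list over the enumeration `cxFaces j`.

module Coboundary (n d : ℕ) (X : List Face) where

  cxFaces : ℕ → List Face
  cxFaces j = if j ≡ᵇ suc d then X else faces n j

  Cochain : Set
  Cochain = List Bool

  valueAt : List Face → Cochain → Face → Bool
  valueAt [] _ τ = false
  valueAt (σ ∷ σs) [] τ = false
  valueAt (σ ∷ σs) (b ∷ bs) τ = if eqFace σ τ then b else valueAt σs bs τ

  δ : ℕ → Cochain → Cochain
  δ j f = map (λ σ → foldr _xor_ false (map (valueAt (cxFaces j) f) (facets σ)))
              (cxFaces (suc j))

  weight : ℕ → Face → ℚ
  weight j σ = safeDiv (ℕ→ℚ (length (filterᵇ (λ τ → σ ⊆F τ) X)))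
                       (ℕ→ℚ (((suc d) C j) ℕ.* length X))

  norm : ℕ → Cochain → ℚ
  norm j f = Σℚ (zipWith (λ σ b → if b then weight j σ else 0ℚ) (cxFaces j) f)

  allCochains : ℕ → List Cochain
  allCochains j = allBools (length (cxFaces j))

  cosetNorm : ℕ → Cochain → ℚ
  cosetNorm j f = minOver (map (λ g → norm (suc j) (zipWith _xor_ f (δ j g))) (allCochains j))
    where
    minOver : List ℚ → ℚ
    minOver [] = 0ℚ  -- never used: allCochains j is nonempty
    minOver (x ∷ xs) = foldr _⊓_ x xs

  inB : ℕ → Cochain → Bool
  inB j f = any (λ g → eqBools (δ j g) f) (allCochains j)

  ratios : ℕ → List ℚ
  ratios j = map (λ f → safeDiv (norm (suc (suc j)) (δ (suc j) f)) (cosetNorm j f))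
                 (filterᵇ (λ f → not (inB j f)) (allCochains (suc j)))

  -- 𝔥(K) = min_{0 ≤ i ≤ d-1} 𝔥_i(K)   (nothing = minimum of the empty set = +∞)
  𝔥 : Maybe ℚ
  𝔥 = minMaybe (concatMap ratios (upTo d))

𝔥<ᵇ : ℕ → ℕ → List Face → ℚ → Bool
𝔥<ᵇ n d X β with Coboundary.𝔥 n d X
... | nothing = false
... | just h = not (β ≤ᵇ h)

probExpansionBelow : (n d k : ℕ) → (List Bool → ℚ) → ℚ → ℚ
probExpansionBelow n d k μ β =
  unionProb k m μ (λ S → 𝔥<ᵇ n d (select (dFaces n d) S) β) (replicate m false)
  where m = length (dFaces n d)

{-# OPTIONS --safe #-}
-- Faces are handled as ordered tuples, cochains as symmetric Boolean functions on tuples without repetition.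
--
-- Probability.  For a set E of d-faces, E[(1+z)^|T ∩ E|] is a principal minor of I + zP, so all principal minors of
-- I + zP are nonnegative and Hadamard's inequality bounds it by (1+zp)^|E| with p = (d+1+ℓ)/(n+ℓ).  This gives
-- exponential tail bounds in both directions for the union X of k trees.  On the star of a (d-1)-face the kernel is
-- a rank one perturbation of a scalar matrix, so a tree avoids all but a of its faces only with probability O(a/n).
-- Hence, up to probability O(n^-s): all (d-1)-faces have degree at least k/2; in every link, X has the expected
-- density, up to constants, on the coboundary of every cochain and on the cofaces of its support, if these are not
-- too few; and a small set of vertices A spans at most (k/G)|A| edges in the link of a (d-2)-face.
--
-- Expansion in the top dimension.  Let f have minimal support in its coset.  Faces of f are fat, and a smaller face
-- is fat if it is contained in many fat faces with one vertex more.  Each face of f is reached through fat faces from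
-- a fat face ρ without fat facets.  The faces of f reached from ρ form a cochain on the link of ρ that is dense and
-- minimal there, so by coning it has a large coboundary, of which X sees the expected proportion.  A d-face odd for
-- this cochain is odd for f, unless it contains fat faces ξ ∪ u and ξ ∪ v with ξ not fat; since the set of such u
-- is then small, X contains few d-faces of this kind.
--
-- Below the top dimension all degrees are comparable, and a cone over a well-chosen vertex suffices.

module Submission where

open import Defs
open import Data.Nat using (ℕ; zero; suc; _≤_; _<_; z≤n; s≤s; _+_; _*_; _∸_; _^_; _≡ᵇ_; _≤ᵇ_; _<ᵇ_; _!; NonZero; >-nonZero; >-nonZero⁻¹)
open import Data.Rational using (ℚ; 0ℚ; 1ℚ) renaming (_<_ to _<ℚ_; _≤_ to _≤ℚ_; _*_ to _*ℚ_; _+_ to _+ℚ_; _-_ to _-ℚ_; -_ to ⊖_)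
open import Data.List using (List; take; []; _∷_; _++_; map; foldr; length; upTo; applyUpTo; zipWith; replicate; concatMap; _∷ʳ_) renaming (drop to dropN)
open import Data.Bool using (Bool; true; false; _∧_; _∨_; not; if_then_else_; _xor_; T)
open import Data.Product using (_×_; _,_; proj₁; proj₂; ∃-syntax)
open import Data.Sum using (_⊎_; inj₁; inj₂)
open import Data.Empty using (⊥; ⊥-elim)
open import Data.Unit using (tt)
open import Data.Maybe using (Maybe; just; nothing)
open import Data.List.Membership.Propositional using (_∈_; _∉_)
open import Data.List.Relation.Unary.Any using (here; there)
open import Data.List.Relation.Unary.All as All using (All; []; _∷_)
open import Data.List.Relation.Unary.AllPairs using ([]; _∷_)
open import Data.List.Relation.Unary.Unique.Propositional using (Unique)
open import Function using (_∘_; id; case_of_)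
open import Level using (0ℓ)
open import Relation.Nullary using (¬_; yes; no; Dec; contradiction)
open import Relation.Binary.PropositionalEquality using (_≡_; _≢_; refl; sym; trans; cong; cong₂; subst; subst₂; module ≡-Reasoning)
open import Tactic.RingSolver.Core.AlmostCommutativeRing using (AlmostCommutativeRing; fromCommutativeRing)
open import Tactic.RingSolver using (solve-∀)
import Data.Nat.Properties as ℕₚ
import Data.Nat.Tactic.RingSolver as ℕSolver
import Data.Rational as ℚ
import Data.Rational.Properties as ℚₚ
import Data.List.Properties as Listₚ
import Data.Bool.Properties as Boolₚ
import Data.List.Membership.Propositional.Properties as ∈ₚ
import Data.List.Relation.Unary.All.Properties as Allₚ
open import Data.List.Relation.Unary.AllPairs using (AllPairs)
open import Data.Bool.ListAction using (any; all)
open import Data.List.Relation.Binary.Permutation.Propositional using (_↭_; prep; swap; ↭-sym; ↭-trans; ↭-refl; ↭-reflexive)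
import Data.List.Relation.Binary.Permutation.Propositional as Perm
import Data.List.Relation.Binary.Permutation.Propositional.Properties as Permₚ
import Data.List.Relation.Unary.AllPairs.Properties as AllPairsₚ
import Data.List.Relation.Unary.Unique.Propositional.Properties as Uniqueₚ
import Data.Integer as ℤ
import Data.Integer.Properties as ℤₚ
import Data.Rational.Unnormalised as ℚᵘ
import Data.Rational.Unnormalised.Properties as ℚᵘₚ
open import Data.Nat.Combinatorics using (_C_; nCn≡1; nCk≡nC[n∸k]; nCk+nC[k+1]≡[n+1]C[k+1])
open import Data.Nat.DivMod using (_/_; m/n*n≤m; m≡m%n+[m/n]*n; m%n<n)

-- The obstacle is entropy. X has only of the order of `k n^d` faces of dimension d, against about
-- `2^(n^d)` cochains, so a union bound controls only cochains whose coboundary has positive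
-- density. A sparse cochain is therefore cut into pieces that are dense in the link of some ρ: if ρ
-- lacks m vertices, there are at most `2^(n^m)` cochains on its link, the relevant counts are of
-- order `k n^m`, and a large constant k wins at every level. At the lowest level a set of w
-- vertices carries about `w log (n / w)` bits, which is not linear in w; there one only asks that
-- the set span few edges, and a probability like `(K w / n)^(b w)` pays for the choice of the set.
-- The constants are fixed in this order: `Cu`, `Cl` and `G` from d and ℓ, then the thresholds `H`
-- level by level, each beating the losses accumulated before it, then `Θ` and `L`, and k last.
-- Hence β depends neither on k nor on the exponent.

ℚring : AlmostCommutativeRing 0ℓ 0ℓ
ℚring = fromCommutativeRing ℚₚ.+-*-commutativeRing isZero
  where
  isZero : ∀ x → Maybe (0ℚ ≡ x)
  isZero x with 0ℚ ℚₚ.≟ x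
  ... | yes p = just p
  ... | no _ = nothing

-- Finite sums of rationals

∑ : {A : Set} → List A → (A → ℚ) → ℚ
∑ xs φ = Σℚ (map φ xs)

module _ {A : Set} where

  ∑-cong : ∀ (xs : List A) {φ ψ : A → ℚ} → (∀ x → x ∈ xs → φ x ≡ ψ x) → ∑ xs φ ≡ ∑ xs ψ
  ∑-cong [] e = refl
  ∑-cong (x ∷ xs) e = cong₂ _+ℚ_ (e x (here refl)) (∑-cong xs (λ y m → e y (there m)))

  ∑-mono : ∀ (xs : List A) {φ ψ : A → ℚ} → (∀ x → x ∈ xs → φ x ≤ℚ ψ x) → ∑ xs φ ≤ℚ ∑ xs ψ
  ∑-mono [] e = ℚₚ.≤-refl
  ∑-mono (x ∷ xs) e = ℚₚ.+-mono-≤ (e x (here refl)) (∑-mono xs (λ y m → e y (there m)))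

  ∑-+ : ∀ (xs : List A) (φ ψ : A → ℚ) → ∑ xs (λ x → φ x +ℚ ψ x) ≡ ∑ xs φ +ℚ ∑ xs ψ
  ∑-+ [] φ ψ = refl
  ∑-+ (x ∷ xs) φ ψ = trans (cong ((φ x +ℚ ψ x) +ℚ_) (∑-+ xs φ ψ)) (lem (φ x) (ψ x) (∑ xs φ) (∑ xs ψ))
    where
    lem : ∀ a b c d → (a +ℚ b) +ℚ (c +ℚ d) ≡ (a +ℚ c) +ℚ (b +ℚ d)
    lem = solve-∀ ℚring

  ∑-*ˡ : ∀ (xs : List A) (c : ℚ) (φ : A → ℚ) → ∑ xs (λ x → c *ℚ φ x) ≡ c *ℚ ∑ xs φ
  ∑-*ˡ [] c φ = sym (ℚₚ.*-zeroʳ c)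
  ∑-*ˡ (x ∷ xs) c φ = trans (cong (c *ℚ φ x +ℚ_) (∑-*ˡ xs c φ)) (sym (ℚₚ.*-distribˡ-+ c (φ x) (∑ xs φ)))

  ∑-++ : ∀ (xs ys : List A) (φ : A → ℚ) → ∑ (xs ++ ys) φ ≡ ∑ xs φ +ℚ ∑ ys φ
  ∑-++ [] ys φ = sym (ℚₚ.+-identityˡ _)
  ∑-++ (x ∷ xs) ys φ = trans (cong (φ x +ℚ_) (∑-++ xs ys φ)) (sym (ℚₚ.+-assoc (φ x) (∑ xs φ) (∑ ys φ)))

  ∑-0 : ∀ (xs : List A) → ∑ xs (λ _ → 0ℚ) ≡ 0ℚ
  ∑-0 [] = refl
  ∑-0 (x ∷ xs) = trans (ℚₚ.+-identityˡ _) (∑-0 xs)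

  ∑-nonneg : ∀ (xs : List A) {φ : A → ℚ} → (∀ x → x ∈ xs → 0ℚ ≤ℚ φ x) → 0ℚ ≤ℚ ∑ xs φ
  ∑-nonneg xs {φ} h = subst (_≤ℚ ∑ xs φ) (∑-0 xs) (∑-mono xs h)

∑-map : ∀ {A B : Set} (g : A → B) (xs : List A) (φ : B → ℚ) → ∑ (map g xs) φ ≡ ∑ xs (φ ∘ g)
∑-map g xs φ = cong Σℚ (sym (Listₚ.map-∘ xs))

∑-swap : ∀ {A B : Set} (xs : List A) (ys : List B) (φ : A → B → ℚ) →
  ∑ xs (λ x → ∑ ys (φ x)) ≡ ∑ ys (λ y → ∑ xs (λ x → φ x y))
∑-swap [] ys φ = sym (∑-0 ys)
∑-swap (x ∷ xs) ys φ = trans (cong (∑ ys (φ x) +ℚ_) (∑-swap xs ys φ)) (sym (∑-+ ys (φ x) _))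

-- Determinants by Laplace expansion

module _ {A : Set} where

  -- Laplace expansion along a row `v`, where `F` gives the minor on the remaining columns. The
  -- nested subtraction produces the alternating signs, so no positions occur.
  lap : (A → ℚ) → (List A → ℚ) → List A → ℚ
  lap v F [] = 0ℚ
  lap v F (c ∷ cs) = v c *ℚ F cs -ℚ lap v (λ xs → F (c ∷ xs)) cs

  detR : List (A → ℚ) → List A → ℚ
  detR [] cs = 1ℚ
  detR (r ∷ rs) cs = lap r (detR rs) cs

  private
    go : ℕ → List A → List (ℕ × A)
    go i [] = []
    go i (x ∷ xs) = (i , x) ∷ go (suc i) xs

    mutual
      indexed≡go : (xs : List A) → indexed xs ≡ go 0 xs
      indexed≡go [] = refl
      indexed≡go (x ∷ xs) with x ∷ xs | 1
      ... | w | z = cong ((0 , x) ∷_) (indexed-tail w z xs)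

      -- The left-hand side is the auxiliary function of Defs.indexed, which has no name
      -- outside Defs; it is found by unification with the use above.
      indexed-tail : (w : List A) (i : ℕ) (xs : List A) → _ ≡ go i xs
      indexed-tail w i [] = refl
      indexed-tail w i (x ∷ xs) = cong ((i , x) ∷_) (indexed-tail w (suc i) xs)

    -- `removeAt` counts positions from the first column, so the induction has to carry the columns
    -- already passed, in `pre`.
    expansion≡lap : ∀ (v : A → ℚ) (F : List A → ℚ) (pre cs : List A) →
      ∑ (go (length pre) cs) (λ p → sign (proj₁ p) *ℚ v (proj₂ p) *ℚ F (removeAt (proj₁ p) (pre ++ cs)))
      ≡ sign (length pre) *ℚ lap v (λ xs → F (pre ++ xs)) cs
    expansion≡lap v F pre [] = sym (ℚₚ.*-zeroʳ (sign (length pre)))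
    expansion≡lap v F pre (c ∷ cs) = begin
      s *ℚ v c *ℚ F (removeAt (length pre) (pre ++ c ∷ cs)) +ℚ ∑ (go (suc (length pre)) cs) (term (pre ++ c ∷ cs))
        ≡⟨ cong₂ _+ℚ_ (cong (λ z → s *ℚ v c *ℚ F z) (remove-mid pre)) rest ⟩
      s *ℚ v c *ℚ F (pre ++ cs) +ℚ (⊖ s) *ℚ lap v (λ xs → F (pre ++ c ∷ xs)) cs
        ≡⟨ lem s (v c) (F (pre ++ cs)) _ ⟩
      s *ℚ (v c *ℚ F (pre ++ cs) -ℚ lap v (λ xs → F (pre ++ c ∷ xs)) cs) ∎
      where
      open ≡-Reasoning
      s = sign (length pre)
      term : List A → ℕ × A → ℚ
      term ys p = sign (proj₁ p) *ℚ v (proj₂ p) *ℚ F (removeAt (proj₁ p) ys)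
      remove-mid : ∀ pre → removeAt (length pre) (pre ++ c ∷ cs) ≡ pre ++ cs
      remove-mid [] = refl
      remove-mid (x ∷ xs) = cong (x ∷_) (remove-mid xs)
      assoc : ∀ xs → (pre ∷ʳ c) ++ xs ≡ pre ++ c ∷ xs
      assoc xs = Listₚ.++-assoc pre (c ∷ []) xs
      len : length (pre ∷ʳ c) ≡ suc (length pre)
      len = trans (Listₚ.length-++ pre) (ℕₚ.+-comm (length pre) 1)
      lap-cong₀ : ∀ {F G : List A → ℚ} cs → (∀ xs → F xs ≡ G xs) → lap v F cs ≡ lap v G cs
      lap-cong₀ [] e = refl
      lap-cong₀ (c ∷ cs) e = cong₂ (λ x y → v c *ℚ x -ℚ y) (e cs) (lap-cong₀ cs (λ xs → e (c ∷ xs)))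
      rest : ∑ (go (suc (length pre)) cs) (term (pre ++ c ∷ cs)) ≡ (⊖ s) *ℚ lap v (λ xs → F (pre ++ c ∷ xs)) cs
      rest = begin
        ∑ (go (suc (length pre)) cs) (term (pre ++ c ∷ cs))
          ≡⟨ cong₂ (λ i ys → ∑ (go i cs) (term ys)) (sym len) (sym (assoc cs)) ⟩
        ∑ (go (length (pre ∷ʳ c)) cs) (term ((pre ∷ʳ c) ++ cs))
          ≡⟨ expansion≡lap v F (pre ∷ʳ c) cs ⟩
        sign (length (pre ∷ʳ c)) *ℚ lap v (λ xs → F ((pre ∷ʳ c) ++ xs)) cs
          ≡⟨ cong₂ (λ i l → sign i *ℚ l) len (lap-cong₀ cs (λ xs → cong F (assoc xs))) ⟩
        (⊖ s) *ℚ lap v (λ xs → F (pre ++ c ∷ xs)) cs ∎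
      lem : ∀ s a f l → s *ℚ a *ℚ f +ℚ (⊖ s) *ℚ l ≡ s *ℚ (a *ℚ f -ℚ l)
      lem = solve-∀ ℚring

  lap-cong : (P : A → Set) {v w : A → ℚ} {F G : List A → ℚ} → (∀ c → P c → v c ≡ w c) →
    (∀ xs → All P xs → F xs ≡ G xs) → ∀ cs → All P cs → lap v F cs ≡ lap w G cs
  lap-cong P e e′ [] [] = refl
  lap-cong P e e′ (c ∷ cs) (p ∷ ps) =
    cong₂ _-ℚ_ (cong₂ _*ℚ_ (e c p) (e′ cs ps)) (lap-cong P e (λ xs q → e′ (c ∷ xs) (p ∷ q)) cs ps)

  lap-congʳ : ∀ (v : A → ℚ) {F G : List A → ℚ} → (∀ xs → F xs ≡ G xs) → ∀ cs → lap v F cs ≡ lap v G cs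
  lap-congʳ v e [] = refl
  lap-congʳ v e (c ∷ cs) = cong₂ (λ x y → v c *ℚ x -ℚ y) (e cs) (lap-congʳ v (λ xs → e (c ∷ xs)) cs)

  det≡detR : ∀ (e : A → A → ℚ) rows cols → det e rows cols ≡ detR (map e rows) cols
  det≡detR e [] cols = refl
  det≡detR e (a ∷ rows) cols = begin
    ∑ (indexed cols) term                                  ≡⟨ cong (λ l → ∑ l term) (indexed≡go cols) ⟩
    ∑ (go 0 cols) term                                     ≡⟨ expansion≡lap (e a) (det e rows) [] cols ⟩
    1ℚ *ℚ lap (e a) (det e rows) cols                      ≡⟨ ℚₚ.*-identityˡ _ ⟩
    lap (e a) (det e rows) cols                            ≡⟨ lap-congʳ (e a) (det≡detR e rows) cols ⟩
    lap (e a) (detR (map e rows)) cols                     ∎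
    where
    open ≡-Reasoning
    term : ℕ × A → ℚ
    term p = sign (proj₁ p) *ℚ e a (proj₂ p) *ℚ det e rows (removeAt (proj₁ p) cols)

  detR-cong : (P : A → Set) {B : Set} (e e′ : B → A → ℚ) (L : List B) → (∀ b → b ∈ L → ∀ c → P c → e b c ≡ e′ b c) →
    ∀ cs → All P cs → detR (map e L) cs ≡ detR (map e′ L) cs
  detR-cong P e e′ [] h cs ps = refl
  detR-cong P e e′ (b ∷ L) h cs ps =
    lap-cong P (h b (here refl)) (λ xs q → detR-cong P e e′ L (λ b′ m → h b′ (there m)) xs q) cs ps

  lap-linˡ : ∀ k (u w : A → ℚ) F cs → lap (λ c → u c +ℚ k *ℚ w c) F cs ≡ lap u F cs +ℚ k *ℚ lap w F cs
  lap-linˡ k u w F [] = sym (lem k)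
    where
    lem : ∀ k → 0ℚ +ℚ k *ℚ 0ℚ ≡ 0ℚ
    lem = solve-∀ ℚring
  lap-linˡ k u w F (c ∷ cs) = trans (cong (((u c +ℚ k *ℚ w c) *ℚ F cs) -ℚ_) (lap-linˡ k u w _ cs))
    (lem k (u c) (w c) (F cs) _ _)
    where
    lem : ∀ k u w f l m → (u +ℚ k *ℚ w) *ℚ f -ℚ (l +ℚ k *ℚ m) ≡ (u *ℚ f -ℚ l) +ℚ k *ℚ (w *ℚ f -ℚ m)
    lem = solve-∀ ℚring

  lap-linʳ : ∀ k v (F G : List A → ℚ) cs → lap v (λ xs → F xs +ℚ k *ℚ G xs) cs ≡ lap v F cs +ℚ k *ℚ lap v G cs
  lap-linʳ k v F G [] = sym (lem k)
    where
    lem : ∀ k → 0ℚ +ℚ k *ℚ 0ℚ ≡ 0ℚ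
    lem = solve-∀ ℚring
  lap-linʳ k v F G (c ∷ cs) = trans (cong ((v c *ℚ (F cs +ℚ k *ℚ G cs)) -ℚ_) (lap-linʳ k v _ _ cs))
    (lem k (v c) (F cs) (G cs) _ _)
    where
    lem : ∀ k v f g l m → v *ℚ (f +ℚ k *ℚ g) -ℚ (l +ℚ k *ℚ m) ≡ (v *ℚ f -ℚ l) +ℚ k *ℚ (v *ℚ g -ℚ m)
    lem = solve-∀ ℚring

  lap-*ʳ : ∀ k v (G : List A → ℚ) cs → lap v (λ xs → k *ℚ G xs) cs ≡ k *ℚ lap v G cs
  lap-*ʳ k v G [] = sym (ℚₚ.*-zeroʳ k)
  lap-*ʳ k v G (c ∷ cs) = trans (cong ((v c *ℚ (k *ℚ G cs)) -ℚ_) (lap-*ʳ k v _ cs)) (lem k (v c) (G cs) _)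
    where
    lem : ∀ k v g m → v *ℚ (k *ℚ g) -ℚ k *ℚ m ≡ k *ℚ (v *ℚ g -ℚ m)
    lem = solve-∀ ℚring

  -- Both sides run over ordered pairs of deleted columns, and exchanging the two rows reverses each
  -- pair. As `F` is arbitrary, this works under any further expansion.
  lap-anticomm : ∀ u v (F : List A → ℚ) cs → lap u (lap v F) cs ≡ ⊖ lap v (lap u F) cs
  lap-anticomm u v F [] = refl
  lap-anticomm u v F (c ∷ cs) = begin
    u c *ℚ lap v F cs -ℚ lap u (λ xs → v c *ℚ F xs -ℚ lap v Fc xs) cs
      ≡⟨ cong (λ z → u c *ℚ lap v F cs -ℚ z) (expand u v) ⟩
    u c *ℚ lap v F cs -ℚ (v c *ℚ lap u F cs -ℚ lap u (lap v Fc) cs)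
      ≡⟨ cong (λ z → u c *ℚ lap v F cs -ℚ (v c *ℚ lap u F cs -ℚ z)) (lap-anticomm u v Fc cs) ⟩
    u c *ℚ lap v F cs -ℚ (v c *ℚ lap u F cs -ℚ ⊖ lap v (lap u Fc) cs)
      ≡⟨ lem (u c) (lap v F cs) (v c) (lap u F cs) _ ⟩
    ⊖ (v c *ℚ lap u F cs -ℚ (u c *ℚ lap v F cs -ℚ lap v (lap u Fc) cs))
      ≡⟨ cong (λ z → ⊖ (v c *ℚ lap u F cs -ℚ z)) (sym (expand v u)) ⟩
    ⊖ (v c *ℚ lap u F cs -ℚ lap v (λ xs → u c *ℚ F xs -ℚ lap u Fc xs) cs) ∎
    where
    open ≡-Reasoning
    Fc : List A → ℚ
    Fc xs = F (c ∷ xs)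
    lem : ∀ a x b y z → a *ℚ x -ℚ (b *ℚ y -ℚ ⊖ z) ≡ ⊖ (b *ℚ y -ℚ (a *ℚ x -ℚ z))
    lem = solve-∀ ℚring
    neg : ∀ x y → x -ℚ y ≡ x +ℚ (⊖ 1ℚ) *ℚ y
    neg = solve-∀ ℚring
    expand : ∀ u v → lap u (λ xs → v c *ℚ F xs -ℚ lap v Fc xs) cs ≡ v c *ℚ lap u F cs -ℚ lap u (lap v Fc) cs
    expand u v = begin
      lap u (λ xs → v c *ℚ F xs -ℚ lap v Fc xs) cs
        ≡⟨ lap-congʳ u (λ xs → neg (v c *ℚ F xs) (lap v Fc xs)) cs ⟩
      lap u (λ xs → v c *ℚ F xs +ℚ (⊖ 1ℚ) *ℚ lap v Fc xs) cs
        ≡⟨ lap-linʳ (⊖ 1ℚ) u _ _ cs ⟩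
      lap u (λ xs → v c *ℚ F xs) cs +ℚ (⊖ 1ℚ) *ℚ lap u (lap v Fc) cs
        ≡⟨ cong (_+ℚ (⊖ 1ℚ) *ℚ lap u (lap v Fc) cs) (lap-*ʳ (v c) u F cs) ⟩
      v c *ℚ lap u F cs +ℚ (⊖ 1ℚ) *ℚ lap u (lap v Fc) cs
        ≡⟨ sym (neg (v c *ℚ lap u F cs) (lap u (lap v Fc) cs)) ⟩
      v c *ℚ lap u F cs -ℚ lap u (lap v Fc) cs ∎

  lap-self : ∀ v (F : List A → ℚ) cs → lap v (lap v F) cs ≡ 0ℚ
  lap-self v F [] = refl
  lap-self v F (c ∷ cs) = begin
    v c *ℚ lap v F cs -ℚ lap v (λ xs → v c *ℚ F xs -ℚ lap v Fc xs) cs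
      ≡⟨ cong (λ z → v c *ℚ lap v F cs -ℚ z) (lap-congʳ v (λ xs → neg (v c *ℚ F xs) (lap v Fc xs)) cs) ⟩
    v c *ℚ lap v F cs -ℚ lap v (λ xs → v c *ℚ F xs +ℚ (⊖ 1ℚ) *ℚ lap v Fc xs) cs
      ≡⟨ cong (λ z → v c *ℚ lap v F cs -ℚ z) (trans (lap-linʳ (⊖ 1ℚ) v _ _ cs)
           (cong₂ (λ a b → a +ℚ (⊖ 1ℚ) *ℚ b) (lap-*ʳ (v c) v F cs) (lap-self v Fc cs))) ⟩
    v c *ℚ lap v F cs -ℚ (v c *ℚ lap v F cs +ℚ (⊖ 1ℚ) *ℚ 0ℚ)
      ≡⟨ lem (v c *ℚ lap v F cs) ⟩
    0ℚ ∎
    where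
    open ≡-Reasoning
    Fc : List A → ℚ
    Fc xs = F (c ∷ xs)
    neg : ∀ x y → x -ℚ y ≡ x +ℚ (⊖ 1ℚ) *ℚ y
    neg = solve-∀ ℚring
    lem : ∀ x → x -ℚ (x +ℚ (⊖ 1ℚ) *ℚ 0ℚ) ≡ 0ℚ
    lem = solve-∀ ℚring

  lap-zero : ∀ v (F : List A → ℚ) cs → (∀ xs → suc (length xs) ≡ length cs → F xs ≡ 0ℚ) → lap v F cs ≡ 0ℚ
  lap-zero v F [] h = refl
  lap-zero v F (c ∷ cs) h = trans
    (cong₂ (λ x y → v c *ℚ x -ℚ y) (h cs refl) (lap-zero v _ cs (λ xs e → h (c ∷ xs) (cong suc e))))
    (lem (v c))
    where
    lem : ∀ a → a *ℚ 0ℚ -ℚ 0ℚ ≡ 0ℚ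
    lem = solve-∀ ℚring

  -- `detR [] cs` is 1 whatever columns are left over. The length condition gives at least as many
  -- rows as columns, so that every term of the expansion uses the column `a` or runs out of
  -- columns.
  detR-zeroColumn : ∀ a (rs : List (A → ℚ)) → All (λ r → r a ≡ 0ℚ) rs → ∀ xs → length xs < length rs →
    detR rs (a ∷ xs) ≡ 0ℚ
  detR-zeroColumn a (r ∷ rs) (z ∷ zs) xs (s≤s l) = begin
    r a *ℚ detR rs xs -ℚ lap r (λ ys → detR rs (a ∷ ys)) xs
      ≡⟨ cong₂ (λ p q → p *ℚ detR rs xs -ℚ q) z
           (lap-zero r _ xs (λ ys e → detR-zeroColumn a rs zs ys (subst (_≤ length rs) (sym e) l))) ⟩
    0ℚ *ℚ detR rs xs -ℚ 0ℚ  ≡⟨ lem (detR rs xs) ⟩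
    0ℚ ∎
    where
    open ≡-Reasoning
    lem : ∀ a → 0ℚ *ℚ a -ℚ 0ℚ ≡ 0ℚ
    lem = solve-∀ ℚring

  -- The multiple of `s` added to the next row dies by `lap-self`; then `lap-anticomm` carries `s`
  -- past that row, so that the induction meets `s` on top again.
  lap-rowOps : ∀ {B : Set} (s : A → ℚ) (e e′ : B → A → ℚ) (k : B → ℚ) → (∀ b c → e′ b c ≡ e b c +ℚ k b *ℚ s c) →
    ∀ (L : List B) cs → lap s (detR (map e′ L)) cs ≡ lap s (detR (map e L)) cs
  lap-rowOps s e e′ k h [] cs = refl
  lap-rowOps s e e′ k h (b ∷ L) cs = begin
    lap s (lap (e′ b) D′) cs
      ≡⟨ lap-congʳ s (λ xs → trans (lap-cong (λ _ → A) (λ c _ → h b c) (λ _ _ → refl) xs (All.universal id xs))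
                                   (lap-linˡ (k b) (e b) s D′ xs)) cs ⟩
    lap s (λ xs → lap (e b) D′ xs +ℚ k b *ℚ lap s D′ xs) cs
      ≡⟨ trans (lap-linʳ (k b) s _ _ cs) (cong (λ z → lap s (lap (e b) D′) cs +ℚ k b *ℚ z) (lap-self s D′ cs)) ⟩
    lap s (lap (e b) D′) cs +ℚ k b *ℚ 0ℚ
      ≡⟨ lem (lap s (lap (e b) D′) cs) (k b) ⟩
    lap s (lap (e b) D′) cs
      ≡⟨ lap-anticomm s (e b) D′ cs ⟩
    ⊖ lap (e b) (lap s D′) cs
      ≡⟨ cong ⊖_ (lap-congʳ (e b) (lap-rowOps s e e′ k h L) cs) ⟩
    ⊖ lap (e b) (lap s D) cs
      ≡⟨ sym (lap-anticomm s (e b) D cs) ⟩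
    lap s (lap (e b) D) cs ∎
    where
    open ≡-Reasoning
    D D′ : List A → ℚ
    D = detR (map e L)
    D′ = detR (map e′ L)
    lem : ∀ x k → x +ℚ k *ℚ 0ℚ ≡ x
    lem = solve-∀ ℚring

  detR-moveRow : ∀ pre u (R : List (A → ℚ)) cs →
    detR (pre ++ u ∷ R) cs ≡ sign (length pre) *ℚ lap u (detR (pre ++ R)) cs
  detR-moveRow [] u R cs = sym (ℚₚ.*-identityˡ _)
  detR-moveRow (r ∷ pre) u R cs = begin
    lap r (detR (pre ++ u ∷ R)) cs
      ≡⟨ lap-congʳ r (detR-moveRow pre u R) cs ⟩
    lap r (λ xs → sign (length pre) *ℚ lap u (detR (pre ++ R)) xs) cs
      ≡⟨ lap-*ʳ (sign (length pre)) r (lap u (detR (pre ++ R))) cs ⟩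
    sign (length pre) *ℚ lap r (lap u (detR (pre ++ R))) cs
      ≡⟨ cong (sign (length pre) *ℚ_) (lap-anticomm r u _ cs) ⟩
    sign (length pre) *ℚ ⊖ lap u (lap r (detR (pre ++ R))) cs
      ≡⟨ lem (sign (length pre)) _ ⟩
    (⊖ sign (length pre)) *ℚ lap u (lap r (detR (pre ++ R))) cs ∎
    where
    open ≡-Reasoning
    lem : ∀ a b → a *ℚ ⊖ b ≡ (⊖ a) *ℚ b
    lem = solve-∀ ℚring

  lap-zeroˡ : ∀ (v : A → ℚ) F cs → All (λ c → v c ≡ 0ℚ) cs → lap v F cs ≡ 0ℚ
  lap-zeroˡ v F [] [] = refl
  lap-zeroˡ v F (c ∷ cs) (p ∷ ps) = trans (cong₂ (λ x y → x *ℚ F cs -ℚ y) p (lap-zeroˡ v _ cs ps)) (lem (F cs))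
    where
    lem : ∀ f → 0ℚ *ℚ f -ℚ 0ℚ ≡ 0ℚ
    lem = solve-∀ ℚring

-- Signs and order in ℚ

sign² : ∀ i → sign i *ℚ sign i ≡ 1ℚ
sign² zero = refl
sign² (suc i) = trans (lem (sign i)) (sign² i)
  where
  lem : ∀ a → (⊖ a) *ℚ (⊖ a) ≡ a *ℚ a
  lem = solve-∀ ℚring

mulˡ : ∀ {a b} c → 0ℚ ≤ℚ c → a ≤ℚ b → c *ℚ a ≤ℚ c *ℚ b
mulˡ c h = ℚₚ.*-monoˡ-≤-nonNeg c {{ℚ.nonNegative h}}

mulʳ : ∀ {a b} c → 0ℚ ≤ℚ c → a ≤ℚ b → a *ℚ c ≤ℚ b *ℚ c
mulʳ c h = ℚₚ.*-monoʳ-≤-nonNeg c {{ℚ.nonNegative h}}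

mul-mono : ∀ {a b c d} → 0ℚ ≤ℚ a → 0ℚ ≤ℚ c → a ≤ℚ b → c ≤ℚ d → a *ℚ c ≤ℚ b *ℚ d
mul-mono {a} {b} {c} {d} ha hc h h′ = ℚₚ.≤-trans (mulʳ c hc h) (mulˡ b (ℚₚ.≤-trans ha h) h′)

mul-nonneg : ∀ {a b} → 0ℚ ≤ℚ a → 0ℚ ≤ℚ b → 0ℚ ≤ℚ a *ℚ b
mul-nonneg {a} {b} ha hb = subst (_≤ℚ a *ℚ b) (ℚₚ.*-zeroʳ a) (mulˡ a ha hb)

add-nonneg : ∀ {a b} → 0ℚ ≤ℚ a → 0ℚ ≤ℚ b → 0ℚ ≤ℚ a +ℚ b
add-nonneg ha hb = ℚₚ.+-mono-≤ ha hb

0≤1 : 0ℚ ≤ℚ 1ℚ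
0≤1 = ℚₚ.nonNegative⁻¹ 1ℚ

pow-nonneg : ∀ {a} k → 0ℚ ≤ℚ a → 0ℚ ≤ℚ a ^ℚ k
pow-nonneg zero h = 0≤1
pow-nonneg (suc k) h = mul-nonneg h (pow-nonneg k h)

neg-neg⁻¹ : ∀ a → ⊖ (⊖ a) ≡ a
neg-neg⁻¹ = solve-∀ ℚring

square-nonneg : ∀ x → 0ℚ ≤ℚ x *ℚ x
square-nonneg x with ℚₚ.≤-total 0ℚ x
... | inj₁ h = mul-nonneg h h
... | inj₂ h = subst (0ℚ ≤ℚ_) (lem x) (mul-nonneg (ℚₚ.neg-antimono-≤ h) (ℚₚ.neg-antimono-≤ h))
  where
  lem : ∀ a → (⊖ a) *ℚ (⊖ a) ≡ a *ℚ a
  lem = solve-∀ ℚring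

zero-product : ∀ {x y} → x *ℚ y ≡ 0ℚ → x ≢ 0ℚ → y ≡ 0ℚ
zero-product {x} {y} e h = begin
  y                        ≡⟨ sym (ℚₚ.*-identityˡ y) ⟩
  1ℚ *ℚ y                  ≡⟨ cong (_*ℚ y) (sym (ℚₚ.*-inverseˡ x)) ⟩
  (ℚ.1/ x) *ℚ x *ℚ y       ≡⟨ ℚₚ.*-assoc (ℚ.1/ x) x y ⟩
  (ℚ.1/ x) *ℚ (x *ℚ y)     ≡⟨ cong ((ℚ.1/ x) *ℚ_) e ⟩
  (ℚ.1/ x) *ℚ 0ℚ           ≡⟨ ℚₚ.*-zeroʳ (ℚ.1/ x) ⟩
  0ℚ ∎
  where
  open ≡-Reasoning
  instance
    nz : ℚ.NonZero x
    nz = ℚ.≢-nonZero h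

neg-square-zero : ∀ x → 0ℚ ≤ℚ ⊖ (x *ℚ x) → x ≡ 0ℚ
neg-square-zero x h with x ℚₚ.≟ 0ℚ
... | yes e = e
... | no ne = zero-product (ℚₚ.≤-antisym le (square-nonneg x)) ne
  where
  le : x *ℚ x ≤ℚ 0ℚ
  le = subst (_≤ℚ 0ℚ) (neg-neg⁻¹ (x *ℚ x)) (ℚₚ.neg-antimono-≤ h)

-- Hadamard's inequality

module _ {A : Set} where

  minor : (A → A → ℚ) → List A → ℚ
  minor M L = detR (map M L) L

  -- The Schur complement of the pivot `a`; `i` stands for the inverse of `M a a`.
  schur : (M : A → A → ℚ) (a : A) (i : ℚ) → A → A → ℚ
  schur M a i x y = M x y +ℚ (⊖ (M x a *ℚ i)) *ℚ M a y

  -- Row operations with the row of `a` turn the rows below into those of `schur M a i` and clear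
  -- the column of `a`, so only the pivot term of the first row survives.
  minor-schur : ∀ M a i → M a a *ℚ i ≡ 1ℚ → ∀ B → minor M (a ∷ B) ≡ M a a *ℚ minor (schur M a i) B
  minor-schur M a i h B = begin
    lap (M a) (detR (map M B)) (a ∷ B)
      ≡⟨ sym (lap-rowOps (M a) M M′ (λ x → ⊖ (M x a *ℚ i)) (λ _ _ → refl) B (a ∷ B)) ⟩
    M a a *ℚ detR (map M′ B) B -ℚ lap (M a) (λ xs → detR (map M′ B) (a ∷ xs)) B
      ≡⟨ cong (λ z → M a a *ℚ detR (map M′ B) B -ℚ z)
           (lap-zero (M a) _ B (λ xs e → detR-zeroColumn a (map M′ B) (Allₚ.map⁺ (All.universal col B)) xs
              (subst (suc (length xs) ≤_) (sym (Listₚ.length-map M′ B)) (ℕₚ.≤-reflexive e)))) ⟩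
    M a a *ℚ detR (map M′ B) B -ℚ 0ℚ
      ≡⟨ lem₂ (M a a *ℚ detR (map M′ B) B) ⟩
    M a a *ℚ minor M′ B ∎
    where
    open ≡-Reasoning
    M′ = schur M a i
    lem₂ : ∀ x → x -ℚ 0ℚ ≡ x
    lem₂ = solve-∀ ℚring
    lem : ∀ x m i → x +ℚ (⊖ (x *ℚ i)) *ℚ m ≡ x -ℚ x *ℚ (m *ℚ i)
    lem = solve-∀ ℚring
    lem₁ : ∀ x → x -ℚ x *ℚ 1ℚ ≡ 0ℚ
    lem₁ = solve-∀ ℚring
    col : ∀ x → M′ x a ≡ 0ℚ
    col x = trans (lem (M x a) (M a a) i) (trans (cong (λ z → M x a -ℚ M x a *ℚ z) h) (lem₁ (M x a)))

  select-[] : (L : List A) → select L [] ≡ []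
  select-[] [] = refl
  select-[] (x ∷ L) = refl

  MinorsNonneg : (A → A → ℚ) → List A → Set
  MinorsNonneg M L = ∀ bs → 0ℚ ≤ℚ minor M (select L bs)

  SymmetricOn : (A → A → ℚ) → List A → Set
  SymmetricOn M L = ∀ x y → x ∈ L → y ∈ L → M x y ≡ M y x

  diagonalProduct : (A → A → ℚ) → List A → ℚ
  diagonalProduct M [] = 1ℚ
  diagonalProduct M (x ∷ L) = M x x *ℚ diagonalProduct M L

  private
    single : ∀ M x → minor M (x ∷ []) ≡ M x x
    single M x = lem (M x x)
      where
      lem : ∀ m → m *ℚ 1ℚ -ℚ 0ℚ ≡ m
      lem = solve-∀ ℚring

    double : ∀ M x y → minor M (x ∷ y ∷ []) ≡ M x x *ℚ M y y -ℚ M x y *ℚ M y x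
    double M x y = lem (M x x) (M y y) (M x y) (M y x)
      where
      lem : ∀ a b c d → a *ℚ (b *ℚ 1ℚ -ℚ 0ℚ) -ℚ (c *ℚ (d *ℚ 1ℚ -ℚ 0ℚ) -ℚ 0ℚ) ≡ a *ℚ b -ℚ c *ℚ d
      lem = solve-∀ ℚring

    diagonal : ∀ M L → MinorsNonneg M L → All (λ x → 0ℚ ≤ℚ M x x) L
    diagonal M [] nn = []
    diagonal M (x ∷ L) nn =
      subst (0ℚ ≤ℚ_) (trans (cong (λ l → minor M (x ∷ l)) (select-[] L)) (single M x)) (nn (true ∷ []))
      ∷ diagonal M L (λ bs → nn (false ∷ bs))

    pairs : ∀ M a L → (∀ bs → 0ℚ ≤ℚ minor M (a ∷ select L bs)) → All (λ x → 0ℚ ≤ℚ minor M (a ∷ x ∷ [])) L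
    pairs M a [] nn = []
    pairs M a (x ∷ L) nn =
      subst (λ l → 0ℚ ≤ℚ minor M (a ∷ x ∷ l)) (select-[] L) (nn (true ∷ []))
      ∷ pairs M a L (λ bs → nn (false ∷ bs))

    diagonalProduct-mono : ∀ M M′ L → All (λ x → 0ℚ ≤ℚ M x x) L → All (λ x → M x x ≤ℚ M′ x x) L →
      0ℚ ≤ℚ diagonalProduct M L × diagonalProduct M L ≤ℚ diagonalProduct M′ L
    diagonalProduct-mono M M′ [] [] [] = 0≤1 , ℚₚ.≤-refl
    diagonalProduct-mono M M′ (x ∷ L) (p ∷ ps) (q ∷ qs) with diagonalProduct-mono M M′ L ps qs
    ... | h₁ , h₂ = mul-nonneg p h₁ , mul-mono p h₁ q h₂

  -- Induction by pivoting. The principal minors of the Schur complement are those of `M` containing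
  -- `a`, divided by `M a a`, hence again nonnegative, and its diagonal is bounded by that of `M`.
  hadamard : ∀ M L → SymmetricOn M L → MinorsNonneg M L → minor M L ≤ℚ diagonalProduct M L
  hadamard M [] s nn = ℚₚ.≤-refl
  hadamard M (a ∷ L) s nn with M a a ℚₚ.≟ 0ℚ
  ... | yes z = ℚₚ.≤-reflexive (trans (lap-zeroˡ (M a) (detR (map M L)) (a ∷ L) (z ∷ row))
                  (sym (trans (cong (_*ℚ diagonalProduct M L) z) (ℚₚ.*-zeroˡ (diagonalProduct M L)))))
    where
    lem : ∀ m b → 0ℚ *ℚ m -ℚ b *ℚ b ≡ ⊖ (b *ℚ b)
    lem = solve-∀ ℚring
    -- With `M a a` zero, the principal minor on `a` and `x` is minus the square of `M a x`, so the
    -- whole row vanishes.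
    row : All (λ c → M a c ≡ 0ℚ) L
    row = All.tabulate λ {x} x∈ → neg-square-zero (M a x) (subst (0ℚ ≤ℚ_)
      (trans (double M a x) (trans (cong₂ (λ p q → p *ℚ M x x -ℚ M a x *ℚ q) z (s x a (there x∈) (here refl))) (lem (M x x) (M a x))))
      (All.lookup (pairs M a L (λ bs → nn (true ∷ bs))) x∈))
  ... | no nz = subst (_≤ℚ M a a *ℚ diagonalProduct M L) (sym (minor-schur M a i inv L))
                  (mulˡ (M a a) pos (ℚₚ.≤-trans (hadamard M′ L s′ nn′) (proj₂ mono)))
    where
    instance
      nonzero : ℚ.NonZero (M a a)
      nonzero = ℚ.≢-nonZero nz
    i = ℚ.1/ M a a
    inv : M a a *ℚ i ≡ 1ℚ
    inv = ℚₚ.*-inverseʳ (M a a)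
    M′ = schur M a i
    pos : 0ℚ ≤ℚ M a a
    pos = All.head (diagonal M (a ∷ L) nn)
    lem₀ : ∀ m i → m *ℚ (i *ℚ i) ≡ (m *ℚ i) *ℚ i
    lem₀ = solve-∀ ℚring
    0≤i : 0ℚ ≤ℚ i
    0≤i = subst (0ℚ ≤ℚ_) (trans (lem₀ (M a a) i) (trans (cong (_*ℚ i) inv) (ℚₚ.*-identityˡ i))) (mul-nonneg pos (square-nonneg i))
    nn′ : MinorsNonneg M′ L
    nn′ bs = subst₂ _≤ℚ_ (ℚₚ.*-zeroʳ i) (trans (cong (i *ℚ_) (minor-schur M a i inv (select L bs)))
      (trans (sym (ℚₚ.*-assoc i (M a a) _)) (trans (cong (_*ℚ minor M′ (select L bs)) (ℚₚ.*-inverseˡ (M a a))) (ℚₚ.*-identityˡ (minor M′ (select L bs))))))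
      (mulˡ i 0≤i (nn (true ∷ bs)))
    lem : ∀ p x y i → p +ℚ (⊖ (x *ℚ i)) *ℚ y ≡ p +ℚ (⊖ (y *ℚ i)) *ℚ x
    lem = solve-∀ ℚring
    s′ : SymmetricOn M′ L
    s′ x y x∈ y∈ = trans (cong₂ (λ p q → p +ℚ (⊖ (M x a *ℚ i)) *ℚ q) (s x y (there x∈) (there y∈)) (s a y (here refl) (there y∈)))
      (trans (cong (λ q → M y x +ℚ (⊖ (q *ℚ i)) *ℚ M y a) (s x a (there x∈) (here refl))) (lem (M y x) (M a x) (M y a) i))
    lem₂ : ∀ m q i → m +ℚ (⊖ (q *ℚ i)) *ℚ q ≡ m -ℚ (q *ℚ q) *ℚ i
    lem₂ = solve-∀ ℚring
    lem₃ : ∀ m → m -ℚ 0ℚ ≡ m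
    lem₃ = solve-∀ ℚring
    dec : ∀ {x} → x ∈ L → M′ x x ≤ℚ M x x
    dec {x} x∈ = subst₂ _≤ℚ_
      (trans (sym (lem₂ (M x x) (M x a) i)) (cong (λ q → M x x +ℚ (⊖ (M x a *ℚ i)) *ℚ q) (s x a (there x∈) (here refl))))
      (lem₃ (M x x))
      (ℚₚ.+-monoʳ-≤ (M x x) (ℚₚ.neg-antimono-≤ (mul-nonneg (square-nonneg (M x a)) 0≤i)))
    mono : 0ℚ ≤ℚ diagonalProduct M′ L × diagonalProduct M′ L ≤ℚ diagonalProduct M L
    mono = diagonalProduct-mono M′ M L (diagonal M′ L nn′) (All.tabulate dec)

  diagonalProduct-const : ∀ M c L → (∀ x → x ∈ L → M x x ≡ c) → diagonalProduct M L ≡ c ^ℚ length L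
  diagonalProduct-const M c [] h = refl
  diagonalProduct-const M c (x ∷ L) h =
    cong₂ _*ℚ_ (h x (here refl)) (diagonalProduct-const M c L (λ y m → h y (there m)))

  lap-unit : ∀ v (F : List A → ℚ) pre x L → v x ≡ 1ℚ → All (λ c → v c ≡ 0ℚ) pre → All (λ c → v c ≡ 0ℚ) L →
    lap v F (pre ++ x ∷ L) ≡ sign (length pre) *ℚ F (pre ++ L)
  lap-unit v F [] x L e [] zs = trans (cong₂ (λ p q → p *ℚ F L -ℚ q) e (lap-zeroˡ v _ L zs)) (lem (F L))
    where
    lem : ∀ f → 1ℚ *ℚ f -ℚ 0ℚ ≡ 1ℚ *ℚ f
    lem = solve-∀ ℚring
  lap-unit v F (p ∷ pre) x L e (z ∷ zs) zs′ =
    trans (cong₂ (λ a b → a *ℚ F (pre ++ x ∷ L) -ℚ b) z (lap-unit v (λ xs → F (p ∷ xs)) pre x L e zs zs′))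
          (lem (F (pre ++ x ∷ L)) (sign (length pre)) (F (p ∷ pre ++ L)))
    where
    lem : ∀ f s g → 0ℚ *ℚ f -ℚ s *ℚ g ≡ (⊖ s) *ℚ g
    lem = solve-∀ ℚring

-- Boolean tests and equality of faces

T⇒≡ : ∀ {b} → T b → b ≡ true
T⇒≡ {true} _ = refl

≡⇒T : ∀ {b} → b ≡ true → T b
≡⇒T refl = tt

≢true : ∀ {b} → b ≢ true → b ≡ false
≢true {true} h = ⊥-elim (h refl)
≢true {false} h = refl

≡ᵇ-refl : ∀ x → (x ≡ᵇ x) ≡ true
≡ᵇ-refl x = T⇒≡ (ℕₚ.≡⇒≡ᵇ x x refl)

≡ᵇ⇒≡ : ∀ {x y} → (x ≡ᵇ y) ≡ true → x ≡ y
≡ᵇ⇒≡ {x} {y} h = ℕₚ.≡ᵇ⇒≡ x y (≡⇒T h)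

≢⇒≡ᵇ : ∀ {x y} → x ≢ y → (x ≡ᵇ y) ≡ false
≢⇒≡ᵇ h = ≢true (h ∘ ≡ᵇ⇒≡)

eqFace-refl : ∀ σ → eqFace σ σ ≡ true
eqFace-refl [] = refl
eqFace-refl (x ∷ σ) rewrite eqFace-refl σ | ≡ᵇ-refl x = refl

eqFace⇒≡ : ∀ σ τ → eqFace σ τ ≡ true → σ ≡ τ
eqFace⇒≡ [] [] h = refl
eqFace⇒≡ (x ∷ σ) (y ∷ τ) h with x ≡ᵇ y in e
... | true = cong₂ _∷_ (≡ᵇ⇒≡ e) (eqFace⇒≡ σ τ h)

≢⇒eqFace : ∀ {σ τ} → σ ≢ τ → eqFace σ τ ≡ false
≢⇒eqFace {σ} {τ} h = ≢true (h ∘ eqFace⇒≡ σ τ)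

-- Principal minors of I + zP as sums over subsets

idKernel : Face → Face → ℚ
idKernel x y = if eqFace x y then 1ℚ else 0ℚ

idKernel-refl : ∀ x → idKernel x x ≡ 1ℚ
idKernel-refl x rewrite eqFace-refl x = refl

idKernel-≢ : ∀ {x y} → x ≢ y → idKernel x y ≡ 0ℚ
idKernel-≢ h rewrite ≢⇒eqFace h = refl

-- The kernel `I + zP`.
mix : ℚ → (Face → Face → ℚ) → Face → Face → ℚ
mix z P x y = idKernel x y +ℚ z *ℚ P x y

-- The unit row and its column stand at the same position, so the sign from moving the row to the
-- top and the sign of its only nonzero entry cancel.
detR-dropUnit : ∀ (P : Face → Face → ℚ) pre x R L → x ∉ pre → x ∉ L →
  detR (map P pre ++ idKernel x ∷ R) (pre ++ x ∷ L) ≡ detR (map P pre ++ R) (pre ++ L)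
detR-dropUnit P pre x R L h₁ h₂ = begin
  detR (map P pre ++ idKernel x ∷ R) (pre ++ x ∷ L)
    ≡⟨ detR-moveRow (map P pre) (idKernel x) R (pre ++ x ∷ L) ⟩
  sign (length (map P pre)) *ℚ lap (idKernel x) (detR (map P pre ++ R)) (pre ++ x ∷ L)
    ≡⟨ cong₂ (λ n → sign n *ℚ_) (Listₚ.length-map P pre)
         (lap-unit (idKernel x) (detR (map P pre ++ R)) pre x L (idKernel-refl x) (zeros h₁) (zeros h₂)) ⟩
  s *ℚ (s *ℚ D)   ≡⟨ sym (ℚₚ.*-assoc s s D) ⟩
  s *ℚ s *ℚ D     ≡⟨ cong (_*ℚ D) (sign² (length pre)) ⟩
  1ℚ *ℚ D         ≡⟨ ℚₚ.*-identityˡ D ⟩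
  D ∎
  where
  open ≡-Reasoning
  s = sign (length pre)
  D = detR (map P pre ++ R) (pre ++ L)
  zeros : ∀ {l} → x ∉ l → All (λ c → idKernel x c ≡ 0ℚ) l
  zeros h = All.tabulate λ {c} c∈ → idKernel-≢ {x} {c} λ { refl → h c∈ }

trues : List Bool → ℕ
trues [] = 0
trues (true ∷ bs) = suc (trues bs)
trues (false ∷ bs) = trues bs

common : List Bool → List Bool → ℕ
common (true ∷ as) (true ∷ bs) = suc (common as bs)
common (_ ∷ as) (_ ∷ bs) = common as bs
common _ _ = 0

detR-linear : ∀ {A : Set} pre (u w : A → ℚ) z R cs →
  detR (pre ++ (λ c → u c +ℚ z *ℚ w c) ∷ R) cs ≡ detR (pre ++ u ∷ R) cs +ℚ z *ℚ detR (pre ++ w ∷ R) cs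
detR-linear [] u w z R cs = lap-linˡ z u w (detR R) cs
detR-linear (r ∷ pre) u w z R cs =
  trans (lap-congʳ r (detR-linear pre u w z R) cs) (lap-linʳ z r _ _ cs)

∑-allBools : ∀ m (φ : List Bool → ℚ) →
  ∑ (allBools (suc m)) φ ≡ ∑ (allBools m) (φ ∘ (true ∷_)) +ℚ ∑ (allBools m) (φ ∘ (false ∷_))
∑-allBools m φ = trans (∑-++ (map (true ∷_) (allBools m)) _ φ)
  (cong₂ _+ℚ_ (∑-map (true ∷_) (allBools m) φ) (∑-map (false ∷_) (allBools m) φ))

minorTerm : (Face → Face → ℚ) → ℚ → List Face → List Face → List Bool → List Bool → ℚ
minorTerm P z pre D E A = if A ⊆ᵇ E then z ^ℚ trues A *ℚ minor P (pre ++ select D A) else 0ℚ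

-- Each row of `I + zP` is the sum of a unit row, which deletes its index, and `z` times a row of
-- `P`, which keeps it. The indices kept so far are collected in `pre`; starting from an empty
-- `pre`, every subset `A` of `E` arises once, with weight `z ^ℚ trues A`.
minor-expansion : ∀ P z pre D E → length E ≡ length D → Unique D → (∀ x → x ∈ pre → x ∉ D) →
  ∑ (allBools (length D)) (minorTerm P z pre D E)
  ≡ detR (map P pre ++ map (mix z P) (select D E)) (pre ++ select D E)
minor-expansion P z pre [] [] e u dj = begin
  1ℚ *ℚ minor P (pre ++ []) +ℚ 0ℚ                ≡⟨ lem (minor P (pre ++ [])) ⟩
  detR (map P (pre ++ [])) (pre ++ [])            ≡⟨ cong (λ l → detR l (pre ++ [])) (Listₚ.map-++ P pre []) ⟩
  detR (map P pre ++ []) (pre ++ []) ∎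
  where
  open ≡-Reasoning
  lem : ∀ m → 1ℚ *ℚ m +ℚ 0ℚ ≡ m
  lem = solve-∀ ℚring
minor-expansion P z pre (x ∷ D) (false ∷ E) e (u₁ ∷ u) dj = begin
  ∑ (allBools (suc (length D))) (minorTerm P z pre (x ∷ D) (false ∷ E))
    ≡⟨ ∑-allBools (length D) (minorTerm P z pre (x ∷ D) (false ∷ E)) ⟩
  ∑ (allBools (length D)) (λ _ → 0ℚ) +ℚ ∑ (allBools (length D)) (minorTerm P z pre D E)
    ≡⟨ trans (cong (_+ℚ ∑ (allBools (length D)) (minorTerm P z pre D E)) (∑-0 (allBools (length D)))) (ℚₚ.+-identityˡ (∑ (allBools (length D)) (minorTerm P z pre D E))) ⟩
  ∑ (allBools (length D)) (minorTerm P z pre D E)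
    ≡⟨ minor-expansion P z pre D E (ℕₚ.suc-injective e) u (λ y y∈ y∈′ → dj y y∈ (there y∈′)) ⟩
  _ ∎
  where open ≡-Reasoning
minor-expansion P z pre (x ∷ D) (true ∷ E) e (u₁ ∷ u) dj = begin
  ∑ (allBools (suc (length D))) (minorTerm P z pre (x ∷ D) (true ∷ E))
    ≡⟨ ∑-allBools (length D) (minorTerm P z pre (x ∷ D) (true ∷ E)) ⟩
  ∑ (allBools (length D)) (λ A → minorTerm P z pre (x ∷ D) (true ∷ E) (true ∷ A)) +ℚ ∑ (allBools (length D)) (minorTerm P z pre D E)
    ≡⟨ cong₂ _+ℚ_ with-x (minor-expansion P z pre D E (ℕₚ.suc-injective e) u (λ y y∈ y∈′ → dj y y∈ (there y∈′))) ⟩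
  z *ℚ detR (map P pre ++ P x ∷ R) (pre ++ x ∷ L) +ℚ detR (map P pre ++ R) (pre ++ L)
    ≡⟨ ℚₚ.+-comm (z *ℚ detR (map P pre ++ P x ∷ R) (pre ++ x ∷ L)) (detR (map P pre ++ R) (pre ++ L)) ⟩
  detR (map P pre ++ R) (pre ++ L) +ℚ z *ℚ detR (map P pre ++ P x ∷ R) (pre ++ x ∷ L)
    ≡⟨ cong (_+ℚ z *ℚ detR (map P pre ++ P x ∷ R) (pre ++ x ∷ L)) (sym (detR-dropUnit P pre x R L (λ x∈ → dj x x∈ (here refl)) x∉L)) ⟩
  detR (map P pre ++ idKernel x ∷ R) (pre ++ x ∷ L) +ℚ z *ℚ detR (map P pre ++ P x ∷ R) (pre ++ x ∷ L)
    ≡⟨ sym (detR-linear (map P pre) (idKernel x) (P x) z R (pre ++ x ∷ L)) ⟩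
  detR (map P pre ++ mix z P x ∷ R) (pre ++ x ∷ L) ∎
  where
  open ≡-Reasoning
  L = select D E
  R = map (mix z P) L
  select-⊆ : ∀ (D : List Face) E {y} → y ∈ select D E → y ∈ D
  select-⊆ (x ∷ D) (true ∷ E) (here p) = here p
  select-⊆ (x ∷ D) (true ∷ E) (there p) = there (select-⊆ D E p)
  select-⊆ (x ∷ D) (false ∷ E) p = there (select-⊆ D E p)
  x∉L : x ∉ L
  x∉L x∈ = All.lookup u₁ (select-⊆ D E x∈) refl
  assoc : ∀ l → (pre ∷ʳ x) ++ l ≡ pre ++ x ∷ l
  assoc = Listₚ.++-assoc pre (x ∷ [])
  lem : ∀ z a b → z *ℚ a *ℚ b ≡ z *ℚ (a *ℚ b)
  lem = solve-∀ ℚring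
  term : ∀ A → minorTerm P z pre (x ∷ D) (true ∷ E) (true ∷ A) ≡ z *ℚ minorTerm P z (pre ∷ʳ x) D E A
  term A with A ⊆ᵇ E
  ... | true = trans (cong (λ l → z *ℚ z ^ℚ trues A *ℚ minor P l) (sym (assoc (select D A)))) (lem z (z ^ℚ trues A) (minor P ((pre ∷ʳ x) ++ select D A)))
  ... | false = sym (ℚₚ.*-zeroʳ z)
  dj′ : ∀ y → y ∈ pre ∷ʳ x → y ∉ D
  dj′ y y∈ y∈′ with ∈ₚ.∈-++⁻ pre y∈
  ... | inj₁ p = dj y p (there y∈′)
  ... | inj₂ (here refl) = All.lookup u₁ y∈′ refl
  with-x : ∑ (allBools (length D)) (λ A → minorTerm P z pre (x ∷ D) (true ∷ E) (true ∷ A)) ≡ z *ℚ detR (map P pre ++ P x ∷ R) (pre ++ x ∷ L)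
  with-x = begin
    ∑ (allBools (length D)) (λ A → minorTerm P z pre (x ∷ D) (true ∷ E) (true ∷ A))
      ≡⟨ ∑-cong (allBools (length D)) (λ A _ → term A) ⟩
    ∑ (allBools (length D)) (λ A → z *ℚ minorTerm P z (pre ∷ʳ x) D E A)
      ≡⟨ ∑-*ˡ (allBools (length D)) z (minorTerm P z (pre ∷ʳ x) D E) ⟩
    z *ℚ ∑ (allBools (length D)) (minorTerm P z (pre ∷ʳ x) D E)
      ≡⟨ cong (z *ℚ_) (minor-expansion P z (pre ∷ʳ x) D E (ℕₚ.suc-injective e) u dj′) ⟩
    z *ℚ detR (map P (pre ∷ʳ x) ++ R) ((pre ∷ʳ x) ++ L)
      ≡⟨ cong₂ (λ r c → z *ℚ detR r c) (trans (cong (_++ R) (Listₚ.map-++ P pre (x ∷ []))) (Listₚ.++-assoc (map P pre) (P x ∷ []) R)) (assoc L) ⟩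
    z *ℚ detR (map P pre ++ P x ∷ R) (pre ++ x ∷ L) ∎

-- Binomial theorem: the surviving terms are the subsets of the intersection of `S` and `E`. The
-- test against `S` is kept as a separate factor because it is what the law averages.
power-common : ∀ z m S E → length S ≡ m → length E ≡ m →
  (1ℚ +ℚ z) ^ℚ common S E ≡ ∑ (allBools m) (λ A → if A ⊆ᵇ E then z ^ℚ trues A *ℚ (if A ⊆ᵇ S then 1ℚ else 0ℚ) else 0ℚ)
power-common z zero [] [] e₁ e₂ = refl
power-common z (suc m) (s ∷ S) (b ∷ E) e₁ e₂ = trans (step s b) (sym (∑-allBools m (term (s ∷ S) (b ∷ E))))
  where
  open ≡-Reasoning
  term : List Bool → List Bool → List Bool → ℚ
  term S E A = if A ⊆ᵇ E then z ^ℚ trues A *ℚ (if A ⊆ᵇ S then 1ℚ else 0ℚ) else 0ℚ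
  ih : (1ℚ +ℚ z) ^ℚ common S E ≡ ∑ (allBools m) (term S E)
  ih = power-common z m S E (ℕₚ.suc-injective e₁) (ℕₚ.suc-injective e₂)
  skip : ∀ {X} → (∀ A → X A ≡ 0ℚ) → (1ℚ +ℚ z) ^ℚ common S E ≡ ∑ (allBools m) X +ℚ ∑ (allBools m) (term S E)
  skip h = trans ih (sym (trans (cong (_+ℚ ∑ (allBools m) (term S E)) (trans (∑-cong (allBools m) (λ A _ → h A)) (∑-0 (allBools m)))) (ℚₚ.+-identityˡ (∑ (allBools m) (term S E)))))
  lem : ∀ z p → (1ℚ +ℚ z) *ℚ p ≡ z *ℚ p +ℚ p
  lem = solve-∀ ℚring
  assoc : ∀ A → z *ℚ term S E A ≡ term (true ∷ S) (true ∷ E) (true ∷ A)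
  assoc A with A ⊆ᵇ E
  ... | true = sym (ℚₚ.*-assoc z (z ^ℚ trues A) (if A ⊆ᵇ S then 1ℚ else 0ℚ))
  ... | false = ℚₚ.*-zeroʳ z
  zero′ : ∀ A → term (false ∷ S) (true ∷ E) (true ∷ A) ≡ 0ℚ
  zero′ A with A ⊆ᵇ E
  ... | true = ℚₚ.*-zeroʳ (z ^ℚ suc (trues A))
  ... | false = refl
  step : ∀ s b → (1ℚ +ℚ z) ^ℚ common (s ∷ S) (b ∷ E) ≡
    ∑ (allBools m) (λ A → term (s ∷ S) (b ∷ E) (true ∷ A)) +ℚ ∑ (allBools m) (λ A → term (s ∷ S) (b ∷ E) (false ∷ A))
  step true true = trans (cong ((1ℚ +ℚ z) *ℚ_) ih) (trans (lem z (∑ (allBools m) (term S E)))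
    (cong (_+ℚ ∑ (allBools m) (term S E)) (trans (sym (∑-*ˡ (allBools m) z (term S E))) (∑-cong (allBools m) (λ A _ → assoc A)))))
  step true false = skip (λ _ → refl)
  step false true = skip zero′
  step false false = skip (λ _ → refl)

-- Faces as strictly increasing lists

∧-trueˡ : ∀ {a b} → a ∧ b ≡ true → a ≡ true
∧-trueˡ {true} h = refl

∧-trueʳ : ∀ {a b} → a ∧ b ≡ true → b ≡ true
∧-trueʳ {true} h = h

∧-intro : ∀ {a b} → a ≡ true → b ≡ true → a ∧ b ≡ true
∧-intro refl refl = refl

module _ {A : Set} where

  any-true : ∀ (p : A → Bool) xs → any p xs ≡ true → ∃[ x ] x ∈ xs × p x ≡ true
  any-true p (x ∷ xs) h with p x in e
  ... | true = x , here refl , e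
  ... | false with any-true p xs h
  ... | y , y∈ , q = y , there y∈ , q

  any-intro : ∀ (p : A → Bool) {x xs} → x ∈ xs → p x ≡ true → any p xs ≡ true
  any-intro p (here refl) e rewrite e = refl
  any-intro p {x} {y ∷ xs} (there x∈) e rewrite any-intro p x∈ e = Boolₚ.∨-zeroʳ (p y)

  all-true : ∀ (p : A → Bool) xs → all p xs ≡ true → ∀ {x} → x ∈ xs → p x ≡ true
  all-true p (x ∷ xs) h (here refl) = ∧-trueˡ h
  all-true p (x ∷ xs) h (there x∈) = all-true p xs (∧-trueʳ {p x} h) x∈

  all-intro : ∀ (p : A → Bool) xs → (∀ {x} → x ∈ xs → p x ≡ true) → all p xs ≡ true
  all-intro p [] h = refl
  all-intro p (x ∷ xs) h = ∧-intro (h (here refl)) (all-intro p xs (h ∘ there))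

  ∈-filterᵇ⁻ : ∀ (p : A → Bool) xs {x} → x ∈ filterᵇ p xs → x ∈ xs × p x ≡ true
  ∈-filterᵇ⁻ p (y ∷ xs) h with p y in e
  ∈-filterᵇ⁻ p (y ∷ xs) (here refl) | true = here refl , e
  ∈-filterᵇ⁻ p (y ∷ xs) (there h) | true with ∈-filterᵇ⁻ p xs h
  ... | a , b = there a , b
  ∈-filterᵇ⁻ p (y ∷ xs) h | false with ∈-filterᵇ⁻ p xs h
  ... | a , b = there a , b

  ∈-filterᵇ⁺ : ∀ (p : A → Bool) {x} xs → x ∈ xs → p x ≡ true → x ∈ filterᵇ p xs
  ∈-filterᵇ⁺ p (y ∷ xs) (here refl) e rewrite e = here refl
  ∈-filterᵇ⁺ p (y ∷ xs) (there h) e with p y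
  ... | true = there (∈-filterᵇ⁺ p xs h e)
  ... | false = ∈-filterᵇ⁺ p xs h e

  All-filterᵇ : ∀ {P : A → Set} (p : A → Bool) {xs} → All P xs → All P (filterᵇ p xs)
  All-filterᵇ p [] = []
  All-filterᵇ p {x ∷ xs} (q ∷ qs) with p x
  ... | true = q ∷ All-filterᵇ p qs
  ... | false = All-filterᵇ p qs

  AllPairs-filterᵇ : ∀ {R : A → A → Set} (p : A → Bool) {xs} → AllPairs R xs → AllPairs R (filterᵇ p xs)
  AllPairs-filterᵇ p [] = []
  AllPairs-filterᵇ p {x ∷ xs} (q ∷ qs) with p x
  ... | true = All-filterᵇ p q ∷ AllPairs-filterᵇ p qs
  ... | false = AllPairs-filterᵇ p qs

  Unique-∷ : ∀ {x : A} {xs} → x ∉ xs → Unique xs → Unique (x ∷ xs)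
  Unique-∷ h u = All.tabulate (λ {y} y∈ e → h (subst (_∈ _) (sym e) y∈)) ∷ u

  Unique-head : ∀ {x : A} {xs} → Unique (x ∷ xs) → x ∉ xs
  Unique-head (h ∷ _) x∈ = All.lookup h x∈ refl

  Unique-resp-↭ : ∀ {xs ys : List A} → xs ↭ ys → Unique xs → Unique ys
  Unique-resp-↭ Perm.refl u = u
  Unique-resp-↭ (prep x p) (h ∷ u) = Permₚ.All-resp-↭ p h ∷ Unique-resp-↭ p u
  Unique-resp-↭ (swap x y p) ((h ∷ h₁) ∷ h₂ ∷ u) =
    ((h ∘ sym) ∷ Permₚ.All-resp-↭ p h₂) ∷ Permₚ.All-resp-↭ p h₁ ∷ Unique-resp-↭ p u
  Unique-resp-↭ (Perm.trans p q) u = Unique-resp-↭ q (Unique-resp-↭ p u)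

  ∈-↭ : ∀ {x : A} {xs} → x ∈ xs → ∃[ ys ] xs ↭ x ∷ ys
  ∈-↭ x∈ with ∈ₚ.∈-∃++ x∈
  ... | ys , zs , refl = ys ++ zs , Permₚ.shift _ ys zs

  Unique-length : ∀ {xs ys : List A} → Unique xs → (∀ {x} → x ∈ xs → x ∈ ys) → length xs ≤ length ys
  Unique-length {[]} u h = z≤n
  Unique-length {x ∷ xs} {ys} (n ∷ u) h with ∈-↭ (h (here refl))
  ... | zs , p = subst (suc (length xs) ≤_) (sym (Permₚ.↭-length p)) (s≤s (Unique-length u h′))
    where
    h′ : ∀ {y} → y ∈ xs → y ∈ zs
    h′ y∈ with Permₚ.∈-resp-↭ p (h (there y∈))
    ... | here refl = ⊥-elim (All.lookup n y∈ refl)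
    ... | there q = q

memb⇒∈ : ∀ {x} ys → memb x ys ≡ true → x ∈ ys
memb⇒∈ {x} ys h with any-true (x ≡ᵇ_) ys h
... | y , y∈ , e rewrite ≡ᵇ⇒≡ {x} {y} e = y∈

∈⇒memb : ∀ {x ys} → x ∈ ys → memb x ys ≡ true
∈⇒memb {x} x∈ = any-intro (x ≡ᵇ_) x∈ (≡ᵇ-refl x)

∉⇒memb : ∀ {x ys} → x ∉ ys → memb x ys ≡ false
∉⇒memb {x} {ys} h = ≢true (h ∘ memb⇒∈ ys)

memb-false⇒∉ : ∀ {x ys} → memb x ys ≡ false → x ∉ ys
memb-false⇒∉ e x∈ with trans (sym e) (∈⇒memb x∈)
... | ()

memb-cong : ∀ {x xs ys} → (x ∈ xs → x ∈ ys) → (x ∈ ys → x ∈ xs) → memb x xs ≡ memb x ys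
memb-cong {x} {xs} {ys} f g with memb x xs in e
... | true = sym (∈⇒memb (f (memb⇒∈ xs e)))
... | false = sym (∉⇒memb (memb-false⇒∉ {ys = xs} e ∘ g))

Unique-⊇ : ∀ {xs ys : List ℕ} → Unique xs → (∀ {x} → x ∈ xs → x ∈ ys) → length ys ≤ length xs → ∀ {y} → y ∈ ys → y ∈ xs
Unique-⊇ {xs} {ys} u h l {y} y∈ with memb y xs in e
... | true = memb⇒∈ xs e
... | false = ⊥-elim (ℕₚ.<⇒≱ (Unique-length (Unique-∷ (memb-false⇒∉ {ys = xs} e) u) h′) l)
  where
  h′ : ∀ {z} → z ∈ y ∷ xs → z ∈ ys
  h′ (here refl) = y∈
  h′ (there z∈) = h z∈

Sorted : List ℕ → Set
Sorted = AllPairs _<_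

Sorted⇒Unique : ∀ {xs} → Sorted xs → Unique xs
Sorted⇒Unique [] = []
Sorted⇒Unique (h ∷ s) = All.map ℕₚ.<⇒≢ h ∷ Sorted⇒Unique s

sorted-ext : ∀ {xs ys} → Sorted xs → Sorted ys → (∀ {x} → x ∈ xs → x ∈ ys) → (∀ {x} → x ∈ ys → x ∈ xs) → xs ≡ ys
sorted-ext {[]} {[]} s t f g = refl
sorted-ext {[]} {y ∷ ys} s t f g with g (here refl)
... | ()
sorted-ext {x ∷ xs} {[]} s t f g with f (here refl)
... | ()
sorted-ext {x ∷ xs} {y ∷ ys} (hx ∷ s) (hy ∷ t) f g = cong₂ _∷_ x≡y (sorted-ext s t f′ g′)
  where
  x≡y : x ≡ y
  x≡y with f (here refl) | g (here refl)
  ... | here e | _ = e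
  ... | there _ | here e = sym e
  ... | there p | there q = ⊥-elim (ℕₚ.<-asym (All.lookup hy p) (All.lookup hx q))
  f′ : ∀ {z} → z ∈ xs → z ∈ ys
  f′ z∈ with f (there z∈)
  ... | here refl = ⊥-elim (ℕₚ.<⇒≢ (All.lookup hx z∈) x≡y)
  ... | there p = p
  g′ : ∀ {z} → z ∈ ys → z ∈ xs
  g′ z∈ with g (there z∈)
  ... | here refl = ⊥-elim (ℕₚ.<⇒≢ (All.lookup hy z∈) (sym x≡y))
  ... | there p = p

upTo-sorted : ∀ n → Sorted (upTo n)
upTo-sorted n = AllPairsₚ.applyUpTo⁺₁ id n (λ i<j _ → i<j)

record IsSubset (V : List ℕ) (k : ℕ) (σ : List ℕ) : Set where
  constructor isSubset
  field
    sorted : Sorted σ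
    ⊆V : ∀ {x} → x ∈ σ → x ∈ V
    size : length σ ≡ k

∈-subsetsOf⁻ : ∀ {V} k {σ} → Sorted V → σ ∈ subsetsOf V k → IsSubset V k σ
∈-subsetsOf⁻ zero s (here refl) = isSubset [] (λ ()) refl
∈-subsetsOf⁻ {v ∷ V} (suc k) (h ∷ s) m with ∈ₚ.∈-++⁻ (map (v ∷_) (subsetsOf V k)) m
... | inj₂ p with ∈-subsetsOf⁻ (suc k) s p
... | isSubset a b c = isSubset a (there ∘ b) c
∈-subsetsOf⁻ {v ∷ V} (suc k) (h ∷ s) m | inj₁ p with ∈ₚ.∈-map⁻ (v ∷_) p
... | σ′ , q , refl with ∈-subsetsOf⁻ k s q
... | isSubset a b c = isSubset (All.tabulate (All.lookup h ∘ b) ∷ a) (λ { (here e) → here e ; (there x) → there (b x) }) (cong suc c)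

∈-subsetsOf⁺ : ∀ {V} k {σ} → Sorted V → IsSubset V k σ → σ ∈ subsetsOf V k
∈-subsetsOf⁺ zero {[]} s _ = here refl
∈-subsetsOf⁺ {[]} (suc k) {x ∷ σ} s (isSubset _ b _) with b (here refl)
... | ()
∈-subsetsOf⁺ {v ∷ V} (suc k) {x ∷ σ} (h ∷ s) (isSubset (hx ∷ a) b c) with b (here refl)
... | here refl = ∈ₚ.∈-++⁺ˡ (∈ₚ.∈-map⁺ (v ∷_) (∈-subsetsOf⁺ k s (isSubset a b′ (ℕₚ.suc-injective c))))
  where
  b′ : ∀ {y} → y ∈ σ → y ∈ V
  b′ y∈ with b (there y∈)
  ... | here refl = ⊥-elim (ℕₚ.<-irrefl refl (All.lookup hx y∈))
  ... | there q = q
... | there x∈ = ∈ₚ.∈-++⁺ʳ (map (v ∷_) (subsetsOf V k)) (∈-subsetsOf⁺ (suc k) s (isSubset (hx ∷ a) b′ c))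
  where
  b′ : ∀ {y} → y ∈ x ∷ σ → y ∈ V
  b′ (here refl) = x∈
  b′ (there y∈) with b (there y∈)
  ... | here refl = ⊥-elim (ℕₚ.<-asym (All.lookup h x∈) (All.lookup hx y∈))
  ... | there q = q

subsetsOf-unique : ∀ {V} k → Sorted V → Unique (subsetsOf V k)
subsetsOf-unique zero s = [] ∷ []
subsetsOf-unique {[]} (suc k) s = []
subsetsOf-unique {v ∷ V} (suc k) (h ∷ s) = Uniqueₚ.++⁺ (Uniqueₚ.map⁺ Listₚ.∷-injectiveʳ (subsetsOf-unique k s)) (subsetsOf-unique (suc k) s) dj
  where
  dj : ∀ {σ} → ¬ (σ ∈ map (v ∷_) (subsetsOf V k) × σ ∈ subsetsOf V (suc k))
  dj (p , q) with ∈ₚ.∈-map⁻ (v ∷_) p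
  ... | _ , _ , refl = ℕₚ.<-irrefl refl (All.lookup h (IsSubset.⊆V (∈-subsetsOf⁻ (suc k) s q) (here refl)))

inter-comm : ∀ {σ τ} → Sorted σ → Sorted τ → inter σ τ ≡ inter τ σ
inter-comm {σ} {τ} s t = sorted-ext (AllPairs-filterᵇ _ s) (AllPairs-filterᵇ _ t) (one σ τ) (one τ σ)
  where
  one : ∀ σ τ {x} → x ∈ inter σ τ → x ∈ inter τ σ
  one σ τ m with ∈-filterᵇ⁻ (λ x → memb x τ) σ m
  ... | a , b = ∈-filterᵇ⁺ (λ x → memb x σ) τ (memb⇒∈ τ b) (∈⇒memb a)

eqFace-sym : ∀ σ τ → eqFace σ τ ≡ eqFace τ σ
eqFace-sym σ τ with eqFace σ τ in e
... | true rewrite eqFace⇒≡ σ τ e = sym (eqFace-refl τ)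
... | false = sym (≢true λ q → case trans (sym e) (trans (cong (eqFace σ) (eqFace⇒≡ τ σ q)) (eqFace-refl σ)) of λ ())

Pmat-sym : ∀ n d ℓ {σ τ} → Sorted σ → Sorted τ → Pmat n d ℓ σ τ ≡ Pmat n d ℓ τ σ
Pmat-sym n d ℓ {σ} {τ} s t = begin
  Q (eqFace σ τ) (inter σ τ) (Jcoef σ τ)
    ≡⟨ cong₂ (λ b i → Q b i (Icoef i σ *ℚ Icoef i τ)) (eqFace-sym σ τ) (inter-comm s t) ⟩
  Q (eqFace τ σ) (inter τ σ) (Icoef (inter τ σ) σ *ℚ Icoef (inter τ σ) τ)
    ≡⟨ cong (Q (eqFace τ σ) (inter τ σ)) (ℚₚ.*-comm (Icoef (inter τ σ) σ) (Icoef (inter τ σ) τ)) ⟩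
  Q (eqFace τ σ) (inter τ σ) (Jcoef τ σ) ∎
  where
  open ≡-Reasoning
  Q : Bool → Face → ℚ → ℚ
  Q b i j = if b then safeDiv (ℕ→ℚ (suc d + ℓ)) (ℕ→ℚ (n + ℓ)) else if length i ≡ᵇ d then safeDiv j (ℕ→ℚ (n + ℓ)) else 0ℚ

-- Facets and incidence signs

data Facet : Face → Face → Set where
  drop : ∀ {x σ} → Facet σ (x ∷ σ)
  keep : ∀ {x σ τ} → Facet σ τ → Facet (x ∷ σ) (x ∷ τ)

subset⇒facet : ∀ {σ τ} → Sorted σ → Sorted τ → (∀ {x} → x ∈ σ → x ∈ τ) → length τ ≡ suc (length σ) → Facet σ τ
subset⇒facet {[]} {y ∷ []} s t h e = drop
subset⇒facet {x ∷ σ} {y ∷ τ} (hx ∷ s) (hy ∷ t) h e with h (here refl)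
... | here refl = keep (subset⇒facet s t h′ (ℕₚ.suc-injective e))
  where
  h′ : ∀ {z} → z ∈ σ → z ∈ τ
  h′ z∈ with h (there z∈)
  ... | here refl = ⊥-elim (ℕₚ.<-irrefl refl (All.lookup hx z∈))
  ... | there q = q
... | there x∈ = subst (λ l → Facet l (y ∷ τ)) (sym σ≡τ) drop
  where
  h′ : ∀ {z} → z ∈ x ∷ σ → z ∈ τ
  h′ (here refl) = x∈
  h′ (there z∈) with h (there z∈)
  ... | here refl = ⊥-elim (ℕₚ.<-asym (All.lookup hx z∈) (All.lookup hy x∈))
  ... | there q = q
  σ≡τ : x ∷ σ ≡ τ
  σ≡τ = sorted-ext (hx ∷ s) t h′ (Unique-⊇ (Sorted⇒Unique (hx ∷ s)) h′ (ℕₚ.≤-reflexive (ℕₚ.suc-injective e)))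

facet-⊆ : ∀ {σ τ} → Facet σ τ → ∀ {x} → x ∈ σ → x ∈ τ
facet-⊆ drop x∈ = there x∈
facet-⊆ (keep f) (here e) = here e
facet-⊆ (keep f) (there x∈) = there (facet-⊆ f x∈)

Icoef-∷ : ∀ x σ τ → Sorted (x ∷ τ) → Icoef (x ∷ σ) (x ∷ τ) ≡ ⊖ Icoef σ τ
Icoef-∷ x σ τ (h ∷ s) = begin
  term (x ∷ σ) (0 , τ) +ℚ ∑ (map up (facetsIx τ)) (term (x ∷ σ))
    ≡⟨ cong₂ _+ℚ_ (cong (λ b → if b then 1ℚ else 0ℚ) (≢⇒eqFace first)) (∑-map up (facetsIx τ) (term (x ∷ σ))) ⟩
  0ℚ +ℚ ∑ (facetsIx τ) (λ p → term (x ∷ σ) (up p))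
    ≡⟨ ℚₚ.+-identityˡ (∑ (facetsIx τ) (λ p → term (x ∷ σ) (up p))) ⟩
  ∑ (facetsIx τ) (λ p → term (x ∷ σ) (up p))
    ≡⟨ ∑-cong (facetsIx τ) (λ p _ → each p) ⟩
  ∑ (facetsIx τ) (λ p → (⊖ 1ℚ) *ℚ term σ p)
    ≡⟨ ∑-*ˡ (facetsIx τ) (⊖ 1ℚ) (term σ) ⟩
  (⊖ 1ℚ) *ℚ Icoef σ τ
    ≡⟨ lem (Icoef σ τ) ⟩
  ⊖ Icoef σ τ ∎
  where
  open ≡-Reasoning
  term : Face → ℕ × Face → ℚ
  term σ p = if eqFace σ (proj₂ p) then sign (proj₁ p) else 0ℚ
  up : ℕ × Face → ℕ × Face
  up p = suc (proj₁ p) , x ∷ proj₂ p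
  first : x ∷ σ ≢ τ
  first refl = ℕₚ.<-irrefl refl (All.head h)
  lem : ∀ a → (⊖ 1ℚ) *ℚ a ≡ ⊖ a
  lem = solve-∀ ℚring
  each : ∀ p → term (x ∷ σ) (up p) ≡ (⊖ 1ℚ) *ℚ term σ p
  each (i , ρ) rewrite ≡ᵇ-refl x with eqFace σ ρ
  ... | true = sym (lem (sign i))
  ... | false = refl

Icoef² : ∀ {σ τ} → Sorted τ → Facet σ τ → Icoef σ τ *ℚ Icoef σ τ ≡ 1ℚ
Icoef² {σ} {x ∷ _} (h ∷ s) drop = trans (cong (λ z → z *ℚ z) one) refl
  where
  open ≡-Reasoning
  term : ℕ × Face → ℚ
  term p = if eqFace σ (proj₂ p) then sign (proj₁ p) else 0ℚ
  up : ℕ × Face → ℕ × Face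
  up p = suc (proj₁ p) , x ∷ proj₂ p
  ne : ∀ ρ → σ ≢ x ∷ ρ
  ne ρ refl = ℕₚ.<-irrefl refl (All.head h)
  one : Icoef σ (x ∷ σ) ≡ 1ℚ
  one = begin
    term (0 , σ) +ℚ ∑ (map up (facetsIx σ)) term
      ≡⟨ cong₂ _+ℚ_ (cong (λ b → if b then 1ℚ else 0ℚ) (eqFace-refl σ)) (∑-map up (facetsIx σ) term) ⟩
    1ℚ +ℚ ∑ (facetsIx σ) (term ∘ up)
      ≡⟨ cong (1ℚ +ℚ_) (trans (∑-cong (facetsIx σ) (λ p _ → cong (λ b → if b then sign (suc (proj₁ p)) else 0ℚ) (≢⇒eqFace (ne (proj₂ p))))) (∑-0 (facetsIx σ))) ⟩
    1ℚ +ℚ 0ℚ ∎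
Icoef² {x ∷ σ} {x ∷ τ} (h ∷ s) (keep f) =
  trans (cong (λ z → z *ℚ z) (Icoef-∷ x σ τ (h ∷ s))) (trans (lem (Icoef σ τ)) (Icoef² s f))
  where
  lem : ∀ a → (⊖ a) *ℚ (⊖ a) ≡ a *ℚ a
  lem = solve-∀ ℚring

Facet-length : ∀ {σ τ} → Facet σ τ → length τ ≡ suc (length σ)
Facet-length drop = refl
Facet-length (keep f) = cong suc (Facet-length f)

-- A further common vertex together with σ would already exhaust both faces, which would then
-- coincide.
inter-star : ∀ {σ τ τ′} → Sorted σ → Sorted τ → Sorted τ′ → Facet σ τ → Facet σ τ′ → τ ≢ τ′ → inter τ τ′ ≡ σ
inter-star {σ} {τ} {τ′} s t t′ f f′ ne = sorted-ext (AllPairs-filterᵇ _ t) s to (λ x∈ → ∈-filterᵇ⁺ _ τ (facet-⊆ f x∈) (∈⇒memb (facet-⊆ f′ x∈)))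
  where
  to : ∀ {x} → x ∈ inter τ τ′ → x ∈ σ
  to {x} m with memb x σ in e
  ... | true = memb⇒∈ σ e
  ... | false = ⊥-elim (ne (sorted-ext t t′ (λ y∈ → sub f′ (proj₂ xx) (Unique-⊇ u (sub f (proj₁ xx)) (len f) y∈))
                                            (λ y∈ → sub f (proj₁ xx) (Unique-⊇ u (sub f′ (proj₂ xx)) (len f′) y∈))))
    where
    xx : x ∈ τ × x ∈ τ′
    xx with ∈-filterᵇ⁻ (λ x → memb x τ′) τ m
    ... | a , b = a , memb⇒∈ τ′ b
    u : Unique (x ∷ σ)
    u = Unique-∷ (memb-false⇒∉ {ys = σ} e) (Sorted⇒Unique s)
    sub : ∀ {ρ} → Facet σ ρ → x ∈ ρ → ∀ {y} → y ∈ x ∷ σ → y ∈ ρ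
    sub g q (here refl) = q
    sub g q (there y∈) = facet-⊆ g y∈
    len : ∀ {ρ} → Facet σ ρ → length ρ ≤ suc (length σ)
    len g = ℕₚ.≤-reflexive (Facet-length g)

-- Natural numbers in ℚ

ℕ→ℚ-+ : ∀ a b → ℕ→ℚ (a + b) ≡ ℕ→ℚ a +ℚ ℕ→ℚ b
ℕ→ℚ-+ a b = ℚₚ.toℚᵘ-injective (ℚᵘₚ.≃-trans (ℚₚ.toℚᵘ-fromℚᵘ (ℚᵘ.mkℚᵘ (ℤ.+ (a + b)) 0))
  (ℚᵘₚ.≃-trans (ℚᵘ.*≡* (cong (λ z → z ℤ.* ℤ.+ 1) (trans (ℤₚ.pos-+ a b) (sym (cong₂ ℤ._+_ (ℤₚ.*-identityʳ (ℤ.+ a)) (ℤₚ.*-identityʳ (ℤ.+ b)))))))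
  (ℚᵘₚ.≃-sym (ℚᵘₚ.≃-trans (ℚₚ.toℚᵘ-homo-+ (ℕ→ℚ a) (ℕ→ℚ b))
    (ℚᵘₚ.+-cong (ℚₚ.toℚᵘ-fromℚᵘ (ℚᵘ.mkℚᵘ (ℤ.+ a) 0)) (ℚₚ.toℚᵘ-fromℚᵘ (ℚᵘ.mkℚᵘ (ℤ.+ b) 0)))))))

ℕ→ℚ-* : ∀ a b → ℕ→ℚ (a * b) ≡ ℕ→ℚ a *ℚ ℕ→ℚ b
ℕ→ℚ-* zero b = sym (ℚₚ.*-zeroˡ (ℕ→ℚ b))
ℕ→ℚ-* (suc a) b = begin
  ℕ→ℚ (b + a * b)                   ≡⟨ ℕ→ℚ-+ b (a * b) ⟩
  ℕ→ℚ b +ℚ ℕ→ℚ (a * b)              ≡⟨ cong (ℕ→ℚ b +ℚ_) (ℕ→ℚ-* a b) ⟩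
  ℕ→ℚ b +ℚ ℕ→ℚ a *ℚ ℕ→ℚ b           ≡⟨ lem (ℕ→ℚ a) (ℕ→ℚ b) ⟩
  (1ℚ +ℚ ℕ→ℚ a) *ℚ ℕ→ℚ b            ≡⟨ cong (_*ℚ ℕ→ℚ b) (sym (ℕ→ℚ-+ 1 a)) ⟩
  ℕ→ℚ (suc a) *ℚ ℕ→ℚ b ∎
  where
  open ≡-Reasoning
  lem : ∀ x y → y +ℚ x *ℚ y ≡ (1ℚ +ℚ x) *ℚ y
  lem = solve-∀ ℚring

ℕ→ℚ-nonneg : ∀ a → 0ℚ ≤ℚ ℕ→ℚ a
ℕ→ℚ-nonneg a = ℚₚ.nonNegative⁻¹ (ℕ→ℚ a) {{ℚₚ.normalize-nonNeg a 1}}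

ℕ→ℚ-mono : ∀ {a b} → a ≤ b → ℕ→ℚ a ≤ℚ ℕ→ℚ b
ℕ→ℚ-mono {a} {b} h = subst₂ _≤ℚ_ (ℚₚ.+-identityʳ (ℕ→ℚ a)) (trans (sym (ℕ→ℚ-+ a (b ∸ a))) (cong ℕ→ℚ (ℕₚ.m+[n∸m]≡n h)))
  (ℚₚ.+-monoʳ-≤ (ℕ→ℚ a) (ℕ→ℚ-nonneg (b ∸ a)))

ℕ→ℚ-pos : ∀ a → 0 < a → 0ℚ <ℚ ℕ→ℚ a
ℕ→ℚ-pos (suc a) h = ℚₚ.positive⁻¹ (ℕ→ℚ (suc a)) {{ℚₚ.normalize-pos (suc a) 1}}

ℕ→ℚ-≢0 : ∀ a → 0 < a → ℕ→ℚ a ≢ 0ℚ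
ℕ→ℚ-≢0 a h e = ℚₚ.<-irrefl (sym e) (ℕ→ℚ-pos a h)

ℕ→ℚ-^ : ∀ a k → ℕ→ℚ (a ^ k) ≡ ℕ→ℚ a ^ℚ k
ℕ→ℚ-^ a zero = refl
ℕ→ℚ-^ a (suc k) = trans (ℕ→ℚ-* a (a ^ k)) (cong (ℕ→ℚ a *ℚ_) (ℕ→ℚ-^ a k))

safeDiv-* : ∀ p {q} → q ≢ 0ℚ → safeDiv p q *ℚ q ≡ p
safeDiv-* p {q} h with q ℚₚ.≟ 0ℚ
... | yes e = ⊥-elim (h e)
... | no ne = trans (ℚₚ.*-assoc p (ℚ.1/_ q {{ℚ.≢-nonZero ne}}) q) (trans (cong (p *ℚ_) (ℚₚ.*-inverseˡ q {{ℚ.≢-nonZero ne}})) (ℚₚ.*-identityʳ p))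

inv : ℕ → ℚ
inv n = safeDiv 1ℚ (ℕ→ℚ n)

inv-* : ∀ n → 0 < n → inv n *ℚ ℕ→ℚ n ≡ 1ℚ
inv-* n h = safeDiv-* 1ℚ (ℕ→ℚ-≢0 n h)

*-cancel : ∀ {a b} c → c ≢ 0ℚ → a *ℚ c ≡ b *ℚ c → a ≡ b
*-cancel {a} {b} c h e = trans (lem₀ a b) (trans (cong (_+ℚ b) d0) (ℚₚ.+-identityˡ b))
  where
  lem₀ : ∀ a b → a ≡ (a -ℚ b) +ℚ b
  lem₀ = solve-∀ ℚring
  lem₁ : ∀ a b c → c *ℚ (a -ℚ b) ≡ a *ℚ c -ℚ b *ℚ c
  lem₁ = solve-∀ ℚring
  d0 : a -ℚ b ≡ 0ℚ
  d0 = zero-product (trans (lem₁ a b c) (trans (cong (_-ℚ b *ℚ c) e) (ℚₚ.+-inverseʳ (b *ℚ c)))) h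

safeDiv-inv : ∀ p n → 0 < n → safeDiv p (ℕ→ℚ n) ≡ p *ℚ inv n
safeDiv-inv p n h = *-cancel (ℕ→ℚ n) (ℕ→ℚ-≢0 n h) (trans (safeDiv-* p (ℕ→ℚ-≢0 n h))
  (sym (trans (ℚₚ.*-assoc p (inv n) (ℕ→ℚ n)) (trans (cong (p *ℚ_) (inv-* n h)) (ℚₚ.*-identityʳ p)))))

inv-nonneg : ∀ n → 0 < n → 0ℚ ≤ℚ inv n
inv-nonneg n h = subst (0ℚ ≤ℚ_) (trans (lem (inv n) (ℕ→ℚ n)) (trans (cong (_*ℚ inv n) (inv-* n h)) (ℚₚ.*-identityˡ (inv n))))
  (mul-nonneg (ℕ→ℚ-nonneg n) (square-nonneg (inv n)))
  where
  lem : ∀ i n → n *ℚ (i *ℚ i) ≡ (i *ℚ n) *ℚ i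
  lem = solve-∀ ℚring

-- The law of one tree

∈-allBools⁻ : ∀ m {S} → S ∈ allBools m → length S ≡ m
∈-allBools⁻ zero (here refl) = refl
∈-allBools⁻ (suc m) h with ∈ₚ.∈-++⁻ (map (true ∷_) (allBools m)) h
... | inj₁ p with ∈ₚ.∈-map⁻ (true ∷_) p
... | S , q , refl = cong suc (∈-allBools⁻ m q)
∈-allBools⁻ (suc m) h | inj₂ p with ∈ₚ.∈-map⁻ (false ∷_) p
... | S , q , refl = cong suc (∈-allBools⁻ m q)

∈-allBools⁺ : ∀ {m} S → length S ≡ m → S ∈ allBools m
∈-allBools⁺ [] refl = here refl
∈-allBools⁺ (true ∷ S) refl = ∈ₚ.∈-++⁺ˡ (∈ₚ.∈-map⁺ (true ∷_) (∈-allBools⁺ S refl))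
∈-allBools⁺ (false ∷ S) refl = ∈ₚ.∈-++⁺ʳ (map (true ∷_) (allBools (length S))) (∈ₚ.∈-map⁺ (false ∷_) (∈-allBools⁺ S refl))

length-select : ∀ {A : Set} (D : List A) E → length E ≡ length D → length (select D E) ≡ trues E
length-select [] [] e = refl
length-select (x ∷ D) (true ∷ E) e = cong suc (length-select D E (ℕₚ.suc-injective e))
length-select (x ∷ D) (false ∷ E) e = length-select D E (ℕₚ.suc-injective e)

select-⊆ : ∀ {A : Set} (D : List A) E {y} → y ∈ select D E → y ∈ D
select-⊆ (x ∷ D) (true ∷ E) (here p) = here p
select-⊆ (x ∷ D) (true ∷ E) (there p) = there (select-⊆ D E p)
select-⊆ (x ∷ D) (false ∷ E) p = there (select-⊆ D E p)

select-unique : ∀ {A : Set} {D : List A} E → Unique D → Unique (select D E)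
select-unique {D = []} E u = []
select-unique {D = x ∷ D} [] u = []
select-unique {D = x ∷ D} (true ∷ E) (h ∷ u) = All.tabulate (All.lookup h ∘ select-⊆ D E) ∷ select-unique E u
select-unique {D = x ∷ D} (false ∷ E) (h ∷ u) = select-unique E u

-- Reads `bs` as a subset of the set coded by `E` and codes it over the full ground set. Thus a
-- principal minor inside a principal submatrix becomes one of the whole kernel.
refine : List Bool → List Bool → List Bool
refine [] bs = []
refine (true ∷ E) [] = false ∷ refine E []
refine (true ∷ E) (b ∷ bs) = b ∷ refine E bs
refine (false ∷ E) bs = false ∷ refine E bs

length-refine : ∀ E bs → length (refine E bs) ≡ length E
length-refine [] bs = refl
length-refine (true ∷ E) [] = cong suc (length-refine E [])
length-refine (true ∷ E) (b ∷ bs) = cong suc (length-refine E bs)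
length-refine (false ∷ E) bs = cong suc (length-refine E bs)

select-refine : ∀ {A : Set} (D : List A) E bs → length E ≡ length D → select D (refine E bs) ≡ select (select D E) bs
select-refine [] [] bs e = refl
select-refine (x ∷ D) (true ∷ E) [] e = trans (select-refine D E [] (ℕₚ.suc-injective e)) (select-[] (select D E))
select-refine (x ∷ D) (true ∷ E) (true ∷ bs) e = cong (x ∷_) (select-refine D E bs (ℕₚ.suc-injective e))
select-refine (x ∷ D) (true ∷ E) (false ∷ bs) e = select-refine D E bs (ℕₚ.suc-injective e)
select-refine (x ∷ D) (false ∷ E) bs e = select-refine D E bs (ℕₚ.suc-injective e)

_≟F_ : (σ τ : Face) → Dec (σ ≡ τ)
_≟F_ = Listₚ.≡-dec ℕₚ._≟_

-- The determinant of u·I − v·ssᵀ for a sign vector s of length m.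
rankOneDet : ℚ → ℚ → ℕ → ℚ
rankOneDet u v zero = 1ℚ
rankOneDet u v (suc m) = u *ℚ rankOneDet u v m -ℚ v *ℚ u ^ℚ m

rankOneDet-closed : ∀ u v m → rankOneDet u v (suc m) ≡ u ^ℚ m *ℚ (u -ℚ ℕ→ℚ (suc m) *ℚ v)
rankOneDet-closed u v zero = lem u v
  where
  lem : ∀ u v → u *ℚ 1ℚ -ℚ v *ℚ 1ℚ ≡ 1ℚ *ℚ (u -ℚ 1ℚ *ℚ v)
  lem = solve-∀ ℚring
rankOneDet-closed u v (suc m) = trans (cong (λ z → u *ℚ z -ℚ v *ℚ (u *ℚ u ^ℚ m)) (rankOneDet-closed u v m))
  (trans (lem u v (u ^ℚ m) (ℕ→ℚ (suc m))) (cong (λ z → u *ℚ u ^ℚ m *ℚ (u -ℚ z *ℚ v)) (sym (ℕ→ℚ-+ 1 (suc m)))))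
  where
  lem : ∀ u v w c → u *ℚ (w *ℚ (u -ℚ c *ℚ v)) -ℚ v *ℚ (u *ℚ w) ≡ u *ℚ w *ℚ (u -ℚ (1ℚ +ℚ c) *ℚ v)
  lem = solve-∀ ℚring

pow-≤1 : ∀ {u} m → 0ℚ ≤ℚ u → u ≤ℚ 1ℚ → u ^ℚ m ≤ℚ 1ℚ
pow-≤1 zero h h′ = ℚₚ.≤-refl
pow-≤1 {u} (suc m) h h′ = mul-mono h (pow-nonneg m h) h′ (pow-≤1 m h h′)

-- In the closed form, `u - (m + 1) v` is the eigenvalue in the direction of the sign vector, all
-- others being `u`. By the last hypothesis it is at most `a v`; the remaining power of `u` is at
-- most 1.
rankOneDet-≤ : ∀ {u v} m a → 0ℚ ≤ℚ u → u ≤ℚ 1ℚ → 0ℚ ≤ℚ v → u ≤ℚ ℕ→ℚ (suc m + a) *ℚ v →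
  rankOneDet u v (suc m) ≤ℚ ℕ→ℚ a *ℚ v
rankOneDet-≤ {u} {v} m a h h′ hv le = begin
  rankOneDet u v (suc m)                     ≡⟨ rankOneDet-closed u v m ⟩
  u ^ℚ m *ℚ (u -ℚ ℕ→ℚ (suc m) *ℚ v)          ≤⟨ mulˡ (u ^ℚ m) (pow-nonneg m h) step ⟩
  u ^ℚ m *ℚ (ℕ→ℚ a *ℚ v)                     ≤⟨ mulʳ (ℕ→ℚ a *ℚ v) (mul-nonneg (ℕ→ℚ-nonneg a) hv) (pow-≤1 m h h′) ⟩
  1ℚ *ℚ (ℕ→ℚ a *ℚ v)                         ≡⟨ ℚₚ.*-identityˡ (ℕ→ℚ a *ℚ v) ⟩
  ℕ→ℚ a *ℚ v ∎
  where
  open ℚₚ.≤-Reasoning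
  lem : ∀ c a v → (c +ℚ a) *ℚ v -ℚ c *ℚ v ≡ a *ℚ v
  lem = solve-∀ ℚring
  step : u -ℚ ℕ→ℚ (suc m) *ℚ v ≤ℚ ℕ→ℚ a *ℚ v
  step = ℚₚ.≤-trans (ℚₚ.+-monoˡ-≤ (⊖ (ℕ→ℚ (suc m) *ℚ v)) le)
    (ℚₚ.≤-reflexive (trans (cong (λ z → z *ℚ v -ℚ ℕ→ℚ (suc m) *ℚ v) (ℕ→ℚ-+ (suc m) a)) (lem (ℕ→ℚ (suc m)) (ℕ→ℚ a) v)))

module _ (u v : ℚ) (s : Face → ℚ) where

  rankOne scaledId : Face → Face → ℚ
  rankOne x y = u *ℚ idKernel x y +ℚ (⊖ (v *ℚ s x)) *ℚ s y
  scaledId x y = u *ℚ idKernel x y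

  private
    scaledId-zero : ∀ {a L} → a ∉ L → All (λ x → scaledId x a ≡ 0ℚ) L
    scaledId-zero {a} h = All.tabulate λ {x} x∈ → trans (cong (u *ℚ_) (idKernel-≢ {x} {a} λ { refl → h x∈ })) (ℚₚ.*-zeroʳ u)

    lap-scaledId : ∀ a F L → a ∉ L → lap (scaledId a) F (a ∷ L) ≡ u *ℚ F L
    lap-scaledId a F L h = trans (cong₂ (λ p q → u *ℚ p *ℚ F L -ℚ q) (idKernel-refl a)
      (lap-zeroˡ (scaledId a) _ L (All.tabulate λ {x} x∈ → trans (cong (u *ℚ_) (idKernel-≢ {a} {x} λ { refl → h x∈ })) (ℚₚ.*-zeroʳ u))))
      (lem u (F L))
      where
      lem : ∀ u f → u *ℚ 1ℚ *ℚ f -ℚ 0ℚ ≡ u *ℚ f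
      lem = solve-∀ ℚring

  minor-scaledId : ∀ {L} → Unique L → minor scaledId L ≡ u ^ℚ length L
  minor-scaledId {[]} _ = refl
  minor-scaledId {a ∷ L} (h ∷ U) = trans (lap-scaledId a (detR (map scaledId L)) L (Unique-head (h ∷ U))) (cong (u *ℚ_) (minor-scaledId U))

  -- Linearity in the first row. Its scalar part leaves the same determinant with one index fewer;
  -- below its multiple of `s`, row operations reduce all other rows to `scaledId`.
  minor-rankOne : ∀ {L} → Unique L → (∀ x → x ∈ L → s x *ℚ s x ≡ 1ℚ) → minor rankOne L ≡ rankOneDet u v (length L)
  minor-rankOne {[]} _ _ = refl
  minor-rankOne {a ∷ L} (h ∷ U) sq = begin
    lap (rankOne a) (detR (map rankOne L)) (a ∷ L)
      ≡⟨ lap-linˡ (⊖ (v *ℚ s a)) (scaledId a) s (detR (map rankOne L)) (a ∷ L) ⟩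
    lap (scaledId a) (detR (map rankOne L)) (a ∷ L) +ℚ (⊖ (v *ℚ s a)) *ℚ lap s (detR (map rankOne L)) (a ∷ L)
      ≡⟨ cong₂ (λ p q → p +ℚ (⊖ (v *ℚ s a)) *ℚ q) (trans (lap-scaledId a (detR (map rankOne L)) L a∉) (cong (u *ℚ_) (minor-rankOne U (λ x m → sq x (there m)))))
           (lap-rowOps s scaledId rankOne (λ x → ⊖ (v *ℚ s x)) (λ _ _ → refl) L (a ∷ L)) ⟩
    u *ℚ rankOneDet u v (length L) +ℚ (⊖ (v *ℚ s a)) *ℚ (s a *ℚ minor scaledId L -ℚ lap s (λ xs → detR (map scaledId L) (a ∷ xs)) L)
      ≡⟨ cong₂ (λ p q → u *ℚ rankOneDet u v (length L) +ℚ (⊖ (v *ℚ s a)) *ℚ (s a *ℚ p -ℚ q)) (minor-scaledId U)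
           (lap-zero s _ L (λ xs e → detR-zeroColumn a (map scaledId L) (Allₚ.map⁺ (scaledId-zero a∉)) xs
              (subst (suc (length xs) ≤_) (sym (Listₚ.length-map scaledId L)) (ℕₚ.≤-reflexive e)))) ⟩
    u *ℚ rankOneDet u v (length L) +ℚ (⊖ (v *ℚ s a)) *ℚ (s a *ℚ u ^ℚ length L -ℚ 0ℚ)
      ≡⟨ lem (u *ℚ rankOneDet u v (length L)) v (s a) (u ^ℚ length L) ⟩
    u *ℚ rankOneDet u v (length L) -ℚ (s a *ℚ s a) *ℚ (v *ℚ u ^ℚ length L)
      ≡⟨ cong (λ p → u *ℚ rankOneDet u v (length L) -ℚ p) (trans (cong (_*ℚ (v *ℚ u ^ℚ length L)) (sq a (here refl))) (ℚₚ.*-identityˡ (v *ℚ u ^ℚ length L))) ⟩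
    u *ℚ rankOneDet u v (length L) -ℚ v *ℚ u ^ℚ length L ∎
    where
    open ≡-Reasoning
    a∉ : a ∉ L
    a∉ = Unique-head (h ∷ U)
    lem : ∀ x v s w → x +ℚ (⊖ (v *ℚ s)) *ℚ (s *ℚ w -ℚ 0ℚ) ≡ x -ℚ (s *ℚ s) *ℚ (v *ℚ w)
    lem = solve-∀ ℚring

module Law (n d ℓ : ℕ) (μ : List Bool → ℚ) (law : IsDeterminantalHypertreeLaw n d ℓ μ) where

  D : List Face
  D = dFaces n d

  P : Face → Face → ℚ
  P = Pmat n d ℓ

  p : ℚ
  p = safeDiv (ℕ→ℚ (suc d + ℓ)) (ℕ→ℚ (n + ℓ))

  Ex : (List Bool → ℚ) → ℚ
  Ex φ = ∑ (allBools (length D)) (λ S → μ S *ℚ φ S)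

  μ-nonneg : ∀ S → S ∈ allBools (length D) → 0ℚ ≤ℚ μ S
  μ-nonneg = proj₁ (proj₁ law)

  Ex-mono : ∀ {φ ψ} → (∀ S → length S ≡ length D → φ S ≤ℚ ψ S) → Ex φ ≤ℚ Ex ψ
  Ex-mono h = ∑-mono (allBools (length D)) (λ S m → mulˡ (μ S) (μ-nonneg S m) (h S (∈-allBools⁻ (length D) m)))

  Ex-const : ∀ c → Ex (λ _ → c) ≡ c
  Ex-const c = begin
    ∑ (allBools (length D)) (λ S → μ S *ℚ c)   ≡⟨ ∑-cong (allBools (length D)) (λ S _ → ℚₚ.*-comm (μ S) c) ⟩
    ∑ (allBools (length D)) (λ S → c *ℚ μ S)   ≡⟨ ∑-*ˡ (allBools (length D)) c μ ⟩
    c *ℚ ∑ (allBools (length D)) μ             ≡⟨ cong (c *ℚ_) (proj₂ (proj₁ law)) ⟩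
    c *ℚ 1ℚ                                    ≡⟨ ℚₚ.*-identityʳ c ⟩
    c ∎
    where open ≡-Reasoning

  Ex-* : ∀ c φ → Ex (λ S → c *ℚ φ S) ≡ c *ℚ Ex φ
  Ex-* c φ = trans (∑-cong (allBools (length D)) (λ S _ → lem (μ S) c (φ S))) (∑-*ˡ (allBools (length D)) c _)
    where
    lem : ∀ a b c → a *ℚ (b *ℚ c) ≡ b *ℚ (a *ℚ c)
    lem = solve-∀ ℚring

  Ex-+ : ∀ φ ψ → Ex (λ S → φ S +ℚ ψ S) ≡ Ex φ +ℚ Ex ψ
  Ex-+ φ ψ = trans (∑-cong (allBools (length D)) (λ S _ → ℚₚ.*-distribˡ-+ (μ S) (φ S) (ψ S))) (∑-+ (allBools (length D)) _ _)

  D-sorted : ∀ {τ} → τ ∈ D → Sorted τ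
  D-sorted m = IsSubset.sorted (∈-subsetsOf⁻ (suc d) (upTo-sorted n) m)

  D-unique : Unique D
  D-unique = subsetsOf-unique (suc d) (upTo-sorted n)

  -- Exchange of summation: `power-common` writes the left side as a combination of inclusion
  -- probabilities, which the law turns into principal minors for `minor-expansion`.
  moment : ∀ z E → length E ≡ length D → Ex (λ S → (1ℚ +ℚ z) ^ℚ common S E) ≡ minor (mix z P) (select D E)
  moment z E len = begin
    ∑ Bs (λ S → μ S *ℚ (1ℚ +ℚ z) ^ℚ common S E)
      ≡⟨ ∑-cong Bs (λ S m → trans (cong (μ S *ℚ_) (power-common z (length D) S E (∈-allBools⁻ (length D) m) len)) (sym (∑-*ˡ Bs (μ S) (term S)))) ⟩
    ∑ Bs (λ S → ∑ Bs (λ A → μ S *ℚ term S A))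
      ≡⟨ ∑-swap Bs Bs (λ S A → μ S *ℚ term S A) ⟩
    ∑ Bs (λ A → ∑ Bs (λ S → μ S *ℚ term S A))
      ≡⟨ ∑-cong Bs each ⟩
    ∑ Bs (minorTerm P z [] D E)
      ≡⟨ minor-expansion P z [] D E len D-unique (λ _ ()) ⟩
    minor (mix z P) (select D E) ∎
    where
    open ≡-Reasoning
    Bs = allBools (length D)
    term : List Bool → List Bool → ℚ
    term S A = if A ⊆ᵇ E then z ^ℚ trues A *ℚ (if A ⊆ᵇ S then 1ℚ else 0ℚ) else 0ℚ
    lem : ∀ m w → m *ℚ (w *ℚ 1ℚ) ≡ w *ℚ m
    lem = solve-∀ ℚring
    lem₀ : ∀ m w → m *ℚ (w *ℚ 0ℚ) ≡ w *ℚ 0ℚ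
    lem₀ = solve-∀ ℚring
    inner : ∀ A m b → m *ℚ (z ^ℚ trues A *ℚ (if b then 1ℚ else 0ℚ)) ≡ z ^ℚ trues A *ℚ (if b then m else 0ℚ)
    inner A m true = lem m (z ^ℚ trues A)
    inner A m false = lem₀ m (z ^ℚ trues A)
    expected : ∀ A b → ∑ Bs (λ S → μ S *ℚ (if b then z ^ℚ trues A *ℚ (if A ⊆ᵇ S then 1ℚ else 0ℚ) else 0ℚ))
      ≡ (if b then z ^ℚ trues A *ℚ ∑ Bs (λ S → if A ⊆ᵇ S then μ S else 0ℚ) else 0ℚ)
    expected A false = trans (∑-cong Bs (λ S _ → ℚₚ.*-zeroʳ (μ S))) (∑-0 Bs)
    expected A true = trans (∑-cong Bs (λ S _ → inner A (μ S) (A ⊆ᵇ S))) (∑-*ˡ Bs (z ^ℚ trues A) _)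
    each : ∀ A → A ∈ Bs → ∑ Bs (λ S → μ S *ℚ term S A) ≡ minorTerm P z [] D E A
    each A m = trans (expected A (A ⊆ᵇ E)) (cong (λ x → if A ⊆ᵇ E then z ^ℚ trues A *ℚ x else 0ℚ)
      (trans (proj₂ law A m) (det≡detR P (select D A) (select D A))))

  moment-nonneg : ∀ z → 0ℚ ≤ℚ 1ℚ +ℚ z → ∀ E → 0ℚ ≤ℚ Ex (λ S → (1ℚ +ℚ z) ^ℚ common S E)
  moment-nonneg z h E = ∑-nonneg (allBools (length D)) (λ S m → mul-nonneg (μ-nonneg S m) (pow-nonneg (common S E) h))

  moment-≤ : ∀ z → 0ℚ ≤ℚ 1ℚ +ℚ z → ∀ E → length E ≡ length D →
    Ex (λ S → (1ℚ +ℚ z) ^ℚ common S E) ≤ℚ (1ℚ +ℚ z *ℚ p) ^ℚ trues E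
  moment-≤ z h E len = begin
    Ex (λ S → (1ℚ +ℚ z) ^ℚ common S E)       ≡⟨ moment z E len ⟩
    minor (mix z P) L                         ≤⟨ hadamard (mix z P) L symm nn ⟩
    diagonalProduct (mix z P) L               ≡⟨ diagonalProduct-const (mix z P) (1ℚ +ℚ z *ℚ p) L diag ⟩
    (1ℚ +ℚ z *ℚ p) ^ℚ length L                ≡⟨ cong ((1ℚ +ℚ z *ℚ p) ^ℚ_) (length-select D E len) ⟩
    (1ℚ +ℚ z *ℚ p) ^ℚ trues E ∎
    where
    open ℚₚ.≤-Reasoning
    L = select D E
    diag : ∀ x → x ∈ L → mix z P x x ≡ 1ℚ +ℚ z *ℚ p
    diag x _ = cong (λ b → (if b then 1ℚ else 0ℚ) +ℚ z *ℚ (if b then p else (if length (inter x x) ≡ᵇ d then safeDiv (Jcoef x x) (ℕ→ℚ (n + ℓ)) else 0ℚ))) (eqFace-refl x)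
    symm : SymmetricOn (mix z P) L
    symm x y mx my = cong₂ (λ a b → a +ℚ z *ℚ b) (cong (λ b → if b then 1ℚ else 0ℚ) (eqFace-sym x y))
      (Pmat-sym n d ℓ (D-sorted (select-⊆ D E mx)) (D-sorted (select-⊆ D E my)))
    -- Subsets of `E` are events too, so their minors are moments of nonnegative variables.
    nn : MinorsNonneg (mix z P) L
    nn bs = subst (0ℚ ≤ℚ_) (trans (moment z (refine E bs) (trans (length-refine E bs) len)) (cong (minor (mix z P)) (select-refine D E bs len)))
      (moment-nonneg z h (refine E bs))

  module Star (σ : Face) (sσ : Sorted σ) (lσ : length σ ≡ d) (0<n : 0 < n + ℓ) (d≤n : d ≤ n) where

    -- On the star of σ, `I - P` has diagonal `u - v` and equals `u I - v s sᵀ`, with `s` the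
    -- incidence signs of σ.
    v u : ℚ
    v = inv (n + ℓ)
    u = ℕ→ℚ (n ∸ d) *ℚ v

    private
      s : Face → ℚ
      s = Icoef σ

      Nv : ℕ→ℚ (n + ℓ) *ℚ v ≡ 1ℚ
      Nv = trans (ℚₚ.*-comm (ℕ→ℚ (n + ℓ)) v) (inv-* (n + ℓ) 0<n)

      u-v : u -ℚ v ≡ 1ℚ +ℚ (⊖ 1ℚ) *ℚ (ℕ→ℚ (suc d + ℓ) *ℚ v)
      u-v = begin
        ℕ→ℚ (n ∸ d) *ℚ v -ℚ v
          ≡⟨ lem (ℕ→ℚ (n ∸ d)) (ℕ→ℚ (suc d + ℓ)) (1ℚ) v ⟩
        (ℕ→ℚ (n ∸ d) +ℚ (ℕ→ℚ (suc d + ℓ) -ℚ 1ℚ)) *ℚ v -ℚ ℕ→ℚ (suc d + ℓ) *ℚ v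
          ≡⟨ cong (λ z → z *ℚ v -ℚ ℕ→ℚ (suc d + ℓ) *ℚ v) total ⟩
        ℕ→ℚ (n + ℓ) *ℚ v -ℚ ℕ→ℚ (suc d + ℓ) *ℚ v
          ≡⟨ cong (λ z → z -ℚ ℕ→ℚ (suc d + ℓ) *ℚ v) Nv ⟩
        1ℚ -ℚ ℕ→ℚ (suc d + ℓ) *ℚ v
          ≡⟨ lem₂ (ℕ→ℚ (suc d + ℓ) *ℚ v) ⟩
        1ℚ +ℚ (⊖ 1ℚ) *ℚ (ℕ→ℚ (suc d + ℓ) *ℚ v) ∎
        where
        open ≡-Reasoning
        lem : ∀ a b o v → a *ℚ v -ℚ v ≡ (a +ℚ (b -ℚ 1ℚ)) *ℚ v -ℚ b *ℚ v
        lem = solve-∀ ℚring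
        lem₂ : ∀ x → 1ℚ -ℚ x ≡ 1ℚ +ℚ (⊖ 1ℚ) *ℚ x
        lem₂ = solve-∀ ℚring
        lem₃ : ∀ a b → a +ℚ ((1ℚ +ℚ b) -ℚ 1ℚ) ≡ a +ℚ b
        lem₃ = solve-∀ ℚring
        total : ℕ→ℚ (n ∸ d) +ℚ (ℕ→ℚ (suc d + ℓ) -ℚ 1ℚ) ≡ ℕ→ℚ (n + ℓ)
        total = trans (cong (λ z → ℕ→ℚ (n ∸ d) +ℚ (z -ℚ 1ℚ)) (ℕ→ℚ-+ 1 (d + ℓ))) (trans (lem₃ (ℕ→ℚ (n ∸ d)) (ℕ→ℚ (d + ℓ)))
          (trans (sym (ℕ→ℚ-+ (n ∸ d) (d + ℓ))) (cong ℕ→ℚ (trans (sym (ℕₚ.+-assoc (n ∸ d) d ℓ)) (cong (_+ ℓ) (ℕₚ.m∸n+n≡m d≤n))))))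

      Pmat-diagonal : ∀ {x y} → x ≡ y → P x y ≡ p
      Pmat-diagonal {x} refl = cong (λ b → if b then p else (if length (inter x x) ≡ᵇ d then safeDiv (Jcoef x x) (ℕ→ℚ (n + ℓ)) else 0ℚ)) (eqFace-refl x)

      Pmat-star : ∀ {x y} → x ≢ y → inter x y ≡ σ → P x y ≡ (s x *ℚ s y) *ℚ v
      Pmat-star {x} {y} ne i = begin
        P x y
          ≡⟨ cong (λ b → if b then p else (if length (inter x y) ≡ᵇ d then safeDiv (Jcoef x y) (ℕ→ℚ (n + ℓ)) else 0ℚ)) (≢⇒eqFace ne) ⟩
        (if length (inter x y) ≡ᵇ d then safeDiv (Jcoef x y) (ℕ→ℚ (n + ℓ)) else 0ℚ)
          ≡⟨ cong (λ t → if length t ≡ᵇ d then safeDiv (Icoef t x *ℚ Icoef t y) (ℕ→ℚ (n + ℓ)) else 0ℚ) i ⟩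
        (if length σ ≡ᵇ d then safeDiv (s x *ℚ s y) (ℕ→ℚ (n + ℓ)) else 0ℚ)
          ≡⟨ cong (λ b → if b then safeDiv (s x *ℚ s y) (ℕ→ℚ (n + ℓ)) else 0ℚ) (trans (cong (_≡ᵇ d) lσ) (≡ᵇ-refl d)) ⟩
        safeDiv (s x *ℚ s y) (ℕ→ℚ (n + ℓ))
          ≡⟨ safeDiv-inv (s x *ℚ s y) (n + ℓ) 0<n ⟩
        (s x *ℚ s y) *ℚ v ∎
        where open ≡-Reasoning

      entry : ∀ {x y} → Sorted x → Sorted y → Facet σ x → Facet σ y → Dec (x ≡ y) → mix (⊖ 1ℚ) P x y ≡ rankOne u v s x y
      entry {x} sx sy fx fy (yes refl) = begin
        idKernel x x +ℚ (⊖ 1ℚ) *ℚ P x x             ≡⟨ cong₂ (λ i z → i +ℚ (⊖ 1ℚ) *ℚ z) (idKernel-refl x) (trans (Pmat-diagonal {x} refl) (safeDiv-inv (ℕ→ℚ (suc d + ℓ)) (n + ℓ) 0<n)) ⟩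
        1ℚ +ℚ (⊖ 1ℚ) *ℚ (ℕ→ℚ (suc d + ℓ) *ℚ v)      ≡⟨ sym u-v ⟩
        u -ℚ v                                       ≡⟨ lem u v ⟩
        u *ℚ 1ℚ -ℚ v *ℚ 1ℚ                          ≡⟨ cong (λ z → u *ℚ 1ℚ -ℚ v *ℚ z) (sym (Icoef² sx fx)) ⟩
        u *ℚ 1ℚ -ℚ v *ℚ (s x *ℚ s x)                ≡⟨ lem₂ u v (s x) ⟩
        u *ℚ 1ℚ +ℚ (⊖ (v *ℚ s x)) *ℚ s x            ≡⟨ cong (λ i → u *ℚ i +ℚ (⊖ (v *ℚ s x)) *ℚ s x) (sym (idKernel-refl x)) ⟩
        u *ℚ idKernel x x +ℚ (⊖ (v *ℚ s x)) *ℚ s x ∎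
        where
        open ≡-Reasoning
        lem : ∀ u v → u -ℚ v ≡ u *ℚ 1ℚ -ℚ v *ℚ 1ℚ
        lem = solve-∀ ℚring
        lem₂ : ∀ u v s → u *ℚ 1ℚ -ℚ v *ℚ (s *ℚ s) ≡ u *ℚ 1ℚ +ℚ (⊖ (v *ℚ s)) *ℚ s
        lem₂ = solve-∀ ℚring
      entry {x} {y} sx sy fx fy (no ne) = begin
        idKernel x y +ℚ (⊖ 1ℚ) *ℚ P x y             ≡⟨ cong₂ (λ i z → i +ℚ (⊖ 1ℚ) *ℚ z) (idKernel-≢ ne) (Pmat-star ne (inter-star sσ sx sy fx fy ne)) ⟩
        0ℚ +ℚ (⊖ 1ℚ) *ℚ ((s x *ℚ s y) *ℚ v)         ≡⟨ lem u v (s x) (s y) ⟩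
        u *ℚ 0ℚ +ℚ (⊖ (v *ℚ s x)) *ℚ s y            ≡⟨ cong (λ i → u *ℚ i +ℚ (⊖ (v *ℚ s x)) *ℚ s y) (sym (idKernel-≢ ne)) ⟩
        u *ℚ idKernel x y +ℚ (⊖ (v *ℚ s x)) *ℚ s y ∎
        where
        open ≡-Reasoning
        lem : ∀ u v a b → 0ℚ +ℚ (⊖ 1ℚ) *ℚ ((a *ℚ b) *ℚ v) ≡ u *ℚ 0ℚ +ℚ (⊖ (v *ℚ a)) *ℚ b
        lem = solve-∀ ℚring

    -- At `z = -1` the moment is the probability that the tree misses `E`, as the zeroth power is 1.
    -- The star of σ has `n - d` faces, so the last hypothesis lets `E` omit at most `a` of them.
    avoid-≤ : ∀ E a m → trues E ≡ suc m → length E ≡ length D → (∀ x → x ∈ select D E → Facet σ x) → n ≤ d + (suc m + a) →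
      Ex (λ S → (1ℚ +ℚ (⊖ 1ℚ)) ^ℚ common S E) ≤ℚ ℕ→ℚ a *ℚ v
    avoid-≤ E a m e len star le = begin
      Ex (λ S → (1ℚ +ℚ (⊖ 1ℚ)) ^ℚ common S E)   ≡⟨ moment (⊖ 1ℚ) E len ⟩
      minor (mix (⊖ 1ℚ) P) L                     ≡⟨ detR-cong (_∈ L) (mix (⊖ 1ℚ) P) (rankOne u v s) L (λ b mb c mc → entry (srt mb) (srt mc) (star b mb) (star c mc) (b ≟F c)) L (All.tabulate id) ⟩
      minor (rankOne u v s) L                     ≡⟨ minor-rankOne u v s (select-unique E D-unique) (λ x mx → Icoef² (srt mx) (star x mx)) ⟩
      rankOneDet u v (length L)                   ≡⟨ cong (rankOneDet u v) (trans (length-select D E len) e) ⟩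
      rankOneDet u v (suc m)                      ≤⟨ rankOneDet-≤ m a u≥0 u≤1 v≥0 u≤ ⟩
      ℕ→ℚ a *ℚ v ∎
      where
      open ℚₚ.≤-Reasoning
      L = select D E
      srt : ∀ {x} → x ∈ L → Sorted x
      srt mx = D-sorted (select-⊆ D E mx)
      v≥0 : 0ℚ ≤ℚ v
      v≥0 = inv-nonneg (n + ℓ) 0<n
      u≥0 : 0ℚ ≤ℚ u
      u≥0 = mul-nonneg (ℕ→ℚ-nonneg (n ∸ d)) v≥0
      u≤1 : u ≤ℚ 1ℚ
      u≤1 = ℚₚ.≤-trans (mulʳ v v≥0 (ℕ→ℚ-mono (ℕₚ.≤-trans (ℕₚ.m∸n≤m n d) (ℕₚ.m≤m+n n ℓ)))) (ℚₚ.≤-reflexive Nv)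
      u≤ : u ≤ℚ ℕ→ℚ (suc m + a) *ℚ v
      u≤ = mulʳ v v≥0 (ℕ→ℚ-mono (ℕₚ.m≤n+o⇒m∸n≤o n d le))

-- Powers

pow-+ : ∀ x a b → x ^ℚ (a + b) ≡ x ^ℚ a *ℚ x ^ℚ b
pow-+ x zero b = sym (ℚₚ.*-identityˡ (x ^ℚ b))
pow-+ x (suc a) b = trans (cong (x *ℚ_) (pow-+ x a b)) (sym (ℚₚ.*-assoc x (x ^ℚ a) (x ^ℚ b)))

pow-* : ∀ x a b → x ^ℚ (a * b) ≡ (x ^ℚ b) ^ℚ a
pow-* x zero b = refl
pow-* x (suc a) b = trans (pow-+ x b (a * b)) (cong (x ^ℚ b *ℚ_) (pow-* x a b))

pow-1 : ∀ a → 1ℚ ^ℚ a ≡ 1ℚ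
pow-1 zero = refl
pow-1 (suc a) = trans (ℚₚ.*-identityˡ (1ℚ ^ℚ a)) (pow-1 a)

pow-distrib : ∀ x y a → (x *ℚ y) ^ℚ a ≡ x ^ℚ a *ℚ y ^ℚ a
pow-distrib x y zero = refl
pow-distrib x y (suc a) = trans (cong ((x *ℚ y) *ℚ_) (pow-distrib x y a)) (lem x y (x ^ℚ a) (y ^ℚ a))
  where
  lem : ∀ x y u v → x *ℚ y *ℚ (u *ℚ v) ≡ x *ℚ u *ℚ (y *ℚ v)
  lem = solve-∀ ℚring

pow-swap : ∀ x a b → (x ^ℚ a) ^ℚ b ≡ (x ^ℚ b) ^ℚ a
pow-swap x a b = trans (sym (pow-* x b a)) (trans (cong (x ^ℚ_) (ℕₚ.*-comm b a)) (pow-* x a b))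

pow-mono : ∀ {x y} a → 0ℚ ≤ℚ x → x ≤ℚ y → x ^ℚ a ≤ℚ y ^ℚ a
pow-mono zero h h′ = ℚₚ.≤-refl
pow-mono (suc a) h h′ = mul-mono h (pow-nonneg a h) h′ (pow-mono a h h′)

1≤pow : ∀ {x} a → 1ℚ ≤ℚ x → 1ℚ ≤ℚ x ^ℚ a
1≤pow {x} a h = subst (_≤ℚ x ^ℚ a) (pow-1 a) (pow-mono a 0≤1 h)

pow-monoʳ : ∀ {x a b} → 1ℚ ≤ℚ x → a ≤ b → x ^ℚ a ≤ℚ x ^ℚ b
pow-monoʳ {x} {a} {b} h le = begin
  x ^ℚ a                     ≡⟨ sym (ℚₚ.*-identityʳ (x ^ℚ a)) ⟩
  x ^ℚ a *ℚ 1ℚ               ≤⟨ mulˡ (x ^ℚ a) (pow-nonneg a (ℚₚ.≤-trans 0≤1 h)) (1≤pow (b ∸ a) h) ⟩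
  x ^ℚ a *ℚ x ^ℚ (b ∸ a)     ≡⟨ sym (pow-+ x a (b ∸ a)) ⟩
  x ^ℚ (a + (b ∸ a))         ≡⟨ cong (x ^ℚ_) (ℕₚ.m+[n∸m]≡n le) ⟩
  x ^ℚ b ∎
  where open ℚₚ.≤-Reasoning

pow-antiʳ : ∀ {x a b} → 0ℚ ≤ℚ x → x ≤ℚ 1ℚ → a ≤ b → x ^ℚ b ≤ℚ x ^ℚ a
pow-antiʳ {x} {a} {b} h h′ le = begin
  x ^ℚ b                     ≡⟨ cong (x ^ℚ_) (sym (ℕₚ.m+[n∸m]≡n le)) ⟩
  x ^ℚ (a + (b ∸ a))         ≡⟨ pow-+ x a (b ∸ a) ⟩
  x ^ℚ a *ℚ x ^ℚ (b ∸ a)     ≤⟨ mulˡ (x ^ℚ a) (pow-nonneg a h) (pow-≤1 (b ∸ a) h h′) ⟩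
  x ^ℚ a *ℚ 1ℚ               ≡⟨ ℚₚ.*-identityʳ (x ^ℚ a) ⟩
  x ^ℚ a ∎
  where open ℚₚ.≤-Reasoning

sub-nonneg : ∀ {a b} → a ≤ℚ b → 0ℚ ≤ℚ b -ℚ a
sub-nonneg {a} {b} h = subst (_≤ℚ b -ℚ a) (ℚₚ.+-inverseʳ a) (ℚₚ.+-monoˡ-≤ (⊖ a) h)

sub-nonneg⁻¹ : ∀ {a b} → 0ℚ ≤ℚ b -ℚ a → a ≤ℚ b
sub-nonneg⁻¹ {a} {b} h = subst₂ _≤ℚ_ (ℚₚ.+-identityˡ a) (lem a b) (ℚₚ.+-monoˡ-≤ a h)
  where
  lem : ∀ a b → (b -ℚ a) +ℚ a ≡ b
  lem = solve-∀ ℚring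

bernoulli⁺ : ∀ {x} N → 0ℚ ≤ℚ x → 1ℚ +ℚ ℕ→ℚ N *ℚ x ≤ℚ (1ℚ +ℚ x) ^ℚ N
bernoulli⁺ {x} zero h = ℚₚ.≤-reflexive (lem x)
  where
  lem : ∀ x → 1ℚ +ℚ 0ℚ *ℚ x ≡ 1ℚ
  lem = solve-∀ ℚring
bernoulli⁺ {x} (suc N) h = begin
  1ℚ +ℚ ℕ→ℚ (suc N) *ℚ x                               ≡⟨ cong (λ z → 1ℚ +ℚ z *ℚ x) (ℕ→ℚ-+ 1 N) ⟩
  1ℚ +ℚ (1ℚ +ℚ ℕ→ℚ N) *ℚ x                             ≤⟨ sub-nonneg⁻¹ (subst (0ℚ ≤ℚ_) (lem (ℕ→ℚ N) x) (mul-nonneg (ℕ→ℚ-nonneg N) (square-nonneg x))) ⟩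
  (1ℚ +ℚ x) *ℚ (1ℚ +ℚ ℕ→ℚ N *ℚ x)                      ≤⟨ mulˡ (1ℚ +ℚ x) (add-nonneg 0≤1 h) (bernoulli⁺ N h) ⟩
  (1ℚ +ℚ x) *ℚ (1ℚ +ℚ x) ^ℚ N ∎
  where
  open ℚₚ.≤-Reasoning
  lem : ∀ n x → n *ℚ (x *ℚ x) ≡ (1ℚ +ℚ x) *ℚ (1ℚ +ℚ n *ℚ x) -ℚ (1ℚ +ℚ (1ℚ +ℚ n) *ℚ x)
  lem = solve-∀ ℚring

bernoulli⁻ : ∀ {x} N → 0ℚ ≤ℚ x → x ≤ℚ 1ℚ → 1ℚ -ℚ ℕ→ℚ N *ℚ x ≤ℚ (1ℚ -ℚ x) ^ℚ N
bernoulli⁻ {x} zero h h′ = ℚₚ.≤-reflexive (lem x)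
  where
  lem : ∀ x → 1ℚ -ℚ 0ℚ *ℚ x ≡ 1ℚ
  lem = solve-∀ ℚring
bernoulli⁻ {x} (suc N) h h′ = begin
  1ℚ -ℚ ℕ→ℚ (suc N) *ℚ x                               ≡⟨ cong (λ z → 1ℚ -ℚ z *ℚ x) (ℕ→ℚ-+ 1 N) ⟩
  1ℚ -ℚ (1ℚ +ℚ ℕ→ℚ N) *ℚ x                             ≤⟨ sub-nonneg⁻¹ (subst (0ℚ ≤ℚ_) (lem (ℕ→ℚ N) x) (mul-nonneg (ℕ→ℚ-nonneg N) (square-nonneg x))) ⟩
  (1ℚ -ℚ x) *ℚ (1ℚ -ℚ ℕ→ℚ N *ℚ x)                      ≤⟨ mulˡ (1ℚ -ℚ x) (sub-nonneg h′) (bernoulli⁻ N h h′) ⟩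
  (1ℚ -ℚ x) *ℚ (1ℚ -ℚ x) ^ℚ N ∎
  where
  open ℚₚ.≤-Reasoning
  lem : ∀ n x → n *ℚ (x *ℚ x) ≡ (1ℚ -ℚ x) *ℚ (1ℚ -ℚ n *ℚ x) -ℚ (1ℚ -ℚ (1ℚ +ℚ n) *ℚ x)
  lem = solve-∀ ℚring

2ℚ : ℚ
2ℚ = 1ℚ +ℚ 1ℚ

1≤2 : 1ℚ ≤ℚ 2ℚ
1≤2 = subst (_≤ℚ 2ℚ) (ℚₚ.+-identityʳ 1ℚ) (ℚₚ.+-monoʳ-≤ 1ℚ 0≤1)

0≤2 : 0ℚ ≤ℚ 2ℚ
0≤2 = ℚₚ.≤-trans 0≤1 1≤2

-- Turns a lower bound on one of the two powers into an upper bound on the other.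
conjugate-≤1 : ∀ {x} N → 0ℚ ≤ℚ x → x ≤ℚ 1ℚ → (1ℚ -ℚ x) ^ℚ N *ℚ (1ℚ +ℚ x) ^ℚ N ≤ℚ 1ℚ
conjugate-≤1 {x} N h h′ = subst₂ _≤ℚ_ (pow-distrib (1ℚ -ℚ x) (1ℚ +ℚ x) N) (pow-1 N)
  (pow-mono N (mul-nonneg (sub-nonneg h′) (add-nonneg 0≤1 h))
    (sub-nonneg⁻¹ (subst (0ℚ ≤ℚ_) (lem x) (square-nonneg x))))
  where
  lem : ∀ x → x *ℚ x ≡ 1ℚ -ℚ (1ℚ -ℚ x) *ℚ (1ℚ +ℚ x)
  lem = solve-∀ ℚring

*inv-≤ : ∀ {x y} c → 0 < c → x ≤ℚ ℕ→ℚ c *ℚ y → x *ℚ inv c ≤ℚ y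
*inv-≤ {x} {y} c h le = ℚₚ.≤-trans (mulʳ (inv c) (inv-nonneg c h) le)
  (ℚₚ.≤-reflexive (trans (lem (ℕ→ℚ c) y (inv c)) (trans (cong (_*ℚ y) (inv-* c h)) (ℚₚ.*-identityˡ y))))
  where
  lem : ∀ c y i → c *ℚ y *ℚ i ≡ (i *ℚ c) *ℚ y
  lem = solve-∀ ℚring

≤-*inv : ∀ {x y} c → 0 < c → ℕ→ℚ c *ℚ x ≤ℚ y → x ≤ℚ y *ℚ inv c
≤-*inv {x} {y} c h le = ℚₚ.≤-trans (ℚₚ.≤-reflexive (sym (trans (lem (ℕ→ℚ c) x (inv c)) (trans (cong (_*ℚ x) (inv-* c h)) (ℚₚ.*-identityˡ x)))))
  (mulʳ (inv c) (inv-nonneg c h) le)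
  where
  lem : ∀ c y i → c *ℚ y *ℚ i ≡ (i *ℚ c) *ℚ y
  lem = solve-∀ ℚring

-- A rational form of `(1 - x)^N ≤ 2^(-N x)`. Splitting `x` into `c` equal parts `y` replaces
-- `1 - x` by `(1 - y)^c`; then `N y ≥ 1` gives `(1 + y)^N ≥ 2` and hence `(1 - y)^N ≤ 1/2`.
exp⁻ : ∀ {x} N c → 0ℚ ≤ℚ x → x ≤ℚ 1ℚ → ℕ→ℚ c ≤ℚ ℕ→ℚ N *ℚ x → 2ℚ ^ℚ c *ℚ (1ℚ -ℚ x) ^ℚ N ≤ℚ 1ℚ
exp⁻ {x} N zero h h′ le = subst (_≤ℚ 1ℚ) (sym (ℚₚ.*-identityˡ ((1ℚ -ℚ x) ^ℚ N))) (pow-≤1 N (sub-nonneg h′) (sub-nonneg⁻¹ (subst (0ℚ ≤ℚ_) (lem x) h)))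
  where
  lem : ∀ x → x ≡ 1ℚ -ℚ (1ℚ -ℚ x)
  lem = solve-∀ ℚring
exp⁻ {x} N c@(suc _) h h′ le = begin
  2ℚ ^ℚ c *ℚ (1ℚ -ℚ x) ^ℚ N                  ≤⟨ mulˡ (2ℚ ^ℚ c) (pow-nonneg c 0≤2) (pow-mono N (sub-nonneg h′) base) ⟩
  2ℚ ^ℚ c *ℚ ((1ℚ -ℚ y) ^ℚ c) ^ℚ N           ≡⟨ cong (2ℚ ^ℚ c *ℚ_) (pow-swap (1ℚ -ℚ y) c N) ⟩
  2ℚ ^ℚ c *ℚ ((1ℚ -ℚ y) ^ℚ N) ^ℚ c           ≡⟨ sym (pow-distrib 2ℚ ((1ℚ -ℚ y) ^ℚ N) c) ⟩
  (2ℚ *ℚ (1ℚ -ℚ y) ^ℚ N) ^ℚ c                ≤⟨ pow-mono c (mul-nonneg 0≤2 p≥0) half ⟩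
  1ℚ ^ℚ c                                     ≡⟨ pow-1 c ⟩
  1ℚ ∎
  where
  open ℚₚ.≤-Reasoning
  0<c : 0 < c
  0<c = s≤s z≤n
  y = x *ℚ inv c
  y≥0 : 0ℚ ≤ℚ y
  y≥0 = mul-nonneg h (inv-nonneg c 0<c)
  cy : ℕ→ℚ c *ℚ y ≡ x
  cy = trans (lem (ℕ→ℚ c) x (inv c)) (trans (cong (_*ℚ x) (inv-* c 0<c)) (ℚₚ.*-identityˡ x))
    where
    lem : ∀ c x i → c *ℚ (x *ℚ i) ≡ (i *ℚ c) *ℚ x
    lem = solve-∀ ℚring
  y≤x : y ≤ℚ x
  y≤x = *inv-≤ c 0<c (ℚₚ.≤-trans (ℚₚ.≤-reflexive (sym (ℚₚ.*-identityˡ x))) (mulʳ x h (ℕ→ℚ-mono {1} {c} 0<c)))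
  y≤1 : y ≤ℚ 1ℚ
  y≤1 = ℚₚ.≤-trans y≤x h′
  p≥0 : 0ℚ ≤ℚ (1ℚ -ℚ y) ^ℚ N
  p≥0 = pow-nonneg N (sub-nonneg y≤1)
  base : 1ℚ -ℚ x ≤ℚ (1ℚ -ℚ y) ^ℚ c
  base = subst (λ z → 1ℚ -ℚ z ≤ℚ (1ℚ -ℚ y) ^ℚ c) cy (bernoulli⁻ c y≥0 y≤1)
  Ny : 1ℚ ≤ℚ ℕ→ℚ N *ℚ y
  Ny = ℚₚ.≤-trans (≤-*inv c 0<c (ℚₚ.≤-trans (ℚₚ.≤-reflexive (ℚₚ.*-identityʳ (ℕ→ℚ c))) le)) (ℚₚ.≤-reflexive (ℚₚ.*-assoc (ℕ→ℚ N) x (inv c)))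
  half : 2ℚ *ℚ (1ℚ -ℚ y) ^ℚ N ≤ℚ 1ℚ
  half = begin
    2ℚ *ℚ (1ℚ -ℚ y) ^ℚ N                     ≡⟨ ℚₚ.*-comm 2ℚ ((1ℚ -ℚ y) ^ℚ N) ⟩
    (1ℚ -ℚ y) ^ℚ N *ℚ 2ℚ                     ≤⟨ mulˡ ((1ℚ -ℚ y) ^ℚ N) p≥0 (ℚₚ.≤-trans (ℚₚ.+-monoʳ-≤ 1ℚ Ny) (bernoulli⁺ N y≥0)) ⟩
    (1ℚ -ℚ y) ^ℚ N *ℚ (1ℚ +ℚ y) ^ℚ N         ≤⟨ conjugate-≤1 N y≥0 y≤1 ⟩
    1ℚ ∎

-- Splitting `x` into `2 c` parts `y` makes `N y` at most one half, where Bernoulli gives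
-- `(1 - y)^N ≥ 1/2` and therefore `(1 + y)^N ≤ 2`.
exp⁺ : ∀ {x} N c → 0 < c → 0ℚ ≤ℚ x → ℕ→ℚ N *ℚ x ≤ℚ ℕ→ℚ c → (1ℚ +ℚ x) ^ℚ N ≤ℚ 2ℚ ^ℚ (2 * c)
exp⁺ {x} zero c 0<c h le = 1≤pow (2 * c) 1≤2
exp⁺ {x} N@(suc _) c 0<c h le = begin
  (1ℚ +ℚ x) ^ℚ N                   ≤⟨ pow-mono N (add-nonneg 0≤1 h) base ⟩
  ((1ℚ +ℚ y) ^ℚ (2 * c)) ^ℚ N      ≡⟨ pow-swap (1ℚ +ℚ y) (2 * c) N ⟩
  ((1ℚ +ℚ y) ^ℚ N) ^ℚ (2 * c)      ≤⟨ pow-mono (2 * c) q≥0 double ⟩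
  2ℚ ^ℚ (2 * c) ∎
  where
  open ℚₚ.≤-Reasoning
  0<e : 0 < 2 * c
  0<e = ℕₚ.≤-trans 0<c (ℕₚ.m≤m+n c (c + 0))
  i = inv (2 * c)
  y = x *ℚ i
  y≥0 : 0ℚ ≤ℚ y
  y≥0 = mul-nonneg h (inv-nonneg (2 * c) 0<e)
  ey : ℕ→ℚ (2 * c) *ℚ y ≡ x
  ey = trans (lem (ℕ→ℚ (2 * c)) x i) (trans (cong (_*ℚ x) (inv-* (2 * c) 0<e)) (ℚₚ.*-identityˡ x))
    where
    lem : ∀ c x i → c *ℚ (x *ℚ i) ≡ (i *ℚ c) *ℚ x
    lem = solve-∀ ℚring
  base : 1ℚ +ℚ x ≤ℚ (1ℚ +ℚ y) ^ℚ (2 * c)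
  base = subst (λ z → 1ℚ +ℚ z ≤ℚ (1ℚ +ℚ y) ^ℚ (2 * c)) ey (bernoulli⁺ (2 * c) y≥0)
  q≥0 : 0ℚ ≤ℚ (1ℚ +ℚ y) ^ℚ N
  q≥0 = pow-nonneg N (add-nonneg 0≤1 y≥0)
  lem₁ : ∀ n x i → 2ℚ *ℚ (n *ℚ (x *ℚ i)) ≡ (2ℚ *ℚ (n *ℚ x)) *ℚ i
  lem₁ = solve-∀ ℚring
  2Ny : 2ℚ *ℚ (ℕ→ℚ N *ℚ y) ≤ℚ 1ℚ
  2Ny = begin
    2ℚ *ℚ (ℕ→ℚ N *ℚ y)                ≡⟨ lem₁ (ℕ→ℚ N) x i ⟩
    (2ℚ *ℚ (ℕ→ℚ N *ℚ x)) *ℚ i         ≤⟨ mulʳ i (inv-nonneg (2 * c) 0<e) (mulˡ 2ℚ 0≤2 le) ⟩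
    (2ℚ *ℚ ℕ→ℚ c) *ℚ i                ≡⟨ cong (_*ℚ i) (sym (ℕ→ℚ-* 2 c)) ⟩
    ℕ→ℚ (2 * c) *ℚ i                  ≡⟨ trans (ℚₚ.*-comm (ℕ→ℚ (2 * c)) i) (inv-* (2 * c) 0<e) ⟩
    1ℚ ∎
  Ny≥0 : 0ℚ ≤ℚ ℕ→ℚ N *ℚ y
  Ny≥0 = mul-nonneg (ℕ→ℚ-nonneg N) y≥0
  lem₂ : ∀ z → 2ℚ *ℚ z ≡ z +ℚ z
  lem₂ = solve-∀ ℚring
  y≤1 : y ≤ℚ 1ℚ
  y≤1 = begin
    y                    ≡⟨ sym (ℚₚ.*-identityˡ y) ⟩
    1ℚ *ℚ y              ≤⟨ mulʳ y y≥0 (ℕ→ℚ-mono {1} {N} (s≤s z≤n)) ⟩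
    ℕ→ℚ N *ℚ y           ≡⟨ sym (ℚₚ.+-identityʳ (ℕ→ℚ N *ℚ y)) ⟩
    ℕ→ℚ N *ℚ y +ℚ 0ℚ     ≤⟨ ℚₚ.+-monoʳ-≤ (ℕ→ℚ N *ℚ y) Ny≥0 ⟩
    ℕ→ℚ N *ℚ y +ℚ ℕ→ℚ N *ℚ y ≡⟨ sym (lem₂ (ℕ→ℚ N *ℚ y)) ⟩
    2ℚ *ℚ (ℕ→ℚ N *ℚ y)   ≤⟨ 2Ny ⟩
    1ℚ ∎
  lem₃ : ∀ z → 2ℚ *ℚ (1ℚ -ℚ z) ≡ 2ℚ -ℚ 2ℚ *ℚ z
  lem₃ = solve-∀ ℚring
  lem₄ : 2ℚ -ℚ 1ℚ ≡ 1ℚ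
  lem₄ = refl
  half : 1ℚ ≤ℚ 2ℚ *ℚ (1ℚ -ℚ y) ^ℚ N
  half = begin
    1ℚ                              ≡⟨ sym lem₄ ⟩
    2ℚ -ℚ 1ℚ                        ≤⟨ ℚₚ.+-monoʳ-≤ 2ℚ (ℚₚ.neg-antimono-≤ 2Ny) ⟩
    2ℚ -ℚ 2ℚ *ℚ (ℕ→ℚ N *ℚ y)        ≡⟨ sym (lem₃ (ℕ→ℚ N *ℚ y)) ⟩
    2ℚ *ℚ (1ℚ -ℚ ℕ→ℚ N *ℚ y)        ≤⟨ mulˡ 2ℚ 0≤2 (bernoulli⁻ N y≥0 y≤1) ⟩
    2ℚ *ℚ (1ℚ -ℚ y) ^ℚ N ∎
  lem₅ : ∀ q r → q *ℚ (2ℚ *ℚ r) ≡ 2ℚ *ℚ (r *ℚ q)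
  lem₅ = solve-∀ ℚring
  double : (1ℚ +ℚ y) ^ℚ N ≤ℚ 2ℚ
  double = begin
    (1ℚ +ℚ y) ^ℚ N                              ≡⟨ sym (ℚₚ.*-identityʳ ((1ℚ +ℚ y) ^ℚ N)) ⟩
    (1ℚ +ℚ y) ^ℚ N *ℚ 1ℚ                        ≤⟨ mulˡ ((1ℚ +ℚ y) ^ℚ N) q≥0 half ⟩
    (1ℚ +ℚ y) ^ℚ N *ℚ (2ℚ *ℚ (1ℚ -ℚ y) ^ℚ N)    ≡⟨ lem₅ ((1ℚ +ℚ y) ^ℚ N) ((1ℚ -ℚ y) ^ℚ N) ⟩
    2ℚ *ℚ ((1ℚ -ℚ y) ^ℚ N *ℚ (1ℚ +ℚ y) ^ℚ N)    ≤⟨ mulˡ 2ℚ 0≤2 (conjugate-≤1 N y≥0 y≤1) ⟩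
    2ℚ *ℚ 1ℚ                                    ≡⟨ ℚₚ.*-identityʳ 2ℚ ⟩
    2ℚ ∎

-- Set operations on Boolean lists

_∪ᵇ_ _∖ᵇ_ : List Bool → List Bool → List Bool
_∪ᵇ_ = zipWith _∨_
_∖ᵇ_ = zipWith (λ e a → e ∧ not a)

length-∪ : ∀ S T {m} → length S ≡ m → length T ≡ m → length (S ∪ᵇ T) ≡ m
length-∪ [] [] refl refl = refl
length-∪ (s ∷ S) (t ∷ T) {suc m} e₁ e₂ = cong suc (length-∪ S T (ℕₚ.suc-injective e₁) (ℕₚ.suc-injective e₂))

length-∖ : ∀ S T {m} → length S ≡ m → length T ≡ m → length (S ∖ᵇ T) ≡ m
length-∖ [] [] refl refl = refl
length-∖ (s ∷ S) (t ∷ T) {suc m} e₁ e₂ = cong suc (length-∖ S T (ℕₚ.suc-injective e₁) (ℕₚ.suc-injective e₂))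

-- Only faces of `E` that `S` has not met count for `T`. The upper tail may forget this; the lower
-- tail needs the exact form.
common-∪ : ∀ S T E {m} → length S ≡ m → length T ≡ m → length E ≡ m →
  common (S ∪ᵇ T) E ≡ common S E + common T (E ∖ᵇ S)
common-∪ [] [] [] refl refl refl = refl
common-∪ (s ∷ S) (t ∷ T) (e ∷ E) {suc m} e₁ e₂ e₃ with common-∪ S T E (ℕₚ.suc-injective e₁) (ℕₚ.suc-injective e₂) (ℕₚ.suc-injective e₃)
common-∪ (true ∷ S) (true ∷ T) (true ∷ E) {suc m} e₁ e₂ e₃ | h = cong suc h
common-∪ (true ∷ S) (false ∷ T) (true ∷ E) {suc m} e₁ e₂ e₃ | h = cong suc h
common-∪ (false ∷ S) (true ∷ T) (true ∷ E) {suc m} e₁ e₂ e₃ | h = trans (cong suc h) (sym (ℕₚ.+-suc (common S E) _))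
common-∪ (false ∷ S) (false ∷ T) (true ∷ E) {suc m} e₁ e₂ e₃ | h = h
common-∪ (true ∷ S) (true ∷ T) (false ∷ E) {suc m} e₁ e₂ e₃ | h = h
common-∪ (true ∷ S) (false ∷ T) (false ∷ E) {suc m} e₁ e₂ e₃ | h = h
common-∪ (false ∷ S) (true ∷ T) (false ∷ E) {suc m} e₁ e₂ e₃ | h = h
common-∪ (false ∷ S) (false ∷ T) (false ∷ E) {suc m} e₁ e₂ e₃ | h = h

common-∖ : ∀ T E S → common T (E ∖ᵇ S) ≤ common T E
common-∖ [] [] S = z≤n
common-∖ [] (e ∷ E) [] = z≤n
common-∖ [] (e ∷ E) (s ∷ S) = z≤n
common-∖ (true ∷ T) [] S = z≤n
common-∖ (false ∷ T) [] S = z≤n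
common-∖ (true ∷ T) (e ∷ E) [] = z≤n
common-∖ (false ∷ T) (e ∷ E) [] = z≤n
common-∖ (true ∷ T) (true ∷ E) (true ∷ S) = ℕₚ.m≤n⇒m≤1+n (common-∖ T E S)
common-∖ (true ∷ T) (true ∷ E) (false ∷ S) = s≤s (common-∖ T E S)
common-∖ (true ∷ T) (false ∷ E) (s ∷ S) = common-∖ T E S
common-∖ (false ∷ T) (true ∷ E) (s ∷ S) = common-∖ T E S
common-∖ (false ∷ T) (false ∷ E) (s ∷ S) = common-∖ T E S

trues-∖ : ∀ E S {m} → length E ≡ m → length S ≡ m → trues E ≡ trues (E ∖ᵇ S) + common S E
trues-∖ [] [] refl refl = refl
trues-∖ (e ∷ E) (s ∷ S) {suc m} e₁ e₂ with trues-∖ E S (ℕₚ.suc-injective e₁) (ℕₚ.suc-injective e₂)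
trues-∖ (true ∷ E) (true ∷ S) {suc m} e₁ e₂ | h = trans (cong suc h) (sym (ℕₚ.+-suc (trues (E ∖ᵇ S)) _))
trues-∖ (true ∷ E) (false ∷ S) {suc m} e₁ e₂ | h = cong suc h
trues-∖ (false ∷ E) (true ∷ S) {suc m} e₁ e₂ | h = h
trues-∖ (false ∷ E) (false ∷ S) {suc m} e₁ e₂ | h = h

common-none : ∀ m E → common (replicate m false) E ≡ 0
common-none zero [] = refl
common-none zero (e ∷ E) = refl
common-none (suc m) [] = refl
common-none (suc m) (e ∷ E) = common-none m E

indicator : Bool → ℚ
indicator b = if b then 1ℚ else 0ℚ

indicator-nonneg : ∀ b → 0ℚ ≤ℚ indicator b
indicator-nonneg true = 0≤1
indicator-nonneg false = ℚₚ.≤-refl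

indicator-≤1 : ∀ b → indicator b ≤ℚ 1ℚ
indicator-≤1 true = ℚₚ.≤-refl
indicator-≤1 false = 0≤1

indicator-mono : ∀ {a b} → (a ≡ true → b ≡ true) → indicator a ≤ℚ indicator b
indicator-mono {true} {b} h rewrite h refl = ℚₚ.≤-refl
indicator-mono {false} {b} h = indicator-nonneg b

-- Tail bounds for the union of k independent trees

module Union (n d ℓ : ℕ) (μ : List Bool → ℚ) (law : IsDeterminantalHypertreeLaw n d ℓ μ) where

  open Law n d ℓ μ law public

  size : ℕ
  size = length D

  none : List Bool
  none = replicate size false

  length-none : length none ≡ size
  length-none = Listₚ.length-replicate size

  unionE : ℕ → (List Bool → ℚ) → List Bool → ℚ
  unionE zero φ acc = φ acc
  unionE (suc k) φ acc = Ex (λ S → unionE k φ (acc ∪ᵇ S))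

  Pr : ℕ → (List Bool → Bool) → List Bool → ℚ
  Pr k Q = unionE k (indicator ∘ Q)

  unionProb≡Pr : ∀ k Q acc → unionProb k size μ Q acc ≡ Pr k Q acc
  unionProb≡Pr zero Q acc = refl
  unionProb≡Pr (suc k) Q acc = ∑-cong (allBools size) (λ S _ → cong (μ S *ℚ_) (unionProb≡Pr k Q (acc ∪ᵇ S)))

  unionE-mono : ∀ k {φ ψ} → (∀ U → length U ≡ size → φ U ≤ℚ ψ U) → ∀ acc → length acc ≡ size →
    unionE k φ acc ≤ℚ unionE k ψ acc
  unionE-mono zero h acc l = h acc l
  unionE-mono (suc k) h acc l = Ex-mono (λ S l′ → unionE-mono k h (acc ∪ᵇ S) (length-∪ acc S l l′))

  unionE-const : ∀ k c acc → unionE k (λ _ → c) acc ≡ c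
  unionE-const zero c acc = refl
  unionE-const (suc k) c acc = trans (∑-cong (allBools size) (λ S _ → cong (μ S *ℚ_) (unionE-const k c (acc ∪ᵇ S)))) (Ex-const c)

  unionE-* : ∀ k c φ acc → unionE k (λ U → c *ℚ φ U) acc ≡ c *ℚ unionE k φ acc
  unionE-* zero c φ acc = refl
  unionE-* (suc k) c φ acc = trans (∑-cong (allBools size) (λ S _ → cong (μ S *ℚ_) (unionE-* k c φ (acc ∪ᵇ S)))) (Ex-* c _)

  unionE-+ : ∀ k φ ψ acc → unionE k (λ U → φ U +ℚ ψ U) acc ≡ unionE k φ acc +ℚ unionE k ψ acc
  unionE-+ zero φ ψ acc = refl
  unionE-+ (suc k) φ ψ acc = trans (∑-cong (allBools size) (λ S _ → cong (μ S *ℚ_) (unionE-+ k φ ψ (acc ∪ᵇ S)))) (Ex-+ _ _)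

  Pr-nonneg : ∀ k Q acc → length acc ≡ size → 0ℚ ≤ℚ Pr k Q acc
  Pr-nonneg k Q acc l = subst (_≤ℚ Pr k Q acc) (unionE-const k 0ℚ acc) (unionE-mono k (λ U _ → indicator-nonneg (Q U)) acc l)

  Pr-≤1 : ∀ k Q acc → length acc ≡ size → Pr k Q acc ≤ℚ 1ℚ
  Pr-≤1 k Q acc l = subst (Pr k Q acc ≤ℚ_) (unionE-const k 1ℚ acc) (unionE-mono k (λ U _ → indicator-≤1 (Q U)) acc l)

  Pr-mono : ∀ k {Q R} → (∀ U → length U ≡ size → Q U ≡ true → R U ≡ true) → ∀ acc → length acc ≡ size → Pr k Q acc ≤ℚ Pr k R acc
  Pr-mono k h = unionE-mono k (λ U l → indicator-mono (h U l))

  Pr-∨ : ∀ k Q R acc → length acc ≡ size → Pr k (λ U → Q U ∨ R U) acc ≤ℚ Pr k Q acc +ℚ Pr k R acc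
  Pr-∨ k Q R acc l = subst (Pr k (λ U → Q U ∨ R U) acc ≤ℚ_) (unionE-+ k _ _ acc) (unionE-mono k (λ U _ → or (Q U) (R U)) acc l)
    where
    or : ∀ a b → indicator (a ∨ b) ≤ℚ indicator a +ℚ indicator b
    or true b = subst (_≤ℚ 1ℚ +ℚ indicator b) (ℚₚ.+-identityʳ 1ℚ) (ℚₚ.+-monoʳ-≤ 1ℚ (indicator-nonneg b))
    or false b = ℚₚ.≤-reflexive (sym (ℚₚ.+-identityˡ (indicator b)))

  Pr-any : ∀ {I : Set} k (Q : I → List Bool → Bool) (is : List I) acc → length acc ≡ size →
    Pr k (λ U → any (λ i → Q i U) is) acc ≤ℚ ∑ is (λ i → Pr k (Q i) acc)
  Pr-any k Q [] acc l = ℚₚ.≤-reflexive (unionE-const k 0ℚ acc)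
  Pr-any k Q (i ∷ is) acc l = ℚₚ.≤-trans (Pr-∨ k (Q i) (λ U → any (λ i → Q i U) is) acc l) (ℚₚ.+-monoʳ-≤ (Pr k (Q i) acc) (Pr-any k Q is acc l))

  Pr-impossible : ∀ k {Q} acc → length acc ≡ size → (∀ U → Q U ≡ false) → Pr k Q acc ≤ℚ 0ℚ
  Pr-impossible k {Q} acc l h = subst (Pr k Q acc ≤ℚ_) (unionE-const k 0ℚ acc)
    (unionE-mono k (λ U _ → ℚₚ.≤-reflexive (cong indicator (h U))) acc l)

  module _ (z : ℚ) (0≤z : 0ℚ ≤ℚ z) (p≥0 : 0ℚ ≤ℚ p) (E : List Bool) (lE : length E ≡ size) where

    private
      s : ℚ
      s = 1ℚ +ℚ z
      1≤s : 1ℚ ≤ℚ s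
      1≤s = subst (_≤ℚ s) (ℚₚ.+-identityʳ 1ℚ) (ℚₚ.+-monoʳ-≤ 1ℚ 0≤z)
      s≥0 : 0ℚ ≤ℚ s
      s≥0 = ℚₚ.≤-trans 0≤1 1≤s
      g : ℚ
      g = (1ℚ +ℚ z *ℚ p) ^ℚ trues E
      g≥0 : 0ℚ ≤ℚ g
      g≥0 = pow-nonneg (trues E) (add-nonneg 0≤1 (mul-nonneg 0≤z p≥0))

    -- A union meets `E` in at most as many faces as its members together, so the exponential is
    -- dominated by a product over the independent trees.
    unionE-exponential : ∀ k acc → length acc ≡ size → unionE k (λ U → s ^ℚ common U E) acc ≤ℚ g ^ℚ k *ℚ s ^ℚ common acc E
    unionE-exponential zero acc l = ℚₚ.≤-reflexive (sym (ℚₚ.*-identityˡ (s ^ℚ common acc E)))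
    unionE-exponential (suc k) acc l = begin
      Ex (λ S → unionE k (λ U → s ^ℚ common U E) (acc ∪ᵇ S))
        ≤⟨ Ex-mono (λ S l′ → ℚₚ.≤-trans (unionE-exponential k (acc ∪ᵇ S) (length-∪ acc S l l′)) (mulˡ (g ^ℚ k) (pow-nonneg k g≥0) (split S l′))) ⟩
      Ex (λ S → g ^ℚ k *ℚ (s ^ℚ common acc E *ℚ s ^ℚ common S E))
        ≡⟨ trans (Ex-* (g ^ℚ k) _) (cong (g ^ℚ k *ℚ_) (Ex-* (s ^ℚ common acc E) _)) ⟩
      g ^ℚ k *ℚ (s ^ℚ common acc E *ℚ Ex (λ S → s ^ℚ common S E))
        ≤⟨ mulˡ (g ^ℚ k) (pow-nonneg k g≥0) (mulˡ (s ^ℚ common acc E) (pow-nonneg (common acc E) s≥0) (moment-≤ z s≥0 E lE)) ⟩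
      g ^ℚ k *ℚ (s ^ℚ common acc E *ℚ g)
        ≡⟨ lem (g ^ℚ k) (s ^ℚ common acc E) g ⟩
      g *ℚ g ^ℚ k *ℚ s ^ℚ common acc E ∎
      where
      open ℚₚ.≤-Reasoning
      lem : ∀ a b c → a *ℚ (b *ℚ c) ≡ c *ℚ a *ℚ b
      lem = solve-∀ ℚring
      split : ∀ S → length S ≡ size → s ^ℚ common (acc ∪ᵇ S) E ≤ℚ s ^ℚ common acc E *ℚ s ^ℚ common S E
      split S l′ = subst (s ^ℚ common (acc ∪ᵇ S) E ≤ℚ_) (pow-+ s (common acc E) (common S E))
        (pow-monoʳ 1≤s (ℕₚ.≤-trans (ℕₚ.≤-reflexive (common-∪ acc S E l l′ lE)) (ℕₚ.+-monoʳ-≤ (common acc E) (common-∖ S E acc))))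

    upper-tail : ∀ k a → Pr k (λ U → a ≤ᵇ common U E) none *ℚ s ^ℚ a ≤ℚ (1ℚ +ℚ z *ℚ p) ^ℚ (k * trues E)
    upper-tail k a = begin
      Pr k (λ U → a ≤ᵇ common U E) none *ℚ s ^ℚ a
        ≡⟨ trans (ℚₚ.*-comm (Pr k (λ U → a ≤ᵇ common U E) none) (s ^ℚ a)) (sym (unionE-* k (s ^ℚ a) _ none)) ⟩
      unionE k (λ U → s ^ℚ a *ℚ indicator (a ≤ᵇ common U E)) none
        ≤⟨ unionE-mono k (λ U _ → markov (common U E)) none length-none ⟩
      unionE k (λ U → s ^ℚ common U E) none
        ≤⟨ unionE-exponential k none length-none ⟩
      g ^ℚ k *ℚ s ^ℚ common none E
        ≡⟨ trans (cong (λ c → g ^ℚ k *ℚ s ^ℚ c) (common-none size E)) (ℚₚ.*-identityʳ (g ^ℚ k)) ⟩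
      g ^ℚ k
        ≡⟨ sym (pow-* (1ℚ +ℚ z *ℚ p) k (trues E)) ⟩
      (1ℚ +ℚ z *ℚ p) ^ℚ (k * trues E) ∎
      where
      open ℚₚ.≤-Reasoning
      markov′ : ∀ c b → (b ≡ true → a ≤ c) → s ^ℚ a *ℚ indicator b ≤ℚ s ^ℚ c
      markov′ c true h = ℚₚ.≤-trans (ℚₚ.≤-reflexive (ℚₚ.*-identityʳ (s ^ℚ a))) (pow-monoʳ 1≤s (h refl))
      markov′ c false h = ℚₚ.≤-trans (ℚₚ.≤-reflexive (ℚₚ.*-zeroʳ (s ^ℚ a))) (pow-nonneg c s≥0)
      markov : ∀ c → s ^ℚ a *ℚ indicator (a ≤ᵇ c) ≤ℚ s ^ℚ c
      markov c = markov′ c (a ≤ᵇ c) (λ e → ℕₚ.≤ᵇ⇒≤ a c (≡⇒T e))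

  module _ (t r : ℚ) (0≤t : 0ℚ ≤ℚ t) (t≤1 : t ≤ℚ 1ℚ) (0≤r : 0ℚ ≤ℚ r) (a : ℕ) (E : List Bool) (lE : length E ≡ size)
    (step : ∀ acc → length acc ≡ size → common acc E < a → Ex (λ S → t ^ℚ common S (E ∖ᵇ acc)) ≤ℚ r) where

    private
      φ : List Bool → ℚ
      φ U = t ^ℚ common U E *ℚ indicator (common U E <ᵇ a)

      <ᵇ-false : ∀ {c} → a ≤ c → (c <ᵇ a) ≡ false
      <ᵇ-false {c} h = ≢true (λ e → ℕₚ.<⇒≱ (ℕₚ.<ᵇ⇒< c a (≡⇒T e)) h)

      vanish : ∀ k acc → length acc ≡ size → a ≤ common acc E → unionE k φ acc ≤ℚ 0ℚ
      vanish zero acc l h = ℚₚ.≤-reflexive (trans (cong (λ b → t ^ℚ common acc E *ℚ indicator b) (<ᵇ-false h)) (ℚₚ.*-zeroʳ (t ^ℚ common acc E)))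
      vanish (suc k) acc l h = subst (unionE (suc k) φ acc ≤ℚ_) (Ex-const 0ℚ)
        (Ex-mono (λ S l′ → vanish k (acc ∪ᵇ S) (length-∪ acc S l l′)
          (ℕₚ.≤-trans h (ℕₚ.≤-trans (ℕₚ.m≤m+n (common acc E) _) (ℕₚ.≤-reflexive (sym (common-∪ acc S E l l′ lE)))))))

      bound : ∀ k acc → length acc ≡ size → unionE k φ acc ≤ℚ r ^ℚ k *ℚ t ^ℚ common acc E
      bound zero acc l = ℚₚ.≤-trans (mulˡ (t ^ℚ common acc E) (pow-nonneg (common acc E) 0≤t) (indicator-≤1 (common acc E <ᵇ a)))
        (ℚₚ.≤-reflexive (trans (ℚₚ.*-identityʳ (t ^ℚ common acc E)) (sym (ℚₚ.*-identityˡ (t ^ℚ common acc E)))))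
      bound (suc k) acc l = decide (ℕₚ.<-≤-connex (common acc E) a)
        where
        open ℚₚ.≤-Reasoning
        lem : ∀ a b c → a *ℚ (b *ℚ c) ≡ c *ℚ a *ℚ b
        lem = solve-∀ ℚring
        decide : (common acc E < a) ⊎ (a ≤ common acc E) → unionE (suc k) φ acc ≤ℚ r ^ℚ suc k *ℚ t ^ℚ common acc E
        decide (inj₂ h) = ℚₚ.≤-trans (vanish (suc k) acc l h) (mul-nonneg (pow-nonneg (suc k) 0≤r) (pow-nonneg (common acc E) 0≤t))
        decide (inj₁ h) = begin
          Ex (λ S → unionE k φ (acc ∪ᵇ S))
            ≤⟨ Ex-mono (λ S l′ → ℚₚ.≤-trans (bound k (acc ∪ᵇ S) (length-∪ acc S l l′))
                 (ℚₚ.≤-reflexive (cong (r ^ℚ k *ℚ_) (trans (cong (t ^ℚ_) (common-∪ acc S E l l′ lE)) (pow-+ t (common acc E) _))))) ⟩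
          Ex (λ S → r ^ℚ k *ℚ (t ^ℚ common acc E *ℚ t ^ℚ common S (E ∖ᵇ acc)))
            ≡⟨ trans (Ex-* (r ^ℚ k) _) (cong (r ^ℚ k *ℚ_) (Ex-* (t ^ℚ common acc E) _)) ⟩
          r ^ℚ k *ℚ (t ^ℚ common acc E *ℚ Ex (λ S → t ^ℚ common S (E ∖ᵇ acc)))
            ≤⟨ mulˡ (r ^ℚ k) (pow-nonneg k 0≤r) (mulˡ (t ^ℚ common acc E) (pow-nonneg (common acc E) 0≤t) (step acc l h)) ⟩
          r ^ℚ k *ℚ (t ^ℚ common acc E *ℚ r)
            ≡⟨ lem (r ^ℚ k) (t ^ℚ common acc E) r ⟩
          r *ℚ r ^ℚ k *ℚ t ^ℚ common acc E ∎

    -- Only faces new to `acc` count, so the contributions of the trees are not independent. The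
    -- indicator in `φ` kills the functional once `a` faces of `E` are met; until then `E ∖ᵇ acc`
    -- lacks fewer than `a` faces of `E`, and `step` supplies a factor `r` for each tree.
    lower-tail : ∀ k → Pr k (λ U → common U E <ᵇ a) none *ℚ t ^ℚ a ≤ℚ r ^ℚ k
    lower-tail k = begin
      Pr k (λ U → common U E <ᵇ a) none *ℚ t ^ℚ a
        ≡⟨ trans (ℚₚ.*-comm (Pr k (λ U → common U E <ᵇ a) none) (t ^ℚ a)) (sym (unionE-* k (t ^ℚ a) _ none)) ⟩
      unionE k (λ U → t ^ℚ a *ℚ indicator (common U E <ᵇ a)) none
        ≤⟨ unionE-mono k (λ U _ → markov (common U E) (common U E <ᵇ a) (λ e → ℕₚ.<⇒≤ (ℕₚ.<ᵇ⇒< (common U E) a (≡⇒T e)))) none length-none ⟩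
      unionE k φ none
        ≤⟨ bound k none length-none ⟩
      r ^ℚ k *ℚ t ^ℚ common none E
        ≡⟨ trans (cong (λ c → r ^ℚ k *ℚ t ^ℚ c) (common-none size E)) (ℚₚ.*-identityʳ (r ^ℚ k)) ⟩
      r ^ℚ k ∎
      where
      open ℚₚ.≤-Reasoning
      markov : ∀ c b → (b ≡ true → c ≤ a) → t ^ℚ a *ℚ indicator b ≤ℚ t ^ℚ c *ℚ indicator b
      markov c true h = mulʳ 1ℚ 0≤1 (pow-antiʳ 0≤t t≤1 (h refl))
      markov c false h = ℚₚ.≤-reflexive (trans (ℚₚ.*-zeroʳ (t ^ℚ a)) (sym (ℚₚ.*-zeroʳ (t ^ℚ c))))

-- Sums over tuples

χ : Bool → ℕ
χ true = 1
χ false = 0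

χ-mono : ∀ {a b} → (a ≡ true → b ≡ true) → χ a ≤ χ b
χ-mono {false} h = z≤n
χ-mono {true} h rewrite h refl = ℕₚ.≤-refl

χ-∧ : ∀ a b → χ (a ∧ b) ≡ χ a * χ b
χ-∧ true b = sym (ℕₚ.+-identityʳ (χ b))
χ-∧ false b = refl

χ-≤1 : ∀ b → χ b ≤ 1
χ-≤1 true = ℕₚ.≤-refl
χ-≤1 false = z≤n

χ-split : ∀ b x → x ≡ χ b * x + χ (not b) * x
χ-split true x = sym (trans (ℕₚ.+-identityʳ (x + 0)) (ℕₚ.+-identityʳ x))
χ-split false x = sym (ℕₚ.+-identityʳ x)

sumL : {A : Set} → List A → (A → ℕ) → ℕ
sumL [] φ = 0
sumL (x ∷ xs) φ = φ x + sumL xs φ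

module _ {A : Set} where

  sumL-cong : ∀ (xs : List A) {φ ψ : A → ℕ} → (∀ x → x ∈ xs → φ x ≡ ψ x) → sumL xs φ ≡ sumL xs ψ
  sumL-cong [] e = refl
  sumL-cong (x ∷ xs) e = cong₂ _+_ (e x (here refl)) (sumL-cong xs (λ y m → e y (there m)))

  sumL-mono : ∀ (xs : List A) {φ ψ : A → ℕ} → (∀ x → x ∈ xs → φ x ≤ ψ x) → sumL xs φ ≤ sumL xs ψ
  sumL-mono [] e = z≤n
  sumL-mono (x ∷ xs) e = ℕₚ.+-mono-≤ (e x (here refl)) (sumL-mono xs (λ y m → e y (there m)))

  sumL-+ : ∀ (xs : List A) (φ ψ : A → ℕ) → sumL xs (λ x → φ x + ψ x) ≡ sumL xs φ + sumL xs ψ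
  sumL-+ [] φ ψ = refl
  sumL-+ (x ∷ xs) φ ψ = trans (cong (φ x + ψ x +_) (sumL-+ xs φ ψ)) (lem (φ x) (ψ x) (sumL xs φ) (sumL xs ψ))
    where
    lem : ∀ a b c d → a + b + (c + d) ≡ a + c + (b + d)
    lem = ℕSolver.solve-∀

  sumL-*ˡ : ∀ (xs : List A) c (φ : A → ℕ) → sumL xs (λ x → c * φ x) ≡ c * sumL xs φ
  sumL-*ˡ [] c φ = sym (ℕₚ.*-zeroʳ c)
  sumL-*ˡ (x ∷ xs) c φ = trans (cong (c * φ x +_) (sumL-*ˡ xs c φ)) (sym (ℕₚ.*-distribˡ-+ c (φ x) (sumL xs φ)))

  sumL-0 : ∀ (xs : List A) → sumL xs (λ _ → 0) ≡ 0
  sumL-0 [] = refl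
  sumL-0 (x ∷ xs) = sumL-0 xs

  sumL-const : ∀ (xs : List A) c → sumL xs (λ _ → c) ≡ length xs * c
  sumL-const [] c = refl
  sumL-const (x ∷ xs) c = cong (c +_) (sumL-const xs c)

  sumL-++ : ∀ (xs ys : List A) φ → sumL (xs ++ ys) φ ≡ sumL xs φ + sumL ys φ
  sumL-++ [] ys φ = refl
  sumL-++ (x ∷ xs) ys φ = trans (cong (φ x +_) (sumL-++ xs ys φ)) (sym (ℕₚ.+-assoc (φ x) _ _))

  sumL-member : ∀ {xs : List A} {x} (φ : A → ℕ) → x ∈ xs → φ x ≤ sumL xs φ
  sumL-member {x ∷ xs} φ (here refl) = ℕₚ.m≤m+n (φ x) _
  sumL-member {y ∷ xs} φ (there m) = ℕₚ.≤-trans (sumL-member φ m) (ℕₚ.m≤n+m _ (φ y))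

  sumL-pos : ∀ (xs : List A) (p : A → Bool) → 0 < sumL xs (χ ∘ p) → ∃[ x ] x ∈ xs × p x ≡ true
  sumL-pos (x ∷ xs) p h with p x in e
  ... | true = x , here refl , e
  ... | false with sumL-pos xs p h
  ... | y , m , q = y , there m , q

sumL-map : ∀ {A B : Set} (g : A → B) xs (φ : B → ℕ) → sumL (map g xs) φ ≡ sumL xs (φ ∘ g)
sumL-map g [] φ = refl
sumL-map g (x ∷ xs) φ = cong (φ (g x) +_) (sumL-map g xs φ)

sumL-concatMap : ∀ {A B : Set} (g : A → List B) xs (φ : B → ℕ) → sumL (concatMap g xs) φ ≡ sumL xs (λ x → sumL (g x) φ)
sumL-concatMap g [] φ = refl
sumL-concatMap g (x ∷ xs) φ = trans (sumL-++ (g x) (concatMap g xs) φ) (cong (sumL (g x) φ +_) (sumL-concatMap g xs φ))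

sumL-swap : ∀ {A B : Set} (xs : List A) (ys : List B) (φ : A → B → ℕ) →
  sumL xs (λ x → sumL ys (φ x)) ≡ sumL ys (λ y → sumL xs (λ x → φ x y))
sumL-swap [] ys φ = sym (sumL-0 ys)
sumL-swap (x ∷ xs) ys φ = trans (cong (sumL ys (φ x) +_) (sumL-swap xs ys φ)) (sym (sumL-+ ys (φ x) _))

-- Symmetric functions of tuples

Tuple : Set
Tuple = List ℕ

Sym : {B : Set} → (Tuple → B) → Set
Sym φ = ∀ {xs ys} → xs ↭ ys → φ xs ≡ φ ys

Distinct : (Tuple → Bool) → Set
Distinct f = ∀ xs → f xs ≡ true → Unique xs

Null : (Tuple → ℕ) → Set
Null φ = ∀ xs → ¬ Unique xs → φ xs ≡ 0

Sym-∷ : ∀ {B : Set} {φ : Tuple → B} x → Sym φ → Sym (λ xs → φ (x ∷ xs))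
Sym-∷ x s p = s (prep x p)

Null-∷ : ∀ {φ} x → Null φ → Null (λ xs → φ (x ∷ xs))
Null-∷ x n xs h = n (x ∷ xs) (λ { (_ ∷ u) → h u })

insAll : ℕ → Tuple → List Tuple
insAll x [] = (x ∷ []) ∷ []
insAll x (y ∷ ys) = (x ∷ y ∷ ys) ∷ map (y ∷_) (insAll x ys)

perms : Tuple → List Tuple
perms [] = [] ∷ []
perms (x ∷ xs) = concatMap (insAll x) (perms xs)

∈-insAll : ∀ x as bs → as ++ x ∷ bs ∈ insAll x (as ++ bs)
∈-insAll x [] [] = here refl
∈-insAll x [] (b ∷ bs) = here refl
∈-insAll x (a ∷ as) bs = there (∈ₚ.∈-map⁺ (a ∷_) (∈-insAll x as bs))

∈-perms : ∀ xs {ys} → ys ↭ xs → ys ∈ perms xs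
∈-perms [] p rewrite Permₚ.↭-empty-inv p = here refl
∈-perms (x ∷ xs) {ys} p with ∈ₚ.∈-∃++ (Permₚ.∈-resp-↭ (↭-sym p) (here refl))
... | as , bs , refl = ∈ₚ.∈-concat⁺′ (∈-insAll x as bs)
  (∈ₚ.∈-map⁺ (insAll x) (∈-perms xs (Permₚ.drop-∷ (↭-trans (↭-sym (Permₚ.shift x as bs)) p))))

swap-cases : ∀ {y z : ℕ} {as bs} → z ∷ as ↭ y ∷ bs →
  (z ≡ y × as ↭ bs) ⊎ (∃[ w ] as ↭ y ∷ w × bs ↭ z ∷ w)
swap-cases {y} {z} {as} {bs} p with z ℕₚ.≟ y
... | yes refl = inj₁ (refl , Permₚ.drop-∷ p)
... | no ne with Permₚ.∈-resp-↭ (↭-sym p) (here refl)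
... | here e = ⊥-elim (ne (sym e))
... | there m with ∈-↭ m
... | w , q = inj₂ (w , q , ↭-sym (Permₚ.drop-∷ (↭-trans (↭-trans (swap y z ↭-refl) (prep z (↭-sym q))) p)))

-- A decidable existential over deletions of one vertex: `φ` sees the chosen entry and the tuple of
-- the other entries.
pickAny : (ℕ → Tuple → Bool) → Tuple → Bool
pickAny φ [] = false
pickAny φ (x ∷ xs) = φ x xs ∨ pickAny (λ y r → φ y (x ∷ r)) xs

pickAny-elim : ∀ φ xs → pickAny φ xs ≡ true → ∃[ y ] ∃[ r ] xs ↭ y ∷ r × φ y r ≡ true
pickAny-elim φ (x ∷ xs) h with φ x xs in e
... | true = x , xs , ↭-refl , e
... | false with pickAny-elim (λ y r → φ y (x ∷ r)) xs h
... | y , r , p , q = y , x ∷ r , ↭-trans (prep x p) (swap x y ↭-refl) , q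

pickAny-intro : ∀ φ xs {y r} → (∀ {s t} → s ↭ t → φ y s ≡ true → φ y t ≡ true) → xs ↭ y ∷ r → φ y r ≡ true → pickAny φ xs ≡ true
pickAny-intro φ [] s p h with Permₚ.∈-resp-↭ (↭-sym p) (here refl)
... | ()
pickAny-intro φ (x ∷ xs) {y} {r} s p h with swap-cases p
... | inj₁ (refl , q) rewrite s (↭-sym q) h = refl
... | inj₂ (w , q₁ , q₂)
  rewrite pickAny-intro (λ y r → φ y (x ∷ r)) xs (λ t → s (prep x t)) q₁ (s q₂ h) = Boolₚ.∨-zeroʳ (φ x xs)

distinctᵇ : Tuple → Bool
distinctᵇ [] = true
distinctᵇ (x ∷ xs) = not (memb x xs) ∧ distinctᵇ xs

distinctᵇ⇒Unique : ∀ xs → distinctᵇ xs ≡ true → Unique xs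
distinctᵇ⇒Unique [] h = []
distinctᵇ⇒Unique (x ∷ xs) h with memb x xs in e
... | false = Unique-∷ (memb-false⇒∉ {ys = xs} e) (distinctᵇ⇒Unique xs h)

Unique⇒distinctᵇ : ∀ {xs} → Unique xs → distinctᵇ xs ≡ true
Unique⇒distinctᵇ [] = refl
Unique⇒distinctᵇ {x ∷ xs} (h ∷ u) rewrite ∉⇒memb {x} {xs} (Unique-head (h ∷ u)) = Unique⇒distinctᵇ u

true-or-false : ∀ b → (b ≡ true) ⊎ (b ≡ false)
true-or-false true = inj₁ refl
true-or-false false = inj₂ refl

bool-ext : ∀ {a b} → (a ≡ true → b ≡ true) → (b ≡ true → a ≡ true) → a ≡ b
bool-ext {true} {b} f g = sym (f refl)
bool-ext {false} {true} f g = g refl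
bool-ext {false} {false} f g = refl

distinctᵇ-sym : Sym distinctᵇ
distinctᵇ-sym {xs} {ys} p = bool-ext
  (λ h → Unique⇒distinctᵇ (Unique-resp-↭ p (distinctᵇ⇒Unique xs h)))
  (λ h → Unique⇒distinctᵇ (Unique-resp-↭ (↭-sym p) (distinctᵇ⇒Unique ys h)))

duplicate : ∀ xs → distinctᵇ xs ≡ false → ∃[ x ] ∃[ w ] xs ↭ x ∷ x ∷ w
duplicate (x ∷ xs) h with memb x xs in e
... | true with ∈-↭ (memb⇒∈ xs e)
... | w , p = x , w , prep x p
duplicate (x ∷ xs) h | false with duplicate xs h
... | y , w , p = y , x ∷ w , ↭-trans (prep x p) (↭-trans (swap x y ↭-refl) (prep y (swap x y ↭-refl)))

-- The coboundary of a symmetric cochain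

dl : (Tuple → Bool) → Tuple → Bool
dl f [] = false
dl f (x ∷ xs) = f xs xor dl (λ ys → f (x ∷ ys)) xs

dl-cong : ∀ {f g} zs → (∀ y ys → zs ↭ y ∷ ys → f ys ≡ g ys) → dl f zs ≡ dl g zs
dl-cong [] h = refl
dl-cong (x ∷ zs) h = cong₂ _xor_ (h x zs ↭-refl)
  (dl-cong zs (λ y ys p → h y (x ∷ ys) (↭-trans (prep x p) (swap x y ↭-refl))))

dl-false : ∀ {f} zs → (∀ y ys → zs ↭ y ∷ ys → f ys ≡ false) → dl f zs ≡ false
dl-false zs h = trans (dl-cong zs h) (const zs)
  where
  const : ∀ zs → dl (λ _ → false) zs ≡ false
  const [] = refl
  const (x ∷ zs) = const zs

xor-swap : ∀ a b c → a xor (b xor c) ≡ b xor (a xor c)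
xor-swap true true c = refl
xor-swap true false c = refl
xor-swap false true c = refl
xor-swap false false c = refl

xor-cancel : ∀ a b → a xor (a xor b) ≡ b
xor-cancel true true = refl
xor-cancel true false = refl
xor-cancel false b = refl

dl-sym : ∀ {f} → Sym f → Sym (dl f)
dl-sym {f} s Perm.refl = refl
dl-sym {f} s (prep x p) = cong₂ _xor_ (s p) (dl-sym (Sym-∷ {φ = f} x s) p)
dl-sym {f} s {x ∷ y ∷ xs} {_ ∷ _ ∷ ys} (swap x y p) = trans (xor-swap (f (y ∷ xs)) (f (x ∷ xs)) _)
  (cong₂ _xor_ (s (prep x p)) (cong₂ _xor_ (s (prep y p))
    (trans (dl-cong xs (λ _ zs _ → s (swap x y ↭-refl))) (dl-sym {λ ys → f (y ∷ x ∷ ys)} (λ q → s (prep y (prep x q))) p))))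
dl-sym {f} s (Perm.trans p q) = trans (dl-sym s p) (dl-sym s q)

-- On a tuple `x ∷ x ∷ w` the two deletions of `x` cancel over F₂, and every other deletion leaves
-- the repetition in place.
dl-distinct : ∀ {f} → Sym f → Distinct f → Distinct (dl f)
dl-distinct {f} s d xs h with true-or-false (distinctᵇ xs)
... | inj₁ e = distinctᵇ⇒Unique xs e
... | inj₂ e with duplicate xs e
... | x , w , p = ⊥-elim (contra (trans (sym h) (trans (dl-sym s p) (trans (xor-cancel (f (x ∷ w)) _)
    (dl-false w (λ y ys _ → ≢true (λ q → Unique-head (d (x ∷ x ∷ ys) q) (here refl))))))))
  where
  contra : true ≡ false → ⊥
  contra ()

dl-exists : ∀ f zs → dl f zs ≡ true → ∃[ y ] ∃[ ys ] zs ↭ y ∷ ys × f ys ≡ true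
dl-exists f (x ∷ zs) h with f zs in e
... | true = x , zs , ↭-refl , e
... | false with dl-exists (λ ys → f (x ∷ ys)) zs h
... | y , ys , p , q = y , x ∷ ys , ↭-trans (prep x p) (swap x y ↭-refl) , q

dl-++ : ∀ f as bs → dl f (as ++ bs) ≡ dl (λ as′ → f (as′ ++ bs)) as xor dl (λ bs′ → f (as ++ bs′)) bs
dl-++ f [] bs = refl
dl-++ f (a ∷ as) bs = trans (cong (f (as ++ bs) xor_) (dl-++ (λ ys → f (a ∷ ys)) as bs))
  (sym (Boolₚ.xor-assoc (f (as ++ bs)) _ _))

dl-xor : ∀ f g zs → dl (λ ys → f ys xor g ys) zs ≡ dl f zs xor dl g zs
dl-xor f g [] = refl
dl-xor f g (x ∷ zs) = trans (cong ((f zs xor g zs) xor_) (dl-xor (λ ys → f (x ∷ ys)) (λ ys → g (x ∷ ys)) zs))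
  (lem (f zs) (g zs) _ _)
  where
  lem : ∀ a b c d → (a xor b) xor (c xor d) ≡ (a xor c) xor (b xor d)
  lem a b c d = trans (Boolₚ.xor-assoc a b (c xor d)) (trans (cong (a xor_) (xor-swap b c d)) (sym (Boolₚ.xor-assoc a c (b xor d))))

dl-dl : ∀ f zs → dl (dl f) zs ≡ false
dl-dl f [] = refl
dl-dl f (x ∷ zs) = trans (cong (dl f zs xor_) (trans (dl-xor f (dl (λ ys → f (x ∷ ys))) zs)
  (cong (dl f zs xor_) (dl-dl (λ ys → f (x ∷ ys)) zs)))) (trans (xor-cancel (dl f zs) false) refl)

module Tuples (V : List ℕ) (V-unique : Unique V) where

  -- All tuples over `V` are summed, repetitions included. A symmetric function that vanishes on
  -- repetitions counts each face once per ordering.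
  T# : ℕ → (Tuple → ℕ) → ℕ
  T# zero φ = φ []
  T# (suc m) φ = sumL V (λ x → T# m (λ xs → φ (x ∷ xs)))

  T-cong : ∀ m {φ ψ} → (∀ xs → length xs ≡ m → All (_∈ V) xs → φ xs ≡ ψ xs) → T# m φ ≡ T# m ψ
  T-cong zero h = h [] refl []
  T-cong (suc m) h = sumL-cong V (λ x x∈ → T-cong m (λ xs l a → h (x ∷ xs) (cong suc l) (x∈ ∷ a)))

  T-mono : ∀ m {φ ψ} → (∀ xs → length xs ≡ m → All (_∈ V) xs → φ xs ≤ ψ xs) → T# m φ ≤ T# m ψ
  T-mono zero h = h [] refl []
  T-mono (suc m) h = sumL-mono V (λ x x∈ → T-mono m (λ xs l a → h (x ∷ xs) (cong suc l) (x∈ ∷ a)))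

  T-+ : ∀ m φ ψ → T# m (λ xs → φ xs + ψ xs) ≡ T# m φ + T# m ψ
  T-+ zero φ ψ = refl
  T-+ (suc m) φ ψ = trans (sumL-cong V (λ x _ → T-+ m _ _)) (sumL-+ V _ _)

  T-*ˡ : ∀ m c φ → T# m (λ xs → c * φ xs) ≡ c * T# m φ
  T-*ˡ zero c φ = refl
  T-*ˡ (suc m) c φ = trans (sumL-cong V (λ x _ → T-*ˡ m c _)) (sumL-*ˡ V c _)

  T-0 : ∀ m → T# m (λ _ → 0) ≡ 0
  T-0 zero = refl
  T-0 (suc m) = trans (sumL-cong V (λ x _ → T-0 m)) (sumL-0 V)

  T-const : ∀ m c → T# m (λ _ → c) ≡ length V ^ m * c
  T-const zero c = sym (ℕₚ.+-identityʳ c)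
  T-const (suc m) c = trans (sumL-cong V (λ x _ → T-const m c)) (trans (sumL-const V (length V ^ m * c)) (sym (ℕₚ.*-assoc (length V) (length V ^ m) c)))

  T-sumL : ∀ {A : Set} m (ys : List A) (φ : A → Tuple → ℕ) → T# m (λ xs → sumL ys (λ y → φ y xs)) ≡ sumL ys (λ y → T# m (φ y))
  T-sumL zero ys φ = refl
  T-sumL (suc m) ys φ = trans (sumL-cong V (λ x _ → T-sumL m ys (λ y xs → φ y (x ∷ xs)))) (sumL-swap V ys _)

  T-++ : ∀ a b φ → T# (a + b) φ ≡ T# a (λ xs → T# b (λ ys → φ (xs ++ ys)))
  T-++ zero b φ = refl
  T-++ (suc a) b φ = sumL-cong V (λ x _ → T-++ a b (λ xs → φ (x ∷ xs)))

  T-pos : ∀ m p → 0 < T# m (χ ∘ p) → ∃[ xs ] p xs ≡ true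
  T-pos zero p h with p [] in e
  ... | true = [] , e
  T-pos (suc m) p h with T-pos′ V h
    where
    T-pos′ : ∀ W → 0 < sumL W (λ x → T# m (λ xs → χ (p (x ∷ xs)))) → ∃[ x ] 0 < T# m (λ xs → χ (p (x ∷ xs)))
    T-pos′ (x ∷ W) h with T# m (λ xs → χ (p (x ∷ xs))) in e
    ... | zero = T-pos′ W h
    ... | suc _ = x , subst (0 <_) (sym e) (s≤s z≤n)
  ... | x , h′ with T-pos m (λ xs → p (x ∷ xs)) h′
  ... | xs , q = x ∷ xs , q

  private
    T-insAll : ∀ m φ → sumL V (λ x → T# m (λ ys → sumL (insAll x ys) φ)) ≡ suc m * T# (suc m) φ
    T-insAll zero φ = trans (sumL-cong V (λ x _ → ℕₚ.+-identityʳ (φ (x ∷ [])))) (sym (ℕₚ.+-identityʳ _))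
    T-insAll (suc m) φ = begin
      sumL V (λ x → sumL V (λ y → T# m (λ zs → φ (x ∷ y ∷ zs) + sumL (map (y ∷_) (insAll x zs)) φ)))
        ≡⟨ sumL-cong V (λ x _ → trans (sumL-cong V (λ y _ → T-+ m _ _)) (sumL-+ V _ _)) ⟩
      sumL V (λ x → sumL V (λ y → T# m (λ zs → φ (x ∷ y ∷ zs))) + sumL V (λ y → T# m (λ zs → sumL (map (y ∷_) (insAll x zs)) φ)))
        ≡⟨ sumL-+ V _ _ ⟩
      T# (suc (suc m)) φ + sumL V (λ x → sumL V (λ y → T# m (λ zs → sumL (map (y ∷_) (insAll x zs)) φ)))
        ≡⟨ cong (T# (suc (suc m)) φ +_) (sumL-swap V V _) ⟩
      T# (suc (suc m)) φ + sumL V (λ y → sumL V (λ x → T# m (λ zs → sumL (map (y ∷_) (insAll x zs)) φ)))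
        ≡⟨ cong (T# (suc (suc m)) φ +_) (sumL-cong V (λ y _ → trans (sumL-cong V (λ x _ → T-cong m (λ zs _ _ → sumL-map (y ∷_) (insAll x zs) φ))) (T-insAll m (λ xs → φ (y ∷ xs))))) ⟩
      T# (suc (suc m)) φ + sumL V (λ y → suc m * T# (suc m) (λ xs → φ (y ∷ xs)))
        ≡⟨ cong (T# (suc (suc m)) φ +_) (sumL-*ˡ V (suc m) _) ⟩
      T# (suc (suc m)) φ + suc m * T# (suc (suc m)) φ ∎
      where open ≡-Reasoning

  -- Rearranging the entries permutes the tuples, so each of the `m !` rearrangements has the same
  -- sum. This prices the choice of a good ordering at a constant factor.
  T-perms : ∀ m φ → T# m (λ xs → sumL (perms xs) φ) ≡ m ! * T# m φ
  T-perms zero φ = refl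
  T-perms (suc m) φ = begin
    sumL V (λ x → T# m (λ xs → sumL (concatMap (insAll x) (perms xs)) φ))
      ≡⟨ sumL-cong V (λ x _ → trans (T-cong m (λ xs _ _ → sumL-concatMap (insAll x) (perms xs) φ)) (T-perms m (λ ys → sumL (insAll x ys) φ))) ⟩
    sumL V (λ x → m ! * T# m (λ ys → sumL (insAll x ys) φ))
      ≡⟨ trans (sumL-*ˡ V (m !) _) (cong (m ! *_) (T-insAll m φ)) ⟩
    m ! * (suc m * T# (suc m) φ)
      ≡⟨ lem (m !) (suc m) (T# (suc m) φ) ⟩
    suc m * m ! * T# (suc m) φ ∎
    where
    open ≡-Reasoning
    lem : ∀ a b c → a * (b * c) ≡ b * a * c
    lem = ℕSolver.solve-∀

  sumL-delta : ∀ {x} (φ : ℕ → ℕ) → x ∈ V → sumL V (λ y → χ (x ≡ᵇ y) * φ y) ≡ φ x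
  sumL-delta {x} φ x∈ = go V V-unique x∈
    where
    skip : ∀ W → x ∉ W → sumL W (λ y → χ (x ≡ᵇ y) * φ y) ≡ 0
    skip [] h = refl
    skip (w ∷ W) h rewrite ≢⇒≡ᵇ {x} {w} (λ e → h (here e)) = skip W (h ∘ there)
    go : ∀ W → Unique W → x ∈ W → sumL W (λ y → χ (x ≡ᵇ y) * φ y) ≡ φ x
    go (w ∷ W) u (here refl) rewrite ≡ᵇ-refl x | skip W (Unique-head u) = trans (ℕₚ.+-identityʳ (φ x + 0)) (ℕₚ.+-identityʳ (φ x))
    go (w ∷ W) (h ∷ u) (there m) rewrite ≢⇒≡ᵇ {x} {w} (λ e → All.lookup h m (sym e)) = go W u m

  -- Where `φ` does not vanish, `x` stands in just one of the `m + 1` positions, and by symmetry all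
  -- positions contribute equally.
  T-contains : ∀ m {φ x} → Sym φ → Null φ → x ∈ V →
    T# (suc m) (λ σ → χ (memb x σ) * φ σ) ≡ suc m * T# m (λ ys → φ (x ∷ ys))
  T-contains m {φ} {x} s z x∈ = begin
    sumL V (λ y → T# m (λ ys → χ ((x ≡ᵇ y) ∨ memb x ys) * φ (y ∷ ys)))
      ≡⟨ sumL-cong V (λ y _ → trans (T-cong m (λ ys _ _ → split y ys)) (T-+ m _ _)) ⟩
    sumL V (λ y → T# m (λ ys → χ (x ≡ᵇ y) * φ (y ∷ ys)) + T# m (λ ys → χ (memb x ys) * φ (y ∷ ys)))
      ≡⟨ sumL-+ V _ _ ⟩
    sumL V (λ y → T# m (λ ys → χ (x ≡ᵇ y) * φ (y ∷ ys))) + sumL V (λ y → T# m (λ ys → χ (memb x ys) * φ (y ∷ ys)))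
      ≡⟨ cong₂ _+_ (trans (sumL-cong V (λ y _ → T-*ˡ m (χ (x ≡ᵇ y)) _)) (sumL-delta (λ y → T# m (λ ys → φ (y ∷ ys))) x∈)) (rest m) ⟩
    T# m (λ ys → φ (x ∷ ys)) + m * T# m (λ ys → φ (x ∷ ys)) ∎
    where
    open ≡-Reasoning
    split : ∀ y ys → χ ((x ≡ᵇ y) ∨ memb x ys) * φ (y ∷ ys) ≡ χ (x ≡ᵇ y) * φ (y ∷ ys) + χ (memb x ys) * φ (y ∷ ys)
    split y ys with x ≡ᵇ y in e | memb x ys in e′
    ... | false | b = refl
    ... | true | false = sym (ℕₚ.+-identityʳ _)
    ... | true | true rewrite z (y ∷ ys) (λ u → Unique-head u (subst (_∈ ys) (≡ᵇ⇒≡ {x} {y} e) (memb⇒∈ ys e′))) = refl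
    rest : ∀ m → sumL V (λ y → T# m (λ ys → χ (memb x ys) * φ (y ∷ ys))) ≡ m * T# m (λ ys → φ (x ∷ ys))
    rest zero = sumL-0 V
    rest (suc m) = begin
      sumL V (λ y → T# (suc m) (λ ys → χ (memb x ys) * φ (y ∷ ys)))
        ≡⟨ sumL-cong V (λ y _ → T-contains m (Sym-∷ {φ = φ} y s) (Null-∷ y z) x∈) ⟩
      sumL V (λ y → suc m * T# m (λ ys → φ (y ∷ x ∷ ys)))
        ≡⟨ sumL-*ˡ V (suc m) _ ⟩
      suc m * sumL V (λ y → T# m (λ ys → φ (y ∷ x ∷ ys)))
        ≡⟨ cong (suc m *_) (sumL-cong V (λ y _ → T-cong m (λ ys _ _ → s (swap y x ↭-refl)))) ⟩
      suc m * T# (suc m) (λ ys → φ (x ∷ ys)) ∎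

  T-subsets : ∀ m {φ} → Sym φ → Null φ → T# m φ ≡ m ! * sumL (subsetsOf V m) φ
  T-subsets zero s z = sym (trans (ℕₚ.+-identityʳ _) (ℕₚ.+-identityʳ _))
  T-subsets (suc m) {φ} s z = begin
    sumL V (λ x → T# m (λ xs → φ (x ∷ xs)))
      ≡⟨ sumL-cong V (λ x _ → T-subsets m (Sym-∷ {φ = φ} x s) (Null-∷ x z)) ⟩
    sumL V (λ x → m ! * sumL (subsetsOf V m) (λ xs → φ (x ∷ xs)))
      ≡⟨ trans (sumL-*ˡ V (m !) _) (cong (m ! *_) (extend V m s z)) ⟩
    m ! * (suc m * sumL (subsetsOf V (suc m)) φ)
      ≡⟨ lem (m !) (suc m) _ ⟩
    suc m * m ! * sumL (subsetsOf V (suc m)) φ ∎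
    where
    open ≡-Reasoning
    lem : ∀ a b c → a * (b * c) ≡ b * a * c
    lem = ℕSolver.solve-∀
    -- Double counting: a subset with `m + 1` elements arises once from each of its elements.
    extend : ∀ W m {φ} → Sym φ → Null φ → sumL W (λ x → sumL (subsetsOf W m) (λ σ → φ (x ∷ σ))) ≡ suc m * sumL (subsetsOf W (suc m)) φ
    extend [] zero s z = refl
    extend [] (suc m) s z = sym (ℕₚ.*-zeroʳ (suc (suc m)))
    extend (w ∷ W) zero {φ} s z = begin
      φ (w ∷ []) + 0 + sumL W (λ x → φ (x ∷ []) + 0)
        ≡⟨ cong (φ (w ∷ []) + 0 +_) (extend W zero s z) ⟩
      φ (w ∷ []) + 0 + 1 * sumL (subsetsOf W 1) φ
        ≡⟨ lem₁ (φ (w ∷ [])) (sumL (subsetsOf W 1) φ) ⟩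
      1 * (φ (w ∷ []) + sumL (subsetsOf W 1) φ) ∎
      where
      lem₁ : ∀ a b → a + 0 + 1 * b ≡ 1 * (a + b)
      lem₁ = ℕSolver.solve-∀
    extend (w ∷ W) (suc m) {φ} s z = begin
      sumL (subsetsOf (w ∷ W) (suc m)) (λ σ → φ (w ∷ σ)) + sumL W (λ x → sumL (subsetsOf (w ∷ W) (suc m)) (λ σ → φ (x ∷ σ)))
        ≡⟨ cong₂ _+_ first (trans (sumL-cong W (λ x _ → split (λ σ → φ (x ∷ σ)))) (sumL-+ W _ _)) ⟩
      A + (sumL W (λ x → sumL (subsetsOf W m) (λ σ → φ (x ∷ w ∷ σ))) + sumL W (λ x → sumL (subsetsOf W (suc m)) (λ σ → φ (x ∷ σ))))
        ≡⟨ cong₂ (λ a b → A + (a + b)) (trans (sumL-cong W (λ x _ → sumL-cong (subsetsOf W m) (λ σ _ → s (swap x w ↭-refl)))) (extend W m (Sym-∷ {φ = φ} w s) (Null-∷ w z))) (extend W (suc m) s z) ⟩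
      A + (suc m * A + suc (suc m) * B)
        ≡⟨ lem₁ A (suc m) B ⟩
      suc (suc m) * (A + B)
        ≡⟨ cong (suc (suc m) *_) (sym (split {suc m} φ)) ⟩
      suc (suc m) * sumL (subsetsOf (w ∷ W) (suc (suc m))) φ ∎
      where
      A = sumL (subsetsOf W (suc m)) (λ σ → φ (w ∷ σ))
      B = sumL (subsetsOf W (suc (suc m))) φ
      split : ∀ {j} ψ → sumL (subsetsOf (w ∷ W) (suc j)) ψ ≡ sumL (subsetsOf W j) (λ σ → ψ (w ∷ σ)) + sumL (subsetsOf W (suc j)) ψ
      split {j} ψ = trans (sumL-++ (map (w ∷_) (subsetsOf W j)) _ ψ) (cong (_+ sumL (subsetsOf W (suc j)) ψ) (sumL-map (w ∷_) (subsetsOf W j) ψ))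
      first : sumL (subsetsOf (w ∷ W) (suc m)) (λ σ → φ (w ∷ σ)) ≡ A
      first = trans (split (λ σ → φ (w ∷ σ))) (cong (_+ A) (trans (sumL-cong (subsetsOf W m) (λ σ _ → z (w ∷ w ∷ σ) (λ u → Unique-head u (here refl)))) (sumL-0 (subsetsOf W m))))
      lem₁ : ∀ a k b → a + (k * a + suc k * b) ≡ suc k * (a + b)
      lem₁ = ℕSolver.solve-∀

-- Small cochains: fat faces and terminal faces

xor-true : ∀ a b → a xor b ≡ true → (a ≡ true) ⊎ (b ≡ true)
xor-true true b h = inj₁ refl
xor-true false b h = inj₂ h

avoids : Tuple → Tuple → Bool
avoids ρ ys = all (λ y → not (memb y ρ)) ys

cumulative : (ℕ → ℕ) → ℕ → ℕ
cumulative H zero = 1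
cumulative H (suc m) = H m * cumulative H m

module Fatness (V : List ℕ) (V-unique : Unique V) (f : Tuple → Bool) (f-sym : Sym f) (f-distinct : Distinct f)
  (H : ℕ → ℕ) (0<N : 0 < length V) where

  open Tuples V V-unique

  N : ℕ
  N = length V

  K : ℕ → ℕ
  K = cumulative H

  -- The level `m` is the number of vertices that ρ lacks to have the size of a face of `f`; being
  -- fat at level `m + 1` asks for at least `N / H m` fat extensions.
  Fat : ℕ → Tuple → Bool
  Fat zero ρ = f ρ
  Fat (suc m) ρ = N ≤ᵇ H m * sumL V (λ x → χ (Fat m (x ∷ ρ)))

  Fat-suc : ∀ m ρ → Fat (suc m) ρ ≡ true → N ≤ H m * sumL V (λ x → χ (Fat m (x ∷ ρ)))
  Fat-suc m ρ h = ℕₚ.≤ᵇ⇒≤ _ _ (≡⇒T h)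

  Thin-suc : ∀ m ρ → Fat (suc m) ρ ≡ false → H m * sumL V (λ x → χ (Fat m (x ∷ ρ))) < N
  Thin-suc m ρ h with ℕₚ.<-≤-connex (H m * sumL V (λ x → χ (Fat m (x ∷ ρ)))) N
  ... | inj₁ l = l
  ... | inj₂ l = case trans (sym h) (T⇒≡ (ℕₚ.≤⇒≤ᵇ l)) of λ ()

  Fat-sym : ∀ m → Sym (Fat m)
  Fat-sym zero p = f-sym p
  Fat-sym (suc m) p = cong (λ z → N ≤ᵇ H m * z) (sumL-cong V (λ x _ → cong χ (Fat-sym m (prep x p))))

  Fat-distinct : ∀ m → Distinct (Fat m)
  Fat-distinct zero = f-distinct
  Fat-distinct (suc m) ρ h with sumL-pos V (λ x → Fat m (x ∷ ρ)) (pos (sumL V (λ x → χ (Fat m (x ∷ ρ)))) (Fat-suc m ρ h))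
    where
    pos : ∀ s → N ≤ H m * s → 0 < s
    pos zero l = ⊥-elim (ℕₚ.<⇒≱ 0<N (subst (N ≤_) (ℕₚ.*-zeroʳ (H m)) l))
    pos (suc s) l = s≤s z≤n
  ... | x , _ , q with Fat-distinct m (x ∷ ρ) q
  ... | _ ∷ u = u

  -- ρ ++ ys is a face of f, and the vertices of ys can be added to ρ one by one through fat faces only.
  R : ℕ → Tuple → Tuple → Bool
  R zero ρ ys = f ρ ∧ f (ρ ++ ys)
  R (suc m) ρ ys = Fat (suc m) ρ ∧ pickAny (λ y r → R m (y ∷ ρ) r) ys

  R-fat : ∀ m ρ ys → R m ρ ys ≡ true → Fat m ρ ≡ true
  R-fat zero ρ ys h = ∧-trueˡ h
  R-fat (suc m) ρ ys h = ∧-trueˡ h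

  R-elim : ∀ m ρ ys → R (suc m) ρ ys ≡ true → ∃[ z ] ∃[ r ] ys ↭ z ∷ r × R m (z ∷ ρ) r ≡ true
  R-elim m ρ ys h = pickAny-elim _ ys (∧-trueʳ {Fat (suc m) ρ} h)

  R-perm : ∀ m {ρ ρ′ ys ys′} → ρ ↭ ρ′ → ys ↭ ys′ → R m ρ ys ≡ true → R m ρ′ ys′ ≡ true
  R-perm zero {ρ} p q h = ∧-intro (trans (f-sym (↭-sym p)) (∧-trueˡ h)) (trans (f-sym (↭-sym (Permₚ.++⁺ p q))) (∧-trueʳ {f ρ} h))
  R-perm (suc m) {ρ} {ρ′} {ys} {ys′} p q h with R-elim m ρ ys h
  ... | z , r , t , e = ∧-intro (trans (Fat-sym (suc m) (↭-sym p)) (R-fat (suc m) ρ ys h))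
    (pickAny-intro _ ys′ (λ s → R-perm m ↭-refl s) (↭-trans (↭-sym q) t) (R-perm m (prep z p) ↭-refl e))

  R-intro : ∀ m ρ {ys z r} → Fat (suc m) ρ ≡ true → ys ↭ z ∷ r → R m (z ∷ ρ) r ≡ true → R (suc m) ρ ys ≡ true
  R-intro m ρ {ys} h p e = ∧-intro h (pickAny-intro _ ys (λ s → R-perm m ↭-refl s) p e)

  R-sym : ∀ m ρ → Sym (R m ρ)
  R-sym m ρ p = bool-ext (R-perm m ↭-refl p) (R-perm m ↭-refl (↭-sym p))

  R-f : ∀ m ρ ys → R m ρ ys ≡ true → f (ρ ++ ys) ≡ true
  R-f zero ρ ys h = ∧-trueʳ {f ρ} h
  R-f (suc m) ρ ys h with R-elim m ρ ys h
  ... | z , r , p , e = trans (f-sym (↭-trans (Permₚ.++⁺ˡ ρ p) (Permₚ.shift z ρ r))) (R-f m (z ∷ ρ) r e)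

  R-start : ∀ ρ → f ρ ≡ true → R zero ρ [] ≡ true
  R-start ρ h = ∧-intro h (trans (cong f (Listₚ.++-identityʳ ρ)) h)

  -- Every vertex added on the way to a face of `f` has at least `N / H i` choices at its level `i`,
  -- and `K m` is the product of these losses.
  R-dense : ∀ m ρ → Fat m ρ ≡ true → N ^ m ≤ K m * T# m (λ ys → χ (R m ρ ys))
  R-dense zero ρ h = ℕₚ.≤-reflexive (cong (λ b → χ b + 0) (sym (R-start ρ h)))
  R-dense (suc m) ρ h = begin
    N * N ^ m                                              ≤⟨ ℕₚ.*-monoˡ-≤ (N ^ m) (Fat-suc m ρ h) ⟩
    H m * sumL V (λ x → χ (Fat m (x ∷ ρ))) * N ^ m         ≡⟨ lem (H m) (sumL V (λ x → χ (Fat m (x ∷ ρ)))) (N ^ m) ⟩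
    H m * (N ^ m * sumL V (λ x → χ (Fat m (x ∷ ρ))))       ≡⟨ cong (H m *_) (sym (sumL-*ˡ V (N ^ m) _)) ⟩
    H m * sumL V (λ x → N ^ m * χ (Fat m (x ∷ ρ)))         ≤⟨ ℕₚ.*-monoʳ-≤ (H m) (sumL-mono V (λ x _ → each x (Fat m (x ∷ ρ)) refl)) ⟩
    H m * sumL V (λ x → K m * T# m (λ ys → χ (R (suc m) ρ (x ∷ ys)))) ≡⟨ cong (H m *_) (sumL-*ˡ V (K m) _) ⟩
    H m * (K m * T# (suc m) (λ ys → χ (R (suc m) ρ ys)))   ≡⟨ sym (ℕₚ.*-assoc (H m) (K m) _) ⟩
    H m * K m * T# (suc m) (λ ys → χ (R (suc m) ρ ys)) ∎
    where
    open ℕₚ.≤-Reasoning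
    lem : ∀ a b c → a * b * c ≡ a * (c * b)
    lem = ℕSolver.solve-∀
    each : ∀ x b → Fat m (x ∷ ρ) ≡ b → N ^ m * χ b ≤ K m * T# m (λ ys → χ (R (suc m) ρ (x ∷ ys)))
    each x false e = ℕₚ.≤-trans (ℕₚ.≤-reflexive (ℕₚ.*-zeroʳ (N ^ m))) z≤n
    each x true e = ℕₚ.≤-trans (ℕₚ.≤-reflexive (ℕₚ.*-identityʳ (N ^ m))) (ℕₚ.≤-trans (R-dense m (x ∷ ρ) e)
      (ℕₚ.*-monoʳ-≤ (K m) (T-mono m (λ ys _ _ → χ-mono (λ r → R-intro m ρ h ↭-refl r)))))

  Term : ℕ → Tuple → Bool
  Term m ρ = Fat m ρ ∧ not (pickAny (λ _ r → Fat (suc m) r) ρ)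

  Term-fat : ∀ m ρ → Term m ρ ≡ true → Fat m ρ ≡ true
  Term-fat m ρ h = ∧-trueˡ h

  Term-thin : ∀ m {ρ y r} → Term m ρ ≡ true → ρ ↭ y ∷ r → Fat (suc m) r ≡ false
  Term-thin m {ρ} {y} {r} h p = ≢true λ e → contra (∧-trueʳ {Fat m ρ} h)
    (pickAny-intro (λ _ r → Fat (suc m) r) ρ (λ s e → trans (Fat-sym (suc m) (↭-sym s)) e) p e)
    where
    contra : ∀ {b} → not b ≡ true → b ≡ true → ⊥
    contra {true} () _
    contra {false} _ ()

  -- Descend to ever smaller fat faces as long as possible.
  terminal-exists : ∀ r m ρ ys → length ρ ≡ r → R m ρ ys ≡ true →
    ∃[ m′ ] ∃[ ρ′ ] ∃[ ys′ ] ρ′ ++ ys′ ↭ ρ ++ ys × length ρ′ + m′ ≡ r + m × length ys′ + m ≡ m′ + length ys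
      × Term m′ ρ′ ≡ true × R m′ ρ′ ys′ ≡ true
  terminal-exists r m ρ ys l h with true-or-false (pickAny (λ _ r → Fat (suc m) r) ρ)
  ... | inj₂ e = m , ρ , ys , ↭-refl , cong (_+ m) l , ℕₚ.+-comm (length ys) m , ∧-intro (R-fat m ρ ys h) (cong not e) , h
  ... | inj₁ e with pickAny-elim _ ρ e
  terminal-exists zero m [] ys l h | inj₁ () | _
  terminal-exists (suc r) m ρ ys l h | inj₁ e | y , ρ₁ , p , q
    with terminal-exists r (suc m) ρ₁ (y ∷ ys) (ℕₚ.suc-injective (trans (sym (Permₚ.↭-length p)) l)) (R-intro m ρ₁ q ↭-refl (R-perm m p ↭-refl h))
  ... | m′ , ρ′ , ys′ , a , b , c , t , u = m′ , ρ′ , ys′ , ↭-trans a (↭-trans (Permₚ.shift y ρ₁ ys) (Permₚ.++⁺ʳ ys (↭-sym p)))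
      , trans b (ℕₚ.+-suc r m) , ℕₚ.suc-injective (trans (sym (ℕₚ.+-suc (length ys′) m)) (trans c (ℕₚ.+-suc m′ (length ys)))) , t , u

  -- For τ with one vertex more than the faces of `f`, the length of `rest` makes `m` the number of
  -- vertices missing from `u ∷ ξ` and `v ∷ ξ`, so their fatness is taken at the right level.
  Rigid : Tuple → Set
  Rigid τ = ∀ m u v ξ rest → length rest ≡ m → τ ↭ u ∷ v ∷ ξ ++ rest →
    Fat m (u ∷ ξ) ≡ true → Fat m (v ∷ ξ) ≡ true → Fat (suc m) ξ ≡ true

  private
    rot : ∀ {y : ℕ} {ρ ρ′} x ys → ρ ↭ y ∷ ρ′ → x ∷ ys ++ ρ ↭ x ∷ y ∷ ρ′ ++ ys
    rot {y} {ρ} {ρ′} x ys p = prep x (↭-trans (Permₚ.++⁺ˡ ys p) (Permₚ.++-comm ys (y ∷ ρ′)))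

    move : ∀ (z : ℕ) {ys r} ρ → ys ↭ z ∷ r → ys ++ ρ ↭ r ++ z ∷ ρ
    move z {ys} {r} ρ p = ↭-trans (Permₚ.++⁺ʳ ρ p) (↭-sym (Permₚ.shift z r ρ))

  mutual
    -- The vertex `y` of ρ is exchanged for `x`, working back from the end of the chain of fat faces
    -- that leads from ρ to `f`. A member of the old chain and the member already obtained for the
    -- new one differ in one vertex, and rigidity makes their intersection fat; the last
    -- intersection is `ρ′`.
    reach-up : ∀ {τ} → Rigid τ → ∀ m ρ ys x → length ys ≡ m → τ ↭ x ∷ ys ++ ρ → R m ρ ys ≡ true →
      ∀ y ρ′ → ρ ↭ y ∷ ρ′ → f (x ∷ ys ++ ρ′) ≡ true → R (suc m) ρ′ (x ∷ ys) ≡ true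
    reach-up rg zero ρ [] x l t h y ρ′ p e =
      R-intro zero ρ′ {x ∷ []} {x} {[]} (rg 0 x y ρ′ [] refl (↭-trans t (rot x [] p)) e (trans (f-sym (↭-sym p)) (R-fat zero ρ [] h))) ↭-refl (R-start (x ∷ ρ′) e)
    reach-up rg (suc m) ρ ys x l t h y ρ′ p e with R-elim m ρ ys h
    ... | z , r , q , hz = R-intro (suc m) ρ′
        (rg (suc m) z y ρ′ (x ∷ r) (cong suc lr)
          (↭-trans t (↭-trans (prep x (↭-trans (Permₚ.++⁺ q p) (prep z (↭-trans (Permₚ.shift y r ρ′) (prep y (Permₚ.++-comm r ρ′))))))
            (↭-trans (swap x z ↭-refl) (prep z (↭-trans (swap x y ↭-refl) (prep y (↭-sym (Permₚ.shift x ρ′ r))))))))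
          (R-fat (suc m) (z ∷ ρ′) (x ∷ r) up) (trans (Fat-sym (suc m) (↭-sym p)) (R-fat (suc m) ρ ys h)))
        (↭-trans (prep x q) (swap x z ↭-refl)) up
      where
      lr : length r ≡ m
      lr = ℕₚ.suc-injective (trans (sym (Permₚ.↭-length q)) l)
      up : R (suc m) (z ∷ ρ′) (x ∷ r) ≡ true
      up = reach-up rg m (z ∷ ρ) r x lr (↭-trans t (prep x (move z ρ q))) hz y (z ∷ ρ′) (↭-trans (prep z p) (swap z y ↭-refl))
        (trans (f-sym (prep x (↭-sym (move z ρ′ q)))) e)

    -- Here the vertex given up lies outside ρ. If it is the first vertex of the chain, `reach-up`
    -- bypasses that step; otherwise the step is kept and the exchange happens further on.
    reach-side : ∀ {τ} → Rigid τ → ∀ m ρ ys x → length ys ≡ m → τ ↭ x ∷ ys ++ ρ → R m ρ ys ≡ true →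
      ∀ y ys′ → ys ↭ y ∷ ys′ → f (x ∷ ys′ ++ ρ) ≡ true → R m ρ (x ∷ ys′) ≡ true
    reach-side rg zero ρ [] x l t h y ys′ p e with Permₚ.∈-resp-↭ (↭-sym p) (here refl)
    ... | ()
    reach-side rg (suc m) ρ ys x l t h y ys′ p e with R-elim m ρ ys h
    ... | z , r , q , hz with swap-cases (↭-trans (↭-sym q) p)
    ... | inj₁ (refl , r↭) = R-perm (suc m) ↭-refl (prep x r↭)
        (reach-up rg m (z ∷ ρ) r x (lr q) (↭-trans t (prep x (move z ρ q))) hz z ρ ↭-refl
          (trans (f-sym (prep x (Permₚ.++⁺ʳ ρ r↭))) e))
      where
      lr : ys ↭ z ∷ r → length r ≡ m
      lr q = ℕₚ.suc-injective (trans (sym (Permₚ.↭-length q)) l)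
    ... | inj₂ (w , r↭ , ys′↭) = R-intro m ρ (R-fat (suc m) ρ ys h) (↭-trans (prep x ys′↭) (swap x z ↭-refl))
        (reach-side rg m (z ∷ ρ) r x (lr q) (↭-trans t (prep x (move z ρ q))) hz y w r↭
          (trans (f-sym (prep x (↭-sym (move z ρ ys′↭)))) e))
      where
      lr : ys ↭ z ∷ r → length r ≡ m
      lr q = ℕₚ.suc-injective (trans (sym (Permₚ.↭-length q)) l)

  -- In a rigid face all faces of f contain the terminal face ρ and reach it, so the parities agree.
  parity : ∀ m ρ zs → Rigid (ρ ++ zs) → Term m ρ ≡ true → length zs ≡ suc m → dl (R m ρ) zs ≡ true → dl f (ρ ++ zs) ≡ true
  parity m ρ zs rg tm l h with dl-exists (R m ρ) zs h
  ... | x , ys , p , hx = trans (dl-++ f ρ zs) (trans (cong₂ _xor_ low high) h)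
    where
    ly : length ys ≡ m
    ly = ℕₚ.suc-injective (trans (sym (Permₚ.↭-length p)) l)
    τ↭ : ρ ++ zs ↭ x ∷ ys ++ ρ
    τ↭ = ↭-trans (Permₚ.++-comm ρ zs) (Permₚ.++⁺ʳ ρ p)
    -- A face of `f` missing a vertex of ρ would, by `reach-up`, make a facet of ρ fat.
    low : dl (λ ρ′ → f (ρ′ ++ zs)) ρ ≡ false
    low = dl-false ρ (λ y ρ′ q → ≢true (λ e → case trans (sym (Term-thin m tm q)) (R-fat (suc m) ρ′ (x ∷ ys)
      (reach-up rg m ρ ys x ly τ↭ hx y ρ′ q (trans (f-sym (↭-trans (↭-sym (Permₚ.++⁺ʳ ρ′ p)) (Permₚ.++-comm zs ρ′))) e))) of λ ()))
    -- The odd parity supplies one reached face; any other face of `f` in this tuple that contains ρ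
    -- differs from it in one vertex, so `reach-side` applies.
    high : dl (λ zs′ → f (ρ ++ zs′)) zs ≡ dl (R m ρ) zs
    high = dl-cong zs (λ y zs′ q → bool-ext (to y zs′ q) (R-f m ρ zs′))
      where
      to : ∀ y zs′ → zs ↭ y ∷ zs′ → f (ρ ++ zs′) ≡ true → R m ρ zs′ ≡ true
      to y zs′ q e with swap-cases (↭-trans (↭-sym p) q)
      ... | inj₁ (refl , r) = R-perm m ↭-refl r hx
      ... | inj₂ (w , r₁ , r₂) = R-perm m ↭-refl (↭-sym r₂)
          (reach-side rg m ρ ys x ly τ↭ hx y w r₁ (trans (f-sym (↭-trans (Permₚ.++⁺ʳ ρ (↭-sym r₂)) (Permₚ.++-comm zs′ ρ))) e))

-- Minimal cochains, links and cones

Unique-++ʳ : ∀ (ρ : Tuple) {σ} → Unique (ρ ++ σ) → Unique σ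
Unique-++ʳ [] u = u
Unique-++ʳ (x ∷ ρ) (_ ∷ u) = Unique-++ʳ ρ u

Unique⇒avoids : ∀ ρ {σ} → Unique (ρ ++ σ) → avoids ρ σ ≡ true
Unique⇒avoids ρ {σ} u = all-intro _ σ (λ {y} y∈ → cong not (∉⇒memb (go ρ u y∈)))
  where
  go : ∀ ρ → Unique (ρ ++ σ) → ∀ {y} → y ∈ σ → y ∉ ρ
  go (x ∷ ρ) u y∈ (here refl) = Unique-head u (∈ₚ.∈-++⁺ʳ ρ y∈)
  go (x ∷ ρ) (_ ∷ u) y∈ (there m) = go ρ u y∈ m

not-true⇒∉ : ∀ {y ρ} → not (memb y ρ) ≡ true → y ∉ ρ
not-true⇒∉ {y} {ρ} h m with memb y ρ in e
not-true⇒∉ {y} {ρ} () m | true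
... | false = memb-false⇒∉ {ys = ρ} e m

avoids⇒Unique : ∀ ρ {σ} → avoids ρ σ ≡ true → Unique ρ → Unique σ → Unique (ρ ++ σ)
avoids⇒Unique ρ {σ} a u v = Uniqueₚ.++⁺ u v (λ (m₁ , m₂) → not-true⇒∉ (all-true _ σ a m₂) m₁)

avoids-sym : ∀ ρ → Sym (avoids ρ)
avoids-sym ρ {xs} {ys} p = bool-ext
  (λ h → all-intro _ ys (λ m → all-true _ xs h (Permₚ.∈-resp-↭ (↭-sym p) m)))
  (λ h → all-intro _ xs (λ m → all-true _ ys h (Permₚ.∈-resp-↭ p m)))

-- The cochain supported on faces through `x` whose restriction to the link of `x` is `g`.
lift : ℕ → (Tuple → Bool) → Tuple → Bool
lift x g = pickAny (λ y r → (x ≡ᵇ y) ∧ (not (memb x r) ∧ g r))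

lift-elim : ∀ x g σ → lift x g σ ≡ true → ∃[ r ] σ ↭ x ∷ r × x ∉ r × g r ≡ true
lift-elim x g σ h with pickAny-elim _ σ h
... | y , r , p , e with ≡ᵇ⇒≡ {x} {y} (∧-trueˡ e)
... | refl = r , p , not-true⇒∉ (∧-trueˡ (∧-trueʳ {x ≡ᵇ x} e)) , ∧-trueʳ {not (memb x r)} (∧-trueʳ {x ≡ᵇ x} e)

lift-intro : ∀ x {g} → Sym g → ∀ σ {r} → σ ↭ x ∷ r → x ∉ r → g r ≡ true → lift x g σ ≡ true
lift-intro x {g} s σ {r} p h e = pickAny-intro (λ y r → (x ≡ᵇ y) ∧ (not (memb x r) ∧ g r)) σ
  (λ {t} {t′} q e → ∧-intro {x ≡ᵇ x} (∧-trueˡ {x ≡ᵇ x} {not (memb x t) ∧ g t} e) (∧-intro {not (memb x t′)} (trans (cong not (memb-cong {x} {t′} {t} (Permₚ.∈-resp-↭ (↭-sym q)) (Permₚ.∈-resp-↭ q))) (∧-trueˡ (∧-trueʳ {x ≡ᵇ x} e)))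
     (trans (s (↭-sym q)) (∧-trueʳ {not (memb x t)} (∧-trueʳ {x ≡ᵇ x} e)))))
  p (∧-intro (≡ᵇ-refl x) (∧-intro (cong not (∉⇒memb h)) e))

lift-sym : ∀ x {g} → Sym g → Sym (lift x g)
lift-sym x {g} s p = bool-ext (one p) (one (↭-sym p))
  where
  one : ∀ {xs ys} → xs ↭ ys → lift x g xs ≡ true → lift x g ys ≡ true
  one {xs} {ys} p h with lift-elim x g xs h
  ... | r , q , n , e = lift-intro x s ys (↭-trans (↭-sym p) q) n e

lift-distinct : ∀ x {g} → Distinct g → Distinct (lift x g)
lift-distinct x {g} d σ h with lift-elim x g σ h
... | r , q , n , e = Unique-resp-↭ (↭-sym q) (Unique-∷ n (d r e))

dl-lift-∉ : ∀ x g σ → x ∉ σ → dl (lift x g) σ ≡ false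
dl-lift-∉ x g σ h = dl-false σ (λ y ys p → ≢true (λ e → case lift-elim x g ys e of λ
  { (r , q , _ , _) → h (Permₚ.∈-resp-↭ (↭-sym p) (there (Permₚ.∈-resp-↭ (↭-sym q) (here refl)))) }))

dl-lift-∈ : ∀ x {g} → Sym g → ∀ ys → x ∉ ys → dl (lift x g) (x ∷ ys) ≡ dl g ys
dl-lift-∈ x {g} s ys h = cong₂ _xor_
  (≢true (λ e → case lift-elim x g ys e of λ { (r , q , _ , _) → h (Permₚ.∈-resp-↭ (↭-sym q) (here refl)) }))
  (dl-cong ys (λ y r p → bool-ext
    (λ e → case lift-elim x g (x ∷ r) e of λ { (r′ , q , _ , e′) → trans (s (Permₚ.drop-∷ q)) e′ })
    (lift-intro x s (x ∷ r) ↭-refl (λ m → h (Permₚ.∈-resp-↭ (↭-sym p) (there m))))))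

module Minimality (V : List ℕ) (V-unique : Unique V) (f : Tuple → Bool) (f-sym : Sym f) (f-distinct : Distinct f) where

  open Tuples V V-unique

  -- Minimality in the link of ρ. The guard `avoids` discards tuples meeting ρ, where `f (ρ ++ ys)`
  -- is false but `dl g` need not be.
  MinOn : Tuple → ℕ → Set
  MinOn ρ m = ∀ g → Sym g → Distinct g →
    T# m (λ ys → χ (f (ρ ++ ys))) ≤ T# m (λ ys → χ (avoids ρ ys ∧ (f (ρ ++ ys) xor dl g ys)))

  -- The coboundary of the lifted competitor lives on faces containing `x`, so all other faces
  -- contribute equally to both sides and cancel. Among the faces containing `x`, its possible
  -- positions give both sides the same factor `m + 1`.
  minOn-link : ∀ ρ m x → x ∈ V → MinOn ρ (suc m) → MinOn (x ∷ ρ) m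
  minOn-link ρ m x x∈ mn g gs gd = begin
    T# m (λ ys → χ (f (x ∷ ρ ++ ys)))     ≡⟨ T-cong m (λ ys _ _ → cong χ (f-sym (↭-sym (Permₚ.shift x ρ ys)))) ⟩
    T# m (λ ys → A (x ∷ ys))              ≤⟨ ℕₚ.*-cancelˡ-≤ (suc m) (subst₂ _≤_ (T-contains m A-sym A-null x∈) (T-contains m B-sym B-null x∈) inside) ⟩
    T# m (λ ys → B (x ∷ ys))              ≤⟨ T-mono m (λ ys _ _ → χ-mono (target ys)) ⟩
    T# m (λ ys → χ (avoids (x ∷ ρ) ys ∧ (f (x ∷ ρ ++ ys) xor dl g ys))) ∎
    where
    open ℕₚ.≤-Reasoning
    ĝ = lift x g
    A B : Tuple → ℕ
    A σ = χ (f (ρ ++ σ))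
    B σ = χ (avoids ρ σ ∧ (f (ρ ++ σ) xor dl ĝ σ))
    fρ-false : ∀ σ → ¬ Unique σ → f (ρ ++ σ) ≡ false
    fρ-false σ h = ≢true (λ e → h (Unique-++ʳ ρ (f-distinct (ρ ++ σ) e)))
    A-sym : Sym A
    A-sym p = cong χ (f-sym (Permₚ.++⁺ˡ ρ p))
    A-null : Null A
    A-null σ h = cong χ (fρ-false σ h)
    B-sym : Sym B
    B-sym p = cong χ (cong₂ _∧_ (avoids-sym ρ p) (cong₂ _xor_ (f-sym (Permₚ.++⁺ˡ ρ p)) (dl-sym (lift-sym x gs) p)))
    B-null : Null B
    B-null σ h = cong χ (trans (cong (avoids ρ σ ∧_) (cong₂ _xor_ (fρ-false σ h)
      (≢true (λ e → h (dl-distinct (lift-sym x gs) (lift-distinct x gd) σ e))))) (Boolₚ.∧-zeroʳ (avoids ρ σ)))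
    outside : ∀ σ → χ (not (memb x σ)) * A σ ≡ χ (not (memb x σ)) * B σ
    outside σ with memb x σ in e
    ... | true = refl
    ... | false = cong (1 *_) (cong χ (bool-ext to from))
      where
      none : dl ĝ σ ≡ false
      none = dl-lift-∉ x g σ (memb-false⇒∉ {ys = σ} e)
      to : f (ρ ++ σ) ≡ true → avoids ρ σ ∧ (f (ρ ++ σ) xor dl ĝ σ) ≡ true
      to h = ∧-intro (Unique⇒avoids ρ (f-distinct (ρ ++ σ) h)) (cong₂ _xor_ h none)
      from : avoids ρ σ ∧ (f (ρ ++ σ) xor dl ĝ σ) ≡ true → f (ρ ++ σ) ≡ true
      from h = trans (sym (trans (cong (f (ρ ++ σ) xor_) none) (Boolₚ.xor-identityʳ (f (ρ ++ σ))))) (∧-trueʳ {avoids ρ σ} h)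
    decompose : ∀ φ → T# (suc m) φ ≡ T# (suc m) (λ σ → χ (memb x σ) * φ σ) + T# (suc m) (λ σ → χ (not (memb x σ)) * φ σ)
    decompose φ = trans (T-cong (suc m) (λ σ _ _ → χ-split (memb x σ) (φ σ))) (T-+ (suc m) (λ σ → χ (memb x σ) * φ σ) (λ σ → χ (not (memb x σ)) * φ σ))
    inside : T# (suc m) (λ σ → χ (memb x σ) * A σ) ≤ T# (suc m) (λ σ → χ (memb x σ) * B σ)
    inside = ℕₚ.+-cancelʳ-≤ (T# (suc m) (λ σ → χ (not (memb x σ)) * A σ)) _ _ (begin
      T# (suc m) (λ σ → χ (memb x σ) * A σ) + T# (suc m) (λ σ → χ (not (memb x σ)) * A σ)   ≡⟨ sym (decompose A) ⟩
      T# (suc m) A                                                                        ≤⟨ mn ĝ (lift-sym x gs) (lift-distinct x gd) ⟩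
      T# (suc m) B                                                                        ≡⟨ decompose B ⟩
      T# (suc m) (λ σ → χ (memb x σ) * B σ) + T# (suc m) (λ σ → χ (not (memb x σ)) * B σ)
        ≡⟨ cong (T# (suc m) (λ σ → χ (memb x σ) * B σ) +_) (T-cong (suc m) (λ σ _ _ → sym (outside σ))) ⟩
      T# (suc m) (λ σ → χ (memb x σ) * B σ) + T# (suc m) (λ σ → χ (not (memb x σ)) * A σ) ∎)
    target : ∀ ys → avoids ρ (x ∷ ys) ∧ (f (ρ ++ x ∷ ys) xor dl ĝ (x ∷ ys)) ≡ true →
      avoids (x ∷ ρ) ys ∧ (f (x ∷ ρ ++ ys) xor dl g ys) ≡ true
    target ys h = ∧-intro av (trans (cong₂ _xor_ (f-sym (↭-sym (Permₚ.shift x ρ ys))) (sym (dl-lift-∈ x gs ys x∉))) val)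
      where
      val : f (ρ ++ x ∷ ys) xor dl ĝ (x ∷ ys) ≡ true
      val = ∧-trueʳ {avoids ρ (x ∷ ys)} h
      u : Unique (x ∷ ys)
      u with xor-true (f (ρ ++ x ∷ ys)) (dl ĝ (x ∷ ys)) val
      ... | inj₁ e = Unique-++ʳ ρ (f-distinct (ρ ++ x ∷ ys) e)
      ... | inj₂ e = dl-distinct (lift-sym x gs) (lift-distinct x gd) (x ∷ ys) e
      x∉ : x ∉ ys
      x∉ = Unique-head u
      av : avoids (x ∷ ρ) ys ≡ true
      av = all-intro _ ys (λ {y} y∈ → cong not (∉⇒memb {y} {x ∷ ρ} (λ
        { (here refl) → x∉ y∈
        ; (there m) → not-true⇒∉ {y} {ρ} (all-true _ (x ∷ ys) (∧-trueˡ {avoids ρ (x ∷ ys)} h) (there y∈)) m })))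

  minOn-links : ∀ ρ m → All (_∈ V) ρ → MinOn [] (length ρ + m) → MinOn ρ m
  minOn-links [] m [] h = h
  minOn-links (x ∷ ρ) m (x∈ ∷ a) h = minOn-link ρ m x x∈ (minOn-links ρ (suc m) a (subst (MinOn []) (sym (ℕₚ.+-suc (length ρ) m)) h))

  module Cone (ρ : Tuple) (m : ℕ) (u : Unique ρ) (mn : MinOn ρ m) (h : Tuple → Bool) (hs : Sym h) (hd : Distinct h)
    (h⊆f : ∀ ys → h ys ≡ true → f (ρ ++ ys) ≡ true) where

    -- `dl h (v ∷ ys)` is `h ys` plus the coboundary of `g`. Adding that coboundary to `f` gives the
    -- part of `f` outside `h` plus this cone term, so cancelling the common part passes the
    -- minimality of `f` on to its piece `h`.
    cone : ∀ v → v ∉ ρ → T# m (χ ∘ h) ≤ T# m (λ ys → χ (distinctᵇ (ρ ++ v ∷ ys) ∧ dl h (v ∷ ys)))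
    cone v v∉ = ℕₚ.+-cancelʳ-≤ (T# m C) _ _ (begin
      T# m (χ ∘ h) + T# m C                                        ≡⟨ sym (T-+ m (χ ∘ h) C) ⟩
      T# m (λ ys → χ (h ys) + C ys)                                ≡⟨ T-cong m (λ ys _ _ → split (h ys) (f (ρ ++ ys)) (h⊆f ys)) ⟩
      T# m (λ ys → χ (f (ρ ++ ys)))                                ≤⟨ mn g (λ p → hs (prep v p)) (λ r e → tail-unique (hd (v ∷ r) e)) ⟩
      T# m (λ ys → χ (avoids ρ ys ∧ (f (ρ ++ ys) xor dl g ys)))    ≤⟨ T-mono m (λ ys _ _ → each ys) ⟩
      T# m (λ ys → B ys + C ys)                                    ≡⟨ T-+ m B C ⟩
      T# m B + T# m C ∎)
      where
      open ℕₚ.≤-Reasoning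
      g : Tuple → Bool
      g r = h (v ∷ r)
      B C : Tuple → ℕ
      B ys = χ (distinctᵇ (ρ ++ v ∷ ys) ∧ dl h (v ∷ ys))
      C ys = χ (f (ρ ++ ys) ∧ not (h ys))
      tail-unique : ∀ {x : ℕ} {xs} → Unique (x ∷ xs) → Unique xs
      tail-unique (_ ∷ u) = u
      split : ∀ a b → (a ≡ true → b ≡ true) → χ a + χ (b ∧ not a) ≡ χ b
      split true b i rewrite i refl = refl
      split false b i = cong χ (Boolₚ.∧-identityʳ b)
      each : ∀ ys → χ (avoids ρ ys ∧ (f (ρ ++ ys) xor dl g ys)) ≤ B ys + C ys
      each ys with f (ρ ++ ys) in ef | h ys in eh
      ... | true | false = ℕₚ.≤-trans (χ-≤1 _) (ℕₚ.m≤n+m 1 _)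
      ... | false | true = case trans (sym ef) (h⊆f ys eh) of λ ()
      ... | true | true = ℕₚ.≤-trans (χ-mono (λ e → both (∧-trueˡ e) (trans (cong (_xor dl g ys) eh) (∧-trueʳ {avoids ρ ys} e)))) (ℕₚ.m≤m+n _ _)
        where
        both : avoids ρ ys ≡ true → dl h (v ∷ ys) ≡ true → distinctᵇ (ρ ++ v ∷ ys) ∧ (true xor dl g ys) ≡ true
        both a e = ∧-intro (Unique⇒distinctᵇ (avoids⇒Unique ρ (∧-intro (cong not (∉⇒memb v∉)) a) u (dl-distinct hs hd (v ∷ ys) e))) (trans (cong (_xor dl g ys) (sym eh)) e)
      ... | false | false = ℕₚ.≤-trans (χ-mono (λ e → both (∧-trueˡ e) (trans (cong (_xor dl g ys) eh) (∧-trueʳ {avoids ρ ys} e)))) (ℕₚ.m≤m+n _ _)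
        where
        both : avoids ρ ys ≡ true → dl h (v ∷ ys) ≡ true → distinctᵇ (ρ ++ v ∷ ys) ∧ (false xor dl g ys) ≡ true
        both a e = ∧-intro (Unique⇒distinctᵇ (avoids⇒Unique ρ (∧-intro (cong not (∉⇒memb v∉)) a) u (dl-distinct hs hd (v ∷ ys) e))) (trans (cong (_xor dl g ys) (sym eh)) e)

    -- Sum over all apexes; those lying in ρ admit no cone and are paid for by the first summand.
    cone-sum : length V * T# m (χ ∘ h) ≤ length ρ * T# m (χ ∘ h) + T# (suc m) (λ zs → χ (distinctᵇ (ρ ++ zs) ∧ dl h zs))
    cone-sum = begin
      length V * t
        ≡⟨ sym (sumL-const V t) ⟩
      sumL V (λ _ → t)
        ≤⟨ sumL-mono V (λ v _ → each v (memb v ρ) refl) ⟩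
      sumL V (λ v → t * χ (memb v ρ) + T# m (λ ys → χ (distinctᵇ (ρ ++ v ∷ ys) ∧ dl h (v ∷ ys))))
        ≡⟨ trans (sumL-+ V _ _) (cong (_+ T# (suc m) (λ zs → χ (distinctᵇ (ρ ++ zs) ∧ dl h zs))) (sumL-*ˡ V t _)) ⟩
      t * sumL V (λ v → χ (memb v ρ)) + T# (suc m) (λ zs → χ (distinctᵇ (ρ ++ zs) ∧ dl h zs))
        ≤⟨ ℕₚ.+-monoˡ-≤ _ (ℕₚ.≤-trans (ℕₚ.*-monoʳ-≤ t few) (ℕₚ.≤-reflexive (ℕₚ.*-comm t (length ρ)))) ⟩
      length ρ * t + T# (suc m) (λ zs → χ (distinctᵇ (ρ ++ zs) ∧ dl h zs)) ∎
      where
      open ℕₚ.≤-Reasoning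
      t = T# m (χ ∘ h)
      each : ∀ v b → memb v ρ ≡ b → t ≤ t * χ b + T# m (λ ys → χ (distinctᵇ (ρ ++ v ∷ ys) ∧ dl h (v ∷ ys)))
      each v true e = ℕₚ.≤-trans (ℕₚ.≤-reflexive (sym (ℕₚ.*-identityʳ t))) (ℕₚ.m≤m+n (t * 1) _)
      each v false e = ℕₚ.≤-trans (cone v (memb-false⇒∉ {ys = ρ} e)) (ℕₚ.m≤n+m _ (t * 0))
      count : ∀ W (p : ℕ → Bool) → sumL W (χ ∘ p) ≡ length (filterᵇ p W)
      count [] p = refl
      count (w ∷ W) p with p w
      ... | true = cong suc (count W p)
      ... | false = count W p
      few : sumL V (λ v → χ (memb v ρ)) ≤ length ρ
      few = ℕₚ.≤-trans (ℕₚ.≤-reflexive (count V (λ v → memb v ρ)))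
        (Unique-length (AllPairs-filterᵇ _ V-unique) (λ m → memb⇒∈ ρ (proj₂ (∈-filterᵇ⁻ (λ v → memb v ρ) V m))))

-- Expansion of minimal cochains in the top dimension

take-++ : ∀ {A : Set} (xs ys : List A) {r} → length xs ≡ r → take r (xs ++ ys) ≡ xs
take-++ [] ys refl = refl
take-++ (x ∷ xs) ys refl = cong (x ∷_) (take-++ xs ys refl)

drop-++ : ∀ {A : Set} (xs ys : List A) {r} → length xs ≡ r → dropN r (xs ++ ys) ≡ ys
drop-++ [] ys refl = refl
drop-++ (x ∷ xs) ys refl = drop-++ xs ys refl

module TopExpansion (V : List ℕ) (V-unique : Unique V) (0<N : 0 < length V) (X : Tuple → Bool) (X-sym : Sym X) (X-distinct : Distinct X)
  (d : ℕ) (H : ℕ → ℕ) (f : Tuple → Bool) (f-sym : Sym f) (f-distinct : Distinct f) where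

  open Tuples V V-unique
  open Fatness V V-unique f f-sym f-distinct H 0<N
  open Minimality V V-unique f f-sym f-distinct

  deg : Tuple → ℕ
  deg σ = sumL V (λ x → χ (X (x ∷ σ)))

  deg-sym : Sym deg
  deg-sym p = sumL-cong V (λ x _ → cong χ (X-sym (prep x p)))

  weight# size# odd# : ℕ
  weight# = T# d (λ σ → χ (f σ) * deg σ)
  size# = T# d (χ ∘ f)
  odd# = T# (suc d) (λ τ → χ (X τ ∧ dl f τ))

  reached : ℕ → Tuple → ℕ
  reached m ρ = T# m (λ ys → χ (R m ρ ys) * deg (ρ ++ ys))

  oddAt : ℕ → Tuple → ℕ
  oddAt m ρ = T# (suc m) (λ zs → χ (X (ρ ++ zs) ∧ dl (R m ρ) zs))

  -- An ordered witness against `Rigid`: after `u` and `v` come the entries of `ξ`, and the last `m`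
  -- entries are free.
  pat : ℕ → Tuple → Bool
  pat m [] = false
  pat m (u ∷ []) = false
  pat m (u ∷ v ∷ w) = Fat m (u ∷ ξ) ∧ (Fat m (v ∷ ξ) ∧ not (Fat (suc m) ξ))
    where ξ = take (d ∸ suc m) w

  rare : Tuple → Bool
  rare τ = any (λ π → any (λ m → pat m π) (upTo d)) (perms τ)

  rare# : ℕ
  rare# = T# (suc d) (λ τ → χ (X τ ∧ rare τ))

  -- By `terminal-exists`, a suitable reordering of each face of `f` begins with a terminal face
  -- that reaches it. Summing over all orderings costs the factor `d !`.
  weight-≤ : weight# ≤ d ! * sumL (upTo (suc d)) (λ m → T# (d ∸ m) (λ ρ → χ (Term m ρ) * reached m ρ))
  weight-≤ = begin
    T# d (λ σ → χ (f σ) * deg σ)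
      ≤⟨ T-mono d (λ σ l _ → each σ l (f σ) refl) ⟩
    T# d (λ σ → sumL (perms σ) Φ)
      ≡⟨ T-perms d Φ ⟩
    d ! * T# d Φ
      ≡⟨ cong (d ! *_) (trans (T-sumL d (upTo (suc d)) (λ m π → Ψ m π * deg π)) (sumL-cong (upTo (suc d)) (λ m m∈ → level m (ℕₚ.≤-pred (∈ₚ.∈-upTo⁻ m∈))))) ⟩
    d ! * sumL (upTo (suc d)) (λ m → T# (d ∸ m) (λ ρ → χ (Term m ρ) * reached m ρ)) ∎
    where
    open ℕₚ.≤-Reasoning
    Ψ : ℕ → Tuple → ℕ
    Ψ m π = χ (Term m (take (d ∸ m) π)) * χ (R m (take (d ∸ m) π) (dropN (d ∸ m) π))
    Φ : Tuple → ℕ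
    Φ π = sumL (upTo (suc d)) (λ m → Ψ m π * deg π)
    each : ∀ σ → length σ ≡ d → ∀ b → f σ ≡ b → χ b * deg σ ≤ sumL (perms σ) Φ
    each σ l false e = z≤n
    each σ l true e with terminal-exists d 0 σ [] l (R-start σ e)
    ... | m , ρ , ys , p , lρ , ly , t , r = begin
      1 * deg σ                                    ≡⟨ cong (1 *_) (deg-sym (↭-sym p′)) ⟩
      1 * deg (ρ ++ ys)                            ≡⟨ cong (_* deg (ρ ++ ys)) (sym one) ⟩
      Ψ m (ρ ++ ys) * deg (ρ ++ ys)                ≤⟨ sumL-member (λ m → Ψ m (ρ ++ ys) * deg (ρ ++ ys)) (∈ₚ.∈-upTo⁺ (s≤s m≤d)) ⟩
      Φ (ρ ++ ys)                                  ≤⟨ sumL-member Φ (∈-perms σ p′) ⟩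
      sumL (perms σ) Φ ∎
      where
      p′ : ρ ++ ys ↭ σ
      p′ = ↭-trans p (↭-reflexive (Listₚ.++-identityʳ σ))
      lρ′ : length ρ + m ≡ d
      lρ′ = trans lρ (ℕₚ.+-identityʳ d)
      m≤d : m ≤ d
      m≤d = ℕₚ.≤-trans (ℕₚ.m≤n+m m (length ρ)) (ℕₚ.≤-reflexive lρ′)
      lr : length ρ ≡ d ∸ m
      lr = trans (sym (ℕₚ.m+n∸n≡m (length ρ) m)) (cong (_∸ m) lρ′)
      one : Ψ m (ρ ++ ys) ≡ 1
      one = trans (cong₂ (λ a b → χ (Term m a) * χ (R m a b)) (take-++ ρ ys lr) (drop-++ ρ ys lr)) (cong₂ (λ a b → χ a * χ b) t r)
    level : ∀ m → m ≤ d → T# d (λ π → Ψ m π * deg π) ≡ T# (d ∸ m) (λ ρ → χ (Term m ρ) * reached m ρ)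
    level m m≤d = begin-equality
      T# d (λ π → Ψ m π * deg π)
        ≡⟨ cong (λ k → T# k (λ π → Ψ m π * deg π)) (sym (ℕₚ.m∸n+n≡m m≤d)) ⟩
      T# (d ∸ m + m) (λ π → Ψ m π * deg π)
        ≡⟨ T-++ (d ∸ m) m _ ⟩
      T# (d ∸ m) (λ ρ → T# m (λ ys → Ψ m (ρ ++ ys) * deg (ρ ++ ys)))
        ≡⟨ T-cong (d ∸ m) (λ ρ l _ → trans (T-cong m (λ ys _ _ → trans (cong (_* deg (ρ ++ ys)) (cong₂ (λ a b → χ (Term m a) * χ (R m a b)) (take-++ ρ ys l) (drop-++ ρ ys l))) (ℕₚ.*-assoc (χ (Term m ρ)) _ _))) (T-*ˡ m (χ (Term m ρ)) _)) ⟩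
      T# (d ∸ m) (λ ρ → χ (Term m ρ) * reached m ρ) ∎

  not-rare⇒Rigid : ∀ τ → length τ ≡ suc d → rare τ ≡ false → Rigid τ
  not-rare⇒Rigid τ l nr m u v ξ rest lr p fu fv with true-or-false (Fat (suc m) ξ)
  ... | inj₁ e = e
  ... | inj₂ e = ⊥-elim (case trans (sym nr) (any-intro _ (∈-perms τ (↭-sym p)) (any-intro _ (∈ₚ.∈-upTo⁺ m<d) found)) of λ ())
    where
    len : suc (length ξ + m) ≡ d
    len = ℕₚ.suc-injective (trans (cong (λ k → suc (suc k)) (trans (cong (length ξ +_) (sym lr)) (sym (Listₚ.length-++ ξ)))) (trans (sym (Permₚ.↭-length p)) l))
    m<d : m < d
    m<d = ℕₚ.≤-trans (s≤s (ℕₚ.m≤n+m m (length ξ))) (ℕₚ.≤-reflexive len)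
    lξ : length ξ ≡ d ∸ suc m
    lξ = trans (sym (ℕₚ.m+n∸n≡m (length ξ) (suc m))) (cong (_∸ suc m) (trans (ℕₚ.+-suc (length ξ) m) len))
    found : pat m (u ∷ v ∷ ξ ++ rest) ≡ true
    found rewrite take-++ ξ rest lξ = ∧-intro fu (∧-intro fv (cong not e))

  -- A tuple splits in only one way into its first `d ∸ m` entries and the rest, so different
  -- terminal faces never count the same tuple; unless the tuple is rare, `parity` applies to it.
  odd-≤ : ∀ m → m ≤ d → T# (d ∸ m) (λ ρ → χ (Term m ρ) * oddAt m ρ) ≤ odd# + rare#
  odd-≤ m m≤d = begin
    T# (d ∸ m) (λ ρ → χ (Term m ρ) * oddAt m ρ)
      ≡⟨ T-cong (d ∸ m) (λ ρ _ _ → sym (T-*ˡ (suc m) (χ (Term m ρ)) (λ zs → χ (X (ρ ++ zs) ∧ dl (R m ρ) zs)))) ⟩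
    T# (d ∸ m) (λ ρ → T# (suc m) (λ zs → χ (Term m ρ) * χ (X (ρ ++ zs) ∧ dl (R m ρ) zs)))
      ≤⟨ T-mono (d ∸ m) (λ ρ l _ → T-mono (suc m) (λ zs l′ _ → each ρ zs l l′ (Term m ρ) refl)) ⟩
    T# (d ∸ m) (λ ρ → T# (suc m) (λ zs → Ω (ρ ++ zs)))
      ≡⟨ sym (T-++ (d ∸ m) (suc m) Ω) ⟩
    T# (d ∸ m + suc m) Ω
      ≡⟨ cong (λ k → T# k Ω) (trans (ℕₚ.+-suc (d ∸ m) m) (cong suc (ℕₚ.m∸n+n≡m m≤d))) ⟩
    T# (suc d) Ω
      ≡⟨ T-+ (suc d) (λ τ → χ (X τ ∧ dl f τ)) (λ τ → χ (X τ ∧ rare τ)) ⟩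
    odd# + rare# ∎
    where
    open ℕₚ.≤-Reasoning
    Ω : Tuple → ℕ
    Ω τ = χ (X τ ∧ dl f τ) + χ (X τ ∧ rare τ)
    each : ∀ ρ zs → length ρ ≡ d ∸ m → length zs ≡ suc m → ∀ b → Term m ρ ≡ b → χ b * χ (X (ρ ++ zs) ∧ dl (R m ρ) zs) ≤ Ω (ρ ++ zs)
    each ρ zs l l′ false e = z≤n
    each ρ zs l l′ true e with true-or-false (rare (ρ ++ zs))
    ... | inj₁ r = ℕₚ.≤-trans (ℕₚ.≤-reflexive (ℕₚ.*-identityˡ _)) (ℕₚ.≤-trans (χ-mono {X (ρ ++ zs) ∧ dl (R m ρ) zs} {X (ρ ++ zs) ∧ rare (ρ ++ zs)} (λ h → ∧-intro {X (ρ ++ zs)} (∧-trueˡ {X (ρ ++ zs)} {dl (R m ρ) zs} h) r))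
        (ℕₚ.m≤n+m (χ (X (ρ ++ zs) ∧ rare (ρ ++ zs))) (χ (X (ρ ++ zs) ∧ dl f (ρ ++ zs)))))
    ... | inj₂ r = ℕₚ.≤-trans (ℕₚ.≤-reflexive (ℕₚ.*-identityˡ _)) (ℕₚ.≤-trans (χ-mono {X (ρ ++ zs) ∧ dl (R m ρ) zs} {X (ρ ++ zs) ∧ dl f (ρ ++ zs)} (λ h → ∧-intro {X (ρ ++ zs)} (∧-trueˡ {X (ρ ++ zs)} {dl (R m ρ) zs} h)
        (parity m ρ zs (not-rare⇒Rigid (ρ ++ zs) len r) e l′ (∧-trueʳ {X (ρ ++ zs)} h)))) (ℕₚ.m≤m+n (χ (X (ρ ++ zs) ∧ dl f (ρ ++ zs))) (χ (X (ρ ++ zs) ∧ rare (ρ ++ zs)))))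
      where
      len : length (ρ ++ zs) ≡ suc d
      len = trans (Listₚ.length-++ ρ) (trans (cong₂ _+_ l l′) (trans (ℕₚ.+-suc (d ∸ m) m) (cong suc (ℕₚ.m∸n+n≡m m≤d))))

  pat# : ℕ → ℕ
  pat# m = T# (suc d) (λ π → χ (X π ∧ pat m π))

  rare-≤ : rare# ≤ suc d ! * sumL (upTo d) pat#
  rare-≤ = begin
    T# (suc d) (λ τ → χ (X τ ∧ rare τ))
      ≤⟨ T-mono (suc d) (λ τ _ _ → each τ) ⟩
    T# (suc d) (λ τ → sumL (perms τ) (λ π → sumL (upTo d) (λ m → χ (X π ∧ pat m π))))
      ≡⟨ T-perms (suc d) (λ π → sumL (upTo d) (λ m → χ (X π ∧ pat m π))) ⟩
    suc d ! * T# (suc d) (λ π → sumL (upTo d) (λ m → χ (X π ∧ pat m π)))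
      ≡⟨ cong (suc d ! *_) (T-sumL (suc d) (upTo d) (λ m π → χ (X π ∧ pat m π))) ⟩
    suc d ! * sumL (upTo d) pat# ∎
    where
    open ℕₚ.≤-Reasoning
    insAll-↭ : ∀ x ys {π} → π ∈ insAll x ys → π ↭ x ∷ ys
    insAll-↭ x [] (here refl) = ↭-refl
    insAll-↭ x (y ∷ ys) (here refl) = ↭-refl
    insAll-↭ x (y ∷ ys) (there m) with ∈ₚ.∈-map⁻ (y ∷_) m
    ... | π , q , refl = ↭-trans (prep y (insAll-↭ x ys q)) (swap y x ↭-refl)
    perms-↭ : ∀ xs {π} → π ∈ perms xs → π ↭ xs
    perms-↭ [] (here refl) = ↭-refl
    perms-↭ (x ∷ xs) m with ∈ₚ.∈-concat⁻′ (map (insAll x) (perms xs)) m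
    ... | l , π∈ , l∈ with ∈ₚ.∈-map⁻ (insAll x) l∈
    ... | ys , y∈ , refl = ↭-trans (insAll-↭ x ys π∈) (prep x (perms-↭ xs y∈))
    each : ∀ τ → χ (X τ ∧ rare τ) ≤ sumL (perms τ) (λ π → sumL (upTo d) (λ m → χ (X π ∧ pat m π)))
    each τ with true-or-false (X τ ∧ rare τ)
    ... | inj₂ e rewrite e = z≤n
    ... | inj₁ e with any-true _ (perms τ) (∧-trueʳ {X τ} e)
    ... | π , π∈ , q with any-true _ (upTo d) q
    ... | m , m∈ , h = ℕₚ.≤-trans (χ-≤1 _) (ℕₚ.≤-trans (ℕₚ.≤-reflexive (cong χ (sym (∧-intro (trans (X-sym (perms-↭ τ π∈)) (∧-trueˡ e)) h))))
        (ℕₚ.≤-trans (sumL-member (λ m → χ (X π ∧ pat m π)) m∈) (sumL-member (λ π → sumL (upTo d) (λ m → χ (X π ∧ pat m π))) π∈)))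

  -- The sum over `v` is moved inside, so that `u ∷ ξ` is fixed and `v` becomes a vertex of its
  -- link.
  pat-split : ∀ m → m < d → pat# m ≡ sumL V (λ u → T# (d ∸ suc m) (λ ξ → sumL V (λ v → T# m (λ rest →
    χ (X (u ∷ v ∷ ξ ++ rest) ∧ (Fat m (u ∷ ξ) ∧ (Fat m (v ∷ ξ) ∧ not (Fat (suc m) ξ))))))))
  pat-split m m<d = begin
    T# (suc d) (λ π → χ (X π ∧ pat m π))
      ≡⟨ cong (λ k → T# (suc k) (λ π → χ (X π ∧ pat m π))) (sym dlen) ⟩
    sumL V (λ u → sumL V (λ v → T# (d ∸ suc m + m) (λ w → χ (X (u ∷ v ∷ w) ∧ pat m (u ∷ v ∷ w)))))
      ≡⟨ sumL-cong V (λ u _ → sumL-cong V (λ v _ → trans (T-++ (d ∸ suc m) m _) (T-cong (d ∸ suc m) (λ ξ l _ → T-cong m (λ rest _ _ →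
           cong (λ z → χ (X (u ∷ v ∷ ξ ++ rest) ∧ (Fat m (u ∷ z) ∧ (Fat m (v ∷ z) ∧ not (Fat (suc m) z))))) (take-++ ξ rest l)))))) ⟩
    sumL V (λ u → sumL V (λ v → T# (d ∸ suc m) (λ ξ → T# m (λ rest → B u v ξ rest))))
      ≡⟨ sumL-cong V (λ u _ → sym (T-sumL (d ∸ suc m) V (λ v ξ → T# m (B u v ξ)))) ⟩
    sumL V (λ u → T# (d ∸ suc m) (λ ξ → sumL V (λ v → T# m (B u v ξ)))) ∎
    where
    open ≡-Reasoning
    dlen : suc (d ∸ suc m + m) ≡ d
    dlen = trans (sym (ℕₚ.+-suc (d ∸ suc m) m)) (ℕₚ.m∸n+n≡m m<d)
    B : ℕ → ℕ → Tuple → Tuple → ℕ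
    B u v ξ rest = χ (X (u ∷ v ∷ ξ ++ rest) ∧ (Fat m (u ∷ ξ) ∧ (Fat m (v ∷ ξ) ∧ not (Fat (suc m) ξ))))

  module Bounds (a b k Cu Cl L Θ G : ℕ)
    (min-degree : ∀ σ → length σ ≡ d → Unique σ → All (_∈ V) σ → a ≤ deg σ)
    (upper : ∀ ρ m h → length ρ + suc m ≡ d → Unique ρ → All (_∈ V) ρ → Sym h → Distinct h →
      Θ * sumL V (λ x → T# (suc m) (λ ys → χ (X (ρ ++ x ∷ ys) ∧ h ys))) ≤ Cu * k * (Θ * T# (suc m) (χ ∘ h) + N ^ suc m))
    (lower : ∀ ρ m h → length ρ + suc m ≡ d → Unique ρ → All (_∈ V) ρ → Sym h → Distinct h →
      N ^ suc (suc m) ≤ L * T# (suc (suc m)) (λ zs → χ (distinctᵇ (ρ ++ zs) ∧ dl h zs)) →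
      k * T# (suc (suc m)) (λ zs → χ (distinctᵇ (ρ ++ zs) ∧ dl h zs)) ≤ Cl * N * T# (suc (suc m)) (λ zs → χ (X (ρ ++ zs) ∧ dl h zs)))
    (tiny : ∀ ξ (A : ℕ → Bool) → suc (length ξ) ≡ d → Unique ξ → All (_∈ V) ξ → H 0 * sumL V (χ ∘ A) < N →
      sumL V (λ u → sumL V (λ v → χ (X (u ∷ v ∷ ξ) ∧ (A u ∧ A v)))) ≤ b * sumL V (χ ∘ A))
    (minimal : MinOn [] d)
    (k≤3a : k ≤ 3 * a) (Gb≤k : G * b ≤ k) (0<G : 0 < G) (0<Θ : 0 < Θ) (1≤C : 1 ≤ 4 * Cu * Cl) (2d≤N : 2 * d ≤ N)
    (0<H : ∀ m → 0 < H m)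
    (H-large : ∀ m → 2 * G * Cu * suc m * K (suc m) ≤ H (suc m))
    (Θ-large : ∀ m → m ≤ d → 2 * G * Cu * K m ≤ Θ) (K≤Θ : ∀ m → m ≤ d → K m ≤ Θ) (L-large : ∀ m → m ≤ d → 2 * K m ≤ L) where

    C′ : ℕ
    C′ = 4 * Cu * Cl

    degree-≤ : a * size# ≤ weight#
    degree-≤ = ℕₚ.≤-trans (ℕₚ.≤-reflexive (sym (T-*ˡ d a _))) (T-mono d (λ σ l m → each σ l m (f σ) refl))
      where
      each : ∀ σ → length σ ≡ d → All (_∈ V) σ → ∀ c → f σ ≡ c → a * χ c ≤ χ c * deg σ
      each σ l m false e = ℕₚ.≤-reflexive (ℕₚ.*-zeroʳ a)
      each σ l m true e = ℕₚ.≤-trans (ℕₚ.≤-reflexive (ℕₚ.*-identityʳ a)) (ℕₚ.≤-trans (min-degree σ l (f-distinct σ e) m) (ℕₚ.≤-reflexive (sym (ℕₚ.*-identityˡ (deg σ)))))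

    R-distinct : ∀ m ρ → Distinct (R m ρ)
    R-distinct m ρ ys h = Unique-++ʳ ρ (f-distinct (ρ ++ ys) (R-f m ρ ys h))

    reached≡ : ∀ m ρ → reached m ρ ≡ sumL V (λ x → T# m (λ ys → χ (X (ρ ++ x ∷ ys) ∧ R m ρ ys)))
    reached≡ m ρ = trans (T-cong m (λ ys _ _ → trans (sym (sumL-*ˡ V (χ (R m ρ ys)) _)) (sumL-cong V (λ x _ →
        trans (ℕₚ.*-comm (χ (R m ρ ys)) _) (trans (sym (χ-∧ (X (x ∷ ρ ++ ys)) (R m ρ ys))) (cong (λ z → χ (z ∧ R m ρ ys)) (X-sym (↭-sym (Permₚ.shift x ρ ys)))))))))
      (T-sumL m V (λ x ys → χ (X (ρ ++ x ∷ ys) ∧ R m ρ ys)))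

    -- `upper` bounds the total degree of the piece by `k` times its size, the cones bound its size
    -- by its coboundary divided by `N`, and `lower` compares this coboundary with the part seen by
    -- `X`. At level 0, ρ is itself the piece and every d-face over it is odd.
    reached-≤ : ∀ m ρ → length ρ + m ≡ d → All (_∈ V) ρ → Term m ρ ≡ true → reached m ρ ≤ C′ * oddAt m ρ
    reached-≤ zero ρ l all∈ t = begin
      reached 0 ρ                                               ≡⟨ reached≡ 0 ρ ⟩
      sumL V (λ x → χ (X (ρ ++ x ∷ []) ∧ R 0 ρ []))             ≡⟨ sumL-cong V (λ x _ → cong (λ z → χ (X (ρ ++ x ∷ []) ∧ z)) (sym (Boolₚ.xor-identityʳ (R 0 ρ [])))) ⟩
      oddAt 0 ρ                                                 ≡⟨ sym (ℕₚ.*-identityˡ (oddAt 0 ρ)) ⟩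
      1 * oddAt 0 ρ                                             ≤⟨ ℕₚ.*-monoˡ-≤ (oddAt 0 ρ) 1≤C ⟩
      C′ * oddAt 0 ρ ∎
      where open ℕₚ.≤-Reasoning
    reached-≤ (suc m) ρ l all∈ t = begin
      reached (suc m) ρ          ≡⟨ reached≡ (suc m) ρ ⟩
      vol                        ≤⟨ vol-≤ ⟩
      2 * Cu * (k * h#)          ≤⟨ ℕₚ.*-monoʳ-≤ (2 * Cu) kh-≤ ⟩
      2 * Cu * (2 * Cl * od)     ≡⟨ lem₀ Cu Cl od ⟩
      4 * Cu * Cl * od ∎
      where
      open ℕₚ.≤-Reasoning
      lem₀ : ∀ x y z → 2 * x * (2 * y * z) ≡ 4 * x * y * z
      lem₀ = ℕSolver.solve-∀
      h : Tuple → Bool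
      h = R (suc m) ρ
      fat : Fat (suc m) ρ ≡ true
      fat = Term-fat (suc m) ρ t
      u : Unique ρ
      u = Fat-distinct (suc m) ρ fat
      m≤d : suc m ≤ d
      m≤d = ℕₚ.≤-trans (ℕₚ.m≤n+m (suc m) (length ρ)) (ℕₚ.≤-reflexive l)
      h# = T# (suc m) (χ ∘ h)
      vol = sumL V (λ x → T# (suc m) (λ ys → χ (X (ρ ++ x ∷ ys) ∧ h ys)))
      e# = T# (suc (suc m)) (λ zs → χ (distinctᵇ (ρ ++ zs) ∧ dl h zs))
      od = oddAt (suc m) ρ
      dense : N ^ suc m ≤ K (suc m) * h#
      dense = R-dense (suc m) ρ fat
      instance
        nzΘ : NonZero Θ
        nzΘ = >-nonZero 0<Θ
        nzN : NonZero N
        nzN = >-nonZero 0<N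
      -- The density of the piece absorbs the additive error of `upper`, because `K ≤ Θ`.
      vol-≤ : vol ≤ 2 * Cu * (k * h#)
      vol-≤ = ℕₚ.*-cancelˡ-≤ Θ (begin
        Θ * vol                              ≤⟨ upper ρ m h l u all∈ (R-sym (suc m) ρ) (R-distinct (suc m) ρ) ⟩
        Cu * k * (Θ * h# + N ^ suc m)        ≤⟨ ℕₚ.*-monoʳ-≤ (Cu * k) (ℕₚ.+-monoʳ-≤ (Θ * h#) (ℕₚ.≤-trans dense (ℕₚ.*-monoˡ-≤ h# (K≤Θ (suc m) m≤d)))) ⟩
        Cu * k * (Θ * h# + Θ * h#)           ≡⟨ lem₁ Cu k Θ h# ⟩
        Θ * (2 * Cu * (k * h#)) ∎)
        where
        lem₁ : ∀ c k t h → c * k * (t * h + t * h) ≡ t * (2 * c * (k * h))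
        lem₁ = ℕSolver.solve-∀
      ρ≤d : length ρ ≤ d
      ρ≤d = ℕₚ.≤-trans (ℕₚ.m≤m+n (length ρ) (suc m)) (ℕₚ.≤-reflexive l)
      -- By `2 d ≤ N`, the apexes inside ρ take at most half of the sum.
      half : N * h# ≤ 2 * e#
      half = ℕₚ.+-cancelˡ-≤ (N * h#) _ _ (begin
        N * h# + N * h#                      ≡⟨ lem₁ (N * h#) ⟩
        2 * (N * h#)                         ≤⟨ ℕₚ.*-monoʳ-≤ 2 (Cone.cone-sum ρ (suc m) u (minOn-links ρ (suc m) all∈ (subst (MinOn []) (sym l) minimal)) h (R-sym (suc m) ρ) (R-distinct (suc m) ρ) (R-f (suc m) ρ)) ⟩
        2 * (length ρ * h# + e#)             ≡⟨ lem₂ (length ρ) h# e# ⟩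
        2 * length ρ * h# + 2 * e#           ≤⟨ ℕₚ.+-monoˡ-≤ (2 * e#) (ℕₚ.*-monoˡ-≤ h# (ℕₚ.≤-trans (ℕₚ.*-monoʳ-≤ 2 ρ≤d) 2d≤N)) ⟩
        N * h# + 2 * e# ∎)
        where
        lem₁ : ∀ x → x + x ≡ 2 * x
        lem₁ = ℕSolver.solve-∀
        lem₂ : ∀ r h e → 2 * (r * h + e) ≡ 2 * r * h + 2 * e
        lem₂ = ℕSolver.solve-∀
      large : N ^ suc (suc m) ≤ L * e#
      large = begin
        N * N ^ suc m                        ≤⟨ ℕₚ.*-monoʳ-≤ N dense ⟩
        N * (K (suc m) * h#)                 ≡⟨ lem₁ N (K (suc m)) h# ⟩
        K (suc m) * (N * h#)                 ≤⟨ ℕₚ.*-monoʳ-≤ (K (suc m)) half ⟩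
        K (suc m) * (2 * e#)                 ≡⟨ lem₂ (K (suc m)) e# ⟩
        2 * K (suc m) * e#                   ≤⟨ ℕₚ.*-monoˡ-≤ e# (L-large (suc m) m≤d) ⟩
        L * e# ∎
        where
        lem₁ : ∀ n k h → n * (k * h) ≡ k * (n * h)
        lem₁ = ℕSolver.solve-∀
        lem₂ : ∀ k e → k * (2 * e) ≡ 2 * k * e
        lem₂ = ℕSolver.solve-∀
      kh-≤ : k * h# ≤ 2 * Cl * od
      kh-≤ = ℕₚ.*-cancelˡ-≤ N (begin
        N * (k * h#)                         ≡⟨ lem₁ N k h# ⟩
        k * (N * h#)                         ≤⟨ ℕₚ.*-monoʳ-≤ k half ⟩
        k * (2 * e#)                         ≡⟨ lem₂ k e# ⟩
        2 * (k * e#)                         ≤⟨ ℕₚ.*-monoʳ-≤ 2 (lower ρ m h l u all∈ (R-sym (suc m) ρ) (R-distinct (suc m) ρ) large) ⟩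
        2 * (Cl * N * od)                    ≡⟨ lem₃ Cl N od ⟩
        N * (2 * Cl * od) ∎)
        where
        lem₁ : ∀ n k h → n * (k * h) ≡ k * (n * h)
        lem₁ = ℕSolver.solve-∀
        lem₂ : ∀ k e → k * (2 * e) ≡ 2 * (k * e)
        lem₂ = ℕSolver.solve-∀
        lem₃ : ∀ c n o → 2 * (c * n * o) ≡ n * (2 * c * o)
        lem₃ = ℕSolver.solve-∀

    -- At level 0 no free entries are left, so the patterns are edges in the link of `ξ`. Their
    -- endpoints lie in the set of `x` with `x ∷ ξ` in `f`, which is small because `ξ` is not fat,
    -- and `tiny` counts them.
    pat0-≤ : 0 < d → G * pat# 0 ≤ k * size#
    pat0-≤ 0<d = begin
      G * pat# 0
        ≡⟨ cong (G *_) (trans (pat-split 0 0<d) (sym (T-sumL j V (λ u ξ → sumL V (λ v → B u v ξ))))) ⟩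
      G * T# j (λ ξ → sumL V (λ u → sumL V (λ v → B u v ξ)))
        ≤⟨ ℕₚ.*-monoʳ-≤ G (T-mono j (λ ξ l a → each ξ l a)) ⟩
      G * T# j (λ ξ → b * sumL V (λ u → χ (f (u ∷ ξ))))
        ≡⟨ cong (G *_) (trans (T-*ˡ j b _) (cong (b *_) (T-sumL j V (λ u ξ → χ (f (u ∷ ξ)))))) ⟩
      G * (b * T# (suc j) (χ ∘ f))
        ≡⟨ trans (sym (ℕₚ.*-assoc G b _)) (cong (λ z → G * b * T# z (χ ∘ f)) sj) ⟩
      G * b * size#
        ≤⟨ ℕₚ.*-monoˡ-≤ size# Gb≤k ⟩
      k * size# ∎
      where
      open ℕₚ.≤-Reasoning
      j = d ∸ 1
      sj : suc j ≡ d
      sj = ℕₚ.m+[n∸m]≡n 0<d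
      B : ℕ → ℕ → Tuple → ℕ
      B u v ξ = χ (X (u ∷ v ∷ ξ ++ []) ∧ (f (u ∷ ξ) ∧ (f (v ∷ ξ) ∧ not (Fat 1 ξ))))
      nothing′ : ∀ ξ → (∀ u v → X (u ∷ v ∷ ξ ++ []) ∧ (f (u ∷ ξ) ∧ (f (v ∷ ξ) ∧ not (Fat 1 ξ))) ≡ false) → sumL V (λ u → sumL V (λ v → B u v ξ)) ≤ b * sumL V (λ u → χ (f (u ∷ ξ)))
      nothing′ ξ h = ℕₚ.≤-trans (ℕₚ.≤-reflexive (trans (sumL-cong V (λ u _ → trans (sumL-cong V (λ v _ → cong χ (h u v))) (sumL-0 V))) (sumL-0 V))) z≤n
      each : ∀ ξ → length ξ ≡ j → All (_∈ V) ξ → sumL V (λ u → sumL V (λ v → B u v ξ)) ≤ b * sumL V (λ u → χ (f (u ∷ ξ)))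
      each ξ l al with true-or-false (Fat 1 ξ) | true-or-false (distinctᵇ ξ)
      ... | inj₁ e | _ = nothing′ ξ (λ u v → ≢true (λ h → case trans (sym (cong not e)) (∧-trueʳ {f (v ∷ ξ)} (∧-trueʳ {f (u ∷ ξ)} (∧-trueʳ {X (u ∷ v ∷ ξ ++ [])} h))) of λ ()))
      ... | inj₂ e | inj₂ e′ = nothing′ ξ (λ u v → ≢true (λ h → case trans (sym e′) (Unique⇒distinctᵇ (Unique-++ʳ (u ∷ []) (f-distinct (u ∷ ξ) (∧-trueˡ (∧-trueʳ {X (u ∷ v ∷ ξ ++ [])} h))))) of λ ()))
      ... | inj₂ e | inj₁ e′ = ℕₚ.≤-trans (sumL-mono V (λ u _ → sumL-mono V (λ v _ → pair u v)))
          (tiny ξ (λ x → f (x ∷ ξ)) (trans (cong suc l) sj) (distinctᵇ⇒Unique ξ e′) al (Thin-suc 0 ξ e))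
        where
        pair : ∀ u v → B u v ξ ≤ χ (X (u ∷ v ∷ ξ) ∧ (f (u ∷ ξ) ∧ f (v ∷ ξ)))
        pair u v = χ-mono λ h →
          let h₁ = ∧-trueʳ {X (u ∷ v ∷ ξ ++ [])} {f (u ∷ ξ) ∧ (f (v ∷ ξ) ∧ not (Fat 1 ξ))} h
              h₂ = ∧-trueʳ {f (u ∷ ξ)} {f (v ∷ ξ) ∧ not (Fat 1 ξ)} h₁ in
          ∧-intro {X (u ∷ v ∷ ξ)} (trans (cong (λ z → X (u ∷ v ∷ z)) (sym (Listₚ.++-identityʳ ξ))) (∧-trueˡ {X (u ∷ v ∷ ξ ++ [])} {f (u ∷ ξ) ∧ (f (v ∷ ξ) ∧ not (Fat 1 ξ))} h))
            (∧-intro {f (u ∷ ξ)} (∧-trueˡ {f (u ∷ ξ)} {f (v ∷ ξ) ∧ not (Fat 1 ξ)} h₁) (∧-trueˡ {f (v ∷ ξ)} {not (Fat 1 ξ)} h₂))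

    -- Each of the `m` positions lies in `A` for a fraction `|A| / N` of the tuples; the factor `N`
    -- on the left avoids an exponent `m - 1`.
    T-anyOf : ∀ (A : ℕ → Bool) m → N * T# m (λ ys → sumL ys (χ ∘ A)) ≡ m * (sumL V (χ ∘ A) * N ^ m)
    T-anyOf A zero = ℕₚ.*-zeroʳ N
    T-anyOf A (suc m) = begin
      N * sumL V (λ x → T# m (λ ys → χ (A x) + sumL ys (χ ∘ A)))
        ≡⟨ cong (N *_) (trans (sumL-cong V (λ x _ → trans (T-+ m _ _) (cong (_+ S) (trans (T-const m (χ (A x))) refl)))) (trans (sumL-+ V _ _) (cong₂ _+_ (sumL-*ˡ V (N ^ m) _) (sumL-const V S)))) ⟩
      N * (N ^ m * sumL V (χ ∘ A) + N * S)
        ≡⟨ cong (λ z → N * (N ^ m * sumL V (χ ∘ A) + z)) (T-anyOf A m) ⟩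
      N * (N ^ m * sumL V (χ ∘ A) + m * (sumL V (χ ∘ A) * N ^ m))
        ≡⟨ lem N (N ^ m) (sumL V (χ ∘ A)) m ⟩
      suc m * (sumL V (χ ∘ A) * (N * N ^ m)) ∎
      where
      open ≡-Reasoning
      S = T# m (λ ys → sumL ys (χ ∘ A))
      lem : ∀ n p a m → n * (p * a + m * (a * p)) ≡ suc m * (a * (n * p))
      lem = ℕSolver.solve-∀

    any-≤ : ∀ (A : ℕ → Bool) ys → χ (any A ys) ≤ sumL ys (χ ∘ A)
    any-≤ A [] = z≤n
    any-≤ A (y ∷ ys) with A y
    ... | true = s≤s z≤n
    ... | false = any-≤ A ys

    module _ (m : ℕ) (m<d : suc m < d) where

      private
        j = d ∸ suc (suc m)
        jlen : suc j + suc m ≡ d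
        jlen = trans (cong suc (ℕₚ.+-suc j m)) (trans (sym (trans (ℕₚ.+-suc j (suc m)) (cong suc (ℕₚ.+-suc j m)))) (ℕₚ.m∸n+n≡m m<d))

      -- Seen from the fat face `u ∷ ξ`, the vertices `v` with `v ∷ ξ` fat form a set of fewer than
      -- `N / H (suc m)` elements, so tuples meeting it have density at most `(m + 1) / H (suc m)`,
      -- to which `upper` adds an error `1 / Θ`. By `H-large`, `Θ-large` and `R-dense`, each of the
      -- two contributes at most `k / (2 G)` times the number of faces reached from `u ∷ ξ`.
      link-pairs : ∀ u ξ → length ξ ≡ j → u ∈ V → All (_∈ V) ξ → Fat (suc m) (u ∷ ξ) ≡ true → Fat (suc (suc m)) ξ ≡ false →
        G * sumL V (λ v → T# (suc m) (λ rest → χ (X (u ∷ v ∷ ξ ++ rest) ∧ Fat (suc m) (v ∷ ξ)))) ≤ k * T# (suc m) (λ ys → χ (R (suc m) (u ∷ ξ) ys))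
      link-pairs u ξ l u∈ all∈ fat thin = ℕₚ.*-cancelˡ-≤ (2 * (Hm * Θ)) (begin
        2 * (Hm * Θ) * (G * I)                                      ≡⟨ lem₁ Hm Θ G I ⟩
        2 * G * (Hm * (Θ * I))                                      ≤⟨ ℕₚ.*-monoʳ-≤ (2 * G) (ℕₚ.*-monoʳ-≤ Hm (ℕₚ.≤-trans (ℕₚ.*-monoʳ-≤ Θ I-≤) (upper (u ∷ ξ) m h lρ uρ (u∈ ∷ all∈) h-sym h-distinct))) ⟩
        2 * G * (Hm * (Cu * k * (Θ * h# + N ^ suc m)))              ≡⟨ lem₂ G Hm (Cu * k) Θ h# (N ^ suc m) ⟩
        2 * G * (Cu * k * (Θ * (Hm * h#) + Hm * N ^ suc m))         ≤⟨ ℕₚ.*-monoʳ-≤ (2 * G) (ℕₚ.*-monoʳ-≤ (Cu * k) (ℕₚ.+-monoˡ-≤ (Hm * N ^ suc m) (ℕₚ.*-monoʳ-≤ Θ Hh-≤))) ⟩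
        2 * G * (Cu * k * (Θ * (suc m * N ^ suc m) + Hm * N ^ suc m)) ≡⟨ lem₃ G Cu k Θ (suc m) (N ^ suc m) Hm ⟩
        k * (2 * G * Cu * (Θ * suc m + Hm)) * N ^ suc m             ≤⟨ ℕₚ.*-monoʳ-≤ (k * (2 * G * Cu * (Θ * suc m + Hm))) (R-dense (suc m) (u ∷ ξ) fat) ⟩
        k * (2 * G * Cu * (Θ * suc m + Hm)) * (K (suc m) * r#)      ≡⟨ lem₄ k G Cu Θ (suc m) Hm (K (suc m)) r# ⟩
        k * r# * (Θ * (2 * G * Cu * suc m * K (suc m)) + Hm * (2 * G * Cu * K (suc m)))
          ≤⟨ ℕₚ.*-monoʳ-≤ (k * r#) (ℕₚ.+-mono-≤ (ℕₚ.*-monoʳ-≤ Θ (H-large m)) (ℕₚ.*-monoʳ-≤ Hm (Θ-large (suc m) (ℕₚ.<⇒≤ m<d)))) ⟩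
        k * r# * (Θ * Hm + Hm * Θ)                                  ≡⟨ lem₅ k r# Θ Hm ⟩
        2 * (Hm * Θ) * (k * r#) ∎)
        where
        open ℕₚ.≤-Reasoning
        Hm = H (suc m)
        instance
          nzN : NonZero N
          nzN = >-nonZero 0<N
          nz2 : NonZero (2 * (Hm * Θ))
          nz2 = >-nonZero (ℕₚ.*-mono-≤ {1} {2} (s≤s z≤n) (ℕₚ.*-mono-≤ (0<H (suc m)) 0<Θ))
        A : ℕ → Bool
        A v = Fat (suc m) (v ∷ ξ)
        h : Tuple → Bool
        h ys = distinctᵇ ys ∧ any A ys
        h-sym : Sym h
        h-sym {xs} {ys} p = cong₂ _∧_ (distinctᵇ-sym p) (bool-ext (one p) (one (↭-sym p)))
          where
          one : ∀ {xs ys} → xs ↭ ys → any A xs ≡ true → any A ys ≡ true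
          one {xs} p e with any-true A xs e
          ... | y , y∈ , q = any-intro A (Permₚ.∈-resp-↭ p y∈) q
        h-distinct : Distinct h
        h-distinct ys e = distinctᵇ⇒Unique ys (∧-trueˡ e)
        h# = T# (suc m) (χ ∘ h)
        r# = T# (suc m) (λ ys → χ (R (suc m) (u ∷ ξ) ys))
        I = sumL V (λ v → T# (suc m) (λ rest → χ (X (u ∷ v ∷ ξ ++ rest) ∧ A v)))
        uρ : Unique (u ∷ ξ)
        uρ = Fat-distinct (suc m) (u ∷ ξ) fat
        lρ : suc (length ξ) + suc m ≡ d
        lρ = trans (cong (λ z → suc z + suc m) l) jlen
        Hh-≤ : Hm * h# ≤ suc m * N ^ suc m
        Hh-≤ = ℕₚ.*-cancelˡ-≤ N (begin
          N * (Hm * h#)                                       ≡⟨ lem₆ N Hm h# ⟩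
          Hm * (N * h#)                                       ≤⟨ ℕₚ.*-monoʳ-≤ Hm (ℕₚ.*-monoʳ-≤ N (T-mono (suc m) (λ ys _ _ → ℕₚ.≤-trans (χ-mono (∧-trueʳ {distinctᵇ ys})) (any-≤ A ys)))) ⟩
          Hm * (N * T# (suc m) (λ ys → sumL ys (χ ∘ A)))      ≡⟨ cong (Hm *_) (T-anyOf A (suc m)) ⟩
          Hm * (suc m * (sumL V (χ ∘ A) * N ^ suc m))         ≡⟨ lem₇ Hm (suc m) (sumL V (χ ∘ A)) (N ^ suc m) ⟩
          suc m * (Hm * sumL V (χ ∘ A) * N ^ suc m)           ≤⟨ ℕₚ.*-monoʳ-≤ (suc m) (ℕₚ.*-monoˡ-≤ (N ^ suc m) (ℕₚ.<⇒≤ (Thin-suc (suc m) ξ thin))) ⟩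
          suc m * (N * N ^ suc m)                             ≡⟨ lem₆ (suc m) N (N ^ suc m) ⟩
          N * (suc m * N ^ suc m) ∎)
          where
          lem₆ : ∀ n h x → n * (h * x) ≡ h * (n * x)
          lem₆ = ℕSolver.solve-∀
          lem₇ : ∀ h m a n → h * (m * (a * n)) ≡ m * (h * a * n)
          lem₇ = ℕSolver.solve-∀
        -- The first entry `x` of `rest` takes the role of the free vertex in `upper`, so that `v`
        -- can enter the cochain. At level 0 `rest` is empty and no such entry exists.
        I-≤ : I ≤ sumL V (λ x → T# (suc m) (λ ys → χ (X (u ∷ ξ ++ x ∷ ys) ∧ h ys)))
        I-≤ = ℕₚ.≤-trans (ℕₚ.≤-reflexive (sumL-swap V V _)) (sumL-mono V (λ x _ → sumL-mono V (λ v _ → T-mono m (λ rest _ _ → χ-mono (λ e → step x v rest e)))))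
          where
          step : ∀ x v rest → X (u ∷ v ∷ ξ ++ x ∷ rest) ∧ A v ≡ true → X (u ∷ ξ ++ x ∷ v ∷ rest) ∧ h (v ∷ rest) ≡ true
          step x v rest e = ∧-intro X′ (∧-intro (Unique⇒distinctᵇ (Unique-++ʳ (u ∷ ξ ++ x ∷ []) (subst Unique (sym (cong (u ∷_) (Listₚ.++-assoc ξ (x ∷ []) (v ∷ rest)))) (X-distinct _ X′))))
              (any-intro A {v} {v ∷ rest} (here refl) (∧-trueʳ {X (u ∷ v ∷ ξ ++ x ∷ rest)} e)))
            where
            X′ : X (u ∷ ξ ++ x ∷ v ∷ rest) ≡ true
            X′ = trans (X-sym (prep u (↭-trans (Permₚ.++⁺ˡ ξ (swap x v ↭-refl)) (Permₚ.shift v ξ (x ∷ rest))))) (∧-trueˡ e)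
        lem₁ : ∀ h t g i → 2 * (h * t) * (g * i) ≡ 2 * g * (h * (t * i))
        lem₁ = ℕSolver.solve-∀
        lem₂ : ∀ g h c t x n → 2 * g * (h * (c * (t * x + n))) ≡ 2 * g * (c * (t * (h * x) + h * n))
        lem₂ = ℕSolver.solve-∀
        lem₃ : ∀ g c k t m n h → 2 * g * (c * k * (t * (m * n) + h * n)) ≡ k * (2 * g * c * (t * m + h)) * n
        lem₃ = ℕSolver.solve-∀
        lem₄ : ∀ k g c t m h κ r → k * (2 * g * c * (t * m + h)) * (κ * r) ≡ k * r * (t * (2 * g * c * m * κ) + h * (2 * g * c * κ))
        lem₄ = ℕSolver.solve-∀
        lem₅ : ∀ k r t h → k * r * (t * h + h * t) ≡ 2 * (h * t) * (k * r)
        lem₅ = ℕSolver.solve-∀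

      pat-suc-≤ : G * pat# (suc m) ≤ k * size#
      pat-suc-≤ = begin
        G * pat# (suc m)
          ≡⟨ cong (G *_) (pat-split (suc m) m<d) ⟩
        G * sumL V (λ u → T# j (λ ξ → B u ξ))
          ≡⟨ trans (sym (sumL-*ˡ V G _)) (sumL-cong V (λ u _ → sym (T-*ˡ j G _))) ⟩
        sumL V (λ u → T# j (λ ξ → G * B u ξ))
          ≤⟨ sumL-mono V (λ u u∈ → T-mono j (λ ξ l al → each u ξ l u∈ al)) ⟩
        sumL V (λ u → T# j (λ ξ → k * T# (suc m) (λ ys → χ (f ((u ∷ ξ) ++ ys)))))
          ≡⟨ trans (sumL-cong V (λ u _ → T-*ˡ j k _)) (sumL-*ˡ V k _) ⟩
        k * T# (suc j) (λ ρ → T# (suc m) (λ ys → χ (f (ρ ++ ys))))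
          ≡⟨ cong (k *_) (trans (sym (T-++ (suc j) (suc m) (χ ∘ f))) (cong (λ z → T# z (χ ∘ f)) jlen)) ⟩
        k * size# ∎
        where
        open ℕₚ.≤-Reasoning
        B : ℕ → Tuple → ℕ
        B u ξ = sumL V (λ v → T# (suc m) (λ rest → χ (X (u ∷ v ∷ ξ ++ rest) ∧ (Fat (suc m) (u ∷ ξ) ∧ (Fat (suc m) (v ∷ ξ) ∧ not (Fat (suc (suc m)) ξ))))))
        vanish : ∀ u ξ → (∀ v rest → X (u ∷ v ∷ ξ ++ rest) ∧ (Fat (suc m) (u ∷ ξ) ∧ (Fat (suc m) (v ∷ ξ) ∧ not (Fat (suc (suc m)) ξ))) ≡ false) → B u ξ ≡ 0
        vanish u ξ h = trans (sumL-cong V (λ v _ → trans (T-cong (suc m) (λ rest _ _ → cong χ (h v rest))) (T-0 (suc m)))) (sumL-0 V)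
        forget : ∀ u v ξ → T# (suc m) (λ rest → χ (X (u ∷ v ∷ ξ ++ rest) ∧ (Fat (suc m) (u ∷ ξ) ∧ (Fat (suc m) (v ∷ ξ) ∧ not (Fat (suc (suc m)) ξ)))))
          ≤ T# (suc m) (λ rest → χ (X (u ∷ v ∷ ξ ++ rest) ∧ Fat (suc m) (v ∷ ξ)))
        forget u v ξ = T-mono (suc m) (λ rest _ _ → go (X (u ∷ v ∷ ξ ++ rest)) (Fat (suc m) (u ∷ ξ)) (Fat (suc m) (v ∷ ξ)) (not (Fat (suc (suc m)) ξ)))
          where
          go : ∀ a b c e → χ (a ∧ (b ∧ (c ∧ e))) ≤ χ (a ∧ c)
          go false b c e = z≤n
          go true false c e = z≤n
          go true true false e = z≤n
          go true true true e = χ-≤1 e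
        each : ∀ u ξ → length ξ ≡ j → u ∈ V → All (_∈ V) ξ → G * B u ξ ≤ k * T# (suc m) (λ ys → χ (f ((u ∷ ξ) ++ ys)))
        each u ξ l u∈ al with true-or-false (Fat (suc m) (u ∷ ξ)) | true-or-false (Fat (suc (suc m)) ξ)
        ... | inj₂ e | _ = ℕₚ.≤-trans (ℕₚ.≤-reflexive (trans (cong (G *_) (vanish u ξ (λ v rest → ≢true (λ h → case trans (sym e) (∧-trueˡ (∧-trueʳ {X (u ∷ v ∷ ξ ++ rest)} h)) of λ ())))) (ℕₚ.*-zeroʳ G))) z≤n
        ... | inj₁ _ | inj₁ e = ℕₚ.≤-trans (ℕₚ.≤-reflexive (trans (cong (G *_) (vanish u ξ (λ v rest → ≢true (λ h → case trans (sym (cong not e)) (∧-trueʳ {Fat (suc m) (v ∷ ξ)} (∧-trueʳ {Fat (suc m) (u ∷ ξ)} (∧-trueʳ {X (u ∷ v ∷ ξ ++ rest)} h))) of λ ())))) (ℕₚ.*-zeroʳ G))) z≤n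
        ... | inj₁ e | inj₂ e′ = ℕₚ.≤-trans (ℕₚ.*-monoʳ-≤ G (sumL-mono V (λ v _ → forget u v ξ)))
            (ℕₚ.≤-trans (link-pairs u ξ l u∈ al e e′) (ℕₚ.*-monoʳ-≤ k (T-mono (suc m) (λ ys _ _ → χ-mono (R-f (suc m) (u ∷ ξ) ys)))))

    pat-≤ : ∀ m → m < d → G * pat# m ≤ k * size#
    pat-≤ zero m<d = pat0-≤ m<d
    pat-≤ (suc m) m<d = pat-suc-≤ m m<d

    -- The value of `G` is the one for which the rare faces contribute at most `G * weight#`, half
    -- of the left side of the chain, which is then cancelled.
    top-expansion : G ≡ 6 * (d ! * suc d * C′) * (suc d ! * d) → weight# ≤ 2 * (d ! * suc d * C′) * odd#
    top-expansion eG = ℕₚ.*-cancelˡ-≤ G (ℕₚ.+-cancelʳ-≤ (G * weight#) _ _ (begin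
      G * weight# + G * weight#                                   ≡⟨ lem₁ G weight# ⟩
      2 * (G * weight#)                                           ≤⟨ ℕₚ.*-monoʳ-≤ 2 (ℕₚ.*-monoʳ-≤ G main) ⟩
      2 * (G * (B * (odd# + rare#)))                              ≡⟨ lem₂ G B odd# rare# ⟩
      G * (2 * B * odd#) + 2 * B * (G * rare#)                    ≤⟨ ℕₚ.+-monoʳ-≤ (G * (2 * B * odd#)) (ℕₚ.*-monoʳ-≤ (2 * B) rare′) ⟩
      G * (2 * B * odd#) + 2 * B * (suc d ! * d * (3 * weight#))  ≡⟨ cong (G * (2 * B * odd#) +_) (lem₃ B (suc d ! * d) weight#) ⟩
      G * (2 * B * odd#) + 6 * B * (suc d ! * d) * weight#        ≡⟨ cong (λ z → G * (2 * B * odd#) + z * weight#) (sym eG) ⟩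
      G * (2 * B * odd#) + G * weight# ∎))
      where
      open ℕₚ.≤-Reasoning
      instance
        nzG : NonZero G
        nzG = >-nonZero 0<G
      B = d ! * suc d * C′
      lem₁ : ∀ g w → g * w + g * w ≡ 2 * (g * w)
      lem₁ = ℕSolver.solve-∀
      lem₂ : ∀ g b o r → 2 * (g * (b * (o + r))) ≡ g * (2 * b * o) + 2 * b * (g * r)
      lem₂ = ℕSolver.solve-∀
      lem₃ : ∀ b c w → 2 * b * (c * (3 * w)) ≡ 6 * b * c * w
      lem₃ = ℕSolver.solve-∀
      main : weight# ≤ B * (odd# + rare#)
      main = begin
        weight#
          ≤⟨ weight-≤ ⟩
        d ! * sumL (upTo (suc d)) (λ m → T# (d ∸ m) (λ ρ → χ (Term m ρ) * reached m ρ))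
          ≤⟨ ℕₚ.*-monoʳ-≤ (d !) (sumL-mono (upTo (suc d)) (λ m m∈ → level m (ℕₚ.≤-pred (∈ₚ.∈-upTo⁻ m∈)))) ⟩
        d ! * sumL (upTo (suc d)) (λ _ → C′ * (odd# + rare#))
          ≡⟨ cong (d ! *_) (trans (sumL-const (upTo (suc d)) _) (cong (_* (C′ * (odd# + rare#))) (Listₚ.length-upTo (suc d)))) ⟩
        d ! * (suc d * (C′ * (odd# + rare#)))
          ≡⟨ lem (d !) (suc d) C′ (odd# + rare#) ⟩
        B * (odd# + rare#) ∎
        where
        lem : ∀ a b c e → a * (b * (c * e)) ≡ a * b * c * e
        lem = ℕSolver.solve-∀
        level : ∀ m → m ≤ d → T# (d ∸ m) (λ ρ → χ (Term m ρ) * reached m ρ) ≤ C′ * (odd# + rare#)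
        level m m≤d = ℕₚ.≤-trans (T-mono (d ∸ m) (λ ρ l al → each ρ (trans (cong (_+ m) l) (ℕₚ.m∸n+n≡m m≤d)) al (Term m ρ) refl))
          (ℕₚ.≤-trans (ℕₚ.≤-reflexive (T-*ˡ (d ∸ m) C′ _)) (ℕₚ.*-monoʳ-≤ C′ (odd-≤ m m≤d)))
          where
          each : ∀ ρ → length ρ + m ≡ d → All (_∈ V) ρ → ∀ c → Term m ρ ≡ c → χ c * reached m ρ ≤ C′ * (χ c * oddAt m ρ)
          each ρ l al false e = z≤n
          each ρ l al true e = ℕₚ.≤-trans (ℕₚ.≤-reflexive (ℕₚ.*-identityˡ _)) (ℕₚ.≤-trans (reached-≤ m ρ l al e) (ℕₚ.≤-reflexive (cong (C′ *_) (sym (ℕₚ.*-identityˡ _)))))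
      rare′ : G * rare# ≤ suc d ! * d * (3 * weight#)
      rare′ = begin
        G * rare#                                     ≤⟨ ℕₚ.*-monoʳ-≤ G rare-≤ ⟩
        G * (suc d ! * sumL (upTo d) pat#)            ≡⟨ lem G (suc d !) (sumL (upTo d) pat#) ⟩
        suc d ! * (G * sumL (upTo d) pat#)            ≡⟨ cong (suc d ! *_) (sym (sumL-*ˡ (upTo d) G pat#)) ⟩
        suc d ! * sumL (upTo d) (λ m → G * pat# m)    ≤⟨ ℕₚ.*-monoʳ-≤ (suc d !) (sumL-mono (upTo d) (λ m m∈ → ℕₚ.≤-trans (pat-≤ m (∈ₚ.∈-upTo⁻ m∈)) k-≤)) ⟩
        suc d ! * sumL (upTo d) (λ _ → 3 * weight#)   ≡⟨ cong (suc d ! *_) (trans (sumL-const (upTo d) (3 * weight#)) (cong (_* (3 * weight#)) (Listₚ.length-upTo d))) ⟩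
        suc d ! * (d * (3 * weight#))                 ≡⟨ sym (ℕₚ.*-assoc (suc d !) d (3 * weight#)) ⟩
        suc d ! * d * (3 * weight#) ∎
        where
        lem : ∀ a b c → a * (b * c) ≡ b * (a * c)
        lem = ℕSolver.solve-∀
        k-≤ : k * size# ≤ 3 * weight#
        k-≤ = ℕₚ.≤-trans (ℕₚ.*-monoˡ-≤ size# k≤3a) (ℕₚ.≤-trans (ℕₚ.≤-reflexive (ℕₚ.*-assoc 3 a size#)) (ℕₚ.*-monoʳ-≤ 3 degree-≤))

-- Faces and tuples

filterᵇ-↭ : ∀ (p : ℕ → Bool) {xs ys} → xs ↭ ys → filterᵇ p xs ↭ filterᵇ p ys
filterᵇ-↭ p Perm.refl = ↭-refl
filterᵇ-↭ p (prep x q) with p x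
... | true = prep x (filterᵇ-↭ p q)
... | false = filterᵇ-↭ p q
filterᵇ-↭ p (swap x y q) with p x | p y
... | true | true = swap x y (filterᵇ-↭ p q)
... | true | false = prep x (filterᵇ-↭ p q)
... | false | true = prep y (filterᵇ-↭ p q)
... | false | false = filterᵇ-↭ p q
filterᵇ-↭ p (Perm.trans q r) = ↭-trans (filterᵇ-↭ p q) (filterᵇ-↭ p r)

filterᵇ-++ : ∀ (p : ℕ → Bool) xs ys → filterᵇ p (xs ++ ys) ≡ filterᵇ p xs ++ filterᵇ p ys
filterᵇ-++ p [] ys = refl
filterᵇ-++ p (x ∷ xs) ys with p x
... | true = cong (x ∷_) (filterᵇ-++ p xs ys)
... | false = filterᵇ-++ p xs ys

filterᵇ-all : ∀ (p : ℕ → Bool) xs → (∀ {x} → x ∈ xs → p x ≡ true) → filterᵇ p xs ≡ xs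
filterᵇ-all p [] h = refl
filterᵇ-all p (x ∷ xs) h rewrite h (here refl) = cong (x ∷_) (filterᵇ-all p xs (h ∘ there))

filterᵇ-none : ∀ (p : ℕ → Bool) xs → (∀ {x} → x ∈ xs → p x ≡ false) → filterᵇ p xs ≡ []
filterᵇ-none p [] h = refl
filterᵇ-none p (x ∷ xs) h rewrite h (here refl) = filterᵇ-none p xs (h ∘ there)

members-↭ : ∀ {xs ys : Tuple} → Unique xs → Unique ys → (∀ {x} → x ∈ xs → x ∈ ys) → (∀ {x} → x ∈ ys → x ∈ xs) → xs ↭ ys
members-↭ {[]} {[]} u v f g = ↭-refl
members-↭ {[]} {y ∷ ys} u v f g with g (here refl)
... | ()
members-↭ {x ∷ xs} {ys} (h ∷ u) v f g with ∈-↭ (f (here refl))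
... | zs , p with Unique-resp-↭ p v
... | h′ ∷ v′ = ↭-trans (prep x (members-↭ u v′ f′ g′)) (↭-sym p)
  where
  f′ : ∀ {y} → y ∈ xs → y ∈ zs
  f′ m with Permₚ.∈-resp-↭ p (f (there m))
  ... | here refl = ⊥-elim (All.lookup h m refl)
  ... | there q = q
  g′ : ∀ {y} → y ∈ zs → y ∈ xs
  g′ m with g (Permₚ.∈-resp-↭ (↭-sym p) (there m))
  ... | here refl = ⊥-elim (All.lookup h′ m refl)
  ... | there q = q

⊆F-sym : ∀ ρ → Sym (ρ ⊆F_)
⊆F-sym ρ {xs} {ys} p = bool-ext (one p) (one (↭-sym p))
  where
  one : ∀ {xs ys} → xs ↭ ys → ρ ⊆F xs ≡ true → ρ ⊆F ys ≡ true
  one {xs} {ys} p h = all-intro _ ρ (λ {x} m → ∈⇒memb {x} {ys} (Permₚ.∈-resp-↭ p (memb⇒∈ {x} xs (all-true _ ρ h m))))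

outside : Tuple → Tuple → Tuple
outside ρ τ = filterᵇ (λ x → not (memb x ρ)) τ

outside-++ : ∀ ρ zs → Unique (ρ ++ zs) → outside ρ (ρ ++ zs) ≡ zs
outside-++ ρ zs u = trans (filterᵇ-++ _ ρ zs) (cong₂ _++_
  (filterᵇ-none _ ρ (λ m → cong not (∈⇒memb m)))
  (filterᵇ-all _ zs (λ m → all-true _ zs (Unique⇒avoids ρ u) m)))

allTuples : List ℕ → ℕ → List Tuple
allTuples V zero = [] ∷ []
allTuples V (suc r) = concatMap (λ x → map (x ∷_) (allTuples V r)) V

∈-allTuples : ∀ V ρ → All (_∈ V) ρ → ρ ∈ allTuples V (length ρ)
∈-allTuples V [] [] = here refl
∈-allTuples V (x ∷ ρ) (x∈ ∷ a) = ∈ₚ.∈-concat⁺′ (∈ₚ.∈-map⁺ (x ∷_) (∈-allTuples V ρ a)) (∈ₚ.∈-map⁺ (λ x → map (x ∷_) (allTuples V (length ρ))) x∈)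

allTuples⁻ : ∀ V r {ρ} → ρ ∈ allTuples V r → length ρ ≡ r × All (_∈ V) ρ
allTuples⁻ V zero (here refl) = refl , []
allTuples⁻ V (suc r) m with ∈ₚ.∈-concat⁻′ (map (λ x → map (x ∷_) (allTuples V r)) V) m
... | l , ρ∈ , l∈ with ∈ₚ.∈-map⁻ (λ x → map (x ∷_) (allTuples V r)) l∈
... | x , x∈ , refl with ∈ₚ.∈-map⁻ (x ∷_) ρ∈
... | ρ′ , m′ , refl with allTuples⁻ V r m′
... | a , b = cong suc a , x∈ ∷ b

length-concatMap : ∀ {A B : Set} (g : A → List B) c xs → (∀ x → length (g x) ≡ c) → length (concatMap g xs) ≡ length xs * c
length-concatMap g c [] h = refl
length-concatMap g c (x ∷ xs) h = trans (Listₚ.length-++ (g x)) (cong₂ _+_ (h x) (length-concatMap g c xs h))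

length-allTuples : ∀ V r → length (allTuples V r) ≡ length V ^ r
length-allTuples V zero = refl
length-allTuples V (suc r) = length-concatMap _ (length V ^ r) V (λ x → trans (Listₚ.length-map (x ∷_) (allTuples V r)) (length-allTuples V r))

length-subsetsOf : ∀ V m → length (subsetsOf V m) ≤ length V ^ m
length-subsetsOf V zero = ℕₚ.≤-refl
length-subsetsOf [] (suc m) = z≤n
length-subsetsOf (v ∷ V) (suc m) = begin
  length (map (v ∷_) (subsetsOf V m) ++ subsetsOf V (suc m))  ≡⟨ trans (Listₚ.length-++ (map (v ∷_) (subsetsOf V m))) (cong (_+ length (subsetsOf V (suc m))) (Listₚ.length-map (v ∷_) (subsetsOf V m))) ⟩
  length (subsetsOf V m) + length (subsetsOf V (suc m))       ≤⟨ ℕₚ.+-mono-≤ (length-subsetsOf V m) (length-subsetsOf V (suc m)) ⟩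
  N ^ m + N * N ^ m                                           ≤⟨ ℕₚ.*-monoʳ-≤ (suc N) (ℕₚ.^-monoˡ-≤ m (ℕₚ.n≤1+n N)) ⟩
  suc N * suc N ^ m ∎
  where
  open ℕₚ.≤-Reasoning
  N = length V

module Vertices (n : ℕ) where

  V : List ℕ
  V = upTo n

  V-sorted : Sorted V
  V-sorted = upTo-sorted n

  V-unique : Unique V
  V-unique = Sorted⇒Unique V-sorted

  length-V : length V ≡ n
  length-V = Listₚ.length-upTo n

  open Tuples V V-unique public

  canon : Tuple → Face
  canon xs = filterᵇ (λ v → memb v xs) V

  canon-cong : ∀ {xs ys} → (∀ {x} → x ∈ xs → x ∈ ys) → (∀ {x} → x ∈ ys → x ∈ xs) → canon xs ≡ canon ys
  canon-cong {xs} {ys} f g = sorted-ext (AllPairs-filterᵇ _ V-sorted) (AllPairs-filterᵇ _ V-sorted) (one f) (one g)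
    where
    one : ∀ {xs ys} → (∀ {x} → x ∈ xs → x ∈ ys) → ∀ {x} → x ∈ canon xs → x ∈ canon ys
    one {xs} {ys} f {x} m with ∈-filterᵇ⁻ (λ v → memb v xs) V m
    ... | a , b = ∈-filterᵇ⁺ _ V a (∈⇒memb {x} {ys} (f (memb⇒∈ {x} xs b)))

  canon-face : ∀ {σ k} → IsSubset V k σ → canon σ ≡ σ
  canon-face {σ} (isSubset s b _) = sorted-ext (AllPairs-filterᵇ _ V-sorted) s
    (λ m → memb⇒∈ σ (proj₂ (∈-filterᵇ⁻ (λ v → memb v σ) V m))) (λ m → ∈-filterᵇ⁺ _ V (b m) (∈⇒memb m))

  canon-↭ : ∀ {xs} → Unique xs → All (_∈ V) xs → canon xs ↭ xs
  canon-↭ {xs} u a = members-↭ (AllPairs-filterᵇ _ V-unique) u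
    (λ m → memb⇒∈ xs (proj₂ (∈-filterᵇ⁻ (λ v → memb v xs) V m))) (λ m → ∈-filterᵇ⁺ _ V (All.lookup a m) (∈⇒memb m))

  canon-subset : ∀ {xs} → Unique xs → All (_∈ V) xs → IsSubset V (length xs) (canon xs)
  canon-subset {xs} u a = isSubset (AllPairs-filterᵇ _ V-sorted) (λ m → proj₁ (∈-filterᵇ⁻ (λ v → memb v xs) V m)) (Permₚ.↭-length (canon-↭ u a))

  face⁻ : ∀ {k σ} → σ ∈ faces n k → IsSubset V k σ
  face⁻ {k} = ∈-subsetsOf⁻ k V-sorted

  canon∈ : ∀ {xs k} → length xs ≡ k → Unique xs → All (_∈ V) xs → canon xs ∈ faces n k
  canon∈ {k = k} refl u a = ∈-subsetsOf⁺ k V-sorted (canon-subset u a)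

  ext : (Face → Bool) → Tuple → Bool
  ext φ xs = distinctᵇ xs ∧ φ (canon xs)

  ext-sym : ∀ φ → Sym (ext φ)
  ext-sym φ p = cong₂ _∧_ (distinctᵇ-sym p) (cong φ (canon-cong (Permₚ.∈-resp-↭ p) (Permₚ.∈-resp-↭ (↭-sym p))))

  ext-distinct : ∀ φ → Distinct (ext φ)
  ext-distinct φ xs h = distinctᵇ⇒Unique xs (∧-trueˡ h)

  ext-face : ∀ φ {k σ} → σ ∈ faces n k → ext φ σ ≡ φ σ
  ext-face φ {k} {σ} m = cong₂ (λ a b → a ∧ φ b) (Unique⇒distinctᵇ (Sorted⇒Unique (IsSubset.sorted s))) (canon-face s)
    where
    s : IsSubset V k σ
    s = face⁻ m

  ext-restrict : ∀ {h} → Sym h → Distinct h → ∀ xs → All (_∈ V) xs → ext h xs ≡ h xs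
  ext-restrict {h} s d xs a = bool-ext
    (λ e → trans (s (↭-sym (canon-↭ (distinctᵇ⇒Unique xs (∧-trueˡ e)) a))) (∧-trueʳ {distinctᵇ xs} e))
    (λ e → ∧-intro (Unique⇒distinctᵇ (d xs e)) (trans (s (canon-↭ (d xs e) a)) e))

  -- Iteration of `T-contains`; multiplying by `M !` expresses the falling factorial without
  -- division.
  T-containsAll : ∀ M ρ {φ} → Sym φ → Null φ → Unique ρ → All (_∈ V) ρ →
    M ! * T# (length ρ + M) (λ τ → χ (ρ ⊆F τ) * φ τ) ≡ (length ρ + M) ! * T# M (λ zs → φ (ρ ++ zs))
  T-containsAll M [] {φ} s z u a = cong (M ! *_) (T-cong M (λ τ _ _ → ℕₚ.*-identityˡ (φ τ)))
  T-containsAll M (x ∷ ρ) {φ} s z u@(_ ∷ u′) (x∈ ∷ a) = begin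
    M ! * T# (suc (length ρ + M)) (λ τ → χ (memb x τ ∧ (ρ ⊆F τ)) * φ τ)
      ≡⟨ cong (M ! *_) (T-cong (suc (length ρ + M)) (λ τ _ _ → trans (cong (_* φ τ) (χ-∧ (memb x τ) (ρ ⊆F τ))) (ℕₚ.*-assoc (χ (memb x τ)) _ _))) ⟩
    M ! * T# (suc (length ρ + M)) (λ τ → χ (memb x τ) * (χ (ρ ⊆F τ) * φ τ))
      ≡⟨ cong (M ! *_) (T-contains (length ρ + M) (λ p → cong₂ (λ a b → χ a * b) (⊆F-sym ρ p) (s p)) (λ τ h → trans (cong (χ (ρ ⊆F τ) *_) (z τ h)) (ℕₚ.*-zeroʳ (χ (ρ ⊆F τ)))) x∈) ⟩
    M ! * (suc (length ρ + M) * T# (length ρ + M) (λ ys → χ (ρ ⊆F (x ∷ ys)) * φ (x ∷ ys)))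
      ≡⟨ cong (λ w → M ! * (suc (length ρ + M) * w)) (T-cong (length ρ + M) (λ ys _ _ → cong (λ b → χ b * φ (x ∷ ys)) (skip ys))) ⟩
    M ! * (suc (length ρ + M) * T# (length ρ + M) (λ ys → χ (ρ ⊆F ys) * φ (x ∷ ys)))
      ≡⟨ lem (M !) (suc (length ρ + M)) _ ⟩
    suc (length ρ + M) * (M ! * T# (length ρ + M) (λ ys → χ (ρ ⊆F ys) * φ (x ∷ ys)))
      ≡⟨ cong (suc (length ρ + M) *_) (T-containsAll M ρ (Sym-∷ {φ = φ} x s) (Null-∷ x z) u′ a) ⟩
    suc (length ρ + M) * ((length ρ + M) ! * T# M (λ zs → φ (x ∷ ρ ++ zs)))
      ≡⟨ sym (ℕₚ.*-assoc (suc (length ρ + M)) ((length ρ + M) !) _) ⟩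
    suc (length ρ + M) ! * T# M (λ zs → φ (x ∷ ρ ++ zs)) ∎
    where
    open ≡-Reasoning
    lem : ∀ a b c → a * (b * c) ≡ b * (a * c)
    lem = ℕSolver.solve-∀
    skip : ∀ ys → ρ ⊆F (x ∷ ys) ≡ ρ ⊆F ys
    skip ys = bool-ext
      (λ h → all-intro _ ρ (λ {y} m → drop-x m (memb⇒∈ (x ∷ ys) (all-true _ ρ h m))))
      (λ h → all-intro _ ρ (λ {y} m → ∈⇒memb {y} {x ∷ ys} (there (memb⇒∈ ys (all-true _ ρ h m)))))
      where
      drop-x : ∀ {y} → y ∈ ρ → y ∈ x ∷ ys → memb y ys ≡ true
      drop-x m (here refl) = ⊥-elim (Unique-head u m)
      drop-x m (there q) = ∈⇒memb q

  over : Tuple → (Tuple → Bool) → Face → Bool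
  over ρ ψ τ = (ρ ⊆F τ) ∧ ψ (outside ρ τ)

  -- The dictionary between sets of faces and sums over tuples in a link: a face over ρ corresponds
  -- to the `M !` orderings of its vertices outside ρ. The factor `d !` brought in by `T-subsets` is
  -- cancelled at the end.
  count-over : ∀ (Y : Face → Bool) d M ρ {ψ} → Sym ψ → length ρ + M ≡ d → Unique ρ → All (_∈ V) ρ →
    M ! * sumL (faces n d) (λ τ → χ (Y τ ∧ over ρ ψ τ)) ≡ T# M (λ zs → χ (ext Y (ρ ++ zs) ∧ ψ zs))
  count-over Y d M ρ {ψ} ψs refl u a = ℕₚ.*-cancelˡ-≡ _ _ (d !) {{ℕₚ.m*n≢0⇒m≢0 (d !) {{d!*1}}}} (begin
    d ! * (M ! * sumL (faces n d) (λ τ → χ (Y τ ∧ over ρ ψ τ)))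
      ≡⟨ lem (d !) (M !) _ ⟩
    M ! * (d ! * sumL (faces n d) (λ τ → χ (Y τ ∧ over ρ ψ τ)))
      ≡⟨ cong (λ w → M ! * (d ! * w)) (sumL-cong (faces n d) (λ τ m → sym (trans (sym (χ-∧ (ρ ⊆F τ) _)) (cong χ (rearrange τ m))))) ⟩
    M ! * (d ! * sumL (subsetsOf V d) (λ τ → χ (ρ ⊆F τ) * φ τ))
      ≡⟨ cong (M ! *_) (sym (T-subsets d (λ p → cong₂ (λ a b → χ a * b) (⊆F-sym ρ p) (φ-sym p)) (λ τ h → trans (cong (χ (ρ ⊆F τ) *_) (φ-null τ h)) (ℕₚ.*-zeroʳ (χ (ρ ⊆F τ)))))) ⟩
    M ! * T# d (λ τ → χ (ρ ⊆F τ) * φ τ)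
      ≡⟨ T-containsAll M ρ φ-sym φ-null u a ⟩
    d ! * T# M (λ zs → φ (ρ ++ zs))
      ≡⟨ cong (d ! *_) (T-cong M (λ zs _ _ → cong χ (strip zs))) ⟩
    d ! * T# M (λ zs → χ (ext Y (ρ ++ zs) ∧ ψ zs)) ∎)
    where
    open ≡-Reasoning
    d!*1 : NonZero (d ! * 1)
    d!*1 = subst NonZero (sym (ℕₚ.*-identityʳ (d !))) (ℕₚ._!≢0 d)
    lem : ∀ a b c → a * (b * c) ≡ b * (a * c)
    lem = ℕSolver.solve-∀
    φ : Tuple → ℕ
    φ τ = χ (ext Y τ ∧ ψ (outside ρ τ))
    φ-sym : Sym φ
    φ-sym p = cong χ (cong₂ _∧_ (ext-sym Y p) (ψs (filterᵇ-↭ _ p)))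
    φ-null : Null φ
    φ-null τ h = cong χ (≢true (λ e → h (ext-distinct Y τ (∧-trueˡ e))))
    rearrange : ∀ τ → τ ∈ faces n d → (ρ ⊆F τ) ∧ (ext Y τ ∧ ψ (outside ρ τ)) ≡ Y τ ∧ over ρ ψ τ
    rearrange τ m = trans (cong (λ b → (ρ ⊆F τ) ∧ (b ∧ ψ (outside ρ τ))) (ext-face Y {d} m)) (swap∧ (ρ ⊆F τ) (Y τ) _)
      where
      swap∧ : ∀ a b c → a ∧ (b ∧ c) ≡ b ∧ (a ∧ c)
      swap∧ true b c = refl
      swap∧ false b c = sym (Boolₚ.∧-zeroʳ b)
    strip : ∀ zs → ext Y (ρ ++ zs) ∧ ψ (outside ρ (ρ ++ zs)) ≡ ext Y (ρ ++ zs) ∧ ψ zs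
    strip zs with true-or-false (ext Y (ρ ++ zs))
    ... | inj₂ e rewrite e = refl
    ... | inj₁ e = cong (λ w → ext Y (ρ ++ zs) ∧ ψ w) (outside-++ ρ zs (ext-distinct Y (ρ ++ zs) e))

inList : List Face → Face → Bool
inList X σ = any (eqFace σ) X

common-count : ∀ (D : List Face) S (E : Face → Bool) → Unique D → length S ≡ length D →
  sumL D (λ τ → χ (inList (select D S) τ ∧ E τ)) ≡ common S (map E D)
common-count [] [] E u l = refl
common-count (τ ∷ D) (true ∷ S) E (h ∷ u) l = trans
  (cong₂ _+_ (cong (λ b → χ ((b ∨ inList (select D S) τ) ∧ E τ)) (eqFace-refl τ))
    (trans (sumL-cong D (λ σ m → cong (λ b → χ ((b ∨ inList (select D S) σ) ∧ E σ)) (≢⇒eqFace {σ} {τ} (λ e → All.lookup h m (sym e))))) (common-count D S E u (ℕₚ.suc-injective l))))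
  (step (E τ))
  where
  step : ∀ b → χ b + common S (map E D) ≡ common (true ∷ S) (b ∷ map E D)
  step true = refl
  step false = refl
common-count (τ ∷ D) (false ∷ S) E (h ∷ u) l = trans
  (cong (_+ sumL D (λ σ → χ (inList (select D S) σ ∧ E σ))) (cong (λ b → χ (b ∧ E τ)) (≢true λ e → case any-true (eqFace τ) (select D S) e of λ
    { (σ , m , q) → All.lookup h (select-⊆ D S m) (eqFace⇒≡ τ σ q) })))
  (trans (common-count D S E u (ℕₚ.suc-injective l)) (step (E τ)))
  where
  step : ∀ b → common S (map E D) ≡ common (false ∷ S) (b ∷ map E D)
  step true = refl
  step false = refl

trues-count : ∀ {A : Set} (D : List A) (E : A → Bool) → sumL D (χ ∘ E) ≡ trues (map E D)
trues-count [] E = refl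
trues-count (τ ∷ D) E with E τ
... | true = cong suc (trues-count D E)
... | false = trues-count D E

-- The coboundary operator and the norms in terms of tuples

frac-mono : ∀ a b {q r} → 0 < q → 0 < r → a * r ≤ b * q → ℕ→ℚ a *ℚ inv q ≤ℚ ℕ→ℚ b *ℚ inv r
frac-mono a b {q} {r} hq hr le = *inv-≤ q hq (≤-trans′ (≤-*inv r hr (subst₂ _≤ℚ_ (trans (ℕ→ℚ-* a r) (ℚₚ.*-comm (ℕ→ℚ a) (ℕ→ℚ r))) (ℕ→ℚ-* b q) (ℕ→ℚ-mono le)))
    (ℚₚ.≤-reflexive (lem (ℕ→ℚ b) (ℕ→ℚ q) (inv r))))
  where
  ≤-trans′ : ∀ {x y z} → x ≤ℚ y → y ≤ℚ z → x ≤ℚ z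
  ≤-trans′ = ℚₚ.≤-trans
  lem : ∀ b q i → b *ℚ q *ℚ i ≡ q *ℚ (b *ℚ i)
  lem = solve-∀ ℚring

inv-pos : ∀ n → 0 < n → 0ℚ <ℚ inv n
inv-pos n h = ℚₚ.≰⇒> λ i≤0 → 1≢0 (trans (sym (inv-* n h)) (trans (cong (_*ℚ ℕ→ℚ n) (ℚₚ.≤-antisym i≤0 (inv-nonneg n h))) (ℚₚ.*-zeroˡ (ℕ→ℚ n))))
  where
  1≢0 : 1ℚ ≢ 0ℚ
  1≢0 ()

safeDiv-≥ : ∀ {β x y} → 0ℚ <ℚ y → β *ℚ y ≤ℚ x → β ≤ℚ safeDiv x y
safeDiv-≥ {β} {x} {y} h le = ℚₚ.*-cancelʳ-≤-pos y {{ℚ.positive h}} (subst (β *ℚ y ≤ℚ_) (sym (safeDiv-* x (λ e → ℚₚ.<-irrefl (sym e) h))) le)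

-- Besides the upper bound `a / q`, an exact value `a₁ / q` of `y` is required: it shows that `y` is
-- positive, whereas `safeDiv` by zero would return zero.
quotient-≥ : ∀ x y a a′ q r c → 0 < c → 0 < q → 0 < r → y ≤ℚ ℕ→ℚ a *ℚ inv q → x ≡ ℕ→ℚ a′ *ℚ inv r → a * r ≤ c * a′ * q →
  ∀ a₁ → 0 < a₁ → y ≡ ℕ→ℚ a₁ *ℚ inv q → inv c ≤ℚ safeDiv x y
quotient-≥ x y a a′ q r c 0<c 0<q 0<r le ex cross a₁ 0<a₁ ey = safeDiv-≥ {inv c} {x} {y} positive (begin
  inv c *ℚ y                                    ≤⟨ mulˡ (inv c) (inv-nonneg c 0<c) le ⟩
  inv c *ℚ (ℕ→ℚ a *ℚ inv q)                     ≡⟨ ℚₚ.*-comm (inv c) (ℕ→ℚ a *ℚ inv q) ⟩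
  ℕ→ℚ a *ℚ inv q *ℚ inv c                       ≤⟨ *inv-≤ c 0<c (ℚₚ.≤-trans (frac-mono a (c * a′) 0<q 0<r cross)
                                                     (ℚₚ.≤-reflexive (trans (cong (_*ℚ inv r) (ℕ→ℚ-* c a′)) (ℚₚ.*-assoc (ℕ→ℚ c) (ℕ→ℚ a′) (inv r))))) ⟩
  ℕ→ℚ a′ *ℚ inv r                               ≡⟨ sym ex ⟩
  x ∎)
  where
  open ℚₚ.≤-Reasoning
  positive : 0ℚ <ℚ y
  positive = subst₂ _<ℚ_ (ℚₚ.*-zeroˡ (inv q)) (sym ey) (ℚₚ.*-monoˡ-<-pos (inv q) {{ℚ.positive (inv-pos q 0<q)}} (ℕ→ℚ-pos a₁ 0<a₁))

binomial-pos : ∀ n k → k ≤ n → 0 < n C k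
binomial-pos n zero h = ℕₚ.≤-reflexive (sym (trans (nCk≡nC[n∸k] h) (nCn≡1 n)))
binomial-pos (suc n) (suc k) (s≤s h) = ℕₚ.≤-trans (binomial-pos n k h) (ℕₚ.≤-trans (ℕₚ.m≤m+n (n C k) (n C suc k)) (ℕₚ.≤-reflexive (nCk+nC[k+1]≡[n+1]C[k+1] n k)))

foldr-⊓-≤ : ∀ x xs {y} → y ∈ x ∷ xs → foldr ℚ._⊓_ x xs ≤ℚ y
foldr-⊓-≤ x [] (here refl) = ℚₚ.≤-refl
foldr-⊓-≤ x (z ∷ xs) (here refl) = ℚₚ.≤-trans (ℚₚ.p⊓q≤q z _) (foldr-⊓-≤ x xs (here refl))
foldr-⊓-≤ x (z ∷ xs) (there (here refl)) = ℚₚ.p⊓q≤p z _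
foldr-⊓-≤ x (z ∷ xs) (there (there m)) = ℚₚ.≤-trans (ℚₚ.p⊓q≤q z _) (foldr-⊓-≤ x xs (there m))

foldr-⊓-∈ : ∀ x xs → foldr ℚ._⊓_ x xs ∈ x ∷ xs
foldr-⊓-∈ x [] = here refl
foldr-⊓-∈ x (z ∷ xs) with ℚₚ.⊓-sel z (foldr ℚ._⊓_ x xs)
... | inj₁ e = there (here e)
... | inj₂ e with foldr-⊓-∈ x xs
... | here q = here (trans e q)
... | there q = there (there (subst (_∈ xs) (sym e) q))

minList : List ℚ → ℚ
minList [] = 0ℚ
minList (x ∷ xs) = foldr ℚ._⊓_ x xs

minList-≤ : ∀ xs {y} → y ∈ xs → minList xs ≤ℚ y
minList-≤ (x ∷ xs) m = foldr-⊓-≤ x xs m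

minList-∈ : ∀ xs {y} → y ∈ xs → minList xs ∈ xs
minList-∈ (x ∷ xs) m = foldr-⊓-∈ x xs

minMaybe-≥ : ∀ β xs → (∀ x → x ∈ xs → β ≤ℚ x) → ∀ h → minMaybe xs ≡ just h → β ≤ℚ h
minMaybe-≥ β (x ∷ xs) a h e with minMaybe xs | minMaybe-≥ β xs (λ y m → a y (there m))
minMaybe-≥ β (x ∷ xs) a h refl | nothing | ih = a x (here refl)
minMaybe-≥ β (x ∷ xs) a h refl | just y | ih = ℚₚ.⊓-glb (a x (here refl)) (ih y refl)

facets-∷ : ∀ x xs → facets (x ∷ xs) ≡ xs ∷ map (x ∷_) (facets xs)
facets-∷ x xs = cong (xs ∷_) (trans (sym (Listₚ.map-∘ (facetsIx xs))) (Listₚ.map-∘ (facetsIx xs)))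

xor-facets : ∀ φ σ → foldr _xor_ false (map φ (facets σ)) ≡ dl φ σ
xor-facets φ [] = refl
xor-facets φ (x ∷ xs) = trans (cong (λ l → foldr _xor_ false (map φ l)) (facets-∷ x xs))
  (cong (φ xs xor_) (trans (cong (foldr _xor_ false) (sym (Listₚ.map-∘ (facets xs)))) (xor-facets (λ ys → φ (x ∷ ys)) xs)))

facets⇒Facet : ∀ σ {ρ} → ρ ∈ facets σ → Facet ρ σ
facets⇒Facet (x ∷ xs) {ρ₀} m with subst (ρ₀ ∈_) (facets-∷ x xs) m
... | here refl = drop
... | there q with ∈ₚ.∈-map⁻ (x ∷_) q
... | ρ , r , refl = keep (facets⇒Facet xs r)

facet-sorted : ∀ {ρ σ} → Facet ρ σ → Sorted σ → Sorted ρ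
facet-sorted drop (_ ∷ s) = s
facet-sorted (keep f) (h ∷ s) = All.tabulate (λ m → All.lookup h (facet-⊆ f m)) ∷ facet-sorted f s

eqBools-refl : ∀ as → eqBools as as ≡ true
eqBools-refl [] = refl
eqBools-refl (true ∷ as) = eqBools-refl as
eqBools-refl (false ∷ as) = eqBools-refl as

module _ (V : Set) where

  map-injective-on : ∀ (F : List V) (φ ψ : V → Bool) → (∀ σ → σ ∈ F → φ σ ≡ ψ σ) → map φ F ≡ map ψ F
  map-injective-on [] φ ψ h = refl
  map-injective-on (σ ∷ F) φ ψ h = cong₂ _∷_ (h σ (here refl)) (map-injective-on F φ ψ (λ τ m → h τ (there m)))

𝔥-not-below : ∀ n d X β → (∀ h → Coboundary.𝔥 n d X ≡ just h → β ≤ℚ h) → 𝔥<ᵇ n d X β ≡ false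
𝔥-not-below n d X β hyp with Coboundary.𝔥 n d X | hyp
... | nothing | _ = refl
... | just h | k = cong not (T⇒≡ (ℚₚ.≤⇒≤ᵇ (k h refl)))

shiftedNorm : ∀ n d (X : List Face) → ℕ → List Bool → List Bool → ℚ
shiftedNorm n d X j f g = Coboundary.norm n d X (suc j) (zipWith _xor_ f (Coboundary.δ n d X j g))

-- Abstracting the whole list keeps the rational arithmetic out of the type of the auxiliary function.
cosetNorm≡minList : ∀ n d X j f → Coboundary.cosetNorm n d X j f ≡ minList (map (shiftedNorm n d X j f) (Coboundary.allCochains n d X j))
cosetNorm≡minList n d X j f with map (shiftedNorm n d X j f) (Coboundary.allCochains n d X j)
... | [] = refl
... | x ∷ xs = refl

module Complex (n d : ℕ) (S : List Bool) (lS : length S ≡ length (dFaces n d)) where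

  open Vertices n public

  X : List Face
  X = select (dFaces n d) S

  open Coboundary n d X public

  D-unique : Unique (dFaces n d)
  D-unique = subsetsOf-unique (suc d) V-sorted

  X̂ : Tuple → Bool
  X̂ = ext (inList X)

  cxFaces-low : ∀ {s} → s ≤ d → cxFaces s ≡ faces n s
  cxFaces-low {s} h = cong (λ b → if b then X else faces n s) (≢⇒≡ᵇ (λ e → ℕₚ.<⇒≱ (s≤s h) (ℕₚ.≤-reflexive (sym e))))

  cxFaces-top : cxFaces (suc d) ≡ X
  cxFaces-top = cong (λ b → if b then X else faces n (suc d)) (≡ᵇ-refl d)

  cxFaces-⊆ : ∀ {s σ} → s ≤ suc d → σ ∈ cxFaces s → σ ∈ faces n s
  cxFaces-⊆ {s} {σ} h m with ℕₚ.m≤n⇒m<n∨m≡n h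
  ... | inj₁ l = subst (σ ∈_) (cxFaces-low (ℕₚ.≤-pred l)) m
  ... | inj₂ refl = select-⊆ (dFaces n d) S (subst (σ ∈_) cxFaces-top m)

  degX : Face → ℕ
  degX σ = length (filterᵇ (λ τ → σ ⊆F τ) X)

  -- The norm multiplied by its denominator `Q s`, so that norms are compared as natural numbers.
  A : ℕ → (Tuple → Bool) → ℕ
  A s h = sumL (cxFaces s) (λ σ → χ (h σ) * degX σ)

  valueAt-map : ∀ F (φ : Face → Bool) {σ} → σ ∈ F → valueAt F (map φ F) σ ≡ φ σ
  valueAt-map (τ ∷ F) φ {σ} m with eqFace τ σ in e
  ... | true = cong φ (eqFace⇒≡ τ σ e)
  valueAt-map (τ ∷ F) φ {σ} (here refl) | false = case trans (sym e) (eqFace-refl τ) of λ ()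
  valueAt-map (τ ∷ F) φ {σ} (there m) | false = valueAt-map F φ m

  map-valueAt : ∀ F f → Unique F → length f ≡ length F → map (valueAt F f) F ≡ f
  map-valueAt [] [] u l = refl
  map-valueAt (τ ∷ F) (b ∷ f) (h ∷ u) l = cong₂ _∷_ (cong (λ c → if c then b else valueAt F f τ) (eqFace-refl τ))
    (trans (map-injective-on Face F _ _ (λ σ m → cong (λ c → if c then b else valueAt F f σ) (≢⇒eqFace {τ} {σ} (All.lookup h m))))
      (map-valueAt F f u (ℕₚ.suc-injective l)))

  hat : ℕ → Cochain → Tuple → Bool
  hat s f = ext (valueAt (faces n s) f)

  lst : ℕ → (Tuple → Bool) → Cochain
  lst s h = map h (cxFaces s)

  lst-hat : ∀ {s f} → s ≤ d → f ∈ allCochains s → lst s (hat s f) ≡ f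
  lst-hat {s} {f} h m = trans (cong (map (hat s f)) (cxFaces-low h)) (trans
    (map-injective-on Face (faces n s) _ _ (λ σ m′ → ext-face (valueAt (faces n s) f) {s} m′))
    (map-valueAt (faces n s) f (subsetsOf-unique s V-sorted) (trans (∈-allBools⁻ _ m) (cong length (cxFaces-low h)))))

  lst∈ : ∀ s h → lst s h ∈ allCochains s
  lst∈ s h = ∈-allBools⁺ (lst s h) (Listₚ.length-map h (cxFaces s))

  facet-face : ∀ {s ρ σ} → σ ∈ faces n (suc s) → Facet ρ σ → ρ ∈ faces n s
  facet-face {s} m f with face⁻ {suc s} m
  ... | isSubset so b l = ∈-subsetsOf⁺ s V-sorted (isSubset (facet-sorted f so) (b ∘ facet-⊆ f) (ℕₚ.suc-injective (trans (sym (Facet-length f)) l)))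

  δ-lst : ∀ {s h} → s ≤ d → δ s (lst s h) ≡ lst (suc s) (dl h)
  δ-lst {s} {h} le = map-injective-on Face (cxFaces (suc s)) _ _ (λ σ m → trans
    (cong (foldr _xor_ false) (map-injective-on Face (facets σ) _ h (λ ρ r →
      trans (cong (λ F → valueAt F (map h F) ρ) (cxFaces-low le)) (valueAt-map (faces n s) h (facet-face (cxFaces-⊆ (s≤s le) m) (facets⇒Facet σ r))))))
    (xor-facets h σ))

  zipWith-lst : ∀ s h h′ → zipWith _xor_ (lst s h) (lst s h′) ≡ lst s (λ σ → h σ xor h′ σ)
  zipWith-lst s h h′ = go (cxFaces s)
    where
    go : ∀ F → zipWith _xor_ (map h F) (map h′ F) ≡ map (λ σ → h σ xor h′ σ) F
    go [] = refl
    go (σ ∷ F) = cong (_ ∷_) (go F)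

  Q : ℕ → ℕ
  Q s = (suc d C s) * length X

  norm-lst : ∀ s h → 0 < Q s → norm s (lst s h) ≡ ℕ→ℚ (A s h) *ℚ inv (Q s)
  norm-lst s h q = go (cxFaces s)
    where
    term : Face → Bool → ℚ
    term σ b = if b then weight s σ else 0ℚ
    each : ∀ σ b → term σ b ≡ ℕ→ℚ (χ b * degX σ) *ℚ inv (Q s)
    each σ false = sym (ℚₚ.*-zeroˡ (inv (Q s)))
    each σ true = trans (safeDiv-inv (ℕ→ℚ (degX σ)) (Q s) q) (cong (λ z → ℕ→ℚ z *ℚ inv (Q s)) (sym (ℕₚ.*-identityˡ (degX σ))))
    go : ∀ F → Σℚ (zipWith term F (map h F)) ≡ ℕ→ℚ (sumL F (λ σ → χ (h σ) * degX σ)) *ℚ inv (Q s)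
    go [] = sym (ℚₚ.*-zeroˡ (inv (Q s)))
    go (σ ∷ F) = trans (cong₂ _+ℚ_ (each σ (h σ)) (go F)) (trans (sym (ℚₚ.*-distribʳ-+ (inv (Q s)) (ℕ→ℚ (χ (h σ) * degX σ)) _))
      (cong (_*ℚ inv (Q s)) (sym (ℕ→ℚ-+ (χ (h σ) * degX σ) _))))

  cosetNorm-≤ : ∀ j f g → g ∈ allCochains j → cosetNorm j f ≤ℚ shiftedNorm n d X j f g
  cosetNorm-≤ j f g m = subst (_≤ℚ shiftedNorm n d X j f g) (sym (cosetNorm≡minList n d X j f)) (minList-≤ _ (∈ₚ.∈-map⁺ (shiftedNorm n d X j f) m))

  cosetNorm-attained : ∀ j f → ∃[ g ] g ∈ allCochains j × cosetNorm j f ≡ shiftedNorm n d X j f g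
  cosetNorm-attained j f = proj₁ r , proj₁ (proj₂ r) , trans (cosetNorm≡minList n d X j f) (proj₂ (proj₂ r))
    where
    r : ∃[ g ] g ∈ allCochains j × minList (map (shiftedNorm n d X j f) (allCochains j)) ≡ shiftedNorm n d X j f g
    r = ∈ₚ.∈-map⁻ (shiftedNorm n d X j f) (minList-∈ _ (∈ₚ.∈-map⁺ (shiftedNorm n d X j f) (lst∈ j (λ _ → false))))


module ComplexExpansion (n d : ℕ) (S : List Bool) (lS : length S ≡ length (dFaces n d)) where

  open Complex n d S lS public

  module Expansion (Cβ Bm : ℕ) (0<Cβ : 0 < Cβ) (0<X : 0 < length X) (Bm-≥ : ∀ s → s ≤ suc d → suc d C s ≤ Bm) (0<Bm : 0 < Bm)
    (deg-pos : ∀ s σ → s ≤ d → σ ∈ faces n s → 0 < degX σ)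
    (expand : ∀ j → j < d → ∀ h → Sym h → Distinct h → ∃[ g ] A (suc j) (λ σ → h σ xor dl g σ) ≤ Cβ * A (suc (suc j)) (dl h)) where

    β : ℚ
    β = inv (Cβ * Bm)

    0<CB : 0 < Cβ * Bm
    0<CB = ℕₚ.*-mono-≤ 0<Cβ 0<Bm

    Q-pos : ∀ s → s ≤ suc d → 0 < Q s
    Q-pos s h = ℕₚ.*-mono-≤ (binomial-pos (suc d) s h) 0<X

    module _ (j : ℕ) (j<d : j < d) (f : Cochain) (m : f ∈ allCochains (suc j)) (nB : inB j f ≡ false) where

      private
        h : Tuple → Bool
        h = hat (suc j) f

        f≡ : lst (suc j) h ≡ f
        f≡ = lst-hat j<d m

        ex : ∃[ g ] A (suc j) (λ σ → h σ xor dl g σ) ≤ Cβ * A (suc (suc j)) (dl h)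
        ex = expand j j<d h (ext-sym (valueAt (faces n (suc j)) f)) (ext-distinct (valueAt (faces n (suc j)) f))

        shift≡ : ∀ g → zipWith _xor_ f (δ j (lst j g)) ≡ lst (suc j) (λ σ → h σ xor dl g σ)
        shift≡ g = trans (cong₂ (zipWith _xor_) (sym f≡) (δ-lst (ℕₚ.<⇒≤ j<d))) (zipWith-lst (suc j) h (dl g))

        q₁ : 0 < Q (suc j)
        q₁ = Q-pos (suc j) (ℕₚ.m≤n⇒m≤1+n j<d)

        q₂ : 0 < Q (suc (suc j))
        q₂ = Q-pos (suc (suc j)) (s≤s j<d)

        shiftedNorm≡ : ∀ g → shiftedNorm n d X j f (lst j g) ≡ ℕ→ℚ (A (suc j) (λ σ → h σ xor dl g σ)) *ℚ inv (Q (suc j))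
        shiftedNorm≡ g = trans (cong (norm (suc j)) (shift≡ g)) (norm-lst (suc j) (λ σ → h σ xor dl g σ) q₁)

        small : cosetNorm j f ≤ℚ ℕ→ℚ (A (suc j) (λ σ → h σ xor dl (proj₁ ex) σ)) *ℚ inv (Q (suc j))
        small = subst (cosetNorm j f ≤ℚ_) (shiftedNorm≡ (proj₁ ex)) (cosetNorm-≤ j f (lst j (proj₁ ex)) (lst∈ j (proj₁ ex)))

        δ-norm : norm (suc (suc j)) (δ (suc j) f) ≡ ℕ→ℚ (A (suc (suc j)) (dl h)) *ℚ inv (Q (suc (suc j)))
        δ-norm = trans (cong (norm (suc (suc j))) (trans (cong (δ (suc j)) (sym f≡)) (δ-lst j<d))) (norm-lst (suc (suc j)) (dl h) q₂)

        -- The norms in consecutive dimensions differ in the binomial coefficient of their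
        -- denominators; `Bm` bounds the ratio.
        cross : A (suc j) (λ σ → h σ xor dl (proj₁ ex) σ) * Q (suc (suc j)) ≤ Cβ * Bm * A (suc (suc j)) (dl h) * Q (suc j)
        cross = begin
          A (suc j) (λ σ → h σ xor dl (proj₁ ex) σ) * ((suc d C suc (suc j)) * length X)
            ≤⟨ ℕₚ.*-mono-≤ (proj₂ ex) (ℕₚ.*-monoˡ-≤ (length X) (Bm-≥ (suc (suc j)) (s≤s j<d))) ⟩
          Cβ * A (suc (suc j)) (dl h) * (Bm * length X)
            ≡⟨ lem Cβ (A (suc (suc j)) (dl h)) Bm (length X) ⟩
          Cβ * Bm * A (suc (suc j)) (dl h) * (1 * length X)
            ≤⟨ ℕₚ.*-monoʳ-≤ (Cβ * Bm * A (suc (suc j)) (dl h)) (ℕₚ.*-monoˡ-≤ (length X) (binomial-pos (suc d) (suc j) (ℕₚ.m≤n⇒m≤1+n j<d))) ⟩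
          Cβ * Bm * A (suc (suc j)) (dl h) * ((suc d C suc j) * length X) ∎
          where
          open ℕₚ.≤-Reasoning
          lem : ∀ c a b x → c * a * (b * x) ≡ c * b * a * (1 * x)
          lem = ℕSolver.solve-∀

        -- All degrees are positive, so a representative of weight zero would vanish on every face,
        -- and `f` would be a coboundary.
        A-pos : ∀ g₁ → g₁ ∈ allCochains j → 0 < A (suc j) (λ σ → h σ xor dl (hat j g₁) σ)
        A-pos g₁ m₁ = decide (true-or-false (any h₁ (faces n (suc j))))
          where
          h₁ : Tuple → Bool
          h₁ σ = h σ xor dl (hat j g₁) σ
          true≢false : true ≢ false
          true≢false ()
          xor-false : ∀ {a b} → a xor b ≡ false → b ≡ a
          xor-false {true} {true} _ = refl
          xor-false {false} {false} _ = refl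
          some : (∃[ σ ] σ ∈ faces n (suc j) × h₁ σ ≡ true) → 0 < A (suc j) h₁
          some (σ , σ∈ , q) = ℕₚ.≤-trans (ℕₚ.≤-trans (deg-pos (suc j) σ j<d σ∈) (ℕₚ.≤-reflexive (trans (sym (ℕₚ.*-identityˡ (degX σ))) (cong (λ b → χ b * degX σ) (sym q)))))
            (sumL-member (λ σ → χ (h₁ σ) * degX σ) (subst (σ ∈_) (sym (cxFaces-low j<d)) σ∈))
          decide : (any h₁ (faces n (suc j)) ≡ true) ⊎ (any h₁ (faces n (suc j)) ≡ false) → 0 < A (suc j) h₁
          decide (inj₁ y) = some (any-true h₁ (faces n (suc j)) y)
          decide (inj₂ nil) = ⊥-elim (true≢false (trans (sym (any-intro (λ g → eqBools (δ j g) f) m₁ (trans (cong (λ z → eqBools z f) eqf) (eqBools-refl f)))) nB))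
            where
            eqf : δ j g₁ ≡ f
            eqf = trans (cong (δ j) (sym (lst-hat (ℕₚ.<⇒≤ j<d) m₁))) (trans (δ-lst (ℕₚ.<⇒≤ j<d)) (trans (cong (map (dl (hat j g₁))) (cxFaces-low j<d)) (trans
              (map-injective-on Face (faces n (suc j)) (dl (hat j g₁)) h (λ σ σ∈ → xor-false {h σ} (≢true (λ t → true≢false (trans (sym (any-intro h₁ σ∈ t)) nil)))))
              (trans (cong (map h) (sym (cxFaces-low j<d))) f≡))))

        value : (∃[ g ] g ∈ allCochains j × cosetNorm j f ≡ shiftedNorm n d X j f g) → ∃[ a ] 0 < a × cosetNorm j f ≡ ℕ→ℚ a *ℚ inv (Q (suc j))
        value (g₁ , m₁ , e) = A (suc j) (λ σ → h σ xor dl (hat j g₁) σ) , A-pos g₁ m₁ ,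
          trans e (trans (cong (shiftedNorm n d X j f) (sym (lst-hat (ℕₚ.<⇒≤ j<d) m₁))) (shiftedNorm≡ (hat j g₁)))

        attained : ∃[ a ] 0 < a × cosetNorm j f ≡ ℕ→ℚ a *ℚ inv (Q (suc j))
        attained = value (cosetNorm-attained j f)

        conclude : (∃[ a ] 0 < a × cosetNorm j f ≡ ℕ→ℚ a *ℚ inv (Q (suc j))) → β ≤ℚ safeDiv (norm (suc (suc j)) (δ (suc j) f)) (cosetNorm j f)
        conclude (a , 0<a , e) = quotient-≥ (norm (suc (suc j)) (δ (suc j) f)) (cosetNorm j f) (A (suc j) (λ σ → h σ xor dl (proj₁ ex) σ))
          (A (suc (suc j)) (dl h)) (Q (suc j)) (Q (suc (suc j))) (Cβ * Bm) 0<CB q₁ q₂ small δ-norm cross a 0<a e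

      ratio-≥ : β ≤ℚ safeDiv (norm (suc (suc j)) (δ (suc j) f)) (cosetNorm j f)
      ratio-≥ = conclude attained

    private
      quotient : ℕ → Cochain → ℚ
      quotient j f = safeDiv (norm (suc (suc j)) (δ (suc j) f)) (cosetNorm j f)

      flip : ∀ {b} → not b ≡ true → b ≡ false
      flip {false} _ = refl

      outsideB : ℕ → Cochain → Bool
      outsideB j f = not (inB j f)

      from-cochain : ∀ x j → j < d → (∃[ f ] f ∈ filterᵇ (outsideB j) (allCochains (suc j)) × x ≡ quotient j f) → β ≤ℚ x
      from-cochain x j j<d (f , f∈ , x≡) = subst (β ≤ℚ_) (sym x≡) (ratio-≥ j j<d f (proj₁ both) (flip (proj₂ both)))
        where
        both : f ∈ allCochains (suc j) × outsideB j f ≡ true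
        both = ∈-filterᵇ⁻ (outsideB j) (allCochains (suc j)) f∈

      from-level : ∀ x l → x ∈ l → (∃[ j ] j ∈ upTo d × l ≡ ratios j) → β ≤ℚ x
      from-level x l x∈ (j , j∈ , l≡) = from-cochain x j (∈ₚ.∈-upTo⁻ j∈) (∈ₚ.∈-map⁻ (quotient j) (subst (x ∈_) l≡ x∈))

      each : ∀ x → x ∈ concatMap ratios (upTo d) → β ≤ℚ x
      each x m = from-level x (proj₁ r) (proj₁ (proj₂ r)) (∈ₚ.∈-map⁻ ratios (proj₂ (proj₂ r)))
        where
        r : ∃[ l ] x ∈ l × l ∈ map ratios (upTo d)
        r = ∈ₚ.∈-concat⁻′ (map ratios (upTo d)) m

    not-below : 𝔥<ᵇ n d X β ≡ false
    not-below = 𝔥-not-below n d X β (minMaybe-≥ β (concatMap ratios (upTo d)) each)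

-- Coboundary expansion of a quasirandom complex

length-filterᵇ : ∀ {A : Set} (p : A → Bool) xs → length (filterᵇ p xs) ≡ sumL xs (χ ∘ p)
length-filterᵇ p [] = refl
length-filterᵇ p (x ∷ xs) with p x
... | true = cong suc (length-filterᵇ p xs)
... | false = length-filterᵇ p xs

length-filterᵇ-≤ : ∀ {A : Set} (p : A → Bool) xs → length (filterᵇ p xs) ≤ length xs
length-filterᵇ-≤ p [] = z≤n
length-filterᵇ-≤ p (x ∷ xs) with p x
... | true = s≤s (length-filterᵇ-≤ p xs)
... | false = ℕₚ.m≤n⇒m≤1+n (length-filterᵇ-≤ p xs)

sumL-select : ∀ {A : Set} (D : List A) S (E : A → Bool) → sumL (select D S) (χ ∘ E) ≡ common S (map E D)
sumL-select [] [] E = refl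
sumL-select [] (true ∷ S) E = refl
sumL-select [] (false ∷ S) E = refl
sumL-select (x ∷ D) [] E = refl
sumL-select (x ∷ D) (true ∷ S) E with E x
... | true = cong suc (sumL-select D S E)
... | false = sumL-select D S E
sumL-select (x ∷ D) (false ∷ S) E = sumL-select D S E

argmin : ∀ {A : Set} (φ : A → ℕ) x xs → ∃[ y ] y ∈ x ∷ xs × (∀ z → z ∈ x ∷ xs → φ y ≤ φ z)
argmin φ x [] = x , here refl , λ { z (here refl) → ℕₚ.≤-refl }
argmin φ x (w ∷ xs) with argmin φ w xs
... | y , y∈ , h with ℕₚ.≤-total (φ x) (φ y)
... | inj₁ le = x , here refl , λ { z (here refl) → ℕₚ.≤-refl ; z (there m) → ℕₚ.≤-trans le (h z m) }
... | inj₂ le = y , there y∈ , λ { z (here refl) → le ; z (there m) → h z m }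

argmin∈ : ∀ {A : Set} (φ : A → ℕ) xs {x} → x ∈ xs → ∃[ y ] y ∈ xs × (∀ z → z ∈ xs → φ y ≤ φ z)
argmin∈ φ (x ∷ xs) _ = argmin φ x xs

-- The whole interface to the probabilistic part. `upper` has an additive error `N ^ suc m / Θ` and
-- `lower` asks for a coboundary of density at least `1 / L`: these are the allowances made for the
-- union bound over all cochains on a link. `tiny` stands in for `upper` where no free vertex is
-- available.
record Quasirandom (n d : ℕ) (X : Tuple → Bool) (H : ℕ → ℕ) (a b k Cu Cl L Θ : ℕ) : Set where
  open Vertices n using (V; T#)
  field
    min-degree : ∀ σ → length σ ≡ d → Unique σ → All (_∈ V) σ → a ≤ sumL V (λ x → χ (X (x ∷ σ)))
    upper : ∀ ρ m h → length ρ + suc m ≡ d → Unique ρ → All (_∈ V) ρ → Sym h → Distinct h →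
      Θ * sumL V (λ x → T# (suc m) (λ ys → χ (X (ρ ++ x ∷ ys) ∧ h ys))) ≤ Cu * k * (Θ * T# (suc m) (χ ∘ h) + length V ^ suc m)
    lower : ∀ ρ m h → length ρ + suc m ≡ d → Unique ρ → All (_∈ V) ρ → Sym h → Distinct h →
      length V ^ suc (suc m) ≤ L * T# (suc (suc m)) (λ zs → χ (distinctᵇ (ρ ++ zs) ∧ dl h zs)) →
      k * T# (suc (suc m)) (λ zs → χ (distinctᵇ (ρ ++ zs) ∧ dl h zs)) ≤ Cl * length V * T# (suc (suc m)) (λ zs → χ (X (ρ ++ zs) ∧ dl h zs))
    tiny : ∀ ξ (A : ℕ → Bool) → suc (length ξ) ≡ d → Unique ξ → All (_∈ V) ξ → H 0 * sumL V (χ ∘ A) < length V →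
      sumL V (λ u → sumL V (λ v → χ (X (u ∷ v ∷ ξ) ∧ (A u ∧ A v)))) ≤ b * sumL V (χ ∘ A)

-- By `H-large` every later threshold beats the product of the earlier ones, which makes two fat
-- faces over a common thin facet rare; `Gb≤k` plays this part at level 0. Through `k≤3a`, multiples
-- of `k` are charged to degrees.
record Constants (d : ℕ) (H : ℕ → ℕ) (a b k Cu Cl L Θ G : ℕ) : Set where
  field
    k≤3a : k ≤ 3 * a
    0<a : 0 < a
    Gb≤k : G * b ≤ k
    0<G : 0 < G
    0<Θ : 0 < Θ
    1≤C : 1 ≤ 4 * Cu * Cl
    0<H : ∀ m → 0 < H m
    H-large : ∀ m → 2 * G * Cu * suc m * cumulative H (suc m) ≤ H (suc m)
    Θ-large : ∀ m → m ≤ d → 2 * G * Cu * cumulative H m ≤ Θ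
    K≤Θ : ∀ m → m ≤ d → cumulative H m ≤ Θ
    L-large : ∀ m → m ≤ d → 2 * cumulative H m ≤ L
    G≡ : G ≡ 6 * (d ! * suc d * (4 * Cu * Cl)) * (suc d ! * d)

expansionConstant : ℕ → ℕ → ℕ → ℕ
expansionConstant d Cu Cl = 2 * (d ! * suc d * (4 * Cu * Cl)) * suc d ! + 6 * Cu * 2 ^ d * (suc d ! * suc d !)

module QuasirandomExpansion (n d : ℕ) (S : List Bool) (lS : length S ≡ length (dFaces n d)) (0<d : 0 < d) (0<n : 0 < n) (2d≤n : 2 * d ≤ n)
  (H : ℕ → ℕ) (a b k Cu Cl L Θ G : ℕ) (cs : Constants d H a b k Cu Cl L Θ G) where

  open ComplexExpansion n d S lS public
  open Constants cs

  module _ (qr : Quasirandom n d X̂ H a b k Cu Cl L Θ) where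

    open Quasirandom qr

    private
      0<N : 0 < length V
      0<N = subst (0 <_) (sym length-V) 0<n

      2d≤N : 2 * d ≤ length V
      2d≤N = subst (2 * d ≤_) (sym length-V) 2d≤n

      N : ℕ
      N = length V

      X̂-sym : Sym X̂
      X̂-sym = ext-sym (inList X)

      X̂-distinct : Distinct X̂
      X̂-distinct = ext-distinct (inList X)

      !-pos : ∀ m → 1 ≤ m !
      !-pos m = >-nonZero⁻¹ (m !) {{ℕₚ._!≢0 m}}

    ∈-V : ∀ {k σ} → σ ∈ faces n k → All (_∈ V) σ
    ∈-V {k} m = All.tabulate (IsSubset.⊆V (face⁻ {k} m))

    ext# : ℕ → Tuple → ℕ
    ext# M σ = T# M (λ zs → χ (X̂ (σ ++ zs)))

    ext#-sym : ∀ M → Sym (ext# M)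
    ext#-sym M p = T-cong M (λ zs _ _ → cong χ (X̂-sym (Permₚ.++⁺ʳ zs p)))

    degX-tuples : ∀ s M {σ} → s + M ≡ suc d → σ ∈ faces n s → M ! * degX σ ≡ ext# M σ
    degX-tuples s M {σ} e m = begin
      M ! * degX σ
        ≡⟨ cong (M ! *_) (trans (length-filterᵇ (σ ⊆F_) X) (sumL-select (dFaces n d) S (σ ⊆F_))) ⟩
      M ! * common S (map (σ ⊆F_) (dFaces n d))
        ≡⟨ cong (λ l → M ! * common S l) (map-injective-on Face (dFaces n d) _ _ (λ τ _ → sym (Boolₚ.∧-identityʳ (σ ⊆F τ)))) ⟩
      M ! * common S (map (over σ (λ _ → true)) (dFaces n d))
        ≡⟨ cong (M ! *_) (sym (common-count (dFaces n d) S (over σ (λ _ → true)) D-unique lS)) ⟩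
      M ! * sumL (dFaces n d) (λ τ → χ (inList X τ ∧ over σ (λ _ → true) τ))
        ≡⟨ count-over (inList X) (suc d) M σ (λ _ → refl) (trans (cong (_+ M) (IsSubset.size (face⁻ {s} m))) e) (Sorted⇒Unique (IsSubset.sorted (face⁻ {s} m))) (∈-V {s} m) ⟩
      T# M (λ zs → χ (X̂ (σ ++ zs) ∧ true))
        ≡⟨ T-cong M (λ zs _ _ → cong χ (Boolₚ.∧-identityʳ (X̂ (σ ++ zs)))) ⟩
      ext# M σ ∎
      where open ≡-Reasoning

    A-tuples : ∀ s M h → s + M ≡ suc d → s ≤ d → Sym h → Distinct h → s ! * (M ! * A s h) ≡ T# s (λ σ → χ (h σ) * ext# M σ)
    A-tuples s M h e le hs hd = begin
      s ! * (M ! * A s h)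
        ≡⟨ cong (λ F → s ! * (M ! * sumL F (λ σ → χ (h σ) * degX σ))) (cxFaces-low le) ⟩
      s ! * (M ! * sumL (faces n s) (λ σ → χ (h σ) * degX σ))
        ≡⟨ cong (s ! *_) (trans (sym (sumL-*ˡ (faces n s) (M !) _)) (sumL-cong (faces n s) (λ σ m → trans (lem (M !) (χ (h σ)) (degX σ)) (cong (χ (h σ) *_) (degX-tuples s M e m))))) ⟩
      s ! * sumL (faces n s) (λ σ → χ (h σ) * ext# M σ)
        ≡⟨ sym (T-subsets s (λ p → cong₂ (λ x y → χ x * y) (hs p) (ext#-sym M p)) (λ σ u → cong (λ x → χ x * ext# M σ) (≢true (λ t → u (hd σ t))))) ⟩
      T# s (λ σ → χ (h σ) * ext# M σ) ∎
      where
      open ≡-Reasoning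
      lem : ∀ x y z → x * (y * z) ≡ y * (x * z)
      lem = ℕSolver.solve-∀

    A-top : ∀ h → Sym h → T# (suc d) (λ τ → χ (X̂ τ ∧ h τ)) ≤ suc d ! * A (suc d) h
    A-top h hs = begin
      T# (suc d) (λ τ → χ (X̂ τ ∧ h τ))
        ≡⟨ T-subsets (suc d) (λ p → cong χ (cong₂ _∧_ (X̂-sym p) (hs p))) (λ τ u → cong χ (≢true (λ t → u (X̂-distinct τ (∧-trueˡ t))))) ⟩
      suc d ! * sumL (dFaces n d) (λ τ → χ (X̂ τ ∧ h τ))
        ≡⟨ cong (suc d ! *_) (trans (sumL-cong (dFaces n d) (λ τ m → cong (λ x → χ (x ∧ h τ)) (ext-face (inList X) {suc d} m)))
             (trans (common-count (dFaces n d) S h D-unique lS) (sym (sumL-select (dFaces n d) S h)))) ⟩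
      suc d ! * sumL X (χ ∘ h)
        ≤⟨ ℕₚ.*-monoʳ-≤ (suc d !) (sumL-mono X (λ σ m → ℕₚ.≤-trans (ℕₚ.≤-reflexive (sym (ℕₚ.*-identityʳ (χ (h σ))))) (ℕₚ.*-monoʳ-≤ (χ (h σ)) (self σ m)))) ⟩
      suc d ! * sumL X (λ σ → χ (h σ) * degX σ)
        ≡⟨ cong (λ F → suc d ! * sumL F (λ σ → χ (h σ) * degX σ)) (sym cxFaces-top) ⟩
      suc d ! * A (suc d) h ∎
      where
      open ℕₚ.≤-Reasoning
      self : ∀ σ → σ ∈ X → 1 ≤ degX σ
      self σ m = ℕₚ.≤-trans (ℕₚ.≤-trans (ℕₚ.≤-reflexive (cong χ (sym (all-intro _ σ (λ q → ∈⇒memb q))))) (sumL-member (λ τ → χ (σ ⊆F τ)) m))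
        (ℕₚ.≤-reflexive (sym (length-filterᵇ (σ ⊆F_) X)))

    -- At most `d` vertices are already taken at each step, so `2 d ≤ N` leaves at least half of
    -- `V`.
    extend-count : ∀ m σ → length σ + m ≤ d → Unique σ → All (_∈ V) σ → N ^ m ≤ 2 ^ m * T# m (λ ys → χ (distinctᵇ (σ ++ ys)))
    extend-count zero σ le u al = ℕₚ.≤-reflexive (trans (cong χ (sym (Unique⇒distinctᵇ (subst Unique (sym (Listₚ.++-identityʳ σ)) u)))) (sym (ℕₚ.+-identityʳ _)))
    extend-count (suc m) σ le u al = begin
      N * N ^ m
        ≤⟨ ℕₚ.*-monoˡ-≤ (N ^ m) half ⟩
      2 * sumL V (λ x → χ (not (memb x σ))) * N ^ m
        ≡⟨ lem (sumL V (λ x → χ (not (memb x σ)))) (N ^ m) ⟩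
      2 * (N ^ m * sumL V (λ x → χ (not (memb x σ))))
        ≡⟨ cong (2 *_) (sym (sumL-*ˡ V (N ^ m) _)) ⟩
      2 * sumL V (λ x → N ^ m * χ (not (memb x σ)))
        ≤⟨ ℕₚ.*-monoʳ-≤ 2 (sumL-mono V (λ x x∈ → each x x∈ (memb x σ) refl)) ⟩
      2 * sumL V (λ x → 2 ^ m * T# m (λ ys → χ (distinctᵇ (σ ++ x ∷ ys))))
        ≡⟨ trans (cong (2 *_) (sumL-*ˡ V (2 ^ m) _)) (sym (ℕₚ.*-assoc 2 (2 ^ m) _)) ⟩
      2 * 2 ^ m * T# (suc m) (λ ys → χ (distinctᵇ (σ ++ ys))) ∎
      where
      open ℕₚ.≤-Reasoning
      lem : ∀ x y → 2 * x * y ≡ 2 * (y * x)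
      lem = ℕSolver.solve-∀
      c∈ = sumL V (λ x → χ (memb x σ))
      c∉ = sumL V (λ x → χ (not (memb x σ)))
      total : N ≡ c∈ + c∉
      total = trans (trans (sym (ℕₚ.*-identityʳ N)) (sym (sumL-const V 1))) (trans (sumL-cong V (λ x _ → one (memb x σ))) (sumL-+ V _ _))
        where
        one : ∀ b → 1 ≡ χ b + χ (not b)
        one true = refl
        one false = refl
      few : c∈ ≤ d
      few = ℕₚ.≤-trans (ℕₚ.≤-reflexive (sym (length-filterᵇ (λ x → memb x σ) V)))
        (ℕₚ.≤-trans (Unique-length (AllPairs-filterᵇ _ V-unique) (λ q → memb⇒∈ σ (proj₂ (∈-filterᵇ⁻ (λ x → memb x σ) V q))))
          (ℕₚ.≤-trans (ℕₚ.m≤m+n (length σ) (suc m)) le))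
      half : N ≤ 2 * c∉
      half = ℕₚ.+-cancelˡ-≤ N _ _ (begin
        N + N                 ≡⟨ lem₂ N ⟩
        2 * N                 ≡⟨ cong (2 *_) total ⟩
        2 * (c∈ + c∉)         ≡⟨ ℕₚ.*-distribˡ-+ 2 c∈ c∉ ⟩
        2 * c∈ + 2 * c∉       ≤⟨ ℕₚ.+-monoˡ-≤ (2 * c∉) (ℕₚ.≤-trans (ℕₚ.*-monoʳ-≤ 2 few) 2d≤N) ⟩
        N + 2 * c∉ ∎)
        where
        lem₂ : ∀ x → x + x ≡ 2 * x
        lem₂ = ℕSolver.solve-∀
      each : ∀ x → x ∈ V → ∀ c → memb x σ ≡ c → N ^ m * χ (not c) ≤ 2 ^ m * T# m (λ ys → χ (distinctᵇ (σ ++ x ∷ ys)))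
      each x x∈ true e = ℕₚ.≤-trans (ℕₚ.≤-reflexive (ℕₚ.*-zeroʳ (N ^ m))) z≤n
      each x x∈ false e = ℕₚ.≤-trans (ℕₚ.≤-reflexive (ℕₚ.*-identityʳ (N ^ m))) (ℕₚ.≤-trans
        (extend-count m (x ∷ σ) (ℕₚ.≤-trans (ℕₚ.≤-reflexive (sym (ℕₚ.+-suc (length σ) m))) le) (Unique-∷ (memb-false⇒∉ {ys = σ} e) u) (x∈ ∷ al))
        (ℕₚ.≤-reflexive (cong (2 ^ m *_) (T-cong m (λ ys _ _ → cong χ (distinctᵇ-sym (↭-sym (Permₚ.shift x σ ys))))))))

    -- σ has many completions to a d-tuple, and the minimum degree applies to each of them.
    ext#-lower : ∀ m σ → length σ + m ≡ d → Unique σ → All (_∈ V) σ → a * N ^ m ≤ 2 ^ m * ext# (suc m) σ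
    ext#-lower m σ l u al = begin
      a * N ^ m
        ≤⟨ ℕₚ.*-monoʳ-≤ a (extend-count m σ (ℕₚ.≤-reflexive l) u al) ⟩
      a * (2 ^ m * T# m (λ ys → χ (distinctᵇ (σ ++ ys))))
        ≡⟨ trans (lem a (2 ^ m) _) (cong (2 ^ m *_) (sym (T-*ˡ m a _))) ⟩
      2 ^ m * T# m (λ ys → a * χ (distinctᵇ (σ ++ ys)))
        ≤⟨ ℕₚ.*-monoʳ-≤ (2 ^ m) (T-mono m (λ ys ly aly → each ys ly aly (distinctᵇ (σ ++ ys)) refl)) ⟩
      2 ^ m * T# m (λ ys → sumL V (λ x → χ (X̂ (σ ++ x ∷ ys))))
        ≡⟨ cong (2 ^ m *_) (T-sumL m V (λ x ys → χ (X̂ (σ ++ x ∷ ys)))) ⟩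
      2 ^ m * ext# (suc m) σ ∎
      where
      open ℕₚ.≤-Reasoning
      lem : ∀ x y z → x * (y * z) ≡ y * (x * z)
      lem = ℕSolver.solve-∀
      each : ∀ ys → length ys ≡ m → All (_∈ V) ys → ∀ c → distinctᵇ (σ ++ ys) ≡ c → a * χ c ≤ sumL V (λ x → χ (X̂ (σ ++ x ∷ ys)))
      each ys ly aly false e = ℕₚ.≤-trans (ℕₚ.≤-reflexive (ℕₚ.*-zeroʳ a)) z≤n
      each ys ly aly true e = ℕₚ.≤-trans (ℕₚ.≤-reflexive (ℕₚ.*-identityʳ a)) (ℕₚ.≤-trans
        (min-degree (σ ++ ys) (trans (Listₚ.length-++ σ) (trans (cong (length σ +_) ly) l)) (distinctᵇ⇒Unique (σ ++ ys) e) (Allₚ.++⁺ al aly))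
        (ℕₚ.≤-reflexive (sumL-cong V (λ x _ → cong χ (X̂-sym (↭-sym (Permₚ.shift x σ ys)))))))

    -- This is `upper` for the full cochain, whose size dominates the additive error up to a
    -- constant.
    ext#-upper : ∀ m σ → length σ + suc m ≡ d → Unique σ → All (_∈ V) σ → ext# (suc (suc m)) σ ≤ 2 * Cu * k * N ^ suc m
    ext#-upper m σ l u al = ℕₚ.*-cancelˡ-≤ Θ {{>-nonZero 0<Θ}} (begin
      Θ * ext# (suc (suc m)) σ
        ≤⟨ ℕₚ.*-monoʳ-≤ Θ (sumL-mono V (λ x _ → T-mono (suc m) (λ ys _ _ → χ-mono (λ t → ∧-intro t (Unique⇒distinctᵇ (tail′ (Unique-++ʳ σ (X̂-distinct (σ ++ x ∷ ys) t)))))))) ⟩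
      Θ * sumL V (λ x → T# (suc m) (λ ys → χ (X̂ (σ ++ x ∷ ys) ∧ distinctᵇ ys)))
        ≤⟨ upper σ m distinctᵇ l u al distinctᵇ-sym distinctᵇ⇒Unique ⟩
      Cu * k * (Θ * T# (suc m) (χ ∘ distinctᵇ) + N ^ suc m)
        ≤⟨ ℕₚ.*-monoʳ-≤ (Cu * k) (ℕₚ.+-mono-≤ (ℕₚ.*-monoʳ-≤ Θ all≤) (ℕₚ.≤-trans (ℕₚ.≤-reflexive (sym (ℕₚ.*-identityˡ (N ^ suc m)))) (ℕₚ.*-monoˡ-≤ (N ^ suc m) 0<Θ))) ⟩
      Cu * k * (Θ * N ^ suc m + Θ * N ^ suc m)
        ≡⟨ lem Cu k Θ (N ^ suc m) ⟩
      Θ * (2 * Cu * k * N ^ suc m) ∎)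
      where
      open ℕₚ.≤-Reasoning
      lem : ∀ c k t x → c * k * (t * x + t * x) ≡ t * (2 * c * k * x)
      lem = ℕSolver.solve-∀
      tail′ : ∀ {x : ℕ} {xs} → Unique (x ∷ xs) → Unique xs
      tail′ (_ ∷ u) = u
      all≤ : T# (suc m) (χ ∘ distinctᵇ) ≤ N ^ suc m
      all≤ = ℕₚ.≤-trans (T-mono (suc m) (λ ys _ _ → χ-≤1 (distinctᵇ ys))) (ℕₚ.≤-reflexive (trans (T-const (suc m) 1) (ℕₚ.*-identityʳ (N ^ suc m))))

    degX-pos : ∀ s σ → s ≤ d → σ ∈ faces n s → 0 < degX σ
    degX-pos s σ le m = pos (degX σ) (ℕₚ.≤-trans below (ℕₚ.≤-reflexive (cong (2 ^ M *_) (sym (degX-tuples s (suc M) sM m)))))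
      where
      M = d ∸ s
      f′ = face⁻ {s} m
      sM : s + suc M ≡ suc d
      sM = trans (ℕₚ.+-suc s M) (cong suc (ℕₚ.m+[n∸m]≡n le))
      below : 1 ≤ 2 ^ M * ext# (suc M) σ
      below = ℕₚ.≤-trans (ℕₚ.*-mono-≤ 0<a (ℕₚ.m^n>0 N {{>-nonZero 0<N}} M))
        (ext#-lower M σ (trans (cong (_+ M) (IsSubset.size f′)) (ℕₚ.m+[n∸m]≡n le)) (Sorted⇒Unique (IsSubset.sorted f′)) (∈-V {s} m))
      pos : ∀ x → 1 ≤ 2 ^ M * (suc M ! * x) → 0 < x
      pos zero h = ⊥-elim (ℕₚ.<⇒≱ h (ℕₚ.≤-reflexive (trans (cong (2 ^ M *_) (ℕₚ.*-zeroʳ (suc M !))) (ℕₚ.*-zeroʳ (2 ^ M)))))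
      pos (suc x) h = s≤s z≤n

    X-nonempty : 0 < length X
    X-nonempty = ℕₚ.≤-trans (degX-pos 0 [] z≤n (here refl)) (length-filterᵇ-≤ ([] ⊆F_) X)

    average : ∀ (φ : ℕ → ℕ) → ∃[ v ] N * φ v ≤ sumL V φ
    average φ = proj₁ r , ℕₚ.≤-trans (ℕₚ.≤-reflexive (sym (sumL-const V (φ (proj₁ r))))) (sumL-mono V (λ x m → proj₂ (proj₂ r) x m))
      where
      some : ∃[ x ] x ∈ V
      some = 0 , ∈ₚ.∈-upTo⁺ 0<n
      r = argmin∈ φ V (proj₂ some)

    -- For `g = h (v ∷ _)`, the sum of `h` and the coboundary of `g` is `dl h (v ∷ _)`, and for the
    -- best vertex `v` its size is at most that of `dl h` divided by `N`. This factor makes up for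
    -- the ratio, of order `N`, between the degrees in consecutive dimensions.
    expand-low : ∀ j → suc j < d → ∀ h → Sym h → Distinct h →
      ∃[ g ] A (suc j) (λ σ → h σ xor dl g σ) ≤ 6 * Cu * 2 ^ d * (suc d ! * suc d !) * A (suc (suc j)) (dl h)
    expand-low j j<d h hs hd = g , (begin
      A s f′                                                          ≤⟨ ℕₚ.≤-trans (ℕₚ.≤-reflexive (sym (trans (ℕₚ.*-identityˡ _) (ℕₚ.*-identityˡ _)))) (ℕₚ.*-mono-≤ (!-pos s) (ℕₚ.*-monoˡ-≤ (A s f′) (!-pos (suc (suc m))))) ⟩
      s ! * (suc (suc m) ! * A s f′)                                  ≡⟨ A-tuples s (suc (suc m)) f′ sM₁ (ℕₚ.<⇒≤ j<d) fs fd ⟩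
      T# s (λ σ → χ (f′ σ) * ext# (suc (suc m)) σ)                    ≤⟨ T-mono s (λ σ l al → up σ l al (f′ σ) refl) ⟩
      T# s (λ σ → 2 * Cu * k * N ^ suc m * χ (f′ σ))                  ≡⟨ T-*ˡ s (2 * Cu * k * N ^ suc m) (χ ∘ f′) ⟩
      2 * Cu * k * N ^ suc m * T# s (χ ∘ f′)                          ≡⟨ lem₁ Cu k N (N ^ m) (T# s (χ ∘ f′)) ⟩
      2 * Cu * (k * N ^ m * (N * T# s (χ ∘ f′)))                      ≤⟨ ℕₚ.*-monoʳ-≤ (2 * Cu) (ℕₚ.*-mono-≤ (ℕₚ.*-monoˡ-≤ (N ^ m) k≤3a) (proj₂ av)) ⟩
      2 * Cu * (3 * a * N ^ m * t)                                    ≡⟨ lem₂ Cu a (N ^ m) t ⟩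
      6 * Cu * (a * N ^ m * t)                                        ≤⟨ ℕₚ.*-monoʳ-≤ (6 * Cu) (ℕₚ.≤-trans low (ℕₚ.*-monoˡ-≤ _ (ℕₚ.^-monoʳ-≤ 2 m≤d))) ⟩
      6 * Cu * (2 ^ d * (suc s ! * (suc m ! * A (suc s) (dl h))))     ≤⟨ ℕₚ.*-monoʳ-≤ (6 * Cu) (ℕₚ.*-monoʳ-≤ (2 ^ d) (ℕₚ.*-mono-≤ (!-mono (ℕₚ.m≤n⇒m≤1+n j<d)) (ℕₚ.*-monoˡ-≤ (A (suc s) (dl h)) (!-mono (s≤s m≤d))))) ⟩
      6 * Cu * (2 ^ d * (suc d ! * (suc d ! * A (suc s) (dl h))))     ≡⟨ lem₃ Cu (2 ^ d) (suc d !) (A (suc s) (dl h)) ⟩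
      6 * Cu * 2 ^ d * (suc d ! * suc d !) * A (suc s) (dl h) ∎)
      where
      open ℕₚ.≤-Reasoning
      s = suc j
      m = d ∸ suc s
      sm : suc s + m ≡ d
      sm = ℕₚ.m+[n∸m]≡n j<d
      sM₁ : s + suc (suc m) ≡ suc d
      sM₁ = trans (ℕₚ.+-suc s (suc m)) (cong suc (trans (ℕₚ.+-suc s m) sm))
      sM₂ : suc s + suc m ≡ suc d
      sM₂ = trans (ℕₚ.+-suc (suc s) m) (cong suc sm)
      m≤d : m ≤ d
      m≤d = ℕₚ.m∸n≤m d (suc s)
      !-mono : ∀ {x y} → x ≤ y → x ! ≤ y !
      !-mono {x} {y} le = subst (λ z → x ! ≤ z !) (ℕₚ.m+[n∸m]≡n le) (go (y ∸ x))
        where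
        go : ∀ i → x ! ≤ (x + i) !
        go zero = ℕₚ.≤-reflexive (cong _! (sym (ℕₚ.+-identityʳ x)))
        go (suc i) = ℕₚ.≤-trans (go i) (ℕₚ.≤-trans (ℕₚ.m≤m+n ((x + i) !) _) (ℕₚ.≤-reflexive (cong _! (sym (ℕₚ.+-suc x i)))))
      t = T# (suc s) (λ τ → χ (dl h τ))
      av = average (λ v → T# s (λ ys → χ (dl h (v ∷ ys))))
      v = proj₁ av
      g : Tuple → Bool
      g r = h (v ∷ r)
      f′ : Tuple → Bool
      f′ σ = dl h (v ∷ σ)
      fs : Sym f′
      fs p = dl-sym hs (prep v p)
      fd : Distinct f′
      fd σ e = Unique-++ʳ (v ∷ []) (dl-distinct hs hd (v ∷ σ) e)
      up : ∀ σ → length σ ≡ s → All (_∈ V) σ → ∀ c → f′ σ ≡ c → χ c * ext# (suc (suc m)) σ ≤ 2 * Cu * k * N ^ suc m * χ c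
      up σ l al false e = z≤n
      up σ l al true e = ℕₚ.≤-trans (ℕₚ.≤-reflexive (ℕₚ.*-identityˡ _)) (ℕₚ.≤-trans (ext#-upper m σ (trans (cong (_+ suc m) l) (trans (ℕₚ.+-suc s m) sm)) (fd σ e) al) (ℕₚ.≤-reflexive (sym (ℕₚ.*-identityʳ _))))
      low : a * N ^ m * t ≤ 2 ^ m * (suc s ! * (suc m ! * A (suc s) (dl h)))
      low = begin
        a * N ^ m * t                                            ≡⟨ sym (T-*ˡ (suc s) (a * N ^ m) (χ ∘ dl h)) ⟩
        T# (suc s) (λ τ → a * N ^ m * χ (dl h τ))                ≤⟨ T-mono (suc s) (λ τ l al → each τ l al (dl h τ) refl) ⟩
        T# (suc s) (λ τ → 2 ^ m * (χ (dl h τ) * ext# (suc m) τ)) ≡⟨ T-*ˡ (suc s) (2 ^ m) (λ τ → χ (dl h τ) * ext# (suc m) τ) ⟩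
        2 ^ m * T# (suc s) (λ τ → χ (dl h τ) * ext# (suc m) τ)   ≡⟨ cong (2 ^ m *_) (sym (A-tuples (suc s) (suc m) (dl h) sM₂ j<d (dl-sym hs) (dl-distinct hs hd))) ⟩
        2 ^ m * (suc s ! * (suc m ! * A (suc s) (dl h))) ∎
        where
        each : ∀ τ → length τ ≡ suc s → All (_∈ V) τ → ∀ c → dl h τ ≡ c → a * N ^ m * χ c ≤ 2 ^ m * (χ c * ext# (suc m) τ)
        each τ l al false e = ℕₚ.≤-trans (ℕₚ.≤-reflexive (ℕₚ.*-zeroʳ (a * N ^ m))) z≤n
        each τ l al true e = ℕₚ.≤-trans (ℕₚ.≤-reflexive (ℕₚ.*-identityʳ (a * N ^ m))) (ℕₚ.≤-trans
          (ext#-lower m τ (trans (cong (_+ m) l) sm) (dl-distinct hs hd τ e) al) (ℕₚ.≤-reflexive (cong (2 ^ m *_) (sym (ℕₚ.*-identityˡ _)))))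
      lem₁ : ∀ c k n x y → 2 * c * k * (n * x) * y ≡ 2 * c * (k * x * (n * y))
      lem₁ = ℕSolver.solve-∀
      lem₂ : ∀ c a x t → 2 * c * (3 * a * x * t) ≡ 6 * c * (a * x * t)
      lem₂ = ℕSolver.solve-∀
      lem₃ : ∀ c p f x → 6 * c * (p * (f * (f * x))) ≡ 6 * c * p * (f * f) * x
      lem₃ = ℕSolver.solve-∀

    xor-sym : ∀ {f g : Tuple → Bool} → Sym f → Sym g → Sym (λ σ → f σ xor g σ)
    xor-sym s t p = cong₂ _xor_ (s p) (t p)

    xor-distinct : ∀ {f g : Tuple → Bool} → Distinct f → Distinct g → Distinct (λ σ → f σ xor g σ)
    xor-distinct {f} {g} s t σ e with xor-true (f σ) (g σ) e
    ... | inj₁ q = s σ q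
    ... | inj₂ q = t σ q

    expand-top : ∀ j → suc j ≡ d → ∀ h → Sym h → Distinct h →
      ∃[ g ] A (suc j) (λ σ → h σ xor dl g σ) ≤ 2 * (d ! * suc d * (4 * Cu * Cl)) * suc d ! * A (suc (suc j)) (dl h)
    expand-top j refl h hs hd = ĝ , (begin
      A d f                                       ≤⟨ ℕₚ.≤-trans (ℕₚ.≤-reflexive (sym (trans (ℕₚ.*-identityˡ _) (ℕₚ.*-identityˡ _)))) (ℕₚ.*-monoˡ-≤ (1 * A d f) (!-pos d)) ⟩
      d ! * (1 * A d f)                           ≡⟨ A-tuples d 1 f (ℕₚ.+-comm d 1) ℕₚ.≤-refl fs fd ⟩
      T# d (λ σ → χ (f σ) * ext# 1 σ)             ≡⟨ T-cong d (λ σ _ _ → cong (χ (f σ) *_) (sumL-cong V (λ x _ → cong χ (X̂-sym (↭-trans (Permₚ.shift x σ []) (prep x (↭-reflexive (Listₚ.++-identityʳ σ)))))))) ⟩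
      Top.weight#                                 ≤⟨ TB.top-expansion G≡ ⟩
      2 * B * Top.odd#                            ≤⟨ ℕₚ.*-monoʳ-≤ (2 * B) (A-top (dl f) (dl-sym fs)) ⟩
      2 * B * (suc d ! * A (suc d) (dl f))        ≡⟨ sym (ℕₚ.*-assoc (2 * B) (suc d !) _) ⟩
      2 * B * suc d ! * A (suc d) (dl f)          ≡⟨ cong (2 * B * suc d ! *_) (sumL-cong (cxFaces (suc d)) (λ σ _ → cong (λ x → χ x * degX σ) (dl-f σ))) ⟩
      2 * B * suc d ! * A (suc d) (dl h) ∎)
      where
      open ℕₚ.≤-Reasoning
      B = d ! * suc d * (4 * Cu * Cl)
      F = faces n j
      -- The representative minimizes the number of tuples and not the norm: `MinOn` compares
      -- cardinalities, and any representative of small norm serves the conclusion.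
      cost : Cochain → ℕ
      cost g = T# d (λ σ → χ (h σ xor dl (hat j g) σ))
      best = argmin∈ cost (allCochains j) (lst∈ j (λ _ → false))
      ĝ f : Tuple → Bool
      ĝ = hat j (proj₁ best)
      f σ = h σ xor dl ĝ σ
      ĝ-sym : Sym ĝ
      ĝ-sym = ext-sym (valueAt F (proj₁ best))
      ĝ-distinct : Distinct ĝ
      ĝ-distinct = ext-distinct (valueAt F (proj₁ best))
      fs : Sym f
      fs = xor-sym hs (dl-sym ĝ-sym)
      fd : Distinct f
      fd = xor-distinct hd (dl-distinct ĝ-sym ĝ-distinct)
      dl-f : ∀ σ → dl f σ ≡ dl h σ
      dl-f σ = trans (dl-xor h (dl ĝ) σ) (trans (cong (dl h σ xor_) (dl-dl ĝ σ)) (Boolₚ.xor-identityʳ (dl h σ)))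
      -- The competitor given by `g` need not come from a Boolean list, but on tuples over `V` it
      -- agrees with one that does.
      minimal : Minimality.MinOn V V-unique f fs fd [] d
      minimal g gs gd = begin
        T# d (λ σ → χ (f σ))                                 ≤⟨ proj₂ (proj₂ best) (lst j g₂) (lst∈ j g₂) ⟩
        T# d (λ σ → χ (h σ xor dl (hat j (lst j g₂)) σ))     ≡⟨ T-cong d (λ σ l al → cong χ (trans (cong (h σ xor_) (dl-cong σ (agree σ l al))) (assoc σ))) ⟩
        T# d (λ σ → χ (avoids [] σ ∧ (f σ xor dl g σ))) ∎
        where
        g₂ : Tuple → Bool
        g₂ σ = ĝ σ xor g σ
        agree : ∀ σ → length σ ≡ d → All (_∈ V) σ → ∀ y ys → σ ↭ y ∷ ys → hat j (lst j g₂) ys ≡ g₂ ys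
        agree σ l al y ys p = trans (restrict ys (ℕₚ.suc-injective (trans (sym (Permₚ.↭-length p)) l)) all∈) (ext-restrict (xor-sym ĝ-sym gs) (xor-distinct ĝ-distinct gd) ys all∈)
          where
          all∈ : All (_∈ V) ys
          all∈ = All.tail (Permₚ.All-resp-↭ p al)
          restrict : ∀ ys → length ys ≡ j → All (_∈ V) ys → hat j (lst j g₂) ys ≡ ext g₂ ys
          restrict ys ly ay with true-or-false (distinctᵇ ys)
          ... | inj₂ e = trans (cong (_∧ valueAt F (lst j g₂) (canon ys)) e) (sym (cong (_∧ g₂ (canon ys)) e))
          ... | inj₁ e = cong (distinctᵇ ys ∧_) (trans (cong (λ W → valueAt F (map g₂ W) (canon ys)) (cxFaces-low (ℕₚ.n≤1+n j)))
              (valueAt-map F g₂ (canon∈ ly (distinctᵇ⇒Unique ys e) ay)))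
        assoc : ∀ σ → h σ xor dl g₂ σ ≡ avoids [] σ ∧ (f σ xor dl g σ)
        assoc σ = trans (cong (h σ xor_) (dl-xor ĝ g σ)) (trans (sym (Boolₚ.xor-assoc (h σ) (dl ĝ σ) (dl g σ))) (sym (cong (_∧ (f σ xor dl g σ)) (all-intro (λ y → not (memb y [])) σ (λ _ → refl)))))
      module Top = TopExpansion V V-unique 0<N X̂ X̂-sym X̂-distinct d H f fs fd
      module TB = Top.Bounds a b k Cu Cl L Θ G min-degree upper lower tiny minimal k≤3a Gb≤k 0<G 0<Θ 1≤C 2d≤N 0<H H-large Θ-large K≤Θ L-large

    expand : ∀ j → j < d → ∀ h → Sym h → Distinct h → ∃[ g ] A (suc j) (λ σ → h σ xor dl g σ) ≤ expansionConstant d Cu Cl * A (suc (suc j)) (dl h)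
    expand j j<d h hs hd with ℕₚ.m≤n⇒m<n∨m≡n j<d
    ... | inj₁ lt = proj₁ r , ℕₚ.≤-trans (proj₂ r) (ℕₚ.*-monoˡ-≤ _ (ℕₚ.m≤n+m (6 * Cu * 2 ^ d * (suc d ! * suc d !)) (2 * (d ! * suc d * (4 * Cu * Cl)) * suc d !)))
      where r = expand-low j lt h hs hd
    ... | inj₂ eq = proj₁ r , ℕₚ.≤-trans (proj₂ r) (ℕₚ.*-monoˡ-≤ _ (ℕₚ.m≤m+n (2 * (d ! * suc d * (4 * Cu * Cl)) * suc d !) (6 * Cu * 2 ^ d * (suc d ! * suc d !))))
      where r = expand-top j eq h hs hd

-- Exceptional events

lookupFace : List Face → List Bool → Face → Bool
lookupFace [] _ τ = false
lookupFace (σ ∷ F) [] τ = false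
lookupFace (σ ∷ F) (b ∷ bs) τ = if eqFace σ τ then b else lookupFace F bs τ

lookupFace-map : ∀ F (φ : Face → Bool) {σ} → σ ∈ F → lookupFace F (map φ F) σ ≡ φ σ
lookupFace-map (τ ∷ F) φ {σ} m with eqFace τ σ in e
... | true = cong φ (eqFace⇒≡ τ σ e)
lookupFace-map (τ ∷ F) φ {σ} (here refl) | false = case trans (sym e) (eqFace-refl τ) of λ ()
lookupFace-map (τ ∷ F) φ {σ} (there m) | false = lookupFace-map F φ m

bitAt : List Bool → ℕ → Bool
bitAt [] x = false
bitAt (b ∷ bs) zero = b
bitAt (b ∷ bs) (suc x) = bitAt bs x

bitAt-upTo : ∀ (A : ℕ → Bool) n {x} → x < n → bitAt (map A (upTo n)) x ≡ A x
bitAt-upTo A n {x} h = go A id n h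
  where
  go : ∀ (A : ℕ → Bool) f n {x} → x < n → bitAt (map A (applyUpTo f n)) x ≡ A (f x)
  go A f (suc n) {zero} h = refl
  go A f (suc n) {suc x} (s≤s h) = go A (f ∘ suc) n h

!-mono : ∀ {x y} → x ≤ y → x ! ≤ y !
!-mono {x} {y} le = subst (λ z → x ! ≤ z !) (ℕₚ.m+[n∸m]≡n le) (go (y ∸ x))
  where
  go : ∀ i → x ! ≤ (x + i) !
  go zero = ℕₚ.≤-reflexive (cong _! (sym (ℕₚ.+-identityʳ x)))
  go (suc i) = ℕₚ.≤-trans (go i) (ℕₚ.≤-trans (ℕₚ.m≤m+n ((x + i) !) _) (ℕₚ.≤-reflexive (cong _! (sym (ℕₚ.+-suc x i)))))

-- The cofaces of the support of `h`.
touches : (Tuple → Bool) → Tuple → Bool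
touches h = pickAny (λ _ r → h r)

touches-sym : ∀ {h} → Sym h → Sym (touches h)
touches-sym {h} s p = bool-ext (one p) (one (↭-sym p))
  where
  one : ∀ {xs ys} → xs ↭ ys → touches h xs ≡ true → touches h ys ≡ true
  one {xs} {ys} p e with pickAny-elim (λ _ r → h r) xs e
  ... | y , r , q , t = pickAny-intro (λ _ r → h r) ys (λ w z → trans (s (↭-sym w)) z) (↭-trans (↭-sym p) q) t

all-sym : ∀ (A : ℕ → Bool) → Sym (all A)
all-sym A {xs} {ys} p = bool-ext
  (λ h → all-intro A ys (λ m → all-true A xs h (Permₚ.∈-resp-↭ (↭-sym p) m)))
  (λ h → all-intro A xs (λ m → all-true A ys h (Permₚ.∈-resp-↭ p m)))

any-false : ∀ {A : Set} (p : A → Bool) xs → any p xs ≡ false → ∀ {x} → x ∈ xs → p x ≡ false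
any-false p xs h m = ≢true (λ e → case trans (sym h) (any-intro p m e) of λ ())

<ᵇ-false : ∀ {x y} → (x <ᵇ y) ≡ false → y ≤ x
<ᵇ-false {x} {y} h = ℕₚ.≮⇒≥ (λ l → case trans (sym h) (T⇒≡ (ℕₚ.<⇒<ᵇ l)) of λ ())

≤ᵇ-false : ∀ {x y} → (x ≤ᵇ y) ≡ false → y < x
≤ᵇ-false {x} {y} h = ℕₚ.≰⇒> (λ l → case trans (sym h) (T⇒≡ (ℕₚ.≤⇒≤ᵇ l)) of λ ())

module Events (n d : ℕ) (H : ℕ → ℕ) (a b′ k c₁ L Θ : ℕ) {{Θ≢0 : NonZero Θ}} {{n≢0 : NonZero n}} where

  open Vertices n public

  D : List Face
  D = dFaces n d

  tuples : ℕ → List Tuple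
  tuples r = filterᵇ distinctᵇ (allTuples V r)

  event : Tuple → (Tuple → Bool) → List Bool
  event ρ ψ = map (over ρ ψ) D

  always : Tuple → Bool
  always _ = true

  cochain : ℕ → List Bool → Tuple → Bool
  cochain s hb = ext (lookupFace (faces n s) hb)

  -- However small the cochain is, the second summand keeps the threshold above `n ^ suc m`, which
  -- bounds the logarithm of the number of cochains, as soon as `Θ ≤ k`.
  weight₂ threshold₂ : ℕ → List Bool → ℕ
  weight₂ m hb = T# (suc m) (χ ∘ cochain (suc m) hb) + suc (n ^ suc m / Θ)
  threshold₂ m hb = 4 * (c₁ * (k * weight₂ m hb))

  event₂ event₃ : ℕ → Tuple → List Bool → List Bool
  event₂ m ρ hb = event ρ (touches (cochain (suc m) hb))
  event₃ m ρ hb = event ρ (dl (cochain (suc m) hb))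

  instance
    16n≢0 : NonZero (16 * n)
    16n≢0 = ℕₚ.m*n≢0 16 n

  -- The expected number of incidences is at least `k / n` times the size of the event. Taking a
  -- sixteenth of this leaves room for the faces already met and for the union bound over cochains.
  threshold₃ : ℕ → Tuple → List Bool → ℕ
  threshold₃ m ρ hb = k * trues (event₃ m ρ hb) / (16 * n)

  large₃ : ℕ → Tuple → List Bool → Bool
  large₃ m ρ hb = n ^ suc (suc m) ≤ᵇ L * (suc (suc m) ! * trues (event₃ m ρ hb))

  event₄ : Tuple → List Bool → List Bool
  event₄ ξ As = event ξ (all (bitAt As))

  bad₁ : Tuple → List Bool → Bool
  bad₁ σ U = common U (event σ always) <ᵇ a

  bad₂ bad₃ : ℕ → Tuple → List Bool → List Bool → Bool
  bad₂ m ρ hb U = threshold₂ m hb ≤ᵇ common U (event₂ m ρ hb)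
  bad₃ m ρ hb U = large₃ m ρ hb ∧ (common U (event₃ m ρ hb) <ᵇ threshold₃ m ρ hb)

  -- Fixing the size `w` allows a base of the exponential moment that depends on it. The first two
  -- tests do not involve `U`; they make the event impossible for sets of another size and for sets
  -- that are not small.
  bad₄ : ℕ → Tuple → List Bool → List Bool → Bool
  bad₄ w ξ As U = ((trues As ≡ᵇ w) ∧ (H 0 * w <ᵇ n)) ∧ (b′ * w <ᵇ common U (event₄ ξ As))

  cochains : ℕ → List (List Bool)
  cochains m = allBools (length (faces n (suc m)))

  Bad₁ Bad₂ Bad₃ Bad₄ Bad : List Bool → Bool
  Bad₁ U = any (λ σ → bad₁ σ U) (tuples d)
  Bad₂ U = any (λ m → any (λ ρ → any (λ hb → bad₂ m ρ hb U) (cochains m)) (tuples (d ∸ suc m))) (upTo d)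
  Bad₃ U = any (λ m → any (λ ρ → any (λ hb → bad₃ m ρ hb U) (cochains m)) (tuples (d ∸ suc m))) (upTo d)
  Bad₄ U = any (λ w → any (λ ξ → any (λ As → bad₄ w ξ As U) (allBools n)) (tuples (d ∸ 1))) (upTo (suc n))
  Bad U = (Bad₁ U ∨ Bad₂ U) ∨ (Bad₃ U ∨ Bad₄ U)

  tuples⁺ : ∀ {ρ r} → length ρ ≡ r → Unique ρ → All (_∈ V) ρ → ρ ∈ tuples r
  tuples⁺ {ρ} {r} refl u al = ∈-filterᵇ⁺ distinctᵇ (allTuples V r) (∈-allTuples V ρ al) (Unique⇒distinctᵇ u)

  tuples⁻ : ∀ {ρ} r → ρ ∈ tuples r → length ρ ≡ r × Unique ρ × All (_∈ V) ρ
  tuples⁻ {ρ} r m with ∈-filterᵇ⁻ distinctᵇ (allTuples V r) m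
  ... | p , q with allTuples⁻ V r p
  ... | l , al = l , distinctᵇ⇒Unique ρ q , al

  trues-event : ∀ M ρ {ψ} → Sym ψ → length ρ + M ≡ suc d → Unique ρ → All (_∈ V) ρ →
    M ! * trues (event ρ ψ) ≡ T# M (λ zs → χ (distinctᵇ (ρ ++ zs) ∧ ψ zs))
  trues-event M ρ {ψ} s l u al = trans (cong (M ! *_) (sym (trues-count D (over ρ ψ))))
    (trans (count-over (λ _ → true) (suc d) M ρ s l u al) (T-cong M (λ zs _ _ → cong (λ z → χ (z ∧ ψ zs)) (Boolₚ.∧-identityʳ (distinctᵇ (ρ ++ zs))))))

  agree : ∀ s {h} → Sym h → Distinct h → ∀ ys → length ys ≡ s → All (_∈ V) ys → cochain s (map h (faces n s)) ys ≡ h ys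
  agree s {h} hs hd ys l al = trans (restrict (true-or-false (distinctᵇ ys))) (ext-restrict hs hd ys al)
    where
    restrict : (distinctᵇ ys ≡ true) ⊎ (distinctᵇ ys ≡ false) → cochain s (map h (faces n s)) ys ≡ ext h ys
    restrict (inj₂ e) = trans (cong (_∧ lookupFace (faces n s) (map h (faces n s)) (canon ys)) e) (sym (cong (_∧ h (canon ys)) e))
    restrict (inj₁ e) = cong (distinctᵇ ys ∧_) (lookupFace-map (faces n s) h (canon∈ l (distinctᵇ⇒Unique ys e) al))

  dl-agree : ∀ s {h} → Sym h → Distinct h → ∀ zs → length zs ≡ suc s → All (_∈ V) zs → dl (cochain s (map h (faces n s))) zs ≡ dl h zs
  dl-agree s hs hd zs l al = dl-cong zs (λ y ys p → agree s hs hd ys (ℕₚ.suc-injective (trans (sym (Permₚ.↭-length p)) l)) (All.tail (Permₚ.All-resp-↭ p al)))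

  cochain∈ : ∀ m (h : Tuple → Bool) → map h (faces n (suc m)) ∈ cochains m
  cochain∈ m h = ∈-allBools⁺ (map h (faces n (suc m))) (Listₚ.length-map h (faces n (suc m)))

  module _ (U : List Bool) (lU : length U ≡ length D) where

    X̂U : Tuple → Bool
    X̂U = ext (inList (select D U))

    common-event : ∀ M ρ {ψ} → Sym ψ → length ρ + M ≡ suc d → Unique ρ → All (_∈ V) ρ →
      M ! * common U (event ρ ψ) ≡ T# M (λ zs → χ (X̂U (ρ ++ zs) ∧ ψ zs))
    common-event M ρ {ψ} s l u al = trans (cong (M ! *_) (sym (common-count D U (over ρ ψ) (subsetsOf-unique (suc d) V-sorted) lU)))
      (count-over (inList (select D U)) (suc d) M ρ s l u al)

    module _ (16L≤k : 16 * (L * suc d !) ≤ k) (0<L : 0 < L) (Θ≤n : Θ ≤ n) (0<d : 0 < d) (good : Bad U ≡ false) where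

      private
        or-false : ∀ {x y} → x ∨ y ≡ false → x ≡ false × y ≡ false
        or-false {false} {false} _ = refl , refl

        good₁ : Bad₁ U ≡ false
        good₁ = proj₁ (or-false (proj₁ (or-false {Bad₁ U ∨ Bad₂ U} good)))
        good₂ : Bad₂ U ≡ false
        good₂ = proj₂ (or-false {Bad₁ U} (proj₁ (or-false {Bad₁ U ∨ Bad₂ U} good)))
        good₃ : Bad₃ U ≡ false
        good₃ = proj₁ (or-false (proj₂ (or-false {Bad₁ U ∨ Bad₂ U} good)))
        good₄ : Bad₄ U ≡ false
        good₄ = proj₂ (or-false {Bad₃ U} (proj₂ (or-false {Bad₁ U ∨ Bad₂ U} good)))

        nV : length V ≡ n
        nV = length-V

        !-pos : ∀ m → 1 ≤ m !
        !-pos m = >-nonZero⁻¹ (m !) {{ℕₚ._!≢0 m}}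

      min-degree : ∀ σ → length σ ≡ d → Unique σ → All (_∈ V) σ → a ≤ sumL V (λ x → χ (X̂U (x ∷ σ)))
      min-degree σ l u al = ℕₚ.≤-trans (<ᵇ-false (any-false (λ σ → bad₁ σ U) (tuples d) good₁ (tuples⁺ l u al)))
        (ℕₚ.≤-reflexive (trans (sym (ℕₚ.*-identityˡ _)) (trans (common-event 1 σ (λ _ → refl) (trans (cong (_+ 1) l) (ℕₚ.+-comm d 1)) u al)
          (sumL-cong V (λ x _ → cong χ (trans (Boolₚ.∧-identityʳ (X̂U (σ ++ x ∷ []))) (ext-sym (inList (select D U)) (↭-trans (Permₚ.shift x σ []) (prep x (↭-reflexive (Listₚ.++-identityʳ σ)))))))))))

      private
        module Link (ρ : Tuple) (m : ℕ) (h : Tuple → Bool) (l : length ρ + suc m ≡ d) (hs : Sym h) (hd : Distinct h) where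
          hb : List Bool
          hb = map h (faces n (suc m))
          m<d : m < d
          m<d = ℕₚ.≤-trans (ℕₚ.m≤n+m (suc m) (length ρ)) (ℕₚ.≤-reflexive l)
          lρ : length ρ ≡ d ∸ suc m
          lρ = trans (sym (ℕₚ.m+n∸n≡m (length ρ) (suc m))) (cong (_∸ suc m) l)
          l₂ : length ρ + suc (suc m) ≡ suc d
          l₂ = trans (ℕₚ.+-suc (length ρ) (suc m)) (cong suc l)
          ĥ : Tuple → Bool
          ĥ = cochain (suc m) hb
          ĥ-sym : Sym ĥ
          ĥ-sym = ext-sym (lookupFace (faces n (suc m)) hb)

      upper : ∀ ρ m h → length ρ + suc m ≡ d → Unique ρ → All (_∈ V) ρ → Sym h → Distinct h →
        Θ * sumL V (λ x → T# (suc m) (λ ys → χ (X̂U (ρ ++ x ∷ ys) ∧ h ys))) ≤ 8 * (c₁ * suc d !) * k * (Θ * T# (suc m) (χ ∘ h) + length V ^ suc m)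
      upper ρ m h l u al hs hd = begin
        Θ * sumL V (λ x → T# (suc m) (λ ys → χ (X̂U (ρ ++ x ∷ ys) ∧ h ys)))
          ≤⟨ ℕₚ.*-monoʳ-≤ Θ (sumL-mono V (λ x _ → T-mono (suc m) (λ ys ly aly → χ-mono {X̂U (ρ ++ x ∷ ys) ∧ h ys} {X̂U (ρ ++ x ∷ ys) ∧ touches ĥ (x ∷ ys)} (λ e → ∧-intro {X̂U (ρ ++ x ∷ ys)} (∧-trueˡ {X̂U (ρ ++ x ∷ ys)} {h ys} e)
               (first x ys (trans (agree (suc m) hs hd ys ly aly) (∧-trueʳ {X̂U (ρ ++ x ∷ ys)} e))))))) ⟩
        Θ * T# (suc (suc m)) (λ zs → χ (X̂U (ρ ++ zs) ∧ touches ĥ zs))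
          ≡⟨ cong (Θ *_) (sym (common-event (suc (suc m)) ρ (touches-sym ĥ-sym) l₂ u al)) ⟩
        Θ * (suc (suc m) ! * common U (event₂ m ρ hb))
          ≤⟨ ℕₚ.*-monoʳ-≤ Θ (ℕₚ.*-mono-≤ (!-mono (s≤s m<d)) (ℕₚ.<⇒≤ (≤ᵇ-false (any-false (λ hb → bad₂ m ρ hb U) (cochains m)
               (any-false (λ ρ → any (λ hb → bad₂ m ρ hb U) (cochains m)) (tuples (d ∸ suc m)) (any-false (λ m → any (λ ρ → any (λ hb → bad₂ m ρ hb U) (cochains m)) (tuples (d ∸ suc m))) (upTo d) good₂ (∈ₚ.∈-upTo⁺ m<d)) (tuples⁺ lρ u al)) (cochain∈ m h))))) ⟩
        Θ * (suc d ! * (4 * (c₁ * (k * (T# (suc m) (χ ∘ ĥ) + suc q)))))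
          ≡⟨ cong (λ z → Θ * (suc d ! * (4 * (c₁ * (k * (z + suc q)))))) (T-cong (suc m) (λ ys ly aly → cong χ (agree (suc m) hs hd ys ly aly))) ⟩
        Θ * (suc d ! * (4 * (c₁ * (k * (h# + suc q)))))
          ≡⟨ lem Θ (suc d !) c₁ k h# (suc q) ⟩
        4 * (c₁ * suc d !) * k * (Θ * h# + Θ * suc q)
          ≤⟨ ℕₚ.*-monoʳ-≤ (4 * (c₁ * suc d !) * k) (ℕₚ.+-mono-≤ (ℕₚ.m≤m+n (Θ * h#) (Θ * h#)) q≤) ⟩
        4 * (c₁ * suc d !) * k * ((Θ * h# + Θ * h#) + 2 * n ^ suc m)
          ≡⟨ lem₂ (c₁ * suc d !) k (Θ * h#) (n ^ suc m) ⟩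
        8 * (c₁ * suc d !) * k * (Θ * h# + n ^ suc m)
          ≡⟨ cong (λ z → 8 * (c₁ * suc d !) * k * (Θ * h# + z ^ suc m)) (sym nV) ⟩
        8 * (c₁ * suc d !) * k * (Θ * h# + length V ^ suc m) ∎
        where
        open ℕₚ.≤-Reasoning
        open Link ρ m h l hs hd
        h# = T# (suc m) (χ ∘ h)
        q = n ^ suc m / Θ
        first : ∀ x ys → ĥ ys ≡ true → touches ĥ (x ∷ ys) ≡ true
        first x ys e = cong (_∨ pickAny (λ _ r → ĥ (x ∷ r)) ys) e
        -- Rounding the error term up costs at most `Θ`, which `n ^ suc m` absorbs because `Θ ≤ n`.
        q≤ : Θ * suc q ≤ 2 * n ^ suc m
        q≤ = begin
          Θ * suc q               ≡⟨ trans (ℕₚ.*-suc Θ q) (ℕₚ.+-comm Θ (Θ * q)) ⟩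
          Θ * q + Θ               ≤⟨ ℕₚ.+-mono-≤ (ℕₚ.≤-trans (ℕₚ.≤-reflexive (ℕₚ.*-comm Θ q)) (m/n*n≤m (n ^ suc m) Θ)) (ℕₚ.≤-trans Θ≤n (ℕₚ.m≤m*n n (n ^ m) {{ℕₚ.m^n≢0 n m}})) ⟩
          n ^ suc m + n ^ suc m   ≡⟨ dbl (n ^ suc m) ⟩
          2 * n ^ suc m ∎
          where
          dbl : ∀ x → x + x ≡ 2 * x
          dbl = ℕSolver.solve-∀
        lem : ∀ t f c k h q → t * (f * (4 * (c * (k * (h + q))))) ≡ 4 * (c * f) * k * (t * h + t * q)
        lem = ℕSolver.solve-∀
        lem₂ : ∀ c k x y → 4 * c * k * ((x + x) + 2 * y) ≡ 8 * c * k * (x + y)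
        lem₂ = ℕSolver.solve-∀

      lower : ∀ ρ m h → length ρ + suc m ≡ d → Unique ρ → All (_∈ V) ρ → Sym h → Distinct h →
        length V ^ suc (suc m) ≤ L * T# (suc (suc m)) (λ zs → χ (distinctᵇ (ρ ++ zs) ∧ dl h zs)) →
        k * T# (suc (suc m)) (λ zs → χ (distinctᵇ (ρ ++ zs) ∧ dl h zs)) ≤ 32 * length V * T# (suc (suc m)) (λ zs → χ (X̂U (ρ ++ zs) ∧ dl h zs))
      lower ρ m h l u al hs hd big = begin
        k * T# (suc (suc m)) (λ zs → χ (distinctᵇ (ρ ++ zs) ∧ dl h zs))       ≡⟨ cong (k *_) (sym trues≡) ⟩
        k * (suc (suc m) ! * t)                                             ≡⟨ lem₁ k (suc (suc m) !) t ⟩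
        suc (suc m) ! * (k * t)                                             ≤⟨ ℕₚ.*-monoʳ-≤ (suc (suc m) !) (ℕₚ.≤-trans kt-≤ (ℕₚ.*-monoʳ-≤ (32 * n) q≤common)) ⟩
        suc (suc m) ! * (32 * n * c)                                        ≡⟨ lem₁ (suc (suc m) !) (32 * n) c ⟩
        32 * n * (suc (suc m) ! * c)                                        ≡⟨ cong₂ (λ x y → 32 * x * y) (sym nV) common≡ ⟩
        32 * length V * T# (suc (suc m)) (λ zs → χ (X̂U (ρ ++ zs) ∧ dl h zs)) ∎
        where
        open ℕₚ.≤-Reasoning
        open Link ρ m h l hs hd
        lem₁ : ∀ x y z → x * (y * z) ≡ y * (x * z)
        lem₁ = ℕSolver.solve-∀
        t = trues (event₃ m ρ hb)
        c = common U (event₃ m ρ hb)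
        q = threshold₃ m ρ hb
        trues≡ : suc (suc m) ! * t ≡ T# (suc (suc m)) (λ zs → χ (distinctᵇ (ρ ++ zs) ∧ dl h zs))
        trues≡ = trans (trues-event (suc (suc m)) ρ (dl-sym ĥ-sym) l₂ u al) (T-cong (suc (suc m)) (λ zs lz az → cong (λ b → χ (distinctᵇ (ρ ++ zs) ∧ b)) (dl-agree (suc m) hs hd zs lz az)))
        common≡ : suc (suc m) ! * c ≡ T# (suc (suc m)) (λ zs → χ (X̂U (ρ ++ zs) ∧ dl h zs))
        common≡ = trans (common-event (suc (suc m)) ρ (dl-sym ĥ-sym) l₂ u al) (T-cong (suc (suc m)) (λ zs lz az → cong (λ b → χ (X̂U (ρ ++ zs) ∧ b)) (dl-agree (suc m) hs hd zs lz az)))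
        big′ : n ^ suc (suc m) ≤ L * (suc (suc m) ! * t)
        big′ = subst₂ (λ x y → x ^ suc (suc m) ≤ L * y) nV (sym trues≡) big
        q≤common : q ≤ c
        q≤common = <ᵇ-false (trans (sym (cong (_∧ (c <ᵇ q)) (T⇒≡ (ℕₚ.≤⇒≤ᵇ big′)))) (any-false (λ hb → bad₃ m ρ hb U) (cochains m)
          (any-false (λ ρ → any (λ hb → bad₃ m ρ hb U) (cochains m)) (tuples (d ∸ suc m)) (any-false (λ m → any (λ ρ → any (λ hb → bad₃ m ρ hb U) (cochains m)) (tuples (d ∸ suc m))) (upTo d) good₃ (∈ₚ.∈-upTo⁺ m<d)) (tuples⁺ lρ u al)) (cochain∈ m h)))
        -- This makes the rounded threshold `q` positive, so that rounding costs at most a factor 2;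
        -- hence 32 instead of 16.
        many : 16 * n ≤ k * t
        many = ℕₚ.*-cancelˡ-≤ (L * suc d !) {{ℕₚ.m*n≢0 L (suc d !) {{>-nonZero 0<L}} {{ℕₚ._!≢0 (suc d)}}}} (begin
          L * suc d ! * (16 * n)                      ≡⟨ lem₂ (L * suc d !) n ⟩
          16 * (L * suc d !) * n                      ≤⟨ ℕₚ.*-mono-≤ 16L≤k (ℕₚ.≤-trans (ℕₚ.m≤m*n n (n ^ suc m) {{ℕₚ.m^n≢0 n (suc m)}}) big′) ⟩
          k * (L * (suc (suc m) ! * t))               ≤⟨ ℕₚ.*-monoʳ-≤ k (ℕₚ.*-monoʳ-≤ L (ℕₚ.*-monoˡ-≤ t (!-mono (s≤s m<d)))) ⟩
          k * (L * (suc d ! * t))                     ≡⟨ lem₃ k L (suc d !) t ⟩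
          L * suc d ! * (k * t) ∎)
          where
          lem₂ : ∀ x n → x * (16 * n) ≡ 16 * x * n
          lem₂ = ℕSolver.solve-∀
          lem₃ : ∀ k l f t → k * (l * (f * t)) ≡ l * f * (k * t)
          lem₃ = ℕSolver.solve-∀
        q*-≤ : k * t < suc q * (16 * n)
        q*-≤ = subst (_< suc q * (16 * n)) (sym (m≡m%n+[m/n]*n (k * t) (16 * n))) (ℕₚ.+-monoˡ-< (q * (16 * n)) (m%n<n (k * t) (16 * n)))
        q-pos : 1 ≤ q
        q-pos with q in e
        ... | zero = ⊥-elim (ℕₚ.<⇒≱ (subst (λ z → k * t < suc z * (16 * n)) e q*-≤) (ℕₚ.≤-trans (ℕₚ.≤-reflexive (ℕₚ.*-identityˡ (16 * n))) many))
        ... | suc _ = s≤s z≤n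
        kt-≤ : k * t ≤ 32 * n * q
        kt-≤ = ℕₚ.≤-trans (ℕₚ.<⇒≤ q*-≤) (ℕₚ.≤-trans (ℕₚ.*-monoˡ-≤ (16 * n) (ℕₚ.+-monoˡ-≤ q q-pos)) (ℕₚ.≤-reflexive (lem₂ q n)))
          where
          lem₂ : ∀ q n → (q + q) * (16 * n) ≡ 32 * n * q
          lem₂ = ℕSolver.solve-∀

      tiny : ∀ ξ (A : ℕ → Bool) → suc (length ξ) ≡ d → Unique ξ → All (_∈ V) ξ → H 0 * sumL V (χ ∘ A) < length V →
        sumL V (λ u → sumL V (λ v → χ (X̂U (u ∷ v ∷ ξ) ∧ (A u ∧ A v)))) ≤ 2 * b′ * sumL V (χ ∘ A)
      tiny ξ A l u al small = begin
        sumL V (λ u → sumL V (λ v → χ (X̂U (u ∷ v ∷ ξ) ∧ (A u ∧ A v))))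
          ≡⟨ sumL-cong V (λ u u∈ → sumL-cong V (λ v v∈ → cong χ (cong₂ _∧_ (ext-sym (inList (select D U)) (Permₚ.++-comm (u ∷ v ∷ []) ξ)) (cong₂ _∧_ (sym (bits u∈)) (trans (sym (bits v∈)) (sym (Boolₚ.∧-identityʳ (bitAt As v)))))))) ⟩
        T# 2 (λ zs → χ (X̂U (ξ ++ zs) ∧ all (bitAt As) zs))
          ≡⟨ sym (common-event 2 ξ (all-sym (bitAt As)) (trans (ℕₚ.+-comm (length ξ) 2) (cong suc l)) u al) ⟩
        2 * common U (event₄ ξ As)
          ≤⟨ ℕₚ.*-monoʳ-≤ 2 {common U (event₄ ξ As)} {b′ * w} (<ᵇ-false {b′ * w} {common U (event₄ ξ As)} notbad) ⟩
        2 * (b′ * w)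
          ≡⟨ sym (ℕₚ.*-assoc 2 b′ w) ⟩
        2 * b′ * w ∎
        where
        open ℕₚ.≤-Reasoning
        As = map A V
        w = sumL V (χ ∘ A)
        bits : ∀ {x} → x ∈ V → bitAt As x ≡ A x
        bits m = bitAt-upTo A n (∈ₚ.∈-upTo⁻ m)
        As∈ : As ∈ allBools n
        As∈ = ∈-allBools⁺ As (trans (Listₚ.length-map A V) nV)
        w≤n : w ≤ n
        w≤n = ℕₚ.≤-trans (sumL-mono V (λ x _ → χ-≤1 (A x))) (ℕₚ.≤-reflexive (trans (sumL-const V 1) (trans (ℕₚ.*-identityʳ (length V)) nV)))
        trues-w : trues As ≡ w
        trues-w = sym (trues-count V A)
        lξ : length ξ ≡ d ∸ 1
        lξ = cong (_∸ 1) l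
        prem : (trues As ≡ᵇ w) ∧ (H 0 * w <ᵇ n) ≡ true
        prem = ∧-intro (T⇒≡ (ℕₚ.≡⇒≡ᵇ (trues As) w trues-w)) (T⇒≡ (ℕₚ.<⇒<ᵇ (subst (H 0 * w <_) nV small)))
        notbad : (b′ * w <ᵇ common U (event₄ ξ As)) ≡ false
        notbad = trans (sym (cong (_∧ (b′ * w <ᵇ common U (event₄ ξ As))) prem)) (any-false (λ As → bad₄ w ξ As U) (allBools n)
          (any-false (λ ξ → any (λ As → bad₄ w ξ As U) (allBools n)) (tuples (d ∸ 1)) (any-false (λ w → any (λ ξ → any (λ As → bad₄ w ξ As U) (allBools n)) (tuples (d ∸ 1))) (upTo (suc n)) good₄ (∈ₚ.∈-upTo⁺ (s≤s w≤n))) (tuples⁺ lξ u al)) As∈)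

      quasirandom : Quasirandom n d X̂U H a (2 * b′) k (8 * (c₁ * suc d !)) 32 L Θ
      quasirandom = record { min-degree = min-degree ; upper = upper ; lower = lower ; tiny = tiny }

-- Probabilities of the exceptional events

ℕ→ℚ-cancel : ∀ {a b} → ℕ→ℚ a ≤ℚ ℕ→ℚ b → a ≤ b
ℕ→ℚ-cancel {a} {b} h = ℕₚ.≮⇒≥ λ b<a → ℚₚ.<-irrefl refl (ℚₚ.<-≤-trans (strict b<a) h)
  where
  strict : b < a → ℕ→ℚ b <ℚ ℕ→ℚ a
  strict b<a = subst₂ _<ℚ_ (ℚₚ.+-identityʳ (ℕ→ℚ b)) (trans (sym (ℕ→ℚ-+ b (a ∸ b))) (cong ℕ→ℚ (ℕₚ.m+[n∸m]≡n (ℕₚ.<⇒≤ b<a))))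
    (ℚₚ.+-monoʳ-< (ℕ→ℚ b) (ℕ→ℚ-pos (a ∸ b) (ℕₚ.m<n⇒0<n∸m b<a)))

-- Numerical estimates for small sets

*-^ : ∀ e x y → (x * y) ^ e ≡ x ^ e * y ^ e
*-^ zero x y = refl
*-^ (suc e) x y = trans (cong (x * y *_) (*-^ e x y)) (lem x y (x ^ e) (y ^ e))
  where
  lem : ∀ x y p q → x * y * (p * q) ≡ x * p * (y * q)
  lem = ℕSolver.solve-∀

-- This is `(1 + 1 / w)^w ≤ 4`, a case of `exp⁺`.
suc-pow-≤ : ∀ w → suc w ^ w ≤ 4 * w ^ w
suc-pow-≤ zero = s≤s z≤n
suc-pow-≤ w@(suc _) = ℕ→ℚ-cancel (begin
  ℕ→ℚ (suc w ^ w)                                   ≡⟨ ℕ→ℚ-^ (suc w) w ⟩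
  ℕ→ℚ (suc w) ^ℚ w                                  ≡⟨ cong (_^ℚ w) base ⟩
  ((1ℚ +ℚ inv w) *ℚ ℕ→ℚ w) ^ℚ w                     ≡⟨ pow-distrib (1ℚ +ℚ inv w) (ℕ→ℚ w) w ⟩
  (1ℚ +ℚ inv w) ^ℚ w *ℚ ℕ→ℚ w ^ℚ w                  ≤⟨ mulʳ (ℕ→ℚ w ^ℚ w) (pow-nonneg w (ℕ→ℚ-nonneg w)) (exp⁺ w 1 (s≤s z≤n) (inv-nonneg w 0<w) (ℚₚ.≤-reflexive (trans (ℚₚ.*-comm (ℕ→ℚ w) (inv w)) (inv-* w 0<w)))) ⟩
  2ℚ ^ℚ 2 *ℚ ℕ→ℚ w ^ℚ w                             ≡⟨ cong (2ℚ ^ℚ 2 *ℚ_) (sym (ℕ→ℚ-^ w w)) ⟩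
  ℕ→ℚ 4 *ℚ ℕ→ℚ (w ^ w)                              ≡⟨ sym (ℕ→ℚ-* 4 (w ^ w)) ⟩
  ℕ→ℚ (4 * w ^ w) ∎)
  where
  open ℚₚ.≤-Reasoning
  0<w : 0 < w
  0<w = s≤s z≤n
  lem : ∀ i x → i *ℚ x +ℚ x ≡ (1ℚ +ℚ i) *ℚ x
  lem = solve-∀ ℚring
  base : ℕ→ℚ (suc w) ≡ (1ℚ +ℚ inv w) *ℚ ℕ→ℚ w
  base = trans (ℕ→ℚ-+ 1 w) (trans (cong (_+ℚ ℕ→ℚ w) (sym (inv-* w 0<w))) (lem (inv w) (ℕ→ℚ w)))

-- While `4 K w ≤ n`, the quantity `(K w / n)^w` does not increase with `w`, so it is at most its
-- value `K / n` at `w = 1`.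
small-set-power : ∀ K n w → 0 < w → 4 * K * w ≤ n → (K * w) ^ w * n ≤ K * n ^ w
small-set-power K n (suc zero) _ h = ℕₚ.≤-reflexive (lem K n)
  where
  lem : ∀ K n → K * 1 * 1 * n ≡ K * (n * 1)
  lem = ℕSolver.solve-∀
small-set-power K n (suc w@(suc _)) _ h = begin
  (K * suc w) * (K * suc w) ^ w * n          ≡⟨ cong (λ z → (K * suc w) * z * n) (*-^ w K (suc w)) ⟩
  (K * suc w) * (K ^ w * suc w ^ w) * n      ≤⟨ ℕₚ.*-monoˡ-≤ n (ℕₚ.*-monoʳ-≤ (K * suc w) (ℕₚ.*-monoʳ-≤ (K ^ w) (suc-pow-≤ w))) ⟩
  (K * suc w) * (K ^ w * (4 * w ^ w)) * n    ≡⟨ lem K (suc w) (K ^ w) (w ^ w) n ⟩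
  4 * K * suc w * (K ^ w * w ^ w * n)        ≡⟨ cong (λ z → 4 * K * suc w * (z * n)) (sym (*-^ w K w)) ⟩
  4 * K * suc w * ((K * w) ^ w * n)          ≤⟨ ℕₚ.*-mono-≤ h (small-set-power K n w (s≤s z≤n) (ℕₚ.≤-trans (ℕₚ.*-monoʳ-≤ (4 * K) (ℕₚ.n≤1+n w)) h)) ⟩
  n * (K * n ^ w)                            ≡⟨ lem₂ n K (n ^ w) ⟩
  K * (n * n ^ w) ∎
  where
  open ℕₚ.≤-Reasoning
  lem : ∀ K w p q n → (K * w) * (p * (4 * q)) * n ≡ 4 * K * w * (p * q * n)
  lem = ℕSolver.solve-∀
  lem₂ : ∀ n K x → n * (K * x) ≡ K * (n * x)
  lem₂ = ℕSolver.solve-∀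

-- The left side bounds the probability (Kw/n)^((e+2)w) of a dense set of w vertices, the right side is the inverse of the number of such sets.
small-set-bound : ∀ K n w e → 0 < w → 4 * (K * K) * w ≤ n → 0 < K →
  (K * w) ^ ((2 + e) * w) * (n ^ e * (4 * n) ^ w) ≤ K ^ e * w ^ w * n ^ ((2 + e) * w)
small-set-bound K n w e 0<w h 0<K = begin
  (K * w) ^ (w + (w + e * w)) * (n ^ e * (4 * n) ^ w)
    ≡⟨ cong (_* (n ^ e * (4 * n) ^ w)) (trans (ℕₚ.^-distribˡ-+-* (K * w) w (w + e * w)) (cong (Q *_) (ℕₚ.^-distribˡ-+-* (K * w) w (e * w)))) ⟩
  Q * (Q * (K * w) ^ (e * w)) * (n ^ e * (4 * n) ^ w)
    ≡⟨ lem Q ((K * w) ^ (e * w)) (n ^ e) ((4 * n) ^ w) ⟩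
  (K * w) ^ (e * w) * n ^ e * (Q * Q * (4 * n) ^ w)
    ≤⟨ ℕₚ.*-mono-≤ first second ⟩
  K ^ e * n ^ (e * w) * (w ^ w * (n ^ w * n ^ w))
    ≡⟨ lem₂ (K ^ e) (n ^ (e * w)) (w ^ w) (n ^ w) ⟩
  K ^ e * w ^ w * (n ^ w * (n ^ w * n ^ (e * w)))
    ≡⟨ cong (K ^ e * w ^ w *_) (sym (trans (ℕₚ.^-distribˡ-+-* n w (w + e * w)) (cong (n ^ w *_) (ℕₚ.^-distribˡ-+-* n w (e * w))))) ⟩
  K ^ e * w ^ w * n ^ (w + (w + e * w)) ∎
  where
  open ℕₚ.≤-Reasoning
  Q = (K * w) ^ w
  lem : ∀ q r x y → q * (q * r) * (x * y) ≡ r * x * (q * q * y)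
  lem = ℕSolver.solve-∀
  lem₂ : ∀ k m w n → k * m * (w * (n * n)) ≡ k * w * (n * (n * m))
  lem₂ = ℕSolver.solve-∀
  4Kw : 4 * K * w ≤ n
  4Kw = ℕₚ.≤-trans (ℕₚ.*-monoˡ-≤ w (ℕₚ.*-monoʳ-≤ 4 (ℕₚ.≤-trans (ℕₚ.≤-reflexive (sym (ℕₚ.*-identityʳ K))) (ℕₚ.*-monoʳ-≤ K 0<K)))) h
  -- Of the exponent `(2 + e) w`, the part `e w` yields the decay `(K / n)^e`.
  first : (K * w) ^ (e * w) * n ^ e ≤ K ^ e * n ^ (e * w)
  first = begin
    (K * w) ^ (e * w) * n ^ e     ≡⟨ cong (λ z → (K * w) ^ z * n ^ e) (ℕₚ.*-comm e w) ⟩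
    (K * w) ^ (w * e) * n ^ e     ≡⟨ cong (_* n ^ e) (sym (ℕₚ.^-*-assoc (K * w) w e)) ⟩
    Q ^ e * n ^ e                 ≡⟨ sym (*-^ e Q n) ⟩
    (Q * n) ^ e                   ≤⟨ ℕₚ.^-monoˡ-≤ e (small-set-power K n w 0<w 4Kw) ⟩
    (K * n ^ w) ^ e               ≡⟨ *-^ e K (n ^ w) ⟩
    K ^ e * (n ^ w) ^ e           ≡⟨ cong (K ^ e *_) (trans (ℕₚ.^-*-assoc n w e) (cong (n ^_) (ℕₚ.*-comm w e))) ⟩
    K ^ e * n ^ (e * w) ∎
  -- The remaining `2 w` gives `(w / (4 n))^w` to pay for the choice of the set. Here the condition
  -- `4 K² w ≤ n` enters, which is the origin of the value of `H 0`.
  second : Q * Q * (4 * n) ^ w ≤ w ^ w * (n ^ w * n ^ w)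
  second = begin
    Q * Q * (4 * n) ^ w                          ≡⟨ trans (cong (_* (4 * n) ^ w) (sym (*-^ w (K * w) (K * w)))) (sym (*-^ w (K * w * (K * w)) (4 * n))) ⟩
    (K * w * (K * w) * (4 * n)) ^ w              ≤⟨ ℕₚ.^-monoˡ-≤ w (ℕₚ.≤-trans (ℕₚ.≤-reflexive (lem₃ K w n)) (ℕₚ.*-monoʳ-≤ (w * n) h)) ⟩
    (w * n * n) ^ w                              ≡⟨ cong (_^ w) (ℕₚ.*-assoc w n n) ⟩
    (w * (n * n)) ^ w                            ≡⟨ trans (*-^ w w (n * n)) (cong (w ^ w *_) (*-^ w n n)) ⟩
    w ^ w * (n ^ w * n ^ w) ∎
    where
    lem₃ : ∀ K w n → K * w * (K * w) * (4 * n) ≡ w * n * (4 * (K * K) * w)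
    lem₃ = ℕSolver.solve-∀

2ℚ≡ : ∀ k → 2ℚ ^ℚ k ≡ ℕ→ℚ (2 ^ k)
2ℚ≡ k = sym (ℕ→ℚ-^ 2 k)

-- The generating function of subsets by size; it replaces estimates of binomial coefficients.
∑-power-trues : ∀ n y → ∑ (allBools n) (λ As → y ^ℚ trues As) ≡ (1ℚ +ℚ y) ^ℚ n
∑-power-trues zero y = refl
∑-power-trues (suc n) y = trans (∑-allBools n (λ As → y ^ℚ trues As)) (trans (cong (_+ℚ ∑ (allBools n) (λ As → y ^ℚ trues As)) (∑-*ˡ (allBools n) y _))
  (trans (lem y (∑ (allBools n) (λ As → y ^ℚ trues As))) (cong ((1ℚ +ℚ y) *ℚ_) (∑-power-trues n y))))
  where
  lem : ∀ y s → y *ℚ s +ℚ s ≡ (1ℚ +ℚ y) *ℚ s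
  lem = solve-∀ ℚring

∑-bound : ∀ {I : Set} (is : List I) (φ : I → ℚ) x y → (∀ i → i ∈ is → φ i *ℚ x ≤ℚ y) → ∑ is φ *ℚ x ≤ℚ ℕ→ℚ (length is) *ℚ y
∑-bound [] φ x y h = ℚₚ.≤-reflexive (trans (ℚₚ.*-zeroˡ x) (sym (ℚₚ.*-zeroˡ y)))
∑-bound (i ∷ is) φ x y h = begin
  (φ i +ℚ ∑ is φ) *ℚ x                    ≡⟨ ℚₚ.*-distribʳ-+ x (φ i) (∑ is φ) ⟩
  φ i *ℚ x +ℚ ∑ is φ *ℚ x                 ≤⟨ ℚₚ.+-mono-≤ (h i (here refl)) (∑-bound is φ x y (λ j m → h j (there m))) ⟩
  y +ℚ ℕ→ℚ (length is) *ℚ y               ≡⟨ lem y (ℕ→ℚ (length is)) ⟩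
  (1ℚ +ℚ ℕ→ℚ (length is)) *ℚ y            ≡⟨ cong (_*ℚ y) (sym (ℕ→ℚ-+ 1 (length is))) ⟩
  ℕ→ℚ (suc (length is)) *ℚ y ∎
  where
  open ℚₚ.≤-Reasoning
  lem : ∀ y l → y +ℚ l *ℚ y ≡ (1ℚ +ℚ l) *ℚ y
  lem = solve-∀ ℚring

common-≤-trues : ∀ S E → common S E ≤ trues E
common-≤-trues [] [] = z≤n
common-≤-trues [] (e ∷ E) = z≤n
common-≤-trues (true ∷ S) [] = z≤n
common-≤-trues (false ∷ S) [] = z≤n
common-≤-trues (true ∷ S) (true ∷ E) = s≤s (common-≤-trues S E)
common-≤-trues (true ∷ S) (false ∷ E) = common-≤-trues S E
common-≤-trues (false ∷ S) (true ∷ E) = ℕₚ.m≤n⇒m≤1+n (common-≤-trues S E)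
common-≤-trues (false ∷ S) (false ∷ E) = common-≤-trues S E

select-∖ : ∀ (D : List Face) (E : Face → Bool) acc {x} → x ∈ select D (map E D ∖ᵇ acc) → E x ≡ true
select-∖ (τ ∷ D) E (true ∷ acc) m with E τ in e
... | true = select-∖ D E acc m
... | false = select-∖ D E acc m
select-∖ (τ ∷ D) E (false ∷ acc) m with E τ in e
select-∖ (τ ∷ D) E (false ∷ acc) (here refl) | true = e
select-∖ (τ ∷ D) E (false ∷ acc) (there m) | true = select-∖ D E acc m
... | false = select-∖ D E acc m

-- Union bound over the position of the additional vertex.
T-touches : ∀ n → let open Vertices n in ∀ M (h : Tuple → Bool) → T# (suc M) (χ ∘ touches h) ≤ suc M * (length V * T# M (χ ∘ h))
T-touches n M h = go M h
  where
  open Vertices n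
  open ℕₚ.≤-Reasoning
  ∨-≤ : ∀ a b → χ (a ∨ b) ≤ χ a + χ b
  ∨-≤ true b = s≤s z≤n
  ∨-≤ false b = ℕₚ.≤-refl
  go : ∀ M (h : Tuple → Bool) → T# (suc M) (χ ∘ touches h) ≤ suc M * (length V * T# M (χ ∘ h))
  go M h = begin
    sumL V (λ x → T# M (λ ys → χ (h ys ∨ touches (λ r → h (x ∷ r)) ys)))
      ≤⟨ sumL-mono V (λ x _ → ℕₚ.≤-trans (T-mono M (λ ys _ _ → ∨-≤ (h ys) _)) (ℕₚ.≤-reflexive (T-+ M (χ ∘ h) _))) ⟩
    sumL V (λ x → T# M (χ ∘ h) + T# M (χ ∘ touches (λ r → h (x ∷ r))))
      ≡⟨ trans (sumL-+ V _ _) (cong (_+ sumL V (λ x → T# M (χ ∘ touches (λ r → h (x ∷ r))))) (sumL-const V (T# M (χ ∘ h)))) ⟩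
    length V * T# M (χ ∘ h) + sumL V (λ x → T# M (χ ∘ touches (λ r → h (x ∷ r))))
      ≤⟨ ℕₚ.+-monoʳ-≤ (length V * T# M (χ ∘ h)) (rest M h) ⟩
    length V * T# M (χ ∘ h) + M * (length V * T# M (χ ∘ h)) ∎
    where
    rest : ∀ M h → sumL V (λ x → T# M (χ ∘ touches (λ r → h (x ∷ r)))) ≤ M * (length V * T# M (χ ∘ h))
    rest zero h = ℕₚ.≤-reflexive (sumL-0 V)
    rest (suc M) h = begin
      sumL V (λ x → T# (suc M) (χ ∘ touches (λ r → h (x ∷ r))))               ≤⟨ sumL-mono V (λ x _ → go M (λ r → h (x ∷ r))) ⟩
      sumL V (λ x → suc M * (length V * T# M (λ r → χ (h (x ∷ r)))))          ≡⟨ trans (sumL-*ˡ V (suc M) _) (cong (suc M *_) (sumL-*ˡ V (length V) _)) ⟩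
      suc M * (length V * T# (suc M) (χ ∘ h)) ∎

½ : ℚ
½ = inv 2

½*2 : ½ *ℚ 2ℚ ≡ 1ℚ
½*2 = inv-* 2 (s≤s z≤n)

scale-cancel : ∀ {x y} c → 0ℚ <ℚ c → x *ℚ c ≤ℚ y *ℚ c → x ≤ℚ y
scale-cancel c h = ℚₚ.*-cancelʳ-≤-pos c {{ℚ.positive h}}

pow-pos : ∀ {x} k → 0ℚ <ℚ x → 0ℚ <ℚ x ^ℚ k
pow-pos zero h = ℚₚ.positive⁻¹ 1ℚ
pow-pos {x} (suc k) h = subst (_<ℚ x *ℚ x ^ℚ k) (ℚₚ.*-zeroˡ (x ^ℚ k)) (ℚₚ.*-monoˡ-<-pos (x ^ℚ k) {{ℚ.positive (pow-pos k h)}} h)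

0<2ℚ : 0ℚ <ℚ 2ℚ
0<2ℚ = ℕ→ℚ-pos 2 (s≤s z≤n)

-- Failure probability of a single event

module Probability (n d ℓ : ℕ) (μ : List Bool → ℚ) (law : IsDeterminantalHypertreeLaw n d ℓ μ)
  (H : ℕ → ℕ) (a b′ k L Θ : ℕ) {{Θ≢0 : NonZero Θ}} {{n≢0 : NonZero n}} (d<n : d < n) where

  c₁ : ℕ
  c₁ = suc d + ℓ

  open Union n d ℓ μ law public
  open Events n d H a b′ k c₁ L Θ public hiding (D)

  0<n : 0 < n
  0<n = ℕₚ.≤-trans (s≤s z≤n) d<n

  0<nℓ : 0 < n + ℓ
  0<nℓ = ℕₚ.≤-trans 0<n (ℕₚ.m≤m+n n ℓ)

  nℚ : ℚ
  nℚ = ℕ→ℚ n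

  0<nℚ : 0ℚ <ℚ nℚ
  0<nℚ = ℕ→ℚ-pos n 0<n

  p≡ : p ≡ ℕ→ℚ c₁ *ℚ inv (n + ℓ)
  p≡ = safeDiv-inv (ℕ→ℚ c₁) (n + ℓ) 0<nℓ

  p≥0 : 0ℚ ≤ℚ p
  p≥0 = subst (0ℚ ≤ℚ_) (sym p≡) (mul-nonneg (ℕ→ℚ-nonneg c₁) (inv-nonneg (n + ℓ) 0<nℓ))

  p≤ : p ≤ℚ ℕ→ℚ c₁ *ℚ inv n
  p≤ = subst (_≤ℚ ℕ→ℚ c₁ *ℚ inv n) (sym p≡) (frac-mono c₁ c₁ 0<nℓ 0<n (ℕₚ.*-monoʳ-≤ c₁ (ℕₚ.m≤m+n n ℓ)))

  p≥ : inv n ≤ℚ p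
  p≥ = subst₂ _≤ℚ_ (ℚₚ.*-identityˡ (inv n)) (sym p≡) (frac-mono 1 c₁ 0<n 0<nℓ (begin
    1 * (n + ℓ)              ≡⟨ ℕₚ.*-identityˡ (n + ℓ) ⟩
    n + ℓ                    ≤⟨ ℕₚ.+-monoʳ-≤ n (ℕₚ.≤-trans (ℕₚ.m≤m*n ℓ n) (ℕₚ.*-monoˡ-≤ n (ℕₚ.m≤n+m ℓ d))) ⟩
    n + (d + ℓ) * n ∎))
    where open ℕₚ.≤-Reasoning

  p≤1 : p ≤ℚ 1ℚ
  p≤1 = subst₂ _≤ℚ_ (sym p≡) (trans (cong (1ℚ *ℚ_) inv1) (ℚₚ.*-identityʳ 1ℚ)) (frac-mono c₁ 1 {n + ℓ} {1} 0<nℓ (s≤s z≤n)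
    (ℕₚ.≤-trans (ℕₚ.≤-reflexive (ℕₚ.*-identityʳ c₁)) (ℕₚ.≤-trans (ℕₚ.+-monoˡ-≤ ℓ d<n) (ℕₚ.≤-reflexive (sym (ℕₚ.*-identityˡ (n + ℓ)))))))
    where
    inv1 : inv 1 ≡ 1ℚ
    inv1 = trans (sym (ℚₚ.*-identityʳ (inv 1))) (inv-* 1 (s≤s z≤n))

  length-event : ∀ ρ ψ → length (event ρ ψ) ≡ size
  length-event ρ ψ = Listₚ.length-map (over ρ ψ) D

  Pr-≥0 : ∀ Q → 0ℚ ≤ℚ Pr k Q none
  Pr-≥0 Q = Pr-nonneg k Q none length-none

  -- While σ has degree less than a, a new tree adds a face over σ except with probability at most (a+1)/n.
  module _ (σ : Tuple) (σ∈ : σ ∈ tuples d) (d+a<n : d + a < n) where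

    private
      σl : length σ ≡ d
      σl = proj₁ (tuples⁻ d σ∈)
      σu : Unique σ
      σu = proj₁ (proj₂ (tuples⁻ d σ∈))
      σa : All (_∈ V) σ
      σa = proj₂ (proj₂ (tuples⁻ d σ∈))
      E : List Bool
      E = event σ always
      s : Face
      s = canon σ
      s-sub : IsSubset V (length σ) s
      s-sub = canon-subset σu σa
      s-len : length s ≡ d
      s-len = trans (IsSubset.size s-sub) σl
      open Star s (IsSubset.sorted s-sub) s-len 0<nℓ (ℕₚ.<⇒≤ d<n)

      star-size : n ≤ d + trues E
      star-size = begin
        n                                                                   ≡⟨ sym length-V ⟩
        length V                                                            ≡⟨ trans (sym (ℕₚ.*-identityʳ (length V))) (sym (sumL-const V 1)) ⟩
        sumL V (λ _ → 1)                                                    ≤⟨ sumL-mono V (λ x _ → each x (memb x σ) refl) ⟩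
        sumL V (λ x → χ (memb x σ) + χ (distinctᵇ (σ ++ x ∷ []) ∧ true))    ≡⟨ sumL-+ V _ _ ⟩
        sumL V (λ x → χ (memb x σ)) + T# 1 (λ zs → χ (distinctᵇ (σ ++ zs) ∧ always zs))
          ≤⟨ ℕₚ.+-mono-≤ few (ℕₚ.≤-reflexive (trans (sym (trues-event 1 σ (λ _ → refl) (trans (cong (_+ 1) σl) (ℕₚ.+-comm d 1)) σu σa)) (ℕₚ.*-identityˡ (trues E)))) ⟩
        d + trues E ∎
        where
        open ℕₚ.≤-Reasoning
        each : ∀ x c → memb x σ ≡ c → 1 ≤ χ c + χ (distinctᵇ (σ ++ x ∷ []) ∧ true)
        each x true e = s≤s z≤n
        each x false e = ℕₚ.≤-reflexive (cong χ (sym (∧-intro (Unique⇒distinctᵇ (Unique-resp-↭ (↭-sym (↭-trans (Permₚ.shift x σ []) (prep x (↭-reflexive (Listₚ.++-identityʳ σ)))))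
          (Unique-∷ (memb-false⇒∉ {ys = σ} e) σu))) refl)))
        few : sumL V (λ x → χ (memb x σ)) ≤ d
        few = ℕₚ.≤-trans (ℕₚ.≤-reflexive (sym (length-filterᵇ (λ x → memb x σ) V)))
          (ℕₚ.≤-trans (Unique-length (AllPairs-filterᵇ _ V-unique) (λ q → memb⇒∈ σ (proj₂ (∈-filterᵇ⁻ (λ x → memb x σ) V q)))) (ℕₚ.≤-reflexive σl))

      t r : ℚ
      t = inv n
      r = ℕ→ℚ (suc a) *ℚ inv n
      t≥0 : 0ℚ ≤ℚ t
      t≥0 = inv-nonneg n 0<n
      t≤1 : t ≤ℚ 1ℚ
      t≤1 = ℚₚ.≤-trans p≥ p≤1
      r≥0 : 0ℚ ≤ℚ r
      r≥0 = mul-nonneg (ℕ→ℚ-nonneg (suc a)) t≥0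

      -- The first summand is the indicator of `c = 0`, whose expectation `avoid-≤` bounds; with
      -- `t = 1 / n` everything else costs no more than another `1 / n`.
      pointwise : ∀ c → t ^ℚ c ≤ℚ (1ℚ +ℚ (⊖ 1ℚ)) ^ℚ c +ℚ t
      pointwise zero = subst (_≤ℚ 1ℚ +ℚ t) (ℚₚ.+-identityʳ 1ℚ) (ℚₚ.+-monoʳ-≤ 1ℚ t≥0)
      pointwise (suc c) = begin
        t *ℚ t ^ℚ c                                 ≤⟨ mulˡ t t≥0 (pow-≤1 c t≥0 t≤1) ⟩
        t *ℚ 1ℚ                                     ≡⟨ lem t ((1ℚ +ℚ (⊖ 1ℚ)) ^ℚ c) ⟩
        (1ℚ +ℚ (⊖ 1ℚ)) *ℚ (1ℚ +ℚ (⊖ 1ℚ)) ^ℚ c +ℚ t ∎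
        where
        open ℚₚ.≤-Reasoning
        lem : ∀ t z → t *ℚ 1ℚ ≡ (1ℚ +ℚ (⊖ 1ℚ)) *ℚ z +ℚ t
        lem = solve-∀ ℚring

      step : ∀ acc → length acc ≡ size → common acc E < a → Ex (λ S → t ^ℚ common S (E ∖ᵇ acc)) ≤ℚ r
      step acc l lt = go (trues (E ∖ᵇ acc)) refl
        where
        open ℚₚ.≤-Reasoning
        total : trues E ≡ trues (E ∖ᵇ acc) + common acc E
        total = trues-∖ E acc (length-event σ always) l
        lem : ∀ x i → x *ℚ i +ℚ i ≡ (1ℚ +ℚ x) *ℚ i
        lem = solve-∀ ℚring
        star : ∀ x → x ∈ select D (E ∖ᵇ acc) → Facet s x
        star x m = subset⇒facet (IsSubset.sorted s-sub) (D-sorted (select-⊆ D (E ∖ᵇ acc) m))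
          (λ {y} y∈ → memb⇒∈ {y} x (all-true _ σ (∧-trueˡ (select-∖ D (over σ always) acc m)) (memb⇒∈ {y} σ (proj₂ (∈-filterᵇ⁻ (λ v → memb v σ) V y∈)))))
          (trans (IsSubset.size (face⁻ {suc d} (select-⊆ D (E ∖ᵇ acc) m))) (cong suc (sym s-len)))
        go : ∀ c → trues (E ∖ᵇ acc) ≡ c → Ex (λ S → t ^ℚ common S (E ∖ᵇ acc)) ≤ℚ r
        go zero e = ⊥-elim (ℕₚ.<⇒≱ d+a<n (ℕₚ.≤-trans star-size (ℕₚ.+-monoʳ-≤ d (ℕₚ.≤-trans (ℕₚ.≤-reflexive (trans total (cong (_+ common acc E) e))) (ℕₚ.<⇒≤ lt)))))
        go (suc m) e = begin
          Ex (λ S → t ^ℚ common S (E ∖ᵇ acc))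
            ≤⟨ Ex-mono (λ S _ → pointwise (common S (E ∖ᵇ acc))) ⟩
          Ex (λ S → (1ℚ +ℚ (⊖ 1ℚ)) ^ℚ common S (E ∖ᵇ acc) +ℚ t)
            ≡⟨ trans (Ex-+ (λ S → (1ℚ +ℚ (⊖ 1ℚ)) ^ℚ common S (E ∖ᵇ acc)) (λ _ → t)) (cong (Ex (λ S → (1ℚ +ℚ (⊖ 1ℚ)) ^ℚ common S (E ∖ᵇ acc)) +ℚ_) (Ex-const t)) ⟩
          Ex (λ S → (1ℚ +ℚ (⊖ 1ℚ)) ^ℚ common S (E ∖ᵇ acc)) +ℚ t
            ≤⟨ ℚₚ.+-monoˡ-≤ t (avoid-≤ (E ∖ᵇ acc) a m e (length-∖ E acc (length-event σ always) l) star
                 (ℕₚ.≤-trans star-size (ℕₚ.+-monoʳ-≤ d (ℕₚ.≤-trans (ℕₚ.≤-reflexive (trans total (cong (_+ common acc E) e))) (ℕₚ.+-monoʳ-≤ (suc m) (ℕₚ.<⇒≤ lt)))))) ⟩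
          ℕ→ℚ a *ℚ inv (n + ℓ) +ℚ t
            ≤⟨ ℚₚ.+-monoˡ-≤ t (frac-mono a a 0<nℓ 0<n (ℕₚ.*-monoʳ-≤ a (ℕₚ.m≤m+n n ℓ))) ⟩
          ℕ→ℚ a *ℚ inv n +ℚ inv n
            ≡⟨ lem (ℕ→ℚ a) (inv n) ⟩
          (1ℚ +ℚ ℕ→ℚ a) *ℚ inv n
            ≡⟨ cong (_*ℚ inv n) (sym (ℕ→ℚ-+ 1 a)) ⟩
          r ∎

    -- The lower tail gives `r^k / t^a`, which is `(a + 1)^k n^(a - k)`: all but `a` of the trees
    -- have to fail.
    Pr-bad₁ : a ≤ k → Pr k (bad₁ σ) none *ℚ nℚ ^ℚ (k ∸ a) ≤ℚ ℕ→ℚ (suc a) ^ℚ k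
    Pr-bad₁ a≤k = begin
      P₁ *ℚ nℚ ^ℚ (k ∸ a)                                 ≡⟨ cong (_*ℚ nℚ ^ℚ (k ∸ a)) (sym (trans (cong (P₁ *ℚ_) (one a)) (ℚₚ.*-identityʳ P₁))) ⟩
      P₁ *ℚ (t ^ℚ a *ℚ nℚ ^ℚ a) *ℚ nℚ ^ℚ (k ∸ a)          ≡⟨ lem P₁ (t ^ℚ a) (nℚ ^ℚ a) (nℚ ^ℚ (k ∸ a)) ⟩
      P₁ *ℚ t ^ℚ a *ℚ (nℚ ^ℚ a *ℚ nℚ ^ℚ (k ∸ a))          ≡⟨ cong (P₁ *ℚ t ^ℚ a *ℚ_) (trans (sym (pow-+ nℚ a (k ∸ a))) (cong (nℚ ^ℚ_) (ℕₚ.m+[n∸m]≡n a≤k))) ⟩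
      P₁ *ℚ t ^ℚ a *ℚ nℚ ^ℚ k                             ≤⟨ mulʳ (nℚ ^ℚ k) (pow-nonneg k (ℕ→ℚ-nonneg n)) (lower-tail t r t≥0 t≤1 r≥0 a E (length-event σ always) step k) ⟩
      r ^ℚ k *ℚ nℚ ^ℚ k                                   ≡⟨ cong (_*ℚ nℚ ^ℚ k) (pow-distrib (ℕ→ℚ (suc a)) t k) ⟩
      ℕ→ℚ (suc a) ^ℚ k *ℚ t ^ℚ k *ℚ nℚ ^ℚ k               ≡⟨ trans (ℚₚ.*-assoc (ℕ→ℚ (suc a) ^ℚ k) (t ^ℚ k) (nℚ ^ℚ k)) (trans (cong (ℕ→ℚ (suc a) ^ℚ k *ℚ_) (one k)) (ℚₚ.*-identityʳ (ℕ→ℚ (suc a) ^ℚ k))) ⟩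
      ℕ→ℚ (suc a) ^ℚ k ∎
      where
      open ℚₚ.≤-Reasoning
      P₁ = Pr k (bad₁ σ) none
      one : ∀ e → t ^ℚ e *ℚ nℚ ^ℚ e ≡ 1ℚ
      one e = trans (sym (pow-distrib t nℚ e)) (trans (cong (_^ℚ e) (inv-* n 0<n)) (pow-1 e))
      lem : ∀ p t u v → p *ℚ (t *ℚ u) *ℚ v ≡ p *ℚ t *ℚ (u *ℚ v)
      lem = solve-∀ ℚring

  module _ (m : ℕ) (m<d : m < d) (ρ : Tuple) (ρ∈ : ρ ∈ tuples (d ∸ suc m)) (hb : List Bool) where

    private
      h : Tuple → Bool
      h = cochain (suc m) hb
      h-sym : Sym h
      h-sym = ext-sym (lookupFace (faces n (suc m)) hb)
      ρu : Unique ρ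
      ρu = proj₁ (proj₂ (tuples⁻ (d ∸ suc m) ρ∈))
      ρa : All (_∈ V) ρ
      ρa = proj₂ (proj₂ (tuples⁻ (d ∸ suc m) ρ∈))
      ρl : length ρ + suc (suc m) ≡ suc d
      ρl = trans (cong (_+ suc (suc m)) (proj₁ (tuples⁻ (d ∸ suc m) ρ∈))) (trans (ℕₚ.+-suc (d ∸ suc m) (suc m)) (cong suc (ℕₚ.m∸n+n≡m m<d)))
      X : ℕ
      X = n ^ suc m

    -- Exponential moment with base 2: the mean is at most `c`, so the moment is at most `2^(2 c)`,
    -- and the threshold `4 c` leaves probability `2^(-2 c)` with `c ≥ X`. Half of the exponent
    -- `2 X` is meant for the union bound over cochains.
    Pr-bad₂ : 0 < k → Θ ≤ k → Pr k (bad₂ m ρ hb) none *ℚ 2ℚ ^ℚ (2 * X) ≤ℚ 1ℚ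
    Pr-bad₂ 0<k Θ≤k = begin
      P₂ *ℚ 2ℚ ^ℚ (2 * X)                ≤⟨ mulˡ P₂ (Pr-≥0 (bad₂ m ρ hb)) (pow-monoʳ 1≤2 (ℕₚ.*-monoʳ-≤ 2 X≤c)) ⟩
      P₂ *ℚ 2ℚ ^ℚ (2 * c)                ≤⟨ scale-cancel (2ℚ ^ℚ (2 * c)) (pow-pos (2 * c) 0<2ℚ) (begin
        P₂ *ℚ 2ℚ ^ℚ (2 * c) *ℚ 2ℚ ^ℚ (2 * c)    ≡⟨ trans (ℚₚ.*-assoc P₂ (2ℚ ^ℚ (2 * c)) (2ℚ ^ℚ (2 * c))) (cong (P₂ *ℚ_) (trans (sym (pow-+ 2ℚ (2 * c) (2 * c))) (cong (2ℚ ^ℚ_) (four c)))) ⟩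
        P₂ *ℚ 2ℚ ^ℚ (4 * c)                     ≤⟨ upper-tail 1ℚ 0≤1 p≥0 E (length-event ρ (touches h)) k (4 * c) ⟩
        (1ℚ +ℚ 1ℚ *ℚ p) ^ℚ (k * trues E)        ≡⟨ cong (λ z → (1ℚ +ℚ z) ^ℚ (k * trues E)) (ℚₚ.*-identityˡ p) ⟩
        (1ℚ +ℚ p) ^ℚ (k * trues E)              ≤⟨ exp⁺ (k * trues E) c 0<c p≥0 mean ⟩
        2ℚ ^ℚ (2 * c)                           ≡⟨ sym (ℚₚ.*-identityˡ (2ℚ ^ℚ (2 * c))) ⟩
        1ℚ *ℚ 2ℚ ^ℚ (2 * c) ∎) ⟩
      1ℚ ∎
      where
      open ℚₚ.≤-Reasoning
      P₂ = Pr k (bad₂ m ρ hb) none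
      E = event₂ m ρ hb
      h# = T# (suc m) (χ ∘ h)
      q = n ^ suc m / Θ
      c = c₁ * (k * weight₂ m hb)
      four : ∀ c → 2 * c + 2 * c ≡ 4 * c
      four = ℕSolver.solve-∀
      0<c : 0 < c
      0<c = ℕₚ.*-mono-≤ {1} {c₁} {1} {k * weight₂ m hb} (s≤s z≤n) (ℕₚ.*-mono-≤ {1} {k} {1} {weight₂ m hb} 0<k (ℕₚ.≤-trans (s≤s z≤n) (ℕₚ.m≤n+m (suc q) h#)))
      X≤c : X ≤ c
      X≤c = ℕₚ.≤-trans (ℕₚ.<⇒≤ (subst (_< suc q * Θ) (sym (m≡m%n+[m/n]*n X Θ)) (ℕₚ.+-monoˡ-< (q * Θ) (m%n<n X Θ))))
        (ℕₚ.≤-trans (ℕₚ.≤-reflexive (ℕₚ.*-comm (suc q) Θ)) (ℕₚ.≤-trans (ℕₚ.*-mono-≤ Θ≤k (ℕₚ.m≤n+m (suc q) h#)) (ℕₚ.m≤n*m (k * weight₂ m hb) c₁)))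
      trues-≤ : trues E ≤ n * h#
      trues-≤ = ℕₚ.*-cancelˡ-≤ (suc (suc m)) (ℕₚ.≤-trans (ℕₚ.*-monoˡ-≤ (trues E) (ℕₚ.m≤m*n (suc (suc m)) (suc m !) {{ℕₚ._!≢0 (suc m)}}))
        (ℕₚ.≤-trans (ℕₚ.≤-reflexive (trues-event (suc (suc m)) ρ (touches-sym h-sym) ρl ρu ρa))
          (ℕₚ.≤-trans (T-mono (suc (suc m)) (λ zs _ _ → χ-mono {distinctᵇ (ρ ++ zs) ∧ touches h zs} {touches h zs} (∧-trueʳ {distinctᵇ (ρ ++ zs)})))
            (ℕₚ.≤-trans (T-touches n (suc m) h) (ℕₚ.≤-reflexive (cong (λ z → suc (suc m) * (z * h#)) length-V))))))
      mean : ℕ→ℚ (k * trues E) *ℚ p ≤ℚ ℕ→ℚ c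
      mean = begin
        ℕ→ℚ (k * trues E) *ℚ p                         ≤⟨ mul-mono (ℕ→ℚ-nonneg (k * trues E)) p≥0 (ℕ→ℚ-mono (ℕₚ.*-monoʳ-≤ k trues-≤)) p≤ ⟩
        ℕ→ℚ (k * (n * h#)) *ℚ (ℕ→ℚ c₁ *ℚ inv n)        ≡⟨ lem (ℕ→ℚ (k * (n * h#))) (ℕ→ℚ c₁) (inv n) ⟩
        (ℕ→ℚ (k * (n * h#)) *ℚ ℕ→ℚ c₁) *ℚ inv n        ≤⟨ *inv-≤ n 0<n (ℚₚ.≤-reflexive (trans (sym (ℕ→ℚ-* (k * (n * h#)) c₁)) (trans (cong ℕ→ℚ (lem₂ k n h# c₁)) (ℕ→ℚ-* n (c₁ * (k * h#)))))) ⟩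
        ℕ→ℚ (c₁ * (k * h#))                            ≤⟨ ℕ→ℚ-mono (ℕₚ.*-monoʳ-≤ c₁ (ℕₚ.*-monoʳ-≤ k (ℕₚ.m≤m+n h# (suc q)))) ⟩
        ℕ→ℚ c ∎
        where
        lem : ∀ x c i → x *ℚ (c *ℚ i) ≡ (x *ℚ c) *ℚ i
        lem = solve-∀ ℚring
        lem₂ : ∀ k n h c → k * (n * h) * c ≡ n * (c * (k * h))
        lem₂ = ℕSolver.solve-∀

    -- Lower tail with base one half. While fewer than `q` faces are met, at least half of the event
    -- is left, so the k trees together yield `2^(-4 q)`; the Markov step gives back `2^q`, and
    -- `q ≥ X` if the coboundary is large. Otherwise the event is impossible.
    Pr-bad₃ : 16 * (L * suc d !) ≤ k → 0 < L → k ≤ 8 * n → Pr k (bad₃ m ρ hb) none *ℚ 2ℚ ^ℚ (2 * X) ≤ℚ 1ℚ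
    Pr-bad₃ 16L≤k 0<L k≤8n = decide (true-or-false (large₃ m ρ hb))
      where
      open ℚₚ.≤-Reasoning
      P₃ = Pr k (bad₃ m ρ hb) none
      E = event₃ m ρ hb
      q = threshold₃ m ρ hb
      tr = trues E
      P′ = Pr k (λ U → common U E <ᵇ q) none
      16nq≤ : 16 * n * q ≤ k * tr
      16nq≤ = ℕₚ.≤-trans (ℕₚ.≤-reflexive (ℕₚ.*-comm (16 * n) q)) (m/n*n≤m (k * tr) (16 * n))
      2q≤ : 2 * q ≤ tr
      2q≤ = ℕₚ.*-cancelˡ-≤ (8 * n) {{ℕₚ.m*n≢0 8 n}} (ℕₚ.≤-trans (ℕₚ.≤-reflexive (lem n q)) (ℕₚ.≤-trans 16nq≤ (ℕₚ.*-monoˡ-≤ tr k≤8n)))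
        where
        lem : ∀ n q → 8 * n * (2 * q) ≡ 16 * n * q
        lem = ℕSolver.solve-∀
      M = k * (tr ∸ q)
      8nq≤M : 8 * n * q ≤ M
      8nq≤M = ℕₚ.*-cancelˡ-≤ 2 (ℕₚ.≤-trans (ℕₚ.≤-reflexive (lem n q)) (ℕₚ.≤-trans 16nq≤ (ℕₚ.≤-trans (ℕₚ.*-monoʳ-≤ k half) (ℕₚ.≤-reflexive (lem₂ k (tr ∸ q))))))
        where
        lem : ∀ n q → 2 * (8 * n * q) ≡ 16 * n * q
        lem = ℕSolver.solve-∀
        lem₂ : ∀ k x → k * (2 * x) ≡ 2 * (k * x)
        lem₂ = ℕSolver.solve-∀
        half : tr ≤ 2 * (tr ∸ q)
        half = ℕₚ.+-cancelʳ-≤ (2 * q) _ _ (ℕₚ.≤-trans (ℕₚ.+-monoʳ-≤ tr 2q≤) (ℕₚ.≤-reflexive (trans (lem₃ tr) (trans (cong (2 *_) (sym (ℕₚ.m∸n+n≡m (ℕₚ.≤-trans (ℕₚ.m≤m+n q (q + 0)) 2q≤)))) (ℕₚ.*-distribˡ-+ 2 (tr ∸ q) q)))))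
          where
          lem₃ : ∀ x → x + x ≡ 2 * x
          lem₃ = ℕSolver.solve-∀
      z x r : ℚ
      z = ⊖ ½
      x = ½ *ℚ p
      r = (1ℚ -ℚ x) ^ℚ (tr ∸ q)
      ½≥0 : 0ℚ ≤ℚ ½
      ½≥0 = inv-nonneg 2 (s≤s z≤n)
      ½≤1 : ½ ≤ℚ 1ℚ
      ½≤1 = subst₂ _≤ℚ_ (ℚₚ.*-identityʳ ½) ½*2 (mulˡ ½ ½≥0 1≤2)
      1+z : 1ℚ +ℚ z ≡ ½
      1+z = trans (cong (_+ℚ z) (sym ½*2)) (lem ½)
        where
        lem : ∀ h → h *ℚ 2ℚ +ℚ (⊖ h) ≡ h
        lem = solve-∀ ℚring
      x≥0 : 0ℚ ≤ℚ x
      x≥0 = mul-nonneg ½≥0 p≥0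
      x≤1 : x ≤ℚ 1ℚ
      x≤1 = mul-mono ½≥0 p≥0 ½≤1 p≤1
      1-x≥0 : 0ℚ ≤ℚ 1ℚ -ℚ x
      1-x≥0 = sub-nonneg x≤1
      1-x≤1 : 1ℚ -ℚ x ≤ℚ 1ℚ
      1-x≤1 = sub-nonneg⁻¹ (subst (0ℚ ≤ℚ_) (lem x) x≥0)
        where
        lem : ∀ x → x ≡ 1ℚ -ℚ (1ℚ -ℚ x)
        lem = solve-∀ ℚring
      step : ∀ acc → length acc ≡ size → common acc E < q → Ex (λ S → ½ ^ℚ common S (E ∖ᵇ acc)) ≤ℚ r
      step acc l lt = begin
        Ex (λ S → ½ ^ℚ common S (E ∖ᵇ acc))                ≡⟨ cong (λ w → Ex (λ S → w ^ℚ common S (E ∖ᵇ acc))) (sym 1+z) ⟩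
        Ex (λ S → (1ℚ +ℚ z) ^ℚ common S (E ∖ᵇ acc))        ≤⟨ moment-≤ z (subst (0ℚ ≤ℚ_) (sym 1+z) ½≥0) (E ∖ᵇ acc) (length-∖ E acc (length-event ρ (dl h)) l) ⟩
        (1ℚ +ℚ z *ℚ p) ^ℚ trues (E ∖ᵇ acc)                 ≡⟨ cong (_^ℚ trues (E ∖ᵇ acc)) (lem ½ p) ⟩
        (1ℚ -ℚ x) ^ℚ trues (E ∖ᵇ acc)                      ≤⟨ pow-antiʳ 1-x≥0 1-x≤1 (ℕₚ.m≤n+o⇒m∸n≤o tr q (ℕₚ.≤-trans (ℕₚ.≤-reflexive (trues-∖ E acc (length-event ρ (dl h)) l)) (ℕₚ.≤-trans (ℕₚ.+-monoʳ-≤ (trues (E ∖ᵇ acc)) (ℕₚ.<⇒≤ lt)) (ℕₚ.≤-reflexive (ℕₚ.+-comm (trues (E ∖ᵇ acc)) q))))) ⟩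
        r ∎
        where
        lem : ∀ h p → 1ℚ +ℚ (⊖ h) *ℚ p ≡ 1ℚ -ℚ h *ℚ p
        lem = solve-∀ ℚring
      deviation : ℕ→ℚ (4 * q) ≤ℚ ℕ→ℚ M *ℚ x
      deviation = begin
        ℕ→ℚ (4 * q)                          ≡⟨ sym (trans (cong (_*ℚ ℕ→ℚ (4 * q)) (trans (cong (½ *ℚ 2ℚ *ℚ_) (inv-* n 0<n)) (trans (ℚₚ.*-identityʳ (½ *ℚ 2ℚ)) ½*2))) (ℚₚ.*-identityˡ (ℕ→ℚ (4 * q)))) ⟩
        ½ *ℚ 2ℚ *ℚ (inv n *ℚ nℚ) *ℚ ℕ→ℚ (4 * q)   ≡⟨ lem ½ 2ℚ (inv n) nℚ (ℕ→ℚ (4 * q)) ⟩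
        (2ℚ *ℚ (nℚ *ℚ ℕ→ℚ (4 * q))) *ℚ (½ *ℚ inv n)  ≡⟨ cong (_*ℚ (½ *ℚ inv n)) (trans (cong (2ℚ *ℚ_) (sym (ℕ→ℚ-* n (4 * q)))) (sym (ℕ→ℚ-* 2 (n * (4 * q))))) ⟩
        ℕ→ℚ (2 * (n * (4 * q))) *ℚ (½ *ℚ inv n)      ≤⟨ mul-mono (ℕ→ℚ-nonneg (2 * (n * (4 * q)))) (mul-nonneg ½≥0 (inv-nonneg n 0<n)) (ℕ→ℚ-mono (ℕₚ.≤-trans (ℕₚ.≤-reflexive (lem₂ n q)) 8nq≤M)) (mulˡ ½ ½≥0 p≥) ⟩
        ℕ→ℚ M *ℚ x ∎
        where
        lem : ∀ h t i n q → h *ℚ t *ℚ (i *ℚ n) *ℚ q ≡ (t *ℚ (n *ℚ q)) *ℚ (h *ℚ i)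
        lem = solve-∀ ℚring
        lem₂ : ∀ n q → 2 * (n * (4 * q)) ≡ 8 * n * q
        lem₂ = ℕSolver.solve-∀
      tail : P′ *ℚ 2ℚ ^ℚ (3 * q) ≤ℚ 1ℚ
      tail = begin
        P′ *ℚ 2ℚ ^ℚ (3 * q)                                  ≡⟨ cong (λ w → P′ *ℚ w) (sym (trans (cong (_*ℚ 2ℚ ^ℚ (3 * q)) one) (ℚₚ.*-identityˡ (2ℚ ^ℚ (3 * q))))) ⟩
        P′ *ℚ ((½ ^ℚ q *ℚ 2ℚ ^ℚ q) *ℚ 2ℚ ^ℚ (3 * q))         ≡⟨ lem P′ (½ ^ℚ q) (2ℚ ^ℚ q) (2ℚ ^ℚ (3 * q)) ⟩
        P′ *ℚ ½ ^ℚ q *ℚ (2ℚ ^ℚ q *ℚ 2ℚ ^ℚ (3 * q))           ≡⟨ cong (P′ *ℚ ½ ^ℚ q *ℚ_) (sym (pow-+ 2ℚ q (3 * q))) ⟩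
        P′ *ℚ ½ ^ℚ q *ℚ 2ℚ ^ℚ (4 * q)                        ≤⟨ mulʳ (2ℚ ^ℚ (4 * q)) (pow-nonneg (4 * q) 0≤2) (lower-tail ½ r ½≥0 ½≤1 (pow-nonneg (tr ∸ q) 1-x≥0) q E (length-event ρ (dl h)) step k) ⟩
        r ^ℚ k *ℚ 2ℚ ^ℚ (4 * q)                              ≡⟨ trans (ℚₚ.*-comm (r ^ℚ k) (2ℚ ^ℚ (4 * q))) (cong (2ℚ ^ℚ (4 * q) *ℚ_) (sym (pow-* (1ℚ -ℚ x) k (tr ∸ q)))) ⟩
        2ℚ ^ℚ (4 * q) *ℚ (1ℚ -ℚ x) ^ℚ M                      ≤⟨ exp⁻ M (4 * q) x≥0 x≤1 deviation ⟩
        1ℚ ∎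
        where
        lem : ∀ p a b c → p *ℚ ((a *ℚ b) *ℚ c) ≡ p *ℚ a *ℚ (b *ℚ c)
        lem = solve-∀ ℚring
        one : ½ ^ℚ q *ℚ 2ℚ ^ℚ q ≡ 1ℚ
        one = trans (sym (pow-distrib ½ 2ℚ q)) (trans (cong (_^ℚ q) ½*2) (pow-1 q))
      X≤q : large₃ m ρ hb ≡ true → X ≤ q
      X≤q e = ℕₚ.≮⇒≥ λ q<X → ℕₚ.<⇒≱ (ℕₚ.≤-trans over′ (ℕₚ.*-monoˡ-≤ (16 * n) q<X)) many
        where
        over′ : k * tr < suc q * (16 * n)
        over′ = subst (_< suc q * (16 * n)) (sym (m≡m%n+[m/n]*n (k * tr) (16 * n))) (ℕₚ.+-monoˡ-< (q * (16 * n)) (m%n<n (k * tr) (16 * n)))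
        lem : ∀ l n x → l * (x * (16 * n)) ≡ 16 * l * (n * x)
        lem = ℕSolver.solve-∀
        lem₂ : ∀ k l f t → k * (l * (f * t)) ≡ l * f * (k * t)
        lem₂ = ℕSolver.solve-∀
        many : X * (16 * n) ≤ k * tr
        many = ℕₚ.*-cancelˡ-≤ (L * suc d !) {{ℕₚ.m*n≢0 L (suc d !) {{>-nonZero 0<L}} {{ℕₚ._!≢0 (suc d)}}}}
          (ℕₚ.≤-trans (ℕₚ.≤-reflexive (lem (L * suc d !) n X)) (ℕₚ.≤-trans (ℕₚ.*-mono-≤ 16L≤k (ℕₚ.≤ᵇ⇒≤ (n ^ suc (suc m)) (L * (suc (suc m) ! * tr)) (≡⇒T e)))
            (ℕₚ.≤-trans (ℕₚ.*-monoʳ-≤ k (ℕₚ.*-monoʳ-≤ L (ℕₚ.*-monoˡ-≤ tr (!-mono (s≤s m<d))))) (ℕₚ.≤-reflexive (lem₂ k L (suc d !) tr)))))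
      decide : (large₃ m ρ hb ≡ true) ⊎ (large₃ m ρ hb ≡ false) → P₃ *ℚ 2ℚ ^ℚ (2 * X) ≤ℚ 1ℚ
      decide (inj₂ e) = begin
        P₃ *ℚ 2ℚ ^ℚ (2 * X)     ≤⟨ mulʳ (2ℚ ^ℚ (2 * X)) (pow-nonneg (2 * X) 0≤2) (Pr-impossible k {bad₃ m ρ hb} none length-none (λ U → cong (_∧ (common U E <ᵇ q)) e)) ⟩
        0ℚ *ℚ 2ℚ ^ℚ (2 * X)     ≡⟨ ℚₚ.*-zeroˡ (2ℚ ^ℚ (2 * X)) ⟩
        0ℚ                      ≤⟨ 0≤1 ⟩
        1ℚ ∎
      decide (inj₁ e) = begin
        P₃ *ℚ 2ℚ ^ℚ (2 * X)     ≤⟨ mul-mono (Pr-≥0 (bad₃ m ρ hb)) (pow-nonneg (2 * X) 0≤2) (Pr-mono k {bad₃ m ρ hb} {λ U → common U E <ᵇ q} (λ U _ t → ∧-trueʳ {large₃ m ρ hb} t) none length-none)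
                                     (pow-monoʳ 1≤2 (ℕₚ.≤-trans (ℕₚ.*-monoʳ-≤ 2 (X≤q e)) (ℕₚ.m≤n+m (2 * q) q))) ⟩
        P′ *ℚ 2ℚ ^ℚ (3 * q)     ≤⟨ tail ⟩
        1ℚ ∎

map-bitAt : ∀ As n → length As ≡ n → map (bitAt As) (upTo n) ≡ As
map-bitAt As n l = go As id n l (λ _ → refl)
  where
  go : ∀ Bs f n → length Bs ≡ n → (∀ x → bitAt As (f x) ≡ bitAt Bs x) → map (bitAt As) (applyUpTo f n) ≡ Bs
  go [] f zero l h = refl
  go (b ∷ Bs) f (suc n) l h = cong₂ _∷_ (h 0) (go Bs (f ∘ suc) n (ℕₚ.suc-injective l) (h ∘ suc))

length-allBools : ∀ m → length (allBools m) ≡ 2 ^ m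
length-allBools zero = refl
length-allBools (suc m) = trans (Listₚ.length-++ (map (true ∷_) (allBools m))) (trans (cong₂ _+_ (Listₚ.length-map (true ∷_) (allBools m)) (Listₚ.length-map (false ∷_) (allBools m)))
  (trans (cong₂ _+_ (length-allBools m) (length-allBools m)) (cong (2 ^ m +_) (sym (ℕₚ.+-identityʳ (2 ^ m))))))

n≤2^n : ∀ n → n ≤ 2 ^ n
n≤2^n zero = z≤n
n≤2^n (suc n) = ℕₚ.+-mono-≤ (ℕₚ.m^n>0 2 n) (ℕₚ.≤-trans (n≤2^n n) (ℕₚ.m≤m+n (2 ^ n) 0))

-- `n` is less than `e q` for `q = n / e + 1`, and `q ≤ 2^q` is raised to the power `e`.
polynomial-≤-exponential : ∀ e .{{_ : NonZero e}} n → n ^ e ≤ e ^ e * 2 ^ e * 2 ^ n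
polynomial-≤-exponential e n = begin
  n ^ e                          ≤⟨ ℕₚ.^-monoˡ-≤ e (ℕₚ.<⇒≤ (subst (_< q * e) (sym (m≡m%n+[m/n]*n n e)) (ℕₚ.+-monoˡ-< (n / e * e) (m%n<n n e)))) ⟩
  (q * e) ^ e                    ≡⟨ *-^ e q e ⟩
  q ^ e * e ^ e                  ≤⟨ ℕₚ.*-monoˡ-≤ (e ^ e) (ℕₚ.^-monoˡ-≤ e (n≤2^n q)) ⟩
  (2 ^ q) ^ e * e ^ e            ≡⟨ cong (_* e ^ e) (ℕₚ.^-*-assoc 2 q e) ⟩
  2 ^ (e + n / e * e) * e ^ e    ≤⟨ ℕₚ.*-monoˡ-≤ (e ^ e) (ℕₚ.^-monoʳ-≤ 2 (ℕₚ.+-monoʳ-≤ e (m/n*n≤m n e))) ⟩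
  2 ^ (e + n) * e ^ e            ≡⟨ cong (_* e ^ e) (ℕₚ.^-distribˡ-+-* 2 e n) ⟩
  2 ^ e * 2 ^ n * e ^ e          ≡⟨ lem (2 ^ e) (2 ^ n) (e ^ e) ⟩
  e ^ e * 2 ^ e * 2 ^ n ∎
  where
  open ℕₚ.≤-Reasoning
  q = suc (n / e)
  lem : ∀ a b c → a * b * c ≡ c * a * b
  lem = ℕSolver.solve-∀

-- Small vertex sets spanning many edges in a link

module SmallSets (n d ℓ : ℕ) (μ : List Bool → ℚ) (law : IsDeterminantalHypertreeLaw n d ℓ μ)
  (H : ℕ → ℕ) (a e k L Θ G : ℕ) {{Θ≢0 : NonZero Θ}} {{n≢0 : NonZero n}} (d<n : d < n) (0<d : 0 < d)
  (k≤4Gb : k ≤ 4 * (G * (2 + e))) (0<k : 0 < k) (H₀≥ : 4 * (2 ^ (8 * ((suc d + ℓ) * G)) * 2 ^ (8 * ((suc d + ℓ) * G))) ≤ H 0) where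

  open Probability n d ℓ μ law H a (2 + e) k L Θ d<n public

  K₀ : ℕ
  K₀ = 2 ^ (8 * (c₁ * G))

  0<K₀ : 0 < K₀
  0<K₀ = ℕₚ.m^n>0 2 (8 * (c₁ * G))

  module _ (ξ : Tuple) (ξ∈ : ξ ∈ tuples (d ∸ 1)) where

    trues-event₄ : ∀ As → length As ≡ n → trues (event₄ ξ As) ≤ trues As * trues As
    trues-event₄ As l = begin
      trues (event₄ ξ As)                                                            ≤⟨ ℕₚ.m≤m+n (trues (event₄ ξ As)) _ ⟩
      2 * trues (event₄ ξ As)                                                        ≡⟨ trues-event 2 ξ (all-sym (bitAt As)) ξl (proj₁ (proj₂ (tuples⁻ (d ∸ 1) ξ∈))) (proj₂ (proj₂ (tuples⁻ (d ∸ 1) ξ∈))) ⟩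
      T# 2 (λ zs → χ (distinctᵇ (ξ ++ zs) ∧ all (bitAt As) zs))                      ≤⟨ sumL-mono V (λ u _ → sumL-mono V (λ v _ → pair (distinctᵇ (ξ ++ u ∷ v ∷ [])) (bitAt As u) (bitAt As v))) ⟩
      sumL V (λ u → sumL V (λ v → χ (bitAt As u) * χ (bitAt As v)))                  ≡⟨ sumL-cong V (λ u _ → sumL-*ˡ V (χ (bitAt As u)) (χ ∘ bitAt As)) ⟩
      sumL V (λ u → χ (bitAt As u) * sumL V (χ ∘ bitAt As))                          ≡⟨ trans (sumL-cong V (λ u _ → ℕₚ.*-comm (χ (bitAt As u)) _)) (sumL-*ˡ V (sumL V (χ ∘ bitAt As)) (χ ∘ bitAt As)) ⟩
      sumL V (χ ∘ bitAt As) * sumL V (χ ∘ bitAt As)                                  ≡⟨ cong (λ z → z * z) (trans (trues-count V (bitAt As)) (cong trues (map-bitAt As n l))) ⟩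
      trues As * trues As ∎
      where
      open ℕₚ.≤-Reasoning
      ξl : length ξ + 2 ≡ suc d
      ξl = trans (cong (_+ 2) (proj₁ (tuples⁻ (d ∸ 1) ξ∈))) (trans (ℕₚ.+-comm (d ∸ 1) 2) (cong suc (ℕₚ.m+[n∸m]≡n 0<d)))
      pair : ∀ x u v → χ (x ∧ (u ∧ (v ∧ true))) ≤ χ u * χ v
      pair false u v = z≤n
      pair true false v = z≤n
      pair true true false = z≤n
      pair true true true = ℕₚ.≤-refl

    module _ (w : ℕ) (0<w : 0 < w) (As : List Bool) (lAs : length As ≡ n) where

      private
        B : ℕ
        B = (2 + e) * w
        E : List Bool
        E = event₄ ξ As
        P′ : ℚ
        P′ = Pr k (λ U → B ≤ᵇ common U E) none
        y : ℚ
        y = ℕ→ℚ w *ℚ inv n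
        y≥0 : 0ℚ ≤ℚ y
        y≥0 = mul-nonneg (ℕ→ℚ-nonneg w) (inv-nonneg n 0<n)

        module _ (tw : trues As ≡ w) (Hw : H 0 * w < n) where

          4KKw≤n : 4 * (K₀ * K₀) * w ≤ n
          4KKw≤n = ℕₚ.≤-trans (ℕₚ.*-monoˡ-≤ w H₀≥) (ℕₚ.<⇒≤ Hw)

          w≤n : w ≤ n
          w≤n = ℕₚ.≤-trans (ℕₚ.m≤n*m w (4 * (K₀ * K₀)) {{ℕₚ.m*n≢0 4 (K₀ * K₀) {{_}} {{ℕₚ.m*n≢0 K₀ K₀ {{>-nonZero 0<K₀}} {{>-nonZero 0<K₀}}}}}}) 4KKw≤n

          -- With base `n / w`, the at most `w * w` pairs, each of probability at most `c₁ / n`,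
          -- contribute an exponent of order `k w` only, while the threshold gains `(w / n)^B`.
          s z : ℚ
          s = nℚ *ℚ inv w
          z = s -ℚ 1ℚ

          s≥0 : 0ℚ ≤ℚ s
          s≥0 = mul-nonneg (ℕ→ℚ-nonneg n) (inv-nonneg w 0<w)

          sw : s *ℚ ℕ→ℚ w ≡ nℚ
          sw = trans (ℚₚ.*-assoc nℚ (inv w) (ℕ→ℚ w)) (trans (cong (nℚ *ℚ_) (inv-* w 0<w)) (ℚₚ.*-identityʳ nℚ))

          z≥0 : 0ℚ ≤ℚ z
          z≥0 = sub-nonneg (≤-*inv w 0<w (ℚₚ.≤-trans (ℚₚ.≤-reflexive (ℚₚ.*-identityʳ (ℕ→ℚ w))) (ℕ→ℚ-mono w≤n)))

          1+z : 1ℚ +ℚ z ≡ s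
          1+z = lem s
            where
            lem : ∀ s → 1ℚ +ℚ (s -ℚ 1ℚ) ≡ s
            lem = solve-∀ ℚring

          z≤s : z ≤ℚ s
          z≤s = subst₂ _≤ℚ_ (ℚₚ.+-identityˡ z) 1+z (ℚₚ.+-monoˡ-≤ z 0≤1)

          c : ℕ
          c = k * (c₁ * w)

          mean : ℕ→ℚ (k * trues E) *ℚ (z *ℚ p) ≤ℚ ℕ→ℚ c
          mean = begin
            ℕ→ℚ (k * trues E) *ℚ (z *ℚ p)                                  ≤⟨ mul-mono (ℕ→ℚ-nonneg (k * trues E)) (mul-nonneg z≥0 p≥0) (ℕ→ℚ-mono (ℕₚ.*-monoʳ-≤ k (ℕₚ.≤-trans (trues-event₄ As lAs) (ℕₚ.≤-reflexive (cong (λ t → t * t) tw))))) (mul-mono z≥0 p≥0 z≤s p≤) ⟩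
            ℕ→ℚ (k * (w * w)) *ℚ ((nℚ *ℚ inv w) *ℚ (ℕ→ℚ c₁ *ℚ inv n))      ≡⟨ lem (ℕ→ℚ (k * (w * w))) nℚ (inv w) (ℕ→ℚ c₁) (inv n) ⟩
            (inv n *ℚ nℚ) *ℚ ((ℕ→ℚ (k * (w * w)) *ℚ ℕ→ℚ c₁) *ℚ inv w)      ≡⟨ trans (cong (_*ℚ ((ℕ→ℚ (k * (w * w)) *ℚ ℕ→ℚ c₁) *ℚ inv w)) (inv-* n 0<n)) (ℚₚ.*-identityˡ ((ℕ→ℚ (k * (w * w)) *ℚ ℕ→ℚ c₁) *ℚ inv w)) ⟩
            (ℕ→ℚ (k * (w * w)) *ℚ ℕ→ℚ c₁) *ℚ inv w                         ≤⟨ *inv-≤ w 0<w (ℚₚ.≤-reflexive (trans (sym (ℕ→ℚ-* (k * (w * w)) c₁)) (trans (cong ℕ→ℚ (lem₂ k w c₁)) (ℕ→ℚ-* w c)))) ⟩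
            ℕ→ℚ c ∎
            where
            open ℚₚ.≤-Reasoning
            lem : ∀ x n i c j → x *ℚ ((n *ℚ i) *ℚ (c *ℚ j)) ≡ (j *ℚ n) *ℚ ((x *ℚ c) *ℚ i)
            lem = solve-∀ ℚring
            lem₂ : ∀ k w c → k * (w * w) * c ≡ w * (k * (c * w))
            lem₂ = ℕSolver.solve-∀

          tail : P′ *ℚ ℕ→ℚ (n ^ B) ≤ℚ ℕ→ℚ ((K₀ * w) ^ B)
          tail = begin
            P′ *ℚ ℕ→ℚ (n ^ B)                                     ≡⟨ cong (P′ *ℚ_) (trans (ℕ→ℚ-^ n B) (trans (cong (_^ℚ B) (sym sw)) (pow-distrib s (ℕ→ℚ w) B))) ⟩
            P′ *ℚ (s ^ℚ B *ℚ ℕ→ℚ w ^ℚ B)                          ≡⟨ sym (ℚₚ.*-assoc P′ (s ^ℚ B) (ℕ→ℚ w ^ℚ B)) ⟩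
            P′ *ℚ s ^ℚ B *ℚ ℕ→ℚ w ^ℚ B                            ≤⟨ mulʳ (ℕ→ℚ w ^ℚ B) (pow-nonneg B (ℕ→ℚ-nonneg w)) (begin
              P′ *ℚ s ^ℚ B                                        ≡⟨ cong (λ t → P′ *ℚ t ^ℚ B) (sym 1+z) ⟩
              P′ *ℚ (1ℚ +ℚ z) ^ℚ B                                ≤⟨ upper-tail z z≥0 p≥0 E (length-event ξ (all (bitAt As))) k B ⟩
              (1ℚ +ℚ z *ℚ p) ^ℚ (k * trues E)                     ≤⟨ exp⁺ (k * trues E) c (ℕₚ.*-mono-≤ {1} {k} {1} {c₁ * w} 0<k (ℕₚ.*-mono-≤ {1} {c₁} {1} {w} (s≤s z≤n) 0<w)) (mul-nonneg z≥0 p≥0) mean ⟩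
              2ℚ ^ℚ (2 * c)                                       ≤⟨ pow-monoʳ 1≤2 exponent ⟩
              2ℚ ^ℚ (B * (8 * (c₁ * G)))                          ≡⟨ pow-* 2ℚ B (8 * (c₁ * G)) ⟩
              (2ℚ ^ℚ (8 * (c₁ * G))) ^ℚ B                         ≡⟨ cong (_^ℚ B) (2ℚ≡ (8 * (c₁ * G))) ⟩
              ℕ→ℚ K₀ ^ℚ B ∎) ⟩
            ℕ→ℚ K₀ ^ℚ B *ℚ ℕ→ℚ w ^ℚ B                             ≡⟨ trans (sym (pow-distrib (ℕ→ℚ K₀) (ℕ→ℚ w) B)) (trans (cong (_^ℚ B) (sym (ℕ→ℚ-* K₀ w))) (sym (ℕ→ℚ-^ (K₀ * w) B))) ⟩
            ℕ→ℚ ((K₀ * w) ^ B) ∎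
            where
            open ℚₚ.≤-Reasoning
            -- The origin of `K₀`: since `k ≤ 4 G (2 + e)`, the moment `2^(2 c)` is at most `K₀^B`.
            exponent : 2 * c ≤ B * (8 * (c₁ * G))
            exponent = ℕₚ.≤-trans (ℕₚ.*-monoʳ-≤ 2 (ℕₚ.*-monoˡ-≤ (c₁ * w) k≤4Gb)) (ℕₚ.≤-reflexive (lem G (2 + e) c₁ w))
              where
              lem : ∀ G b c w → 2 * (4 * (G * b) * (c * w)) ≡ b * w * (8 * (c * G))
              lem = ℕSolver.solve-∀

          small : P′ *ℚ (nℚ ^ℚ e *ℚ 2ℚ ^ℚ (2 * w)) ≤ℚ ℕ→ℚ (K₀ ^ e) *ℚ y ^ℚ w
          small = scale-cancel (nℚ ^ℚ w *ℚ ℕ→ℚ (n ^ B)) (ℚ-pos (pow-pos w 0<nℚ) (ℕ→ℚ-pos (n ^ B) (ℕₚ.m^n>0 n B))) (begin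
            P′ *ℚ (nℚ ^ℚ e *ℚ 2ℚ ^ℚ (2 * w)) *ℚ (nℚ ^ℚ w *ℚ ℕ→ℚ (n ^ B))
              ≡⟨ lem P′ (nℚ ^ℚ e) (2ℚ ^ℚ (2 * w)) (nℚ ^ℚ w) (ℕ→ℚ (n ^ B)) ⟩
            P′ *ℚ ℕ→ℚ (n ^ B) *ℚ (nℚ ^ℚ e *ℚ (2ℚ ^ℚ (2 * w) *ℚ nℚ ^ℚ w))
              ≡⟨ cong (P′ *ℚ ℕ→ℚ (n ^ B) *ℚ_) natural ⟩
            P′ *ℚ ℕ→ℚ (n ^ B) *ℚ ℕ→ℚ (n ^ e * (4 * n) ^ w)
              ≤⟨ mulʳ (ℕ→ℚ (n ^ e * (4 * n) ^ w)) (ℕ→ℚ-nonneg (n ^ e * (4 * n) ^ w)) tail ⟩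
            ℕ→ℚ ((K₀ * w) ^ B) *ℚ ℕ→ℚ (n ^ e * (4 * n) ^ w)
              ≡⟨ sym (ℕ→ℚ-* ((K₀ * w) ^ B) (n ^ e * (4 * n) ^ w)) ⟩
            ℕ→ℚ ((K₀ * w) ^ B * (n ^ e * (4 * n) ^ w))
              ≤⟨ ℕ→ℚ-mono (small-set-bound K₀ n w e 0<w 4KKw≤n 0<K₀) ⟩
            ℕ→ℚ (K₀ ^ e * w ^ w * n ^ B)
              ≡⟨ trans (ℕ→ℚ-* (K₀ ^ e * w ^ w) (n ^ B)) (cong (_*ℚ ℕ→ℚ (n ^ B)) (ℕ→ℚ-* (K₀ ^ e) (w ^ w))) ⟩
            ℕ→ℚ (K₀ ^ e) *ℚ ℕ→ℚ (w ^ w) *ℚ ℕ→ℚ (n ^ B)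
              ≡⟨ cong (λ t → ℕ→ℚ (K₀ ^ e) *ℚ t *ℚ ℕ→ℚ (n ^ B)) (trans (ℕ→ℚ-^ w w) (trans (cong (_^ℚ w) (sym yn)) (pow-distrib y nℚ w))) ⟩
            ℕ→ℚ (K₀ ^ e) *ℚ (y ^ℚ w *ℚ nℚ ^ℚ w) *ℚ ℕ→ℚ (n ^ B)
              ≡⟨ lem₂ (ℕ→ℚ (K₀ ^ e)) (y ^ℚ w) (nℚ ^ℚ w) (ℕ→ℚ (n ^ B)) ⟩
            ℕ→ℚ (K₀ ^ e) *ℚ y ^ℚ w *ℚ (nℚ ^ℚ w *ℚ ℕ→ℚ (n ^ B)) ∎)
            where
            open ℚₚ.≤-Reasoning
            ℚ-pos : ∀ {a b} → 0ℚ <ℚ a → 0ℚ <ℚ b → 0ℚ <ℚ a *ℚ b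
            ℚ-pos {a} {b} ha hb = subst (_<ℚ a *ℚ b) (ℚₚ.*-zeroˡ b) (ℚₚ.*-monoˡ-<-pos b {{ℚ.positive hb}} ha)
            yn : y *ℚ nℚ ≡ ℕ→ℚ w
            yn = trans (ℚₚ.*-assoc (ℕ→ℚ w) (inv n) nℚ) (trans (cong (ℕ→ℚ w *ℚ_) (inv-* n 0<n)) (ℚₚ.*-identityʳ (ℕ→ℚ w)))
            lem : ∀ p x t v b → p *ℚ (x *ℚ t) *ℚ (v *ℚ b) ≡ p *ℚ b *ℚ (x *ℚ (t *ℚ v))
            lem = solve-∀ ℚring
            lem₂ : ∀ k y v b → k *ℚ (y *ℚ v) *ℚ b ≡ k *ℚ y *ℚ (v *ℚ b)
            lem₂ = solve-∀ ℚring
            natural : nℚ ^ℚ e *ℚ (2ℚ ^ℚ (2 * w) *ℚ nℚ ^ℚ w) ≡ ℕ→ℚ (n ^ e * (4 * n) ^ w)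
            natural = sym (trans (ℕ→ℚ-* (n ^ e) ((4 * n) ^ w)) (cong₂ _*ℚ_ (ℕ→ℚ-^ n e) (trans (ℕ→ℚ-^ (4 * n) w) (trans (cong (_^ℚ w) (ℕ→ℚ-* 4 n))
              (trans (pow-distrib (ℕ→ℚ 4) nℚ w) (cong (_*ℚ nℚ ^ℚ w) (trans (pow-swap 2ℚ 2 w) (trans (sym (pow-* 2ℚ 2 w)) refl))))))))

      -- The right side carries `y ^ℚ trues As` so that the sum over all Boolean lists becomes
      -- `(1 + y)^n`, which is at most `2^(2 w)` for `y = w / n`. Lists of another size are allowed
      -- because their event is impossible.
      Pr-bad₄ : Pr k (bad₄ w ξ As) none *ℚ (nℚ ^ℚ e *ℚ 2ℚ ^ℚ (2 * w)) ≤ℚ ℕ→ℚ (K₀ ^ e) *ℚ y ^ℚ trues As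
      Pr-bad₄ = decide (true-or-false ((trues As ≡ᵇ w) ∧ (H 0 * w <ᵇ n)))
        where
        open ℚₚ.≤-Reasoning
        P₄ = Pr k (bad₄ w ξ As) none
        F = nℚ ^ℚ e *ℚ 2ℚ ^ℚ (2 * w)
        F≥0 : 0ℚ ≤ℚ F
        F≥0 = mul-nonneg (pow-nonneg e (ℕ→ℚ-nonneg n)) (pow-nonneg (2 * w) 0≤2)
        decide : ((trues As ≡ᵇ w) ∧ (H 0 * w <ᵇ n) ≡ true) ⊎ ((trues As ≡ᵇ w) ∧ (H 0 * w <ᵇ n) ≡ false) → P₄ *ℚ F ≤ℚ ℕ→ℚ (K₀ ^ e) *ℚ y ^ℚ trues As
        decide (inj₂ nil) = begin
          P₄ *ℚ F     ≤⟨ mulʳ F F≥0 (Pr-impossible k {bad₄ w ξ As} none length-none (λ U → cong (_∧ (B <ᵇ common U E)) nil)) ⟩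
          0ℚ *ℚ F     ≡⟨ ℚₚ.*-zeroˡ F ⟩
          0ℚ          ≤⟨ mul-nonneg (ℕ→ℚ-nonneg (K₀ ^ e)) (pow-nonneg (trues As) y≥0) ⟩
          ℕ→ℚ (K₀ ^ e) *ℚ y ^ℚ trues As ∎
        decide (inj₁ ye) = begin
          P₄ *ℚ F     ≤⟨ mulʳ F F≥0 (Pr-mono k {bad₄ w ξ As} {λ U → B ≤ᵇ common U E} (λ U _ t → T⇒≡ (ℕₚ.≤⇒≤ᵇ (ℕₚ.<⇒≤ (ℕₚ.<ᵇ⇒< B (common U E) (≡⇒T (∧-trueʳ {(trues As ≡ᵇ w) ∧ (H 0 * w <ᵇ n)} t)))))) none length-none) ⟩
          P′ *ℚ F     ≤⟨ small tw (ℕₚ.<ᵇ⇒< (H 0 * w) n (≡⇒T (∧-trueʳ {trues As ≡ᵇ w} ye))) ⟩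
          ℕ→ℚ (K₀ ^ e) *ℚ y ^ℚ w   ≡⟨ cong (λ t → ℕ→ℚ (K₀ ^ e) *ℚ y ^ℚ t) (sym tw) ⟩
          ℕ→ℚ (K₀ ^ e) *ℚ y ^ℚ trues As ∎
          where
          tw : trues As ≡ w
          tw = ≡ᵇ⇒≡ (∧-trueˡ ye)

    ∑-bad₄ : ∀ w → ∑ (allBools n) (λ As → Pr k (bad₄ w ξ As) none) *ℚ nℚ ^ℚ e ≤ℚ ℕ→ℚ (K₀ ^ e)
    ∑-bad₄ zero = begin
      ∑ (allBools n) (λ As → Pr k (bad₄ 0 ξ As) none) *ℚ nℚ ^ℚ e   ≤⟨ mulʳ (nℚ ^ℚ e) (pow-nonneg e (ℕ→ℚ-nonneg n)) (ℚₚ.≤-trans (∑-mono (allBools n) (λ As m → Pr-impossible k {bad₄ 0 ξ As} none length-none (empty As (∈-allBools⁻ n m)))) (ℚₚ.≤-reflexive (∑-0 (allBools n)))) ⟩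
      0ℚ *ℚ nℚ ^ℚ e                                               ≡⟨ ℚₚ.*-zeroˡ (nℚ ^ℚ e) ⟩
      0ℚ                                                          ≤⟨ ℕ→ℚ-nonneg (K₀ ^ e) ⟩
      ℕ→ℚ (K₀ ^ e) ∎
      where
      open ℚₚ.≤-Reasoning
      empty : ∀ As → length As ≡ n → ∀ U → bad₄ 0 ξ As U ≡ false
      empty As l U = ≢true λ t → ℕₚ.<⇒≱ (ℕₚ.<ᵇ⇒< ((2 + e) * 0) (common U (event₄ ξ As)) (≡⇒T (∧-trueʳ {(trues As ≡ᵇ 0) ∧ (H 0 * 0 <ᵇ n)} t)))
        (ℕₚ.≤-trans (common-≤-trues U (event₄ ξ As)) (ℕₚ.≤-trans (trues-event₄ As l) (ℕₚ.≤-trans (ℕₚ.≤-reflexive (cong (λ z → z * z) (≡ᵇ⇒≡ {trues As} {0} (∧-trueˡ {trues As ≡ᵇ 0} (∧-trueˡ t))))) z≤n)))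
    ∑-bad₄ w@(suc _) = scale-cancel (2ℚ ^ℚ (2 * w)) (pow-pos (2 * w) 0<2ℚ) (begin
      ∑ (allBools n) φ *ℚ nℚ ^ℚ e *ℚ 2ℚ ^ℚ (2 * w)                ≡⟨ ℚₚ.*-assoc (∑ (allBools n) φ) (nℚ ^ℚ e) (2ℚ ^ℚ (2 * w)) ⟩
      ∑ (allBools n) φ *ℚ F                                       ≡⟨ trans (ℚₚ.*-comm (∑ (allBools n) φ) F) (sym (∑-*ˡ (allBools n) F φ)) ⟩
      ∑ (allBools n) (λ As → F *ℚ φ As)                           ≤⟨ ∑-mono (allBools n) (λ As m → ℚₚ.≤-trans (ℚₚ.≤-reflexive (ℚₚ.*-comm F (φ As))) (Pr-bad₄ w (s≤s z≤n) As (∈-allBools⁻ n m))) ⟩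
      ∑ (allBools n) (λ As → ℕ→ℚ (K₀ ^ e) *ℚ y ^ℚ trues As)       ≡⟨ trans (∑-*ˡ (allBools n) (ℕ→ℚ (K₀ ^ e)) (λ As → y ^ℚ trues As)) (cong (ℕ→ℚ (K₀ ^ e) *ℚ_) (∑-power-trues n y)) ⟩
      ℕ→ℚ (K₀ ^ e) *ℚ (1ℚ +ℚ y) ^ℚ n                              ≤⟨ mulˡ (ℕ→ℚ (K₀ ^ e)) (ℕ→ℚ-nonneg (K₀ ^ e)) (exp⁺ n w (s≤s z≤n) (mul-nonneg (ℕ→ℚ-nonneg w) (inv-nonneg n 0<n)) (ℚₚ.≤-reflexive ny)) ⟩
      ℕ→ℚ (K₀ ^ e) *ℚ 2ℚ ^ℚ (2 * w) ∎)
      where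
      open ℚₚ.≤-Reasoning
      φ : List Bool → ℚ
      φ As = Pr k (bad₄ w ξ As) none
      F y : ℚ
      F = nℚ ^ℚ e *ℚ 2ℚ ^ℚ (2 * w)
      y = ℕ→ℚ w *ℚ inv n
      ny : nℚ *ℚ y ≡ ℕ→ℚ w
      ny = trans (lem nℚ (ℕ→ℚ w) (inv n)) (trans (cong (_*ℚ ℕ→ℚ w) (inv-* n 0<n)) (ℚₚ.*-identityˡ (ℕ→ℚ w)))
        where
        lem : ∀ n w i → n *ℚ (w *ℚ i) ≡ (i *ℚ n) *ℚ w
        lem = solve-∀ ℚring

-- Union bound over all exceptional events

polynomialFactor : ℕ → ℕ
polynomialFactor e = e ^ e * 2 ^ e

failureConstant : (d s a k e K₀ : ℕ) → ℚ
failureConstant d s a k e K₀ = (ℕ→ℚ (suc a) ^ℚ k +ℚ ℕ→ℚ (d * C₀)) +ℚ (ℕ→ℚ (d * C₀) +ℚ ℕ→ℚ (2 * K₀ ^ e))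
  where C₀ = polynomialFactor (d + s)

module Total (n d ℓ : ℕ) (μ : List Bool → ℚ) (law : IsDeterminantalHypertreeLaw n d ℓ μ)
  (H : ℕ → ℕ) (a e k L Θ G s : ℕ) {{Θ≢0 : NonZero Θ}} {{n≢0 : NonZero n}} (d<n : d < n) (0<d : 0 < d)
  (k≤4Gb : k ≤ 4 * (G * (2 + e))) (0<k : 0 < k) (H₀≥ : 4 * (2 ^ (8 * ((suc d + ℓ) * G)) * 2 ^ (8 * ((suc d + ℓ) * G))) ≤ H 0)
  (d+a<n : d + a < n) (a≤k : a ≤ k) (ds≤k-a : d + s ≤ k ∸ a) (Θ≤k : Θ ≤ k) (16L≤k : 16 * (L * suc d !) ≤ k) (0<L : 0 < L)
  (k≤8n : k ≤ 8 * n) (ds≤e : d + s ≤ e) where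

  open SmallSets n d ℓ μ law H a e k L Θ G d<n 0<d k≤4Gb 0<k H₀≥ public

  private
    1≤nℚ : 1ℚ ≤ℚ nℚ
    1≤nℚ = ℕ→ℚ-mono {1} {n} 0<n

    nᵈ : ℚ
    nᵈ = nℚ ^ℚ d

    0<nᵈ : 0ℚ <ℚ nᵈ
    0<nᵈ = pow-pos d 0<nℚ

    tuples-count : ∀ r → length (tuples r) ≤ n ^ r
    tuples-count r = ℕₚ.≤-trans (length-filterᵇ-≤ distinctᵇ (allTuples V r)) (ℕₚ.≤-reflexive (trans (length-allTuples V r) (cong (_^ r) length-V)))

    pow-split : nℚ ^ℚ (d + s) ≡ nℚ ^ℚ s *ℚ nᵈ
    pow-split = trans (pow-+ nℚ d s) (ℚₚ.*-comm nᵈ (nℚ ^ℚ s))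

    C₀ : ℕ
    C₀ = polynomialFactor (d + s)

    poly : n ^ (d + s) ≤ C₀ * 2 ^ n
    poly = polynomial-≤-exponential (d + s) {{>-nonZero (ℕₚ.≤-trans 0<d (ℕₚ.m≤m+n d s))}} n

  -- There are at most `n^d` tuples σ, each failing with probability of order `n^(a - k)`; hence the
  -- requirement `d + s ≤ k ∸ a`.
  Pr-Bad₁ : Pr k Bad₁ none *ℚ nℚ ^ℚ s ≤ℚ ℕ→ℚ (suc a) ^ℚ k
  Pr-Bad₁ = scale-cancel nᵈ 0<nᵈ (begin
    Pr k Bad₁ none *ℚ nℚ ^ℚ s *ℚ nᵈ                   ≡⟨ trans (ℚₚ.*-assoc (Pr k Bad₁ none) (nℚ ^ℚ s) nᵈ) (cong (Pr k Bad₁ none *ℚ_) (sym pow-split)) ⟩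
    Pr k Bad₁ none *ℚ nℚ ^ℚ (d + s)                   ≤⟨ mulʳ (nℚ ^ℚ (d + s)) (pow-nonneg (d + s) (ℕ→ℚ-nonneg n)) (Pr-any k bad₁ (tuples d) none length-none) ⟩
    ∑ (tuples d) (λ σ → Pr k (bad₁ σ) none) *ℚ nℚ ^ℚ (d + s)
      ≤⟨ ∑-bound (tuples d) (λ σ → Pr k (bad₁ σ) none) (nℚ ^ℚ (d + s)) M (λ σ m → ℚₚ.≤-trans (mulˡ (Pr k (bad₁ σ) none) (Pr-≥0 (bad₁ σ)) (pow-monoʳ 1≤nℚ ds≤k-a)) (Pr-bad₁ σ m d+a<n a≤k)) ⟩
    ℕ→ℚ (length (tuples d)) *ℚ M                      ≤⟨ mulʳ M (pow-nonneg k (ℕ→ℚ-nonneg (suc a))) (ℕ→ℚ-mono (tuples-count d)) ⟩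
    ℕ→ℚ (n ^ d) *ℚ M                                  ≡⟨ trans (cong (_*ℚ M) (ℕ→ℚ-^ n d)) (ℚₚ.*-comm nᵈ M) ⟩
    M *ℚ nᵈ ∎)
    where
    open ℚₚ.≤-Reasoning
    M = ℕ→ℚ (suc a) ^ℚ k

  module _ (Q : ℕ → Tuple → List Bool → List Bool → Bool)
    (each : ∀ m → m < d → ∀ ρ → ρ ∈ tuples (d ∸ suc m) → ∀ hb → Pr k (Q m ρ hb) none *ℚ 2ℚ ^ℚ (2 * n ^ suc m) ≤ℚ 1ℚ) where

    private
      Q₁ : ℕ → Tuple → List Bool → Bool
      Q₁ m ρ U = any (λ hb → Q m ρ hb U) (cochains m)
      Q₂ : ℕ → List Bool → Bool
      Q₂ m U = any (λ ρ → Q₁ m ρ U) (tuples (d ∸ suc m))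
      Q₃ : List Bool → Bool
      Q₃ U = any (λ m → Q₂ m U) (upTo d)

      -- At most `2^X` cochains compete, each failing with probability at most `2^(-2 X)`, and
      -- `X ≥ n`.
      level₁ : ∀ m → m < d → ∀ ρ → ρ ∈ tuples (d ∸ suc m) → Pr k (Q₁ m ρ) none *ℚ 2ℚ ^ℚ n ≤ℚ 1ℚ
      level₁ m m<d ρ ρ∈ = begin
        P₁ *ℚ 2ℚ ^ℚ n          ≤⟨ mulˡ P₁ (Pr-≥0 (Q₁ m ρ)) (pow-monoʳ 1≤2 (ℕₚ.m≤m*n n (n ^ m) {{ℕₚ.m^n≢0 n m}})) ⟩
        P₁ *ℚ 2ℚ ^ℚ X          ≤⟨ scale-cancel (2ℚ ^ℚ X) (pow-pos X 0<2ℚ) (begin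
          P₁ *ℚ 2ℚ ^ℚ X *ℚ 2ℚ ^ℚ X                                        ≡⟨ trans (ℚₚ.*-assoc P₁ (2ℚ ^ℚ X) (2ℚ ^ℚ X)) (cong (P₁ *ℚ_) (trans (sym (pow-+ 2ℚ X X)) (cong (λ z → 2ℚ ^ℚ (X + z)) (sym (ℕₚ.+-identityʳ X))))) ⟩
          P₁ *ℚ 2ℚ ^ℚ (2 * X)                                            ≤⟨ mulʳ (2ℚ ^ℚ (2 * X)) (pow-nonneg (2 * X) 0≤2) (Pr-any k (Q m ρ) (cochains m) none length-none) ⟩
          ∑ (cochains m) (λ hb → Pr k (Q m ρ hb) none) *ℚ 2ℚ ^ℚ (2 * X)  ≤⟨ ∑-bound (cochains m) (λ hb → Pr k (Q m ρ hb) none) (2ℚ ^ℚ (2 * X)) 1ℚ (λ hb _ → each m m<d ρ ρ∈ hb) ⟩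
          ℕ→ℚ (length (cochains m)) *ℚ 1ℚ                                ≡⟨ ℚₚ.*-identityʳ (ℕ→ℚ (length (cochains m))) ⟩
          ℕ→ℚ (length (cochains m))                                      ≡⟨ cong ℕ→ℚ (length-allBools (length (faces n (suc m)))) ⟩
          ℕ→ℚ (2 ^ length (faces n (suc m)))                             ≤⟨ ℕ→ℚ-mono (ℕₚ.^-monoʳ-≤ 2 (ℕₚ.≤-trans (length-subsetsOf V (suc m)) (ℕₚ.≤-reflexive (cong (_^ suc m) length-V)))) ⟩
          ℕ→ℚ (2 ^ X)                                                    ≡⟨ trans (sym (2ℚ≡ X)) (sym (ℚₚ.*-identityˡ (2ℚ ^ℚ X))) ⟩
          1ℚ *ℚ 2ℚ ^ℚ X ∎) ⟩
        1ℚ ∎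
        where
        open ℚₚ.≤-Reasoning
        X = n ^ suc m
        P₁ = Pr k (Q₁ m ρ) none

      level₂ : ∀ m → m < d → Pr k (Q₂ m) none *ℚ 2ℚ ^ℚ n ≤ℚ ℕ→ℚ (n ^ d)
      level₂ m m<d = begin
        Pr k (Q₂ m) none *ℚ 2ℚ ^ℚ n                                            ≤⟨ mulʳ (2ℚ ^ℚ n) (pow-nonneg n 0≤2) (Pr-any k (Q₁ m) (tuples (d ∸ suc m)) none length-none) ⟩
        ∑ (tuples (d ∸ suc m)) (λ ρ → Pr k (Q₁ m ρ) none) *ℚ 2ℚ ^ℚ n           ≤⟨ ∑-bound (tuples (d ∸ suc m)) (λ ρ → Pr k (Q₁ m ρ) none) (2ℚ ^ℚ n) 1ℚ (λ ρ ρ∈ → level₁ m m<d ρ ρ∈) ⟩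
        ℕ→ℚ (length (tuples (d ∸ suc m))) *ℚ 1ℚ                                ≡⟨ ℚₚ.*-identityʳ (ℕ→ℚ (length (tuples (d ∸ suc m)))) ⟩
        ℕ→ℚ (length (tuples (d ∸ suc m)))                                      ≤⟨ ℕ→ℚ-mono (ℕₚ.≤-trans (tuples-count (d ∸ suc m)) (ℕₚ.^-monoʳ-≤ n (ℕₚ.m∸n≤m d (suc m)))) ⟩
        ℕ→ℚ (n ^ d) ∎
        where open ℚₚ.≤-Reasoning

    -- The bound `2^(-n)` of each link beats both the at most `n^d` choices of ρ and the desired
    -- factor `n^s`; `C₀` is the constant of that comparison.
    Pr-family : Pr k Q₃ none *ℚ nℚ ^ℚ s ≤ℚ ℕ→ℚ (d * C₀)
    Pr-family = scale-cancel (2ℚ ^ℚ n) (pow-pos n 0<2ℚ) (begin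
      P₃ *ℚ nℚ ^ℚ s *ℚ 2ℚ ^ℚ n                                  ≡⟨ lem P₃ (nℚ ^ℚ s) (2ℚ ^ℚ n) ⟩
      P₃ *ℚ 2ℚ ^ℚ n *ℚ nℚ ^ℚ s                                  ≤⟨ mulʳ (nℚ ^ℚ s) (pow-nonneg s (ℕ→ℚ-nonneg n)) (ℚₚ.≤-trans (mulʳ (2ℚ ^ℚ n) (pow-nonneg n 0≤2) (Pr-any k Q₂ (upTo d) none length-none))
                                                                     (∑-bound (upTo d) (λ m → Pr k (Q₂ m) none) (2ℚ ^ℚ n) (ℕ→ℚ (n ^ d)) (λ m m∈ → level₂ m (∈ₚ.∈-upTo⁻ m∈)))) ⟩
      ℕ→ℚ (length (upTo d)) *ℚ ℕ→ℚ (n ^ d) *ℚ nℚ ^ℚ s           ≡⟨ cong (λ l → ℕ→ℚ l *ℚ ℕ→ℚ (n ^ d) *ℚ nℚ ^ℚ s) (Listₚ.length-upTo d) ⟩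
      ℕ→ℚ d *ℚ ℕ→ℚ (n ^ d) *ℚ nℚ ^ℚ s                           ≡⟨ trans (ℚₚ.*-assoc (ℕ→ℚ d) (ℕ→ℚ (n ^ d)) (nℚ ^ℚ s)) (cong (ℕ→ℚ d *ℚ_) (sym (trans (cong ℕ→ℚ (ℕₚ.^-distribˡ-+-* n d s)) (trans (ℕ→ℚ-* (n ^ d) (n ^ s)) (cong (ℕ→ℚ (n ^ d) *ℚ_) (ℕ→ℚ-^ n s)))))) ⟩
      ℕ→ℚ d *ℚ ℕ→ℚ (n ^ (d + s))                                ≤⟨ mulˡ (ℕ→ℚ d) (ℕ→ℚ-nonneg d) (ℕ→ℚ-mono poly) ⟩
      ℕ→ℚ d *ℚ ℕ→ℚ (C₀ * 2 ^ n)                                 ≡⟨ trans (cong (ℕ→ℚ d *ℚ_) (ℕ→ℚ-* C₀ (2 ^ n))) (trans (sym (ℚₚ.*-assoc (ℕ→ℚ d) (ℕ→ℚ C₀) (ℕ→ℚ (2 ^ n)))) (cong₂ _*ℚ_ (sym (ℕ→ℚ-* d C₀)) (sym (2ℚ≡ n)))) ⟩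
      ℕ→ℚ (d * C₀) *ℚ 2ℚ ^ℚ n ∎)
      where
      open ℚₚ.≤-Reasoning
      P₃ = Pr k Q₃ none
      lem : ∀ a b c → a *ℚ b *ℚ c ≡ a *ℚ c *ℚ b
      lem = solve-∀ ℚring

  -- There are `n + 1` sizes and at most `n^(d - 1)` tuples ξ, together at most `2 n^d` cases of
  -- order `n^(-e)`; hence the requirement `d + s ≤ e`.
  Pr-Bad₄ : Pr k Bad₄ none *ℚ nℚ ^ℚ s ≤ℚ ℕ→ℚ (2 * K₀ ^ e)
  Pr-Bad₄ = scale-cancel nᵈ 0<nᵈ (begin
    P₄ *ℚ nℚ ^ℚ s *ℚ nᵈ                                   ≡⟨ trans (ℚₚ.*-assoc P₄ (nℚ ^ℚ s) nᵈ) (cong (P₄ *ℚ_) (sym pow-split)) ⟩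
    P₄ *ℚ nℚ ^ℚ (d + s)                                   ≤⟨ mulˡ P₄ (Pr-≥0 Bad₄) (pow-monoʳ 1≤nℚ ds≤e) ⟩
    P₄ *ℚ nℚ ^ℚ e                                         ≤⟨ mulʳ (nℚ ^ℚ e) nᵉ≥0 (Pr-any k Q₂ (upTo (suc n)) none length-none) ⟩
    ∑ (upTo (suc n)) (λ w → Pr k (Q₂ w) none) *ℚ nℚ ^ℚ e  ≤⟨ ∑-bound (upTo (suc n)) (λ w → Pr k (Q₂ w) none) (nℚ ^ℚ e) M (λ w _ → level₂ w) ⟩
    ℕ→ℚ (length (upTo (suc n))) *ℚ M                      ≡⟨ trans (cong (λ l → ℕ→ℚ l *ℚ M) (Listₚ.length-upTo (suc n))) (sym (trans (ℕ→ℚ-* (suc n) (n ^ (d ∸ 1) * K₀ ^ e)) (cong (ℕ→ℚ (suc n) *ℚ_) (ℕ→ℚ-* (n ^ (d ∸ 1)) (K₀ ^ e))))) ⟩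
    ℕ→ℚ (suc n * (n ^ (d ∸ 1) * K₀ ^ e))                  ≤⟨ ℕ→ℚ-mono (ℕₚ.≤-trans (ℕₚ.*-monoˡ-≤ (n ^ (d ∸ 1) * K₀ ^ e) suc≤) (ℕₚ.≤-reflexive count)) ⟩
    ℕ→ℚ (2 * K₀ ^ e * n ^ d)                              ≡⟨ trans (ℕ→ℚ-* (2 * K₀ ^ e) (n ^ d)) (cong (ℕ→ℚ (2 * K₀ ^ e) *ℚ_) (ℕ→ℚ-^ n d)) ⟩
    ℕ→ℚ (2 * K₀ ^ e) *ℚ nᵈ ∎)
    where
    open ℚₚ.≤-Reasoning
    P₄ = Pr k Bad₄ none
    nᵉ≥0 : 0ℚ ≤ℚ nℚ ^ℚ e
    nᵉ≥0 = pow-nonneg e (ℕ→ℚ-nonneg n)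
    M = ℕ→ℚ (n ^ (d ∸ 1)) *ℚ ℕ→ℚ (K₀ ^ e)
    Q₁ : ℕ → Tuple → List Bool → Bool
    Q₁ w ξ U = any (λ As → bad₄ w ξ As U) (allBools n)
    Q₂ : ℕ → List Bool → Bool
    Q₂ w U = any (λ ξ → Q₁ w ξ U) (tuples (d ∸ 1))
    suc≤ : suc n ≤ 2 * n
    suc≤ = ℕₚ.≤-trans (ℕₚ.+-monoˡ-≤ n 0<n) (ℕₚ.≤-reflexive (cong (n +_) (sym (ℕₚ.+-identityʳ n))))
    lem : ∀ n x K → 2 * n * (x * K) ≡ 2 * K * (n * x)
    lem = ℕSolver.solve-∀
    count : 2 * n * (n ^ (d ∸ 1) * K₀ ^ e) ≡ 2 * K₀ ^ e * n ^ d
    count = trans (lem n (n ^ (d ∸ 1)) (K₀ ^ e)) (cong (λ z → 2 * K₀ ^ e * n ^ z) (ℕₚ.m+[n∸m]≡n 0<d))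
    level₂ : ∀ w → Pr k (Q₂ w) none *ℚ nℚ ^ℚ e ≤ℚ M
    level₂ w = begin
      Pr k (Q₂ w) none *ℚ nℚ ^ℚ e                                         ≤⟨ mulʳ (nℚ ^ℚ e) nᵉ≥0 (Pr-any k (Q₁ w) (tuples (d ∸ 1)) none length-none) ⟩
      ∑ (tuples (d ∸ 1)) (λ ξ → Pr k (Q₁ w ξ) none) *ℚ nℚ ^ℚ e            ≤⟨ ∑-bound (tuples (d ∸ 1)) (λ ξ → Pr k (Q₁ w ξ) none) (nℚ ^ℚ e) (ℕ→ℚ (K₀ ^ e))
        (λ ξ ξ∈ → ℚₚ.≤-trans (mulʳ (nℚ ^ℚ e) nᵉ≥0 (Pr-any k (bad₄ w ξ) (allBools n) none length-none)) (∑-bad₄ ξ ξ∈ w)) ⟩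
      ℕ→ℚ (length (tuples (d ∸ 1))) *ℚ ℕ→ℚ (K₀ ^ e)                       ≤⟨ mulʳ (ℕ→ℚ (K₀ ^ e)) (ℕ→ℚ-nonneg (K₀ ^ e)) (ℕ→ℚ-mono (tuples-count (d ∸ 1))) ⟩
      M ∎

  Pr-Bad : Pr k Bad none *ℚ nℚ ^ℚ s ≤ℚ failureConstant d s a k e K₀
  Pr-Bad = begin
    Pr k Bad none *ℚ nˢ
      ≤⟨ mulʳ nˢ nˢ≥0 (ℚₚ.≤-trans (Pr-∨ k (λ U → Bad₁ U ∨ Bad₂ U) (λ U → Bad₃ U ∨ Bad₄ U) none length-none)
           (ℚₚ.+-mono-≤ (Pr-∨ k Bad₁ Bad₂ none length-none) (Pr-∨ k Bad₃ Bad₄ none length-none))) ⟩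
    ((Pr k Bad₁ none +ℚ Pr k Bad₂ none) +ℚ (Pr k Bad₃ none +ℚ Pr k Bad₄ none)) *ℚ nˢ
      ≡⟨ lem (Pr k Bad₁ none) (Pr k Bad₂ none) (Pr k Bad₃ none) (Pr k Bad₄ none) nˢ ⟩
    (Pr k Bad₁ none *ℚ nˢ +ℚ Pr k Bad₂ none *ℚ nˢ) +ℚ (Pr k Bad₃ none *ℚ nˢ +ℚ Pr k Bad₄ none *ℚ nˢ)
      ≤⟨ ℚₚ.+-mono-≤ (ℚₚ.+-mono-≤ Pr-Bad₁ (Pr-family bad₂ (λ m m<d ρ ρ∈ hb → Pr-bad₂ m m<d ρ ρ∈ hb 0<k Θ≤k)))
           (ℚₚ.+-mono-≤ (Pr-family bad₃ (λ m m<d ρ ρ∈ hb → Pr-bad₃ m m<d ρ ρ∈ hb 16L≤k 0<L k≤8n)) Pr-Bad₄) ⟩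
    failureConstant d s a k e K₀ ∎
    where
    open ℚₚ.≤-Reasoning
    nˢ = nℚ ^ℚ s
    nˢ≥0 : 0ℚ ≤ℚ nˢ
    nˢ≥0 = pow-nonneg s (ℕ→ℚ-nonneg n)
    lem : ∀ a b c d x → ((a +ℚ b) +ℚ (c +ℚ d)) *ℚ x ≡ (a *ℚ x +ℚ b *ℚ x) +ℚ (c *ℚ x +ℚ d *ℚ x)
    lem = solve-∀ ℚring

-- Choice of the constants

module Choice (d ℓ s : ℕ) (0<d : 0 < d) where

  -- `c₁ / n` bounds the probability of a single d-face, `Cu` and `Cl` are the factors with which
  -- the good event yields `upper` and `lower`, `G` is dictated by the absorption of rare faces, and
  -- `K₀` by the moment for small sets.
  c₁ Cu Cl G K₀ : ℕ
  c₁ = suc d + ℓ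
  Cu = 8 * (c₁ * suc d !)
  Cl = 32
  G = 6 * (d ! * suc d * (4 * Cu * Cl)) * (suc d ! * d)
  K₀ = 2 ^ (8 * (c₁ * G))

  -- The pairs (H m , cumulative H m).
  HK : ℕ → ℕ × ℕ
  HK zero = 4 * (K₀ * K₀) , 1
  HK (suc m) = 2 * G * Cu * suc m * c , c
    where c = proj₁ (HK m) * proj₂ (HK m)

  H : ℕ → ℕ
  H m = proj₁ (HK m)

  -- `H (suc m)` has to be a multiple of `cumulative H (suc m)`, which is itself defined from `H`.
  -- The recursion on pairs breaks this circle, and here its second component is identified.
  cumulative≡ : ∀ m → cumulative H m ≡ proj₂ (HK m)
  cumulative≡ zero = refl
  cumulative≡ (suc m) = cong (H m *_) (cumulative≡ m)

  !-pos : ∀ m → 1 ≤ m !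
  !-pos m = >-nonZero⁻¹ (m !) {{ℕₚ._!≢0 m}}

  *-pos : ∀ {x y} → 1 ≤ x → 1 ≤ y → 1 ≤ x * y
  *-pos {x} {y} h h′ = ℕₚ.*-mono-≤ {1} {x} {1} {y} h h′

  Cu-pos : 1 ≤ Cu
  Cu-pos = *-pos {8} (s≤s z≤n) (*-pos {c₁} (s≤s z≤n) (!-pos (suc d)))

  C-pos : 1 ≤ 4 * Cu * Cl
  C-pos = *-pos {4 * Cu} (*-pos {4} (s≤s z≤n) Cu-pos) (s≤s z≤n)

  G-pos : 1 ≤ G
  G-pos = *-pos (*-pos {6} (s≤s z≤n) (*-pos (*-pos (!-pos d) (s≤s z≤n)) C-pos)) (*-pos (!-pos (suc d)) 0<d)

  K₀-pos : 1 ≤ K₀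
  K₀-pos = ℕₚ.m^n>0 2 (8 * (c₁ * G))

  HK-pos : ∀ m → 1 ≤ H m × 1 ≤ proj₂ (HK m)
  HK-pos zero = *-pos {4} (s≤s z≤n) (*-pos K₀-pos K₀-pos) , s≤s z≤n
  HK-pos (suc m) = *-pos (*-pos {2 * G * Cu} (*-pos {2 * G} (*-pos {2} (s≤s z≤n) G-pos) Cu-pos) (s≤s z≤n)) c-pos , c-pos
    where
    c-pos : 1 ≤ H m * proj₂ (HK m)
    c-pos = *-pos (proj₁ (HK-pos m)) (proj₂ (HK-pos m))

  Kmax Θ L : ℕ
  Kmax = cumulative H d
  Θ = 2 * G * Cu * Kmax
  L = 2 * Kmax

  cumulative-mono : ∀ {m m′} → m ≤ m′ → cumulative H m ≤ cumulative H m′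
  cumulative-mono {m} {m′} le = subst (λ z → cumulative H m ≤ cumulative H z) (ℕₚ.m+[n∸m]≡n le) (go (m′ ∸ m))
    where
    go : ∀ i → cumulative H m ≤ cumulative H (m + i)
    go zero = ℕₚ.≤-reflexive (cong (cumulative H) (sym (ℕₚ.+-identityʳ m)))
    go (suc i) = ℕₚ.≤-trans (go i) (ℕₚ.≤-trans (ℕₚ.≤-trans (ℕₚ.≤-reflexive (sym (ℕₚ.*-identityˡ (cumulative H (m + i))))) (ℕₚ.*-monoˡ-≤ (cumulative H (m + i)) (proj₁ (HK-pos (m + i)))))
      (ℕₚ.≤-reflexive (cong (cumulative H) (sym (ℕₚ.+-suc m i)))))

  Kmax-pos : 1 ≤ Kmax
  Kmax-pos = cumulative-mono {0} {d} z≤n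

  2GCu-pos : 1 ≤ 2 * G * Cu
  2GCu-pos = *-pos (*-pos {2} (s≤s z≤n) G-pos) Cu-pos

  Θ-pos : 1 ≤ Θ
  Θ-pos = *-pos 2GCu-pos Kmax-pos

  -- The first summand makes `a` and `k ∸ a` at least `d + s`, the second makes `b′` at least
  -- `2 + d + s`, and the third provides `Θ ≤ k` and `16 L (d + 1)! ≤ k` for the union bounds over
  -- cochains.
  k₀ : ℕ
  k₀ = (2 * (d + s) + 2) + (2 * G * (2 + (d + s)) + (16 * (L * suc d !) + Θ))

  instance
    2G≢0 : NonZero (2 * G)
    2G≢0 = >-nonZero (*-pos {2} (s≤s z≤n) G-pos)

  module Large (k : ℕ) (k₀≤k : k₀ ≤ k) where

    -- The 2 in the divisor of `b′` accounts for the ordered pairs counted in `tiny`. Of the `b′`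
    -- units of exponent per vertex, two pay for the choice of the set and `e` remain.
    a b′ e : ℕ
    a = k / 2
    b′ = k / (2 * G)
    e = b′ ∸ 2

    private
      first : 2 * (d + s) + 2 ≤ k
      first = ℕₚ.≤-trans (ℕₚ.m≤m+n (2 * (d + s) + 2) _) k₀≤k
      second : 2 * G * (2 + (d + s)) ≤ k
      second = ℕₚ.≤-trans (ℕₚ.≤-trans (ℕₚ.m≤m+n (2 * G * (2 + (d + s))) _) (ℕₚ.m≤n+m _ (2 * (d + s) + 2))) k₀≤k
      rest : 16 * (L * suc d !) + Θ ≤ k
      rest = ℕₚ.≤-trans (ℕₚ.≤-trans (ℕₚ.m≤n+m (16 * (L * suc d !) + Θ) (2 * G * (2 + (d + s)))) (ℕₚ.m≤n+m _ (2 * (d + s) + 2))) k₀≤k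

      div-≥ : ∀ x m .{{_ : NonZero m}} → m * x ≤ k → x ≤ k / m
      div-≥ x m h = ℕₚ.≮⇒≥ λ lt → ℕₚ.<⇒≱ (subst (_< suc (k / m) * m) (sym (m≡m%n+[m/n]*n k m)) (ℕₚ.+-monoˡ-< (k / m * m) (m%n<n k m)))
        (ℕₚ.≤-trans (ℕₚ.*-monoˡ-≤ m lt) (ℕₚ.≤-trans (ℕₚ.≤-reflexive (ℕₚ.*-comm x m)) h))

    16L≤k : 16 * (L * suc d !) ≤ k
    16L≤k = ℕₚ.≤-trans (ℕₚ.m≤m+n _ Θ) rest

    Θ≤k : Θ ≤ k
    Θ≤k = ℕₚ.≤-trans (ℕₚ.m≤n+m Θ _) rest

    a-large : suc (d + s) ≤ a
    a-large = div-≥ (suc (d + s)) 2 (ℕₚ.≤-trans (ℕₚ.≤-reflexive (lem (d + s))) first)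
      where
      lem : ∀ x → 2 * suc x ≡ 2 * x + 2
      lem = ℕSolver.solve-∀

    0<a : 0 < a
    0<a = ℕₚ.≤-trans (s≤s z≤n) a-large

    2a≤k : 2 * a ≤ k
    2a≤k = ℕₚ.≤-trans (ℕₚ.≤-reflexive (ℕₚ.*-comm 2 a)) (m/n*n≤m k 2)

    a≤k : a ≤ k
    a≤k = ℕₚ.≤-trans (ℕₚ.m≤m+n a (a + 0)) 2a≤k

    0<k : 0 < k
    0<k = ℕₚ.≤-trans 0<a a≤k

    k≤3a : k ≤ 3 * a
    k≤3a = ℕₚ.≤-trans (ℕₚ.≤-pred (ℕₚ.≤-trans (subst (_< suc a * 2) (sym (m≡m%n+[m/n]*n k 2)) (ℕₚ.+-monoˡ-< (a * 2) (m%n<n k 2))) (ℕₚ.≤-reflexive (lem a)))) (ℕₚ.≤-trans (ℕₚ.+-monoˡ-≤ (2 * a) 0<a) (ℕₚ.≤-reflexive (lem₂ a)))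
      where
      lem : ∀ a → suc a * 2 ≡ suc (1 + 2 * a)
      lem = ℕSolver.solve-∀
      lem₂ : ∀ a → a + 2 * a ≡ 3 * a
      lem₂ = ℕSolver.solve-∀

    ds≤k-a : d + s ≤ k ∸ a
    ds≤k-a = ℕₚ.≤-trans (ℕₚ.<⇒≤ a-large) (ℕₚ.m+n≤o⇒m≤o∸n a (ℕₚ.≤-trans (ℕₚ.≤-reflexive (cong (a +_) (sym (ℕₚ.+-identityʳ a)))) 2a≤k))

    b-large : 2 + (d + s) ≤ b′
    b-large = div-≥ (2 + (d + s)) (2 * G) second

    b≡ : 2 + e ≡ b′
    b≡ = ℕₚ.m+[n∸m]≡n (ℕₚ.≤-trans (ℕₚ.m≤m+n 2 (d + s)) b-large)

    ds≤e : d + s ≤ e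
    ds≤e = ℕₚ.+-cancelˡ-≤ 2 _ _ (ℕₚ.≤-trans b-large (ℕₚ.≤-reflexive (sym b≡)))

    Gb≤k : G * (2 * (2 + e)) ≤ k
    Gb≤k = ℕₚ.≤-trans (ℕₚ.≤-reflexive (trans (cong (λ z → G * (2 * z)) b≡) (lem G b′))) (m/n*n≤m k (2 * G))
      where
      lem : ∀ G b → G * (2 * b) ≡ b * (2 * G)
      lem = ℕSolver.solve-∀

    k≤4Gb : k ≤ 4 * (G * (2 + e))
    k≤4Gb = ℕₚ.≤-trans (ℕₚ.<⇒≤ (subst (_< suc b′ * (2 * G)) (sym (m≡m%n+[m/n]*n k (2 * G))) (ℕₚ.+-monoˡ-< (b′ * (2 * G)) (m%n<n k (2 * G)))))
      (ℕₚ.≤-trans (ℕₚ.*-monoˡ-≤ (2 * G) (ℕₚ.+-monoˡ-≤ b′ (ℕₚ.≤-trans (s≤s z≤n) b-large))) (ℕₚ.≤-reflexive (trans (lem G b′) (cong (λ z → 4 * (G * z)) (sym b≡)))))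
      where
      lem : ∀ G b → (b + b) * (2 * G) ≡ 4 * (G * b)
      lem = ℕSolver.solve-∀

    constants : Constants d H a (2 * (2 + e)) k Cu Cl L Θ G
    constants = record
      { k≤3a = k≤3a ; 0<a = 0<a ; Gb≤k = Gb≤k ; 0<G = G-pos ; 0<Θ = Θ-pos ; 1≤C = C-pos
      ; 0<H = λ m → proj₁ (HK-pos m)
      ; H-large = λ m → ℕₚ.≤-reflexive (cong (2 * G * Cu * suc m *_) (cumulative≡ (suc m)))
      ; Θ-large = λ m le → ℕₚ.*-monoʳ-≤ (2 * G * Cu) (cumulative-mono le)
      ; K≤Θ = λ m le → ℕₚ.≤-trans (cumulative-mono le) (ℕₚ.≤-trans (ℕₚ.≤-reflexive (sym (ℕₚ.*-identityˡ Kmax))) (ℕₚ.*-monoˡ-≤ Kmax 2GCu-pos))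
      ; L-large = λ m le → ℕₚ.*-monoʳ-≤ 2 (cumulative-mono le)
      ; G≡ = refl
      }

  Cβ Bm : ℕ
  Cβ = expansionConstant d Cu Cl
  Bm = sumL (upTo (suc (suc d))) (suc d C_)

  Bm-≥ : ∀ j → j ≤ suc d → suc d C j ≤ Bm
  Bm-≥ j le = sumL-member (suc d C_) (∈ₚ.∈-upTo⁺ (s≤s le))

  Bm-pos : 0 < Bm
  Bm-pos = ℕₚ.≤-trans (binomial-pos (suc d) 0 z≤n) (Bm-≥ 0 z≤n)

  Cβ-pos : 0 < Cβ
  Cβ-pos = ℕₚ.≤-trans (*-pos {2 * (d ! * suc d * (4 * Cu * Cl))} (*-pos {2} (s≤s z≤n) (*-pos (*-pos (!-pos d) (s≤s z≤n)) C-pos)) (!-pos (suc d)))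
    (ℕₚ.m≤m+n (2 * (d ! * suc d * (4 * Cu * Cl)) * suc d !) _)

  β : ℚ
  β = inv (Cβ * Bm)

  β-pos : 0ℚ <ℚ β
  β-pos = inv-pos (Cβ * Bm) (ℕₚ.*-mono-≤ Cβ-pos Bm-pos)

-- From the good event to the failure probability

pow-≤-self : ∀ {u} q → 1 ≤ q → 0ℚ ≤ℚ u → u ≤ℚ 1ℚ → u ^ℚ q ≤ℚ u
pow-≤-self {u} (suc q) _ h h′ = subst (u *ℚ u ^ℚ q ≤ℚ_) (ℚₚ.*-identityʳ u) (mulˡ u h (pow-≤1 q h h′))

module Conclusion (d ℓ s : ℕ) (0<d : 0 < d) (k : ℕ) (k₀≤k : Choice.k₀ d ℓ s 0<d ≤ k) where

  open Choice d ℓ s 0<d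
  open Large k k₀≤k

  N : ℕ
  N = suc (2 * d + (a + (Θ + k)))

  module _ (n : ℕ) (N≤n : N ≤ n) (μ : List Bool → ℚ) (law : IsDeterminantalHypertreeLaw n d ℓ μ) where

    private
      instance
        Θ≢0 : NonZero Θ
        Θ≢0 = >-nonZero Θ-pos

        n≢0 : NonZero n
        n≢0 = >-nonZero (ℕₚ.≤-trans (s≤s z≤n) N≤n)

      0<L : 0 < L
      0<L = *-pos {2} (s≤s z≤n) Kmax-pos

      rest≤n : a + (Θ + k) ≤ n
      rest≤n = ℕₚ.≤-trans (ℕₚ.m≤n+m (a + (Θ + k)) (suc (2 * d))) N≤n

      2d≤n : 2 * d ≤ n
      2d≤n = ℕₚ.≤-trans (ℕₚ.≤-trans (ℕₚ.m≤m+n (2 * d) (a + (Θ + k))) (ℕₚ.n≤1+n _)) N≤n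

      d+a<n : d + a < n
      d+a<n = ℕₚ.≤-trans (s≤s (ℕₚ.+-mono-≤ (ℕₚ.m≤m+n d (d + 0)) (ℕₚ.m≤m+n a (Θ + k)))) N≤n

      d<n : d < n
      d<n = ℕₚ.≤-trans (s≤s (ℕₚ.m≤m+n d a)) d+a<n

      Θ≤n : Θ ≤ n
      Θ≤n = ℕₚ.≤-trans (ℕₚ.≤-trans (ℕₚ.m≤m+n Θ k) (ℕₚ.m≤n+m (Θ + k) a)) rest≤n

      k≤8n : k ≤ 8 * n
      k≤8n = ℕₚ.≤-trans (ℕₚ.≤-trans (ℕₚ.≤-trans (ℕₚ.m≤n+m k Θ) (ℕₚ.m≤n+m (Θ + k) a)) rest≤n) (ℕₚ.m≤m+n n (7 * n))

    open Total n d ℓ μ law H a e k L Θ G s d<n 0<d k≤4Gb 0<k ℕₚ.≤-refl d+a<n a≤k ds≤k-a Θ≤k 16L≤k 0<L k≤8n ds≤e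
      using (Pr; Bad; none; length-none; size; nℚ; Pr-Bad; Pr-mono; Pr-nonneg; Pr-≤1; unionProb≡Pr; quasirandom; 0<n)

    contracting : List Bool → Bool
    contracting U = 𝔥<ᵇ n d (select (dFaces n d) U) β

    good⇒expanding : ∀ U → length U ≡ size → Bad U ≡ false → contracting U ≡ false
    good⇒expanding U lU good = Expansion.not-below Cβ Bm Cβ-pos (X-nonempty qr) Bm-≥ Bm-pos (degX-pos qr) (expand qr)
      where
      open QuasirandomExpansion n d U lU 0<d 0<n 2d≤n H a (2 * (2 + e)) k Cu Cl L Θ G constants
      qr : Quasirandom n d X̂ H a (2 * (2 + e)) k Cu Cl L Θ
      qr = quasirandom U lU 16L≤k 0<L Θ≤n 0<d good

    contracting⇒bad : ∀ U → length U ≡ size → contracting U ≡ true → Bad U ≡ true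
    contracting⇒bad U lU c = decide (true-or-false (Bad U))
      where
      decide : (Bad U ≡ true) ⊎ (Bad U ≡ false) → Bad U ≡ true
      decide (inj₁ bad) = bad
      decide (inj₂ good) = contradiction (trans (sym c) (good⇒expanding U lU good)) λ ()

    failure-bound : ∀ q → 1 ≤ q → (probExpansionBelow n d k μ β ^ℚ q) *ℚ (ℕ→ℚ n ^ℚ s) ≤ℚ failureConstant d s a k e K₀
    failure-bound q 1≤q = begin
      (probExpansionBelow n d k μ β ^ℚ q) *ℚ nˢ    ≡⟨ cong (λ x → (x ^ℚ q) *ℚ nˢ) (unionProb≡Pr k contracting none) ⟩
      -- A probability raised to a power `q ≥ 1` does not grow, so the bound with integral exponent
      -- `s` settles every rational exponent `s / q`.
      (Pr k contracting none ^ℚ q) *ℚ nˢ           ≤⟨ mulʳ nˢ nˢ≥0 (pow-≤-self q 1≤q (Pr-nonneg k contracting none length-none) (Pr-≤1 k contracting none length-none)) ⟩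
      Pr k contracting none *ℚ nˢ                  ≤⟨ mulʳ nˢ nˢ≥0 (Pr-mono k contracting⇒bad none length-none) ⟩
      Pr k Bad none *ℚ nˢ                          ≤⟨ Pr-Bad ⟩
      failureConstant d s a k e K₀ ∎
      where
      open ℚₚ.≤-Reasoning
      nˢ = ℕ→ℚ n ^ℚ s
      nˢ≥0 : 0ℚ ≤ℚ nˢ
      nˢ≥0 = pow-nonneg s (ℕ→ℚ-nonneg n)

theorem21 : (d ℓ p q : ℕ) → 1 ≤ d → 1 ≤ p → 1 ≤ q →
    ∃[ β ] (0ℚ <ℚ β × ∃[ k₀ ] ((k : ℕ) → k₀ ≤ k →
      ∃[ C ] ∃[ N ] ((n : ℕ) → N ≤ n → (μ : List Bool → ℚ) →
        IsDeterminantalHypertreeLaw n d ℓ μ →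
        (probExpansionBelow n d k μ β ^ℚ q) *ℚ (ℕ→ℚ n ^ℚ p) ≤ℚ C)))
theorem21 d ℓ p q 1≤d 1≤p 1≤q = Choice.β d ℓ p 1≤d , Choice.β-pos d ℓ p 1≤d , Choice.k₀ d ℓ p 1≤d , λ k k₀≤k →
  _ , Conclusion.N d ℓ p 1≤d k k₀≤k , λ n N≤n μ law → Conclusion.failure-bound d ℓ p 1≤d k k₀≤k n N≤n μ law q 1≤q
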